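{- Let $p,q,r$ be pairwise distinct prime numbers such that $q\neq 2$, $p\equiv 3 \pmod 4$, $p\equiv 1 \pmod r$, $r\equiv \pm 3 \pmod 8$, the residue class of $p$ is a generator of the multiplicative group $(\mathbb{Z}/q^{r-1}\mathbb{Z})^{*}$, the residue class of $q$ is a generator of the multiplicative group $(\mathbb{Z}/r\mathbb{Z})^{*}$, and $2$ is an $r$-th power residue modulo $q$. Then for every pair of coprime integers $(x,y)$ satisfying $$x^{4}-q^{4}=p\,y^{r},$$ the prime $p$ divides $y$.
   Context: "$2$ is an $r$-th power residue modulo $q$" means there exists an integer $a$ with $a^{r}\equiv 2 \pmod q$. -}

module Defs where

open import Data.Nat using (ℕ)
open import Data.Integer using (ℤ; +_; _-_; _^_)
open import Data.Integer.Divisibility using (_∣_)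
open import Data.Integer.Coprimality using (Coprime)
open import Data.Product using (∃; _×_)

_≡_[mod_] : ℤ → ℤ → ℤ → Set
a ≡ b [mod n ] = n ∣ (a - b)

IsGenerator : ℤ → ℕ → Set
IsGenerator g n =
  Coprime g (+ n) × (∀ (a : ℤ) → Coprime a (+ n) → ∃ λ (k : ℕ) → a ≡ (g ^ k) [mod (+ n) ])

IsRthPowerResidue : ℤ → ℕ → ℤ → Set
IsRthPowerResidue b r q = ∃ λ (a : ℤ) → (a ^ r) ≡ b [mod q ]

module Submission where

{-
Write x⁴ − q⁴ = (x² + q²)(x² − q²).  As p ≡ 3 (mod 4), −1 is not a square modulo p, so p divides
x² − q² = pY, and (x² + q²) Y = yʳ.  In fact this is impossible, whether or not p divides y.

If x is even, then x² + q² is an r-th power and x + iq = (u + iv)ʳ in ℤ[i], so v divides q.  If v = ± q,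
then ± r is a square modulo q, which by reciprocity contradicts that q generates (ℤ/r)*.  If v = ± 1,
then q ≡ ± 1 (mod r), so r = 3, and a cubic equation remains.

If x is odd, then q = A + B with B even, A² + B² = aʳ and 2ʳ⁻³ ∣ B.  For r = 3 one of A and B is a cube,
which gives a rational point on Y² = X³ − 1; there the descent ends with n² = X⁴ + 3X²Y² + 3Y⁴.  For r > 3
write A ± iB = zʳ with z = u + iw, so that Re zʳ ± Im zʳ = q.  The factor u + w of the left-hand side is q
itself.  Reducing the equation modulo q², modulo w − u and modulo Re zⁿ ± Im zⁿ for a suitable n
determines Jacobi symbols that violate the reciprocity law.

Most of these moduli have unknown factorisations and signs.  The symbol (a/N) is therefore defined for all
odd N by the sign count of Gauss's lemma (Schering), which makes reciprocity a count of lattice points.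
-}

open import Defs
open import Data.Nat using (ℕ; _∸_) renaming (_^_ to _^ℕ_)
open import Data.Nat.Primality using (Prime)
open import Data.Integer using (ℤ; +_; -_; _-_; _*_; _^_)
open import Data.Integer.Divisibility using (_∣_)
open import Data.Integer.Coprimality using (Coprime)
open import Data.Product using (_×_)
open import Data.Sum using (_⊎_)
open import Relation.Binary.PropositionalEquality using (_≡_; _≢_)

open import Algebra.Bundles using (CommutativeRing)
import Algebra.Definitions.RawMonoid
open import Algebra.Structures using (IsCommutativeRing)
open import Data.Empty using (⊥; ⊥-elim)
open import Data.Fin as Fin using (Fin; toℕ; fromℕ<)
open import Data.Fin.Permutation using (Permutation; permutation)
import Data.Fin.Properties as Finₚ
open import Data.Integer as ℤ using (-[1+_]; ∣_∣; _+_; sign)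
import Data.Integer.Divisibility.Signed as ℤS
open import Data.Integer.DivMod using (_%ℕ_; _/ℕ_; n%ℕd<d; a≡a%ℕn+[a/ℕn]*n)
import Data.Integer.Properties as ℤₚ
open import Data.Integer.Tactic.RingSolver using (solve-∀)
open import Data.Maybe.Base using (just; nothing)
open import Data.Nat as ℕ using (zero; suc; z≤n; s≤s; ⌊_/2⌋)
open import Data.Nat.Combinatorics using (nCn≡1; nCk≡nC[n∸k]; k>n⇒nCk≡0; nCk+nC[k+1]≡[n+1]C[k+1]) renaming (_C_ to _choose_)
import Data.Nat.Divisibility as ℕ∣
import Data.Nat.DivMod as ℕD
open import Data.Nat.Induction using (<-rec; <-wellFounded)
open import Data.Nat.Primality using (euclidsLemma; prime⇒irreducible; prime⇒nonTrivial; ¬prime[0]; ¬prime[1])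
import Data.Nat.Properties as ℕₚ
import Data.Nat.Tactic.RingSolver as ℕS
open import Data.Product using (∃; _,_; proj₁; proj₂)
open import Data.Sign as Sign using (Sign)
import Data.Sign.Properties as Signₚ
open import Data.Sum using (inj₁; inj₂; reduce)
open import Induction.WellFounded using (Acc; acc)
open import Level using (0ℓ)
open import Relation.Binary.PropositionalEquality
  using (refl; sym; trans; cong; cong₂; subst; subst₂; isEquivalence; module ≡-Reasoning)
open import Relation.Nullary using (Dec; yes; no)
open import Relation.Nullary.Decidable using (from-yes; _→-dec_; _⊎-dec_)
import Tactic.RingSolver as RS
open import Tactic.RingSolver.Core.AlmostCommutativeRing using (AlmostCommutativeRing; fromCommutativeRing)
open import Algebra.Properties.CommutativeMonoid.Sum Signₚ.*-commutativeMonoid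
  using () renaming (sum to ∏; sum-cong-≗ to ∏-cong; ∑-distrib-+ to ∏-distrib-*; ∑-comm to ∏-comm; sum-permute to ∏-permute)

-- For r > 3 let E(α) = Re α ± Im α and a = u² + w². Modulo X = E(zⁿ) the number zⁿ is a rational
-- multiple of 1 ∓ i, so z²ⁿ ≡ ∓ i aⁿ. If r = 2nm ± 1 or r = 2nm ± 3 with m odd, then E(zʳ) = q
-- collapses modulo X, up to powers of a, to q ≡ V or q ≡ VM, where V = w - u and M = u² + 4uw + w²
-- satisfy Re z³ + Im z³ = - VM. Reciprocity turns the symbols over X into symbols of X over q, V, M
-- and a. These are computable, since z ≡ u(1 - i) modulo q and z ≡ u(1 + i) modulo V, and they
-- contradict the congruence. The obstacle is that reciprocity depends on the signs of V and M. For
-- N ≡ 1 (mod 4) the symbol (-1/|N|) is the sign of N; hence reducing the equation modulo V or M, so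
-- as to force (-1/|N|) = 1, proves positivity. That q generates (ℤ/r)* supplies (q/r) = - 1, and q
-- ≢ ± 1 (mod r) for r ≠ 3, because 2 is a non-residue modulo r. The power of 2 in w controls q
-- modulo 8.

-- Congruences, coprimality and Euclidean division over a commutative ring

module RingArith {A : Set} {_+_ _*_ : A → A → A} { -_ : A → A} {0# 1# : A}
  (isCR : IsCommutativeRing _≡_ _+_ _*_ -_ 0# 1#)
  (_^_ : A → ℕ → A) (^-zero : ∀ x → x ^ 0 ≡ 1#) (^-suc : ∀ x n → x ^ suc n ≡ (x * (x ^ n)))
  where

  -- Module parameters carry no fixity, so the operations are renamed.
  infixl 6 _⊞_
  infixl 7 _⊠_
  private
    _⊞_ = _+_
    _⊠_ = _*_

    CR : CommutativeRing 0ℓ 0ℓ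
    CR = record { isCommutativeRing = isCR }

    module CR = CommutativeRing CR

    open import Algebra.Solver.Ring.NaturalCoefficients.Default CR.commutativeSemiring
      using (solve; _:+_; _:*_; _:=_)

    cancel-neg : ∀ b q m → (b ⊞ q ⊠ m) ⊞ (- q) ⊠ m ≡ b
    cancel-neg b q m = trans (CR.+-assoc b _ _)
      (trans (cong (b ⊞_) (trans (sym (CR.distribʳ m q (- q)))
        (trans (cong (_⊠ m) (CR.-‿inverseʳ q)) (CR.zeroˡ m)))) (CR.+-identityʳ b))

  infix 4 _≈_[_] _∣ᴿ_

  record _≈_[_] (a b m : A) : Set where
    constructor mod
    field
      quot : A
      eqn  : a ≡ b ⊞ quot ⊠ m

  record _∣ᴿ_ (d a : A) : Set where
    constructor div
    field
      quot : A
      eqn  : a ≡ quot ⊠ d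

  -- Coprimality as a Bézout identity passes to products, powers, divisors and congruent elements by
  -- ring identities alone, in ℤ and ℤ[i] alike and without factoring the modulus.
  record Coprimeᴿ (a b : A) : Set where
    constructor bez
    field
      {s t} : A
      eqn   : s ⊠ a ⊞ t ⊠ b ≡ 1#

  module _ {m : A} where

    ≡⇒≈ : ∀ {a b} → a ≡ b → a ≈ b [ m ]
    ≡⇒≈ {a} refl = mod 0# (sym (trans (cong (a ⊞_) (CR.zeroˡ m)) (CR.+-identityʳ a)))

    ≈-refl : ∀ {a} → a ≈ a [ m ]
    ≈-refl = ≡⇒≈ refl

    ≈-sym : ∀ {a b} → a ≈ b [ m ] → b ≈ a [ m ]
    ≈-sym {a} {b} (mod q refl) = mod (- q) (sym (cancel-neg b q m))

    ≈-trans : ∀ {a b c} → a ≈ b [ m ] → b ≈ c [ m ] → a ≈ c [ m ]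
    ≈-trans {c = c} (mod q refl) (mod q′ refl) = mod (q′ ⊞ q)
      (solve 4 (λ c q q′ m → (c :+ q′ :* m) :+ q :* m := c :+ (q′ :+ q) :* m) refl c q q′ m)

    +-cong-≈ : ∀ {a b c d} → a ≈ b [ m ] → c ≈ d [ m ] → a ⊞ c ≈ b ⊞ d [ m ]
    +-cong-≈ {b = b} {d = d} (mod q refl) (mod q′ refl) = mod (q ⊞ q′)
      (solve 5 (λ b d q q′ m → (b :+ q :* m) :+ (d :+ q′ :* m) := (b :+ d) :+ (q :+ q′) :* m) refl b d q q′ m)

    *-cong-≈ : ∀ {a b c d} → a ≈ b [ m ] → c ≈ d [ m ] → a ⊠ c ≈ b ⊠ d [ m ]
    *-cong-≈ {b = b} {d = d} (mod q refl) (mod q′ refl) = mod (b ⊠ q′ ⊞ q ⊠ d ⊞ q ⊠ m ⊠ q′)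
      (solve 5 (λ b d q q′ m → (b :+ q :* m) :* (d :+ q′ :* m)
        := b :* d :+ (b :* q′ :+ q :* d :+ q :* m :* q′) :* m) refl b d q q′ m)

    ^-cong-≈ : ∀ {a b} n → a ≈ b [ m ] → a ^ n ≈ b ^ n [ m ]
    ^-cong-≈ {a} {b} zero    p = ≡⇒≈ (trans (^-zero a) (sym (^-zero b)))
    ^-cong-≈ {a} {b} (suc n) p rewrite ^-suc a n | ^-suc b n = *-cong-≈ p (^-cong-≈ n p)

    *-congˡ-≈ : ∀ c {a b} → a ≈ b [ m ] → c ⊠ a ≈ c ⊠ b [ m ]
    *-congˡ-≈ c = *-cong-≈ ≈-refl

    *-congʳ-≈ : ∀ c {a b} → a ≈ b [ m ] → a ⊠ c ≈ b ⊠ c [ m ]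
    *-congʳ-≈ c p = *-cong-≈ p ≈-refl

  ^-+ : ∀ x m n → x ^ (m ℕ.+ n) ≡ (x ^ m) ⊠ (x ^ n)
  ^-+ x zero    n rewrite ^-zero x = sym (CR.*-identityˡ _)
  ^-+ x (suc m) n rewrite ^-suc x (m ℕ.+ n) | ^-suc x m | ^-+ x m n = sym (CR.*-assoc _ _ _)

  ^-distrib : ∀ x y n → (x ⊠ y) ^ n ≡ (x ^ n) ⊠ (y ^ n)
  ^-distrib x y zero rewrite ^-zero (x ⊠ y) | ^-zero x | ^-zero y = sym (CR.*-identityˡ _)
  ^-distrib x y (suc n) rewrite ^-suc (x ⊠ y) n | ^-suc x n | ^-suc y n | ^-distrib x y n =
    solve 4 (λ a b c d → (a :* b) :* (c :* d) := (a :* c) :* (b :* d)) refl x y (x ^ n) (y ^ n)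

  1^ : ∀ n → 1# ^ n ≡ 1#
  1^ zero = ^-zero 1#
  1^ (suc n) rewrite ^-suc 1# n | 1^ n = CR.*-identityˡ 1#

  ^-* : ∀ x m n → x ^ (m ℕ.* n) ≡ (x ^ n) ^ m
  ^-* x zero    n rewrite ^-zero x | ^-zero (x ^ n) = refl
  ^-* x (suc m) n rewrite ^-+ x n (m ℕ.* n) | ^-suc (x ^ n) m | ^-* x m n = refl

  Coprime-sym : ∀ {a b} → Coprimeᴿ a b → Coprimeᴿ b a
  Coprime-sym {a} {b} (bez {s} {t} e) = bez (trans (CR.+-comm (t ⊠ b) (s ⊠ a)) e)

  Coprime-1 : ∀ {a} → Coprimeᴿ 1# a
  Coprime-1 {a} = bez {s = 1#} {t = 0#} (trans (cong₂ _⊞_ (CR.*-identityˡ 1#) (CR.zeroˡ a)) (CR.+-identityʳ 1#))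

  Coprime-*ˡ : ∀ {a b m} → Coprimeᴿ a m → Coprimeᴿ b m → Coprimeᴿ (a ⊠ b) m
  Coprime-*ˡ {a} {b} {m} (bez {s} {t} e) (bez {s′} {t′} e′) =
    bez {s = s ⊠ s′} {t = s ⊠ a ⊠ t′ ⊞ t}
      (trans (solve 6 (λ a b m s s′ z → (s :* s′) :* (a :* b) :+ z :* m := (s :* a) :* (s′ :* b) :+ z :* m)
                refl a b m s s′ (s ⊠ a ⊠ t′ ⊞ t))
      (trans (solve 5 (λ α β m t t′ → α :* β :+ (α :* t′ :+ t) :* m := α :* (β :+ t′ :* m) :+ t :* m)
                refl (s ⊠ a) (s′ ⊠ b) m t t′)
      (trans (cong (λ x → s ⊠ a ⊠ x ⊞ t ⊠ m) e′)
      (trans (cong (_⊞ t ⊠ m) (CR.*-identityʳ (s ⊠ a))) e))))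

  Coprime-*ʳ : ∀ {a b m} → Coprimeᴿ m a → Coprimeᴿ m b → Coprimeᴿ m (a ⊠ b)
  Coprime-*ʳ p q = Coprime-sym (Coprime-*ˡ (Coprime-sym p) (Coprime-sym q))

  Coprime-^ˡ : ∀ {a m} n → Coprimeᴿ a m → Coprimeᴿ (a ^ n) m
  Coprime-^ˡ {a} zero    p rewrite ^-zero a  = Coprime-1
  Coprime-^ˡ {a} (suc n) p rewrite ^-suc a n = Coprime-*ˡ p (Coprime-^ˡ n p)

  Coprime-∣ˡ : ∀ {a b m} → a ∣ᴿ b → Coprimeᴿ b m → Coprimeᴿ a m
  Coprime-∣ˡ {a} {m = m} (div q refl) (bez {s} {t} e) = bez {s = s ⊠ q} {t = t}
    (trans (solve 5 (λ s q a t m → s :* q :* a :+ t :* m := s :* (q :* a) :+ t :* m) refl s q a t m) e)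

  Coprime-≈ : ∀ {a b m} → a ≈ b [ m ] → Coprimeᴿ b m → Coprimeᴿ a m
  Coprime-≈ {a} {b} {m} p c = shift (≈-sym p) c
    where
    shift : b ≈ a [ m ] → Coprimeᴿ b m → Coprimeᴿ a m
    shift (mod q refl) (bez {s} {t} e) = bez {s = s} {t = s ⊠ q ⊞ t}
      (trans (solve 5 (λ a q m s t → s :* a :+ (s :* q :+ t) :* m := s :* (a :+ q :* m) :+ t :* m) refl a q m s t) e)

  Coprime-∣* : ∀ {a b c} → Coprimeᴿ a b → a ∣ᴿ (b ⊠ c) → a ∣ᴿ c
  Coprime-∣* {a} {b} {c} (bez {s} {t} e) (div q e′) = div (s ⊠ c ⊞ t ⊠ q)
    (trans (sym (CR.*-identityˡ c)) (trans (cong (_⊠ c) (sym e))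
      (trans (solve 5 (λ s a t b c → (s :* a :+ t :* b) :* c := s :* a :* c :+ t :* (b :* c)) refl s a t b c)
        (trans (cong (λ x → s ⊠ a ⊠ c ⊞ t ⊠ x) e′)
          (solve 5 (λ s a t c q → s :* a :* c :+ t :* (q :* a) := (s :* c :+ t :* q) :* a) refl s a t c q)))))

  ∣ᴿ-trans : ∀ {a b c} → a ∣ᴿ b → b ∣ᴿ c → a ∣ᴿ c
  ∣ᴿ-trans {a} (div q refl) (div q′ refl) = div (q′ ⊠ q) (sym (CR.*-assoc q′ q a))

  record GCDᴿ (x y : A) : Set where
    constructor gcdᴿ
    field
      {d s t x′ y′} : A
      bézout : s ⊠ x ⊞ t ⊠ y ≡ d
      x-eq   : x ≡ x′ ⊠ d
      y-eq   : y ≡ y′ ⊠ d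

  private
    mul-rot : ∀ a b c → a ⊠ b ⊠ c ≡ a ⊠ c ⊠ b
    mul-rot = solve 3 (λ a b c → a :* b :* c := a :* c :* b) refl

    mul-swap : ∀ a b c → a ⊠ (b ⊠ c) ≡ b ⊠ (c ⊠ a)
    mul-swap = solve 3 (λ a b c → a :* (b :* c) := b :* (c :* a)) refl

    mul-out : ∀ a b c → a ⊠ (b ⊠ c) ≡ a ⊠ c ⊠ b
    mul-out = solve 3 (λ a b c → a :* (b :* c) := a :* c :* b) refl

    dist-out : ∀ s x t z d → (s ⊠ x ⊞ t ⊠ z) ⊠ d ≡ s ⊠ (x ⊠ d) ⊞ t ⊠ (z ⊠ d)
    dist-out = solve 5 (λ s x t z d → (s :* x :+ t :* z) :* d := s :* (x :* d) :+ t :* (z :* d)) refl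

  -- With d = gcd(x, z), x = x′d and z = z′d, cancelling d gives x′y = z′ⁿdⁿ⁻¹, so x′ and dⁿ⁻¹ are associates.
  coprime-factor-of-power :
    (∀ d a b → d ≢ 0# → a ⊠ d ≡ b ⊠ d → a ≡ b) → (∀ x y → GCDᴿ x y) →
    ∀ {x y z} n → x ≢ 0# → Coprimeᴿ x y → x ⊠ y ≡ z ^ (suc n) →
    ∃ λ d → (x ∣ᴿ (d ^ suc n)) × ((d ^ suc n) ∣ᴿ x)
  coprime-factor-of-power cancel gcds {x} {y} {z} n x≢0 cop e with gcds x z
  ... | gcdᴿ {d} {s} {t} {x′} {z′} bz refl refl = d , x∣ , ∣x
    where
    d≢0 : d ≢ 0#
    d≢0 refl = x≢0 (CR.zeroʳ x′)
    cop′ : Coprimeᴿ x′ z′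
    cop′ = bez {s = s} {t = t} (cancel d (s ⊠ x′ ⊞ t ⊠ z′) 1# d≢0
      (trans (dist-out s x′ t z′ d) (trans bz (sym (CR.*-identityˡ d)))))
    key : x′ ⊠ y ≡ (z′ ^ suc n) ⊠ (d ^ n)
    key = cancel d (x′ ⊠ y) ((z′ ^ suc n) ⊠ (d ^ n)) d≢0 (trans (mul-rot x′ y d)
      (trans e (trans (^-distrib z′ d (suc n)) (trans (cong ((z′ ^ suc n) ⊠_) (^-suc d n))
        (mul-out (z′ ^ suc n) d (d ^ n))))))
    x′∣ : x′ ∣ᴿ (d ^ n)
    x′∣ = Coprime-∣* (Coprime-sym (Coprime-^ˡ (suc n) (Coprime-sym cop′)))
      (div y (trans (sym key) (CR.*-comm x′ y)))
    ∣x′ : (d ^ n) ∣ᴿ x′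
    ∣x′ = Coprime-∣* (Coprime-^ˡ n (Coprime-∣ˡ (div x′ refl) cop))
      (div (z′ ^ suc n) (trans (CR.*-comm y x′) key))
    x∣ : (x′ ⊠ d) ∣ᴿ (d ^ suc n)
    x∣ = scale x′∣
      where
      scale : x′ ∣ᴿ (d ^ n) → (x′ ⊠ d) ∣ᴿ (d ^ suc n)
      scale (div q e) = div q (trans (^-suc d n) (trans (cong (d ⊠_) e) (mul-swap d q x′)))
    ∣x : (d ^ suc n) ∣ᴿ (x′ ⊠ d)
    ∣x = scale ∣x′
      where
      scale : (d ^ n) ∣ᴿ x′ → (d ^ suc n) ∣ᴿ (x′ ⊠ d)
      scale (div q e) = div q (trans (cong (_⊠ d) e)
        (trans (trans (mul-rot q (d ^ n) d) (CR.*-assoc q d (d ^ n))) (cong (q ⊠_) (sym (^-suc d n)))))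

  module Euclid (size : A → ℕ) (zero? : ∀ x → x ≡ 0# ⊎ x ≢ 0#)
    (divide : ∀ x y → y ≢ 0# → ∃ λ κ → ∃ λ ρ → (x ≡ κ ⊠ y ⊞ ρ) × (size ρ ℕ.< size y)) where

    private
      base : ∀ x → GCDᴿ x 0#
      base x = gcdᴿ {d = x} {1#} {0#} {1#} {0#}
        (trans (cong₂ _⊞_ (CR.*-identityˡ x) (CR.zeroˡ 0#)) (CR.+-identityʳ x))
        (sym (CR.*-identityˡ x)) (sym (CR.zeroˡ x))

      bézout-step : ∀ t κ y ρ s → t ⊠ (κ ⊠ y ⊞ ρ) ⊞ (s ⊞ (- (t ⊠ κ))) ⊠ y ≡ s ⊠ y ⊞ t ⊠ ρ
      bézout-step t κ y ρ s = trans
        (solve 6 (λ t κ y ρ s n → t :* (κ :* y :+ ρ) :+ (s :+ n) :* y := (s :* y :+ t :* ρ) :+ (t :* κ :+ n) :* y)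
          refl t κ y ρ s (- (t ⊠ κ)))
        (trans (cong (λ z → (s ⊠ y ⊞ t ⊠ ρ) ⊞ z ⊠ y) (CR.-‿inverseʳ (t ⊠ κ)))
          (trans (cong ((s ⊠ y ⊞ t ⊠ ρ) ⊞_) (CR.zeroˡ y)) (CR.+-identityʳ _)))

      cofactor-step : ∀ κ y d ρ → κ ⊠ (y ⊠ d) ⊞ ρ ⊠ d ≡ (κ ⊠ y ⊞ ρ) ⊠ d
      cofactor-step = solve 4 (λ κ y d ρ → κ :* (y :* d) :+ ρ :* d := (κ :* y :+ ρ) :* d) refl

      step : ∀ κ {y ρ} → GCDᴿ y ρ → GCDᴿ (κ ⊠ y ⊞ ρ) y
      step κ {y} {ρ} (gcdᴿ {d} {s} {t} {y′} {ρ′} b p q) =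
        gcdᴿ {d = d} {t} {s ⊞ (- (t ⊠ κ))} {κ ⊠ y′ ⊞ ρ′} {y′}
          (trans (bézout-step t κ y ρ s) b)
          (trans (cong₂ (λ u v → κ ⊠ u ⊞ v) p q) (cofactor-step κ y′ d ρ′)) p

      go : ∀ fuel x y → size y ℕ.< fuel → GCDᴿ x y
      go (suc fuel) x y (ℕ.s≤s l) with zero? y
      ... | inj₁ refl = base x
      ... | inj₂ y≢0 with divide x y y≢0
      ...   | κ , ρ , refl , ρ<y = step κ (go fuel y ρ (ℕₚ.<-≤-trans ρ<y l))

    gcd : ∀ x y → GCDᴿ x y
    gcd x y = go (suc (size y)) x y ℕₚ.≤-refl

open RingArith ℤₚ.+-*-isCommutativeRing _^_ (λ _ → refl) (λ _ _ → refl) public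

-- Signs and products of signs

σ : Sign → ℤ
σ Sign.+ = + 1
σ Sign.- = - (+ 1)

+≢- : Sign.+ ≢ Sign.-
+≢- ()

cancel-sign : ∀ s t → s Sign.* t ≡ t → s ≡ Sign.+
cancel-sign Sign.+ t e = refl
cancel-sign Sign.- Sign.+ ()
cancel-sign Sign.- Sign.- ()

σ-* : ∀ s t → σ (s Sign.* t) ≡ σ s * σ t
σ-* Sign.+ Sign.+ = refl
σ-* Sign.+ Sign.- = refl
σ-* Sign.- Sign.+ = refl
σ-* Sign.- Sign.- = refl

alternate : ℕ → Sign
alternate zero    = Sign.+
alternate (suc n) = Sign.- Sign.* alternate n

-- The sign sequences evaluated below change value at most once, so their products are read off from
-- the position of the change.
∏-threshold : ∀ {h} t e → t ℕ.+ e ≡ h → ∀ (s₁ s₂ : Sign) (f : Fin h → Sign) →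
  (∀ k → toℕ k ℕ.< t → f k ≡ s₁) → (∀ k → t ℕ.≤ toℕ k → f k ≡ s₂) →
  ∏ f ≡ ∏ {t} (λ _ → s₁) Sign.* ∏ {e} (λ _ → s₂)
∏-threshold zero zero refl s₁ s₂ f p q = refl
∏-threshold zero (suc e) refl s₁ s₂ f p q
  rewrite q Fin.zero z≤n
        | ∏-threshold zero e refl s₁ s₂ (λ k → f (Fin.suc k)) (λ k ()) (λ k _ → q (Fin.suc k) z≤n) = refl
∏-threshold (suc t) e refl s₁ s₂ f p q
  rewrite p Fin.zero (s≤s z≤n)
        | ∏-threshold t e refl s₁ s₂ (λ k → f (Fin.suc k))
            (λ k l → p (Fin.suc k) (s≤s l)) (λ k l → q (Fin.suc k) (s≤s l))
  = sym (Signₚ.*-assoc s₁ _ _)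

∏-+ : ∀ n → ∏ {n} (λ _ → Sign.+) ≡ Sign.+
∏-+ zero    = refl
∏-+ (suc n) = ∏-+ n

∏-- : ∀ n → ∏ {n} (λ _ → Sign.-) ≡ alternate n
∏-- zero    = refl
∏-- (suc n) = cong (Sign.- Sign.*_) (∏-- n)

alternate-double : ∀ n → alternate n Sign.* alternate n ≡ Sign.+
alternate-double n = Signₚ.s*s≡+ (alternate n)

alternate-+ : ∀ m n → alternate (m ℕ.+ n) ≡ alternate m Sign.* alternate n
alternate-+ zero    n = refl
alternate-+ (suc m) n = trans (cong (Sign.- Sign.*_) (alternate-+ m n)) (sym (Signₚ.*-assoc Sign.- (alternate m) (alternate n)))

module _ {N : ℕ} .{{_ : ℕ.NonZero N}} where

  small-multiple : ∀ {d : ℤ} q → d ≡ q * + N → ∣ d ∣ ℕ.< N → d ≡ + 0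
  small-multiple {d} q e l = go ∣ q ∣ refl
    where
    ∣d∣ : ∣ d ∣ ≡ ∣ q ∣ ℕ.* N
    ∣d∣ = trans (cong ∣_∣ e) (ℤₚ.abs-* q (+ N))
    go : ∀ k → ∣ q ∣ ≡ k → d ≡ + 0
    go zero    eq = ℤₚ.∣i∣≡0⇒i≡0 (trans ∣d∣ (cong (ℕ._* N) eq))
    go (suc k) eq = ⊥-elim (ℕₚ.<⇒≱ l (ℕₚ.≤-trans (ℕₚ.m≤m+n N (k ℕ.* N))
                      (ℕₚ.≤-reflexive (sym (trans ∣d∣ (cong (ℕ._* N) eq))))))

  residue-unique : ∀ {c} {ρ} q → c ≡ + ρ + q * + N → ρ ℕ.< N → c %ℕ N ≡ ρ
  residue-unique {c} {ρ} q e l = ℤₚ.+-injective (ℤₚ.i-j≡0⇒i≡j (+ ρ′) (+ ρ)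
    (small-multiple (q - c /ℕ N)
      (diff (+ ρ′) (+ ρ) q (c /ℕ N) (+ N) (trans (sym (a≡a%ℕn+[a/ℕn]*n c N)) e))
      (ℕₚ.≤-<-trans (ℕₚ.≤-reflexive (cong ∣_∣ (ℤₚ.m-n≡m⊖n ρ′ ρ)))
        (ℕₚ.≤-<-trans (ℤₚ.∣m⊝n∣≤m⊔n ρ′ ρ) (ℕₚ.⊔-pres-<m (n%ℕd<d c N) l)))))
    where
    ρ′ = c %ℕ N
    diff : ∀ a b q q′ n → a + q′ * n ≡ b + q * n → a - b ≡ (q - q′) * n
    diff a b q q′ n e = trans (lem₁ a b q′ n) (trans (cong (λ x → x - b - q′ * n) e) (lem₂ b q q′ n))
      where
      lem₁ : ∀ a b q′ n → a - b ≡ (a + q′ * n) - b - q′ * n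
      lem₁ = solve-∀
      lem₂ : ∀ b q q′ n → (b + q * n) - b - q′ * n ≡ (q - q′) * n
      lem₂ = solve-∀

  residue-cong : ∀ {a b} → a ≈ b [ + N ] → a %ℕ N ≡ b %ℕ N
  residue-cong {a} {b} (mod q refl) = residue-unique (b /ℕ N + q)
    (trans (cong (_+ q * + N) (a≡a%ℕn+[a/ℕn]*n b N)) (lem (+ (b %ℕ N)) (b /ℕ N) q (+ N))) (n%ℕd<d b N)
    where
    lem : ∀ r c q n → r + c * n + q * n ≡ r + (c + q) * n
    lem = solve-∀

-- The symbol of Gauss and Schering for the modulus N = 2h + 1

odd : ℕ → ℕ
odd h = suc (h ℕ.+ h)

K : ∀ {h} → Fin h → ℤ
K k = + suc (toℕ k)

module Schering (h : ℕ) where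

  N : ℕ
  N = odd h

  sgn : ℤ → Sign
  sgn c with c %ℕ N ℕ.≤? h
  ... | yes _ = Sign.+
  ... | no  _ = Sign.-

  record Rep (c : ℤ) (s : Sign) (k : Fin h) : Set where
    constructor rep
    field cong-≈ : c ≈ σ s * K k [ + N ]

  h<N : h ℕ.< N
  h<N = s≤s (ℕₚ.m≤m+n h h)

  private
    neg-rep : ∀ m k q → - (+ 1) * k + q * m ≡ (m - k) + (q - + 1) * m
    neg-rep = solve-∀

    pos-rep : ∀ m k q → + 1 * k + q * m ≡ k + q * m
    pos-rep = solve-∀

  N-K : (k : Fin h) → + (N ℕ.∸ suc (toℕ k)) ≡ + N - K k
  N-K k = sym (trans (ℤₚ.m-n≡m⊖n N (suc (toℕ k)))
    (ℤₚ.⊖-≥ (ℕₚ.≤-trans (Finₚ.toℕ<n k) (ℕₚ.<⇒≤ h<N))))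

  rep-residue⁺ : ∀ {c k} → Rep c Sign.+ k → c %ℕ N ≡ suc (toℕ k)
  rep-residue⁺ {k = k} (rep (mod q refl)) = residue-unique q (pos-rep (+ N) (K k) q) (ℕₚ.≤-<-trans (Finₚ.toℕ<n k) h<N)

  rep-residue⁻ : ∀ {c k} → Rep c Sign.- k → c %ℕ N ≡ N ℕ.∸ suc (toℕ k)
  rep-residue⁻ {k = k} (rep (mod q refl)) = residue-unique (q - + 1)
    (trans (neg-rep (+ N) (K k) q) (cong (_+ (q - + 1) * + N) (sym (N-K k))))
    (s≤s (ℕₚ.m∸n≤m (h ℕ.+ h) (toℕ k)))

  h<N∸k : ∀ (k : Fin h) → h ℕ.< N ℕ.∸ suc (toℕ k)
  h<N∸k k = ℕₚ.≤-trans (ℕₚ.≤-reflexive (sym (ℕₚ.m+n∸n≡m (suc h) h)))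
    (ℕₚ.∸-monoʳ-≤ {suc (toℕ k)} {h} N (Finₚ.toℕ<n k))

  sgn-rep : ∀ {c s k} → Rep c s k → sgn c ≡ s
  sgn-rep {c} {Sign.+} {k} R with c %ℕ N ℕ.≤? h
  ... | yes _ = refl
  ... | no ≰h = ⊥-elim (≰h (ℕₚ.≤-trans (ℕₚ.≤-reflexive (rep-residue⁺ R)) (Finₚ.toℕ<n k)))
  sgn-rep {c} {Sign.-} {k} R with c %ℕ N ℕ.≤? h
  ... | yes ≤h = ⊥-elim (ℕₚ.<⇒≱ (h<N∸k k) (ℕₚ.≤-trans (ℕₚ.≤-reflexive (sym (rep-residue⁻ R))) ≤h))
  ... | no _   = refl

  rep-unique : ∀ {c s t k l} → Rep c s k → Rep c t l → k ≡ l
  rep-unique {s = Sign.+} {Sign.+} R R′ = Finₚ.toℕ-injective (ℕₚ.suc-injective (trans (sym (rep-residue⁺ R)) (rep-residue⁺ R′)))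
  rep-unique {s = Sign.-} {Sign.-} {k} {l} R R′ = Finₚ.toℕ-injective (ℕₚ.suc-injective
    (ℕₚ.∸-cancelˡ-≡ (ℕₚ.≤-trans (Finₚ.toℕ<n k) (ℕₚ.<⇒≤ h<N)) (ℕₚ.≤-trans (Finₚ.toℕ<n l) (ℕₚ.<⇒≤ h<N))
      (trans (sym (rep-residue⁻ R)) (rep-residue⁻ R′))))
  rep-unique {s = Sign.+} {Sign.-} R R′ with trans (sym (sgn-rep R)) (sgn-rep R′)
  ... | ()
  rep-unique {s = Sign.-} {Sign.+} R R′ with trans (sym (sgn-rep R)) (sgn-rep R′)
  ... | ()

  index : ∀ {j} → 0 ℕ.< j → j ℕ.≤ h → ∃ λ (k : Fin h) → suc (toℕ k) ≡ j
  index {suc j} _ l = fromℕ< l , cong suc (Finₚ.toℕ-fromℕ< l)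

  rep-exists : ∀ c → c %ℕ N ≢ 0 → ∃ λ s → ∃ λ k → Rep c s k
  rep-exists c ρ≢0 with c %ℕ N ℕ.≤? h
  ... | yes ≤h with index (ℕₚ.n≢0⇒n>0 ρ≢0) ≤h
  ...   | k , e = Sign.+ , k , rep (mod (c /ℕ N) (trans (a≡a%ℕn+[a/ℕn]*n c N)
            (trans (cong (λ x → + x + c /ℕ N * + N) (sym e)) (sym (pos-rep (+ N) (K k) (c /ℕ N))))))
  rep-exists c ρ≢0 | no ≰h
    with index {N ℕ.∸ c %ℕ N} (ℕₚ.m<n⇒0<n∸m (n%ℕd<d c N))
      (ℕₚ.≤-trans (ℕₚ.∸-monoʳ-≤ N (ℕₚ.≰⇒> ≰h)) (ℕₚ.≤-reflexive (ℕₚ.m+n∸n≡m h h)))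
  ...   | k , e = Sign.- , k , rep (mod (c /ℕ N + + 1) (trans (a≡a%ℕn+[a/ℕn]*n c N)
            (trans (cong (_+ c /ℕ N * + N) ρ≡) (lem (+ N) (K k) (c /ℕ N)))))
    where
    ρ≡ : + (c %ℕ N) ≡ + N - K k
    ρ≡ = trans (cong +_ (trans (sym (ℕₚ.m∸[m∸n]≡n (ℕₚ.<⇒≤ (n%ℕd<d c N)))) (cong (N ℕ.∸_) (sym e)))) (N-K k)
    lem : ∀ m k q → (m - k) + q * m ≡ - (+ 1) * k + (q + + 1) * m
    lem = solve-∀

  -- Gauss's lemma taken as the definition; for composite N this is still the Jacobi symbol. When a
  -- is not coprime to N the product is a sign and not 0, which is why multiplicativity carries
  -- coprimality hypotheses.
  jacobi : ℤ → Sign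
  jacobi a = ∏ {h} (λ k → sgn (a * K k))

  sgn-cong : ∀ {a b} → a ≈ b [ + N ] → sgn a ≡ sgn b
  sgn-cong {a} {b} e with a %ℕ N ℕ.≤? h | b %ℕ N ℕ.≤? h
  ... | yes _ | yes _ = refl
  ... | no  _ | no  _ = refl
  ... | yes p | no ¬p = ⊥-elim (¬p (subst (ℕ._≤ h) (residue-cong e) p))
  ... | no ¬p | yes p = ⊥-elim (¬p (subst (ℕ._≤ h) (sym (residue-cong e)) p))

  jacobi-cong : ∀ {a b} → a ≈ b [ + N ] → jacobi a ≡ jacobi b
  jacobi-cong e = ∏-cong {h} (λ k → sgn-cong (*-congʳ-≈ (K k) e))

  K-not-multiple : ∀ {a} (k : Fin h) q → Coprimeᴿ a (+ N) → a * K k ≢ q * + N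
  K-not-multiple {a} k q cop e = absurd (Coprime-∣* {+ N} {a} {K k} (Coprime-sym {a} {+ N} cop) (div q e))
    where
    absurd : + N ∣ᴿ K k → ⊥
    absurd (div q′ e′) = nonzero (small-multiple {N} q′ e′ (ℕₚ.≤-<-trans (Finₚ.toℕ<n k) h<N))
      where
      nonzero : K k ≢ + 0
      nonzero ()

  residue≢0 : ∀ {a} → Coprimeᴿ a (+ N) → (k : Fin h) → (a * K k) %ℕ N ≢ 0
  residue≢0 {a} cop k eq = K-not-multiple k ((a * K k) /ℕ N) cop
    (trans (a≡a%ℕn+[a/ℕn]*n (a * K k) N)
      (trans (cong (λ x → + x + (a * K k) /ℕ N * + N) eq) (ℤₚ.+-identityˡ _)))

  module Act {a : ℤ} (cop : Coprimeᴿ a (+ N)) where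
    private
      E : (k : Fin h) → ∃ λ s → ∃ λ l → Rep (a * K k) s l
      E k = rep-exists (a * K k) (residue≢0 cop k)
    act-sign : Fin h → Sign
    act-sign k = proj₁ (E k)
    act : Fin h → Fin h
    act k = proj₁ (proj₂ (E k))
    act-rep : ∀ k → Rep (a * K k) (act-sign k) (act k)
    act-rep k = proj₂ (proj₂ (E k))

  -- Absolutely least residues are unique up to sign, so multiplication by an inverse of b undoes
  -- multiplication by b. This makes `act` a permutation.
  act-inverse : ∀ {a b} (ca : Coprimeᴿ a (+ N)) (cb : Coprimeᴿ b (+ N)) → a * b ≈ + 1 [ + N ] →
    ∀ k → Act.act ca (Act.act cb k) ≡ k
  act-inverse {a} {b} ca cb e k = rep-unique {a * K l} {Act.act-sign ca l} {s} (Act.act-rep ca l) (rep key)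
    where
    l = Act.act cb k
    s = Act.act-sign cb k
    σ² : ∀ s x → x ≡ σ s * (σ s * x)
    σ² Sign.+ = lem where
      lem : ∀ x → x ≡ + 1 * (+ 1 * x)
      lem = solve-∀
    σ² Sign.- = lem where
      lem : ∀ x → x ≡ - (+ 1) * (- (+ 1) * x)
      lem = solve-∀
    shuffle : ∀ σ a x → σ * (σ * (a * x)) ≡ σ * (a * (σ * x))
    shuffle = solve-∀
    key : a * K l ≈ σ s * K k [ + N ]
    key = ≈-trans (≡⇒≈ (trans (σ² s (a * K l)) (shuffle (σ s) a (K l))))
      (*-congˡ-≈ (σ s) (≈-trans (*-congˡ-≈ a (≈-sym (Rep.cong-≈ (Act.act-rep cb k))))
        (≈-trans (≡⇒≈ (sym (ℤₚ.*-assoc a b (K k))))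
          (≈-trans (*-congʳ-≈ (K k) e) (≡⇒≈ (ℤₚ.*-identityˡ (K k)))))))

  -- Multiplication by b permutes 1, …, h up to signs.
  jacobi-* : ∀ {a b} → Coprimeᴿ a (+ N) → Coprimeᴿ b (+ N) → jacobi (a * b) ≡ jacobi a Sign.* jacobi b
  jacobi-* {a} {b} ca cb = begin
    ∏ {h} (λ k → sgn (a * b * K k))                        ≡⟨ ∏-cong {h} step ⟩
    ∏ {h} (λ k → sgn (a * K (act k)) Sign.* sgn (b * K k)) ≡⟨ ∏-distrib-* {h} (λ k → sgn (a * K (act k))) (λ k → sgn (b * K k)) ⟩
    ∏ {h} (λ k → sgn (a * K (act k))) Sign.* jacobi b        ≡⟨ cong (Sign._* jacobi b) (sym (∏-permute {h} {h} (λ k → sgn (a * K k)) π)) ⟩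
    jacobi a Sign.* jacobi b                                     ∎
    where
    open ≡-Reasoning
    open Act cb
    inv = bezout-inverse cb
      where
      bezout-inverse : Coprimeᴿ b (+ N) → ∃ λ b′ → Coprimeᴿ b′ (+ N) × (b * b′ ≈ + 1 [ + N ]) × (b′ * b ≈ + 1 [ + N ])
      bezout-inverse (bez {s} {t} e) = s , bez {s = b} {t = t} (trans (cong (_+ t * + N) (ℤₚ.*-comm b s)) e) ,
        ≈-sym (mod t (trans (sym e) (cong (_+ t * + N) (ℤₚ.*-comm s b)))) , ≈-sym (mod t (sym e))
    π : Permutation h h
    π = permutation act (Act.act (proj₁ (proj₂ inv)))
      (act-inverse cb (proj₁ (proj₂ inv)) (proj₁ (proj₂ (proj₂ inv))))
      (act-inverse (proj₁ (proj₂ inv)) cb (proj₂ (proj₂ (proj₂ inv))))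
    shuffle : ∀ a s x → a * (s * x) ≡ s * (a * x)
    shuffle = solve-∀
    step : ∀ k → sgn (a * b * K k) ≡ sgn (a * K (act k)) Sign.* sgn (b * K k)
    step k = trans (sgn-rep (rep {s = s′ Sign.* s} {k = Act.act ca (act k)} both))
      (sym (cong₂ Sign._*_ (sgn-rep (Act.act-rep ca (act k))) (sgn-rep (act-rep k))))
      where
      s = act-sign k
      s′ = Act.act-sign ca (act k)
      both : a * b * K k ≈ σ (s′ Sign.* s) * K (Act.act ca (act k)) [ + N ]
      both = ≈-trans (≡⇒≈ (ℤₚ.*-assoc a b (K k)))
        (≈-trans (*-congˡ-≈ a (Rep.cong-≈ (act-rep k)))
        (≈-trans (≡⇒≈ (shuffle a (σ s) (K (act k))))
        (≈-trans (*-congˡ-≈ (σ s) (Rep.cong-≈ (Act.act-rep ca (act k))))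
          (≡⇒≈ (trans (sym (ℤₚ.*-assoc (σ s) (σ s′) _))
            (cong (_* K (Act.act ca (act k))) (trans (ℤₚ.*-comm (σ s) (σ s′)) (sym (σ-* s′ s)))))))))

  jacobi-1 : jacobi (+ 1) ≡ Sign.+
  jacobi-1 = trans (∏-cong {h} (λ k → sgn-rep {k = k} (rep ≈-refl))) (∏-+ h)

  jacobi-neg1 : jacobi (- (+ 1)) ≡ alternate h
  jacobi-neg1 = trans (∏-cong {h} (λ k → sgn-rep {k = k} (rep ≈-refl))) (∏-- h)

  -- Here t is ⌊h/2⌋: the doubles 2k stay within 1, ..., h for k ≤ t, and the remaining e of them
  -- have negative least residue.
  jacobi-2 : ∀ t e → t ℕ.+ e ≡ h → 2 ℕ.* t ℕ.≤ h → h ℕ.≤ suc (2 ℕ.* t) → jacobi (+ 2) ≡ alternate e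
  jacobi-2 t e refl lo hi = trans (∏-threshold t e refl Sign.+ Sign.- (λ k → sgn (+ 2 * K k)) pos neg)
      (trans (cong (Sign._* ∏ {e} (λ _ → Sign.-)) (∏-+ t)) (∏-- e))
    where
    pos : ∀ k → toℕ k ℕ.< t → sgn (+ 2 * K k) ≡ Sign.+
    pos k l with index {2 ℕ.* suc (toℕ k)} (s≤s z≤n) (ℕₚ.≤-trans (ℕₚ.*-monoʳ-≤ 2 l) lo)
    ... | j , eq = sgn-rep (rep {k = j} (≡⇒≈ (trans (sym (ℤₚ.pos-* 2 (suc (toℕ k)))) (trans (cong +_ (sym eq)) (sym (ℤₚ.*-identityˡ (K j)))))))
    neg : ∀ k → t ℕ.≤ toℕ k → sgn (+ 2 * K k) ≡ Sign.-
    neg k l with index {N ℕ.∸ 2 ℕ.* suc (toℕ k)} (ℕₚ.m<n⇒0<n∸m (s≤s 2K≤)) (ℕₚ.≤-trans (ℕₚ.∸-monoʳ-≤ N h<2K) (ℕₚ.≤-reflexive (ℕₚ.m+n∸n≡m h h)))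
      where
      2K≤ : 2 ℕ.* suc (toℕ k) ℕ.≤ h ℕ.+ h
      2K≤ = ℕₚ.≤-trans (ℕₚ.*-monoʳ-≤ 2 (Finₚ.toℕ<n k)) (ℕₚ.≤-reflexive (cong (h ℕ.+_) (ℕₚ.+-identityʳ h)))
      h<2K : suc h ℕ.≤ 2 ℕ.* suc (toℕ k)
      h<2K = ℕₚ.≤-trans (s≤s hi) (ℕₚ.≤-trans (ℕₚ.≤-reflexive (lem t)) (ℕₚ.*-monoʳ-≤ 2 (s≤s l)))
        where
        lem : ∀ t → 2 ℕ.+ 2 ℕ.* t ≡ 2 ℕ.* suc t
        lem = ℕS.solve-∀
    ... | j , eq = sgn-rep (rep {k = j} (mod (+ 1) (trans (sym (ℤₚ.pos-* 2 (suc (toℕ k)))) (trans (lem (+ N) (+ (2 ℕ.* suc (toℕ k))))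
        (cong (λ x → - (+ 1) * x + + 1 * + N) (sym eq′))))))
      where
      eq′ : K j ≡ + N - + (2 ℕ.* suc (toℕ k))
      eq′ = trans (cong +_ eq) (sym (trans (ℤₚ.m-n≡m⊖n N (2 ℕ.* suc (toℕ k))) (ℤₚ.⊖-≥ 2K≤N)))
        where
        2K≤N : 2 ℕ.* suc (toℕ k) ℕ.≤ N
        2K≤N = ℕₚ.m≤n⇒m≤1+n (ℕₚ.≤-trans (ℕₚ.*-monoʳ-≤ 2 (Finₚ.toℕ<n k)) (ℕₚ.≤-reflexive (cong (h ℕ.+_) (ℕₚ.+-identityʳ h))))
      lem : ∀ n x → x ≡ - (+ 1) * (n - x) + + 1 * n
      lem = solve-∀

-- Quadratic reciprocity by counting lattice points

cmp : ℕ → ℕ → Sign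
cmp x y with x ℕ.≤? y
... | yes _ = Sign.+
... | no  _ = Sign.-

cmp-≤ : ∀ {x y} → x ℕ.≤ y → cmp x y ≡ Sign.+
cmp-≤ {x} {y} p with x ℕ.≤? y
... | yes _ = refl
... | no ¬p = ⊥-elim (¬p p)

cmp-> : ∀ {x y} → y ℕ.< x → cmp x y ≡ Sign.-
cmp-> {x} {y} p with x ℕ.≤? y
... | yes q = ⊥-elim (ℕₚ.<⇒≱ p q)
... | no _  = refl

cmp-≢ : ∀ {x y} → x ≢ y → cmp x y Sign.* cmp y x ≡ Sign.-
cmp-≢ {x} {y} x≢y with ℕₚ.≤-total x y
... | inj₁ p = cong₂ Sign._*_ (cmp-≤ p) (cmp-> (ℕₚ.≤∧≢⇒< p x≢y))
... | inj₂ p = cong₂ Sign._*_ (cmp-> (ℕₚ.≤∧≢⇒< p (λ e → x≢y (sym e)))) (cmp-≤ p)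

Kℕ : ∀ {h} → Fin h → ℕ
Kℕ k = suc (toℕ k)

-- The sign of (k/N - l/M)(k/N + l/M - 1/2), Kronecker's factor for the pair (k, l), with
-- denominators cleared.
cell : ℕ → ℕ → ℕ → ℕ → Sign
cell M N k l = cmp (N ℕ.* l) (M ℕ.* k) Sign.* cmp (M ℕ.* N) (2 ℕ.* (N ℕ.* l) ℕ.+ 2 ℕ.* (M ℕ.* k))

private
  -- With Mk = ρ + fN and M = 2h′ + 1, the second comparison in `cell` changes at l = h′ - f if ρ ≤
  -- h and at l = h′ - f - 1 if ρ > h. These four inequalities bound it on both sides of the change.
  below-low : ∀ h f x ρ L → ρ ℕ.≤ h → L ℕ.≤ x → 2 ℕ.* (odd h ℕ.* L) ℕ.+ 2 ℕ.* (ρ ℕ.+ f ℕ.* odd h) ℕ.< odd (f ℕ.+ x) ℕ.* odd h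
  below-low h f x ρ L p q = ℕₚ.≤-trans
    (s≤s (ℕₚ.+-mono-≤ (ℕₚ.*-monoʳ-≤ 2 (ℕₚ.*-monoʳ-≤ (odd h) q)) (ℕₚ.*-monoʳ-≤ 2 (ℕₚ.+-monoˡ-≤ (f ℕ.* odd h) p))))
    (ℕₚ.≤-reflexive (lem h f x))
    where
    lem : ∀ h f x → 1 ℕ.+ (2 ℕ.* ((1 ℕ.+ (h ℕ.+ h)) ℕ.* x) ℕ.+ 2 ℕ.* (h ℕ.+ f ℕ.* (1 ℕ.+ (h ℕ.+ h)))) ≡ (1 ℕ.+ ((f ℕ.+ x) ℕ.+ (f ℕ.+ x))) ℕ.* (1 ℕ.+ (h ℕ.+ h))
    lem = ℕS.solve-∀

  above-low : ∀ h f x ρ L → x ℕ.< L → odd (f ℕ.+ x) ℕ.* odd h ℕ.≤ 2 ℕ.* (odd h ℕ.* L) ℕ.+ 2 ℕ.* (ρ ℕ.+ f ℕ.* odd h)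
  above-low h f x ρ L q = ℕₚ.≤-trans (ℕₚ.≤-trans (ℕₚ.m≤m+n _ (odd h)) (ℕₚ.≤-reflexive (lem h f x)))
    (ℕₚ.+-mono-≤ (ℕₚ.*-monoʳ-≤ 2 (ℕₚ.*-monoʳ-≤ (odd h) q)) (ℕₚ.*-monoʳ-≤ 2 (ℕₚ.m≤n+m (f ℕ.* odd h) ρ)))
    where
    lem : ∀ h f x → (1 ℕ.+ ((f ℕ.+ x) ℕ.+ (f ℕ.+ x))) ℕ.* (1 ℕ.+ (h ℕ.+ h)) ℕ.+ (1 ℕ.+ (h ℕ.+ h)) ≡ 2 ℕ.* ((1 ℕ.+ (h ℕ.+ h)) ℕ.* (1 ℕ.+ x)) ℕ.+ 2 ℕ.* (f ℕ.* (1 ℕ.+ (h ℕ.+ h)))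
    lem = ℕS.solve-∀

  below-high : ∀ h f y ρ L → ρ ℕ.< odd h → L ℕ.≤ y → 2 ℕ.* (odd h ℕ.* L) ℕ.+ 2 ℕ.* (ρ ℕ.+ f ℕ.* odd h) ℕ.< odd (suc (f ℕ.+ y)) ℕ.* odd h
  below-high h f y ρ L (s≤s p) q = ℕₚ.≤-trans
    (s≤s (ℕₚ.+-mono-≤ (ℕₚ.*-monoʳ-≤ 2 (ℕₚ.*-monoʳ-≤ (odd h) q)) (ℕₚ.*-monoʳ-≤ 2 (ℕₚ.+-monoˡ-≤ (f ℕ.* odd h) p))))
    (ℕₚ.≤-trans (ℕₚ.m≤m+n _ (2 ℕ.* h ℕ.+ 2)) (ℕₚ.≤-reflexive (lem h f y)))
    where
    lem : ∀ h f y → 1 ℕ.+ (2 ℕ.* ((1 ℕ.+ (h ℕ.+ h)) ℕ.* y) ℕ.+ 2 ℕ.* ((h ℕ.+ h) ℕ.+ f ℕ.* (1 ℕ.+ (h ℕ.+ h)))) ℕ.+ (2 ℕ.* h ℕ.+ 2) ≡ (1 ℕ.+ ((1 ℕ.+ (f ℕ.+ y)) ℕ.+ (1 ℕ.+ (f ℕ.+ y)))) ℕ.* (1 ℕ.+ (h ℕ.+ h))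
    lem = ℕS.solve-∀

  above-high : ∀ h f y ρ L → h ℕ.< ρ → y ℕ.< L → odd (suc (f ℕ.+ y)) ℕ.* odd h ℕ.≤ 2 ℕ.* (odd h ℕ.* L) ℕ.+ 2 ℕ.* (ρ ℕ.+ f ℕ.* odd h)
  above-high h f y ρ L p q = ℕₚ.≤-trans (ℕₚ.≤-trans (ℕₚ.m≤m+n _ 1) (ℕₚ.≤-reflexive (lem h f y)))
    (ℕₚ.+-mono-≤ (ℕₚ.*-monoʳ-≤ 2 (ℕₚ.*-monoʳ-≤ (odd h) q)) (ℕₚ.*-monoʳ-≤ 2 (ℕₚ.+-monoˡ-≤ (f ℕ.* odd h) p)))
    where
    lem : ∀ h f y → (1 ℕ.+ ((1 ℕ.+ (f ℕ.+ y)) ℕ.+ (1 ℕ.+ (f ℕ.+ y)))) ℕ.* (1 ℕ.+ (h ℕ.+ h)) ℕ.+ 1 ≡ 2 ℕ.* ((1 ℕ.+ (h ℕ.+ h)) ℕ.* (1 ℕ.+ y)) ℕ.+ 2 ℕ.* ((1 ℕ.+ h) ℕ.+ f ℕ.* (1 ℕ.+ (h ℕ.+ h)))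
    lem = ℕS.solve-∀

  half-≤ : ∀ {f g} → f ℕ.+ f ℕ.< odd g → f ℕ.≤ g
  half-≤ {f} {g} (s≤s p) with ℕₚ.≤-total f g
  ... | inj₁ q = q
  ... | inj₂ q with ℕₚ.m≤n⇒m<n∨m≡n q
  ...   | inj₂ refl = ℕₚ.≤-refl
  ...   | inj₁ r = ⊥-elim (ℕₚ.<⇒≱ (ℕₚ.+-mono-<-≤ r q) p)

sgn-≤ : ∀ h c → c %ℕ odd h ℕ.≤ h → Schering.sgn h c ≡ Sign.+
sgn-≤ h c p with c %ℕ odd h ℕ.≤? h
... | yes _ = refl
... | no ¬p = ⊥-elim (¬p p)

sgn-> : ∀ h c → h ℕ.< c %ℕ odd h → Schering.sgn h c ≡ Sign.-
sgn-> h c p with c %ℕ odd h ℕ.≤? h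
... | yes q = ⊥-elim (ℕₚ.<⇒≱ p q)
... | no _  = refl

-- Kronecker's product formula for the Gauss sign of one multiple of M.
sgn-cells : ∀ h h′ k → 1 ℕ.≤ k → k ℕ.≤ h → Schering.sgn h (+ (odd h′ ℕ.* k)) ≡ ∏ {h′} (λ l → cell (odd h′) (odd h) k (Kℕ l))
sgn-cells h h′ k 1≤k k≤h = trans main (sym (∏-distrib-* {h′} g₁ g₂))
  where
  M = odd h′
  N = odd h
  ρ = (M ℕ.* k) ℕ.% N
  f = (M ℕ.* k) ℕ./ N
  g₁ g₂ : Fin h′ → Sign
  g₁ l = cmp (N ℕ.* Kℕ l) (M ℕ.* k)
  g₂ l = cmp (M ℕ.* N) (2 ℕ.* (N ℕ.* Kℕ l) ℕ.+ 2 ℕ.* (M ℕ.* k))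
  Mk : M ℕ.* k ≡ ρ ℕ.+ f ℕ.* N
  Mk = ℕD.m≡m%n+[m/n]*n (M ℕ.* k) N
  ρ<N : ρ ℕ.< N
  ρ<N = ℕD.m%n<n (M ℕ.* k) N
  2Mk<MN : 2 ℕ.* (M ℕ.* k) ℕ.< M ℕ.* N
  2Mk<MN = ℕₚ.≤-trans (ℕₚ.≤-trans (ℕₚ.m≤m+n (suc (2 ℕ.* (M ℕ.* k))) (h′ ℕ.+ h′)) (ℕₚ.≤-reflexive (lem h′ k)))
    (ℕₚ.*-monoʳ-≤ M (s≤s (ℕₚ.+-mono-≤ k≤h k≤h)))
    where
    lem : ∀ h′ k → 1 ℕ.+ 2 ℕ.* ((1 ℕ.+ (h′ ℕ.+ h′)) ℕ.* k) ℕ.+ (h′ ℕ.+ h′) ≡ (1 ℕ.+ (h′ ℕ.+ h′)) ℕ.* (1 ℕ.+ (k ℕ.+ k))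
    lem = ℕS.solve-∀
  f≤h′ : f ℕ.≤ h′
  f≤h′ = half-≤ (ℕₚ.*-cancelʳ-< N (f ℕ.+ f) M (ℕₚ.≤-<-trans
    (ℕₚ.≤-trans (ℕₚ.m≤n+m ((f ℕ.+ f) ℕ.* N) (2 ℕ.* ρ)) (ℕₚ.≤-reflexive (trans (lem ρ f N) (cong (2 ℕ.*_) (sym Mk))))) 2Mk<MN))
    where
    lem : ∀ ρ f N → 2 ℕ.* ρ ℕ.+ (f ℕ.+ f) ℕ.* N ≡ 2 ℕ.* (ρ ℕ.+ f ℕ.* N)
    lem = ℕS.solve-∀
  x = h′ ℕ.∸ f
  f+x : f ℕ.+ x ≡ h′
  f+x = ℕₚ.m+[n∸m]≡n f≤h′
  ∏-g₁ : ∏ {h′} g₁ ≡ alternate x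
  ∏-g₁ = trans (∏-threshold f x f+x Sign.+ Sign.- g₁ pos neg)
    (trans (cong (Sign._* ∏ {x} (λ _ → Sign.-)) (∏-+ f)) (∏-- x))
    where
    pos : ∀ l → toℕ l ℕ.< f → g₁ l ≡ Sign.+
    pos l p = cmp-≤ (ℕₚ.≤-trans (ℕₚ.*-monoʳ-≤ N p) (ℕₚ.≤-trans (ℕₚ.≤-trans (ℕₚ.≤-reflexive (ℕₚ.*-comm N f)) (ℕₚ.m≤n+m (f ℕ.* N) ρ)) (ℕₚ.≤-reflexive (sym Mk))))
    neg : ∀ l → f ℕ.≤ toℕ l → g₁ l ≡ Sign.-
    neg l p = cmp-> (ℕₚ.≤-<-trans (ℕₚ.≤-reflexive Mk) (ℕₚ.<-≤-trans (ℕₚ.+-monoˡ-< (f ℕ.* N) ρ<N)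
      (ℕₚ.≤-trans (ℕₚ.≤-reflexive (ℕₚ.*-comm (suc f) N)) (ℕₚ.*-monoʳ-≤ N (s≤s p)))))
  ∏-g₂ : ∀ t e → t ℕ.+ e ≡ h′ → (∀ L → L ℕ.≤ t → 2 ℕ.* (N ℕ.* L) ℕ.+ 2 ℕ.* (ρ ℕ.+ f ℕ.* N) ℕ.< M ℕ.* N) →
    (∀ L → t ℕ.< L → M ℕ.* N ℕ.≤ 2 ℕ.* (N ℕ.* L) ℕ.+ 2 ℕ.* (ρ ℕ.+ f ℕ.* N)) → ∏ {h′} g₂ ≡ alternate t
  ∏-g₂ t e t+e lo hi = trans (∏-threshold t e t+e Sign.- Sign.+ g₂
      (λ l p → cmp-> (subst (λ z → 2 ℕ.* (N ℕ.* Kℕ l) ℕ.+ 2 ℕ.* z ℕ.< M ℕ.* N) (sym Mk) (lo (Kℕ l) p)))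
      (λ l p → cmp-≤ (subst (λ z → M ℕ.* N ℕ.≤ 2 ℕ.* (N ℕ.* Kℕ l) ℕ.+ 2 ℕ.* z) (sym Mk) (hi (Kℕ l) (s≤s p)))))
    (trans (cong₂ Sign._*_ (∏-- t) (∏-+ e)) (Signₚ.*-identityʳ _))
  main : Schering.sgn h (+ (M ℕ.* k)) ≡ ∏ {h′} g₁ Sign.* ∏ {h′} g₂
  -- The two products are (-1)^x and (-1)^x if ρ ≤ h, but (-1)^x and (-1)^(x - 1) if ρ > h.
  main with ℕₚ.≤-<-connex ρ h
  ... | inj₁ ρ≤h = trans (sgn-≤ h (+ (M ℕ.* k)) ρ≤h) (sym (trans (cong₂ Sign._*_ ∏-g₁
        (∏-g₂ x f (trans (ℕₚ.+-comm x f) f+x)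
          (λ L p → subst (λ z → 2 ℕ.* (N ℕ.* L) ℕ.+ 2 ℕ.* (ρ ℕ.+ f ℕ.* N) ℕ.< odd z ℕ.* N) f+x (below-low h f x ρ L ρ≤h p))
          (λ L p → subst (λ z → odd z ℕ.* N ℕ.≤ 2 ℕ.* (N ℕ.* L) ℕ.+ 2 ℕ.* (ρ ℕ.+ f ℕ.* N)) f+x (above-low h f x ρ L p))))
        (alternate-double x)))
  ... | inj₂ h<ρ = trans (sgn-> h (+ (M ℕ.* k)) h<ρ) (sym (trans (cong₂ Sign._*_
        (trans ∏-g₁ (cong alternate x≡)) (∏-g₂ y (suc f) (trans (ℕₚ.+-suc y f) (trans (cong suc (ℕₚ.+-comm y f)) f+y))
          (λ L p → subst (λ z → 2 ℕ.* (N ℕ.* L) ℕ.+ 2 ℕ.* (ρ ℕ.+ f ℕ.* N) ℕ.< odd z ℕ.* N) f+y (below-high h f y ρ L ρ<N p))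
          (λ L p → subst (λ z → odd z ℕ.* N ℕ.≤ 2 ℕ.* (N ℕ.* L) ℕ.+ 2 ℕ.* (ρ ℕ.+ f ℕ.* N)) f+y (above-high h f y ρ L h<ρ p))))
        (trans (Signₚ.*-assoc Sign.- (alternate y) (alternate y)) (cong (Sign.- Sign.*_) (alternate-double y)))))
    where
    lem : ∀ h f N → 2 ℕ.* ((1 ℕ.+ h) ℕ.+ f ℕ.* N) ≡ (1 ℕ.+ (h ℕ.+ h)) ℕ.+ (f ℕ.+ f) ℕ.* N ℕ.+ 1
    lem = ℕS.solve-∀
    f<h′ : suc f ℕ.≤ h′
    f<h′ = half-≤ (ℕₚ.≤-<-trans (ℕₚ.≤-reflexive (cong suc (ℕₚ.+-suc f f))) (s≤s f+f<))
      where
      f+f< : suc (f ℕ.+ f) ℕ.< h′ ℕ.+ h′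
      -- The estimate gives only 2f + 1 ≤ 2h′; parity makes it strict.
      f+f< = strict (ℕₚ.≤-pred (ℕₚ.*-cancelʳ-< N (suc (f ℕ.+ f)) M (ℕₚ.<-≤-trans (ℕₚ.≤-<-trans
        (ℕₚ.≤-trans (ℕₚ.m≤m+n (N ℕ.+ (f ℕ.+ f) ℕ.* N) 1) (ℕₚ.≤-trans (ℕₚ.≤-reflexive (sym (lem h f N)))
          (ℕₚ.≤-trans (ℕₚ.*-monoʳ-≤ 2 (ℕₚ.+-monoˡ-≤ (f ℕ.* N) h<ρ)) (ℕₚ.≤-reflexive (cong (2 ℕ.*_) (sym Mk)))))) 2Mk<MN) ℕₚ.≤-refl)))
        where
        strict : suc (f ℕ.+ f) ℕ.≤ h′ ℕ.+ h′ → suc (f ℕ.+ f) ℕ.< h′ ℕ.+ h′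
        strict p with ℕₚ.m≤n⇒m<n∨m≡n p
        ... | inj₁ q = q
        ... | inj₂ e = ⊥-elim (parity f h′ e)
          where
          parity : ∀ a b → suc (a ℕ.+ a) ≢ b ℕ.+ b
          parity zero    (suc zero)    ()
          parity zero    (suc (suc b)) ()
          parity (suc a) (suc b) e = parity a b (ℕₚ.suc-injective (trans (cong suc (sym (ℕₚ.+-suc a a))) (trans (ℕₚ.suc-injective e) (ℕₚ.+-suc b b))))
    y = h′ ℕ.∸ suc f
    f+y : suc (f ℕ.+ y) ≡ h′
    f+y = ℕₚ.m+[n∸m]≡n f<h′
    x≡ : x ≡ suc y
    x≡ = ℕₚ.+-cancelˡ-≡ f x (suc y) (trans f+x (trans (sym f+y) (sym (ℕₚ.+-suc f y))))

-- Exchanging (M, k) with (N, l) keeps the second factor of `cell` and reverses the first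
-- comparison, in which equality is excluded by coprimality. So each of the h · h′ pairs contributes
-- - 1.
reciprocity : ∀ h h′ → Coprimeᴿ (+ odd h′) (+ odd h) →
  Schering.jacobi h (+ odd h′) Sign.* Schering.jacobi h′ (+ odd h) ≡ ∏ {h} (λ _ → alternate h′)
reciprocity h h′ cop = begin
  Schering.jacobi h (+ M) Sign.* Schering.jacobi h′ (+ N)
    ≡⟨ cong₂ Sign._*_ (expand h h′) (trans (expand h′ h) (∏-comm {h′} {h} (λ l k → cell N M (Kℕ l) (Kℕ k)))) ⟩
  ∏ {h} (λ k → ∏ {h′} (λ l → cell M N (Kℕ k) (Kℕ l))) Sign.* ∏ {h} (λ k → ∏ {h′} (λ l → cell N M (Kℕ l) (Kℕ k)))
    ≡⟨ sym (∏-distrib-* {h} _ _) ⟩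
  ∏ {h} (λ k → ∏ {h′} (λ l → cell M N (Kℕ k) (Kℕ l)) Sign.* ∏ {h′} (λ l → cell N M (Kℕ l) (Kℕ k)))
    ≡⟨ ∏-cong {h} (λ k → trans (sym (∏-distrib-* {h′} _ _)) (trans (∏-cong {h′} (λ l → pair k l)) (∏-- h′))) ⟩
  ∏ {h} (λ _ → alternate h′) ∎
  where
  open ≡-Reasoning
  M = odd h′
  N = odd h
  expand : ∀ h h′ → Schering.jacobi h (+ odd h′) ≡ ∏ {h} (λ k → ∏ {h′} (λ l → cell (odd h′) (odd h) (Kℕ k) (Kℕ l)))
  expand h h′ = ∏-cong {h} (λ k → trans (cong (Schering.sgn h) (sym (ℤₚ.pos-* (odd h′) (Kℕ k)))) (sgn-cells h h′ (Kℕ k) (s≤s z≤n) (Finₚ.toℕ<n k)))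
  pair : ∀ (k : Fin h) (l : Fin h′) → cell M N (Kℕ k) (Kℕ l) Sign.* cell N M (Kℕ l) (Kℕ k) ≡ Sign.-
  pair k l = trans (cong (λ z → a Sign.* b Sign.* (c Sign.* z)) (cong₂ cmp (ℕₚ.*-comm N M) (ℕₚ.+-comm (2 ℕ.* (M ℕ.* Kℕ k)) (2 ℕ.* (N ℕ.* Kℕ l)))))
    (trans (shuffle a b c) (cmp-≢ ≢))
    where
    a = cmp (N ℕ.* Kℕ l) (M ℕ.* Kℕ k)
    b = cmp (M ℕ.* N) (2 ℕ.* (N ℕ.* Kℕ l) ℕ.+ 2 ℕ.* (M ℕ.* Kℕ k))
    c = cmp (M ℕ.* Kℕ k) (N ℕ.* Kℕ l)
    shuffle : ∀ a b c → a Sign.* b Sign.* (c Sign.* b) ≡ a Sign.* c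
    shuffle Sign.+ Sign.+ Sign.+ = refl
    shuffle Sign.+ Sign.+ Sign.- = refl
    shuffle Sign.+ Sign.- Sign.+ = refl
    shuffle Sign.+ Sign.- Sign.- = refl
    shuffle Sign.- Sign.+ Sign.+ = refl
    shuffle Sign.- Sign.+ Sign.- = refl
    shuffle Sign.- Sign.- Sign.+ = refl
    shuffle Sign.- Sign.- Sign.- = refl
    ≢ : N ℕ.* Kℕ l ≢ M ℕ.* Kℕ k
    ≢ e = Schering.K-not-multiple h k (K l) cop
      (trans (sym (ℤₚ.pos-* M (Kℕ k))) (trans (cong +_ (sym e)) (trans (ℤₚ.pos-* N (Kℕ l)) (ℤₚ.*-comm (+ N) (K l)))))

-- The symbol for odd moduli of either sign

-1ℤ : ℤ
-1ℤ = - (+ 1)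

half : ℤ → ℕ
half X = ⌊ ∣ X ∣ /2⌋

⌊odd/2⌋ : ∀ m → ⌊ odd m /2⌋ ≡ m
⌊odd/2⌋ zero    = refl
⌊odd/2⌋ (suc m) = cong suc (trans (cong (λ x → ⌊ x /2⌋) (ℕₚ.+-suc m m)) (⌊odd/2⌋ m))

-- A residue class modulo d determines |X| only together with the sign of X: |X| is in the class of
-- c for X > 0 and of d - c for X < 0. The functions `h⁺` and `h⁻` are the resulting forms of (|X| -
-- 1)/2.
data Shape (X : ℤ) (h⁺ h⁻ : ℕ → ℕ) : Set where
  pos : ∀ m → sign X ≡ Sign.+ → half X ≡ h⁺ m → Shape X h⁺ h⁻
  neg : ∀ m → sign X ≡ Sign.- → half X ≡ h⁻ m → Shape X h⁺ h⁻

private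
  abs⁺ : ∀ c d m → + c + + m * + d ≡ + (c ℕ.+ m ℕ.* d)
  abs⁺ c d m = trans (cong (λ z → + c + z) (sym (ℤₚ.pos-* m d))) (sym (ℤₚ.pos-+ c (m ℕ.* d)))

  abs⁻ : ∀ c e d m → d ≡ c ℕ.+ e → + c + -[1+ m ] * + d ≡ - (+ (e ℕ.+ m ℕ.* d))
  abs⁻ c e d m refl = trans (cong (λ z → + c + - (+ 1 + + m) * z) (ℤₚ.pos-+ c e)) (trans (lem (+ c) (+ e) (+ m))
    (cong -_ (trans (cong (λ z → + e + + m * z) (sym (ℤₚ.pos-+ c e))) (abs⁺ e (c ℕ.+ e) m))))
    where
    lem : ∀ c e m → c + - (+ 1 + m) * (c + e) ≡ - (e + m * (c + e))
    lem = solve-∀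

  shape : ∀ c e d {X} → suc d ≡ suc (suc c) ℕ.+ e → (h⁺ h⁻ : ℕ → ℕ) →
    (∀ m → suc c ℕ.+ m ℕ.* d ≡ odd (h⁺ m)) → (∀ m → e ℕ.+ m ℕ.* d ≡ odd (h⁻ m)) →
    X ≈ + suc c [ + d ] → Shape X h⁺ h⁻
  shape c e d de h⁺ h⁻ p n (mod (+ m) refl) = pos m (cong sign (abs⁺ (suc c) d m))
    (trans (cong half (abs⁺ (suc c) d m)) (trans (cong ⌊_/2⌋ (p m)) (⌊odd/2⌋ (h⁺ m))))
  shape c e d de h⁺ h⁻ p n (mod -[1+ m ] refl) = neg m
    (cong sign (trans (abs⁻ (suc c) e d m (ℕₚ.suc-injective de)) (cong (λ z → - (+ z)) (n m))))
    (trans (cong half (abs⁻ (suc c) e d m (ℕₚ.suc-injective de)))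
      (trans (cong ⌊_/2⌋ (trans (ℤₚ.∣-i∣≡∣i∣ (+ (e ℕ.+ m ℕ.* d))) (n m))) (⌊odd/2⌋ (h⁻ m))))

shape-1[4] : ∀ {X} → X ≈ + 1 [ + 4 ] → Shape X (λ m → m ℕ.+ m) (λ m → suc (m ℕ.+ m))
shape-1[4] = shape 0 3 4 refl _ _ l₁ l₂
  where
  l₁ : ∀ m → 1 ℕ.+ m ℕ.* 4 ≡ 1 ℕ.+ ((m ℕ.+ m) ℕ.+ (m ℕ.+ m))
  l₁ = ℕS.solve-∀
  l₂ : ∀ m → 3 ℕ.+ m ℕ.* 4 ≡ 1 ℕ.+ ((1 ℕ.+ (m ℕ.+ m)) ℕ.+ (1 ℕ.+ (m ℕ.+ m)))
  l₂ = ℕS.solve-∀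

shape-1[8] : ∀ {X} → X ≈ + 1 [ + 8 ] → Shape X (λ m → 2 ℕ.* m ℕ.+ 2 ℕ.* m) (λ m → suc (2 ℕ.* m) ℕ.+ suc (suc (2 ℕ.* m)))
shape-1[8] = shape 0 7 8 refl _ _ l₁ l₂
  where
  l₁ : ∀ m → 1 ℕ.+ m ℕ.* 8 ≡ 1 ℕ.+ ((2 ℕ.* m ℕ.+ 2 ℕ.* m) ℕ.+ (2 ℕ.* m ℕ.+ 2 ℕ.* m))
  l₁ = ℕS.solve-∀
  l₂ : ∀ m → 7 ℕ.+ m ℕ.* 8 ≡ 1 ℕ.+ (((1 ℕ.+ 2 ℕ.* m) ℕ.+ (2 ℕ.+ 2 ℕ.* m)) ℕ.+ ((1 ℕ.+ 2 ℕ.* m) ℕ.+ (2 ℕ.+ 2 ℕ.* m)))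
  l₂ = ℕS.solve-∀

shape-3[8] : ∀ {X} → X ≈ + 3 [ + 8 ] → Shape X (λ m → 2 ℕ.* m ℕ.+ suc (2 ℕ.* m)) (λ m → suc (2 ℕ.* m) ℕ.+ suc (2 ℕ.* m))
shape-3[8] = shape 2 5 8 refl _ _ l₁ l₂
  where
  l₁ : ∀ m → 3 ℕ.+ m ℕ.* 8 ≡ 1 ℕ.+ ((2 ℕ.* m ℕ.+ (1 ℕ.+ 2 ℕ.* m)) ℕ.+ (2 ℕ.* m ℕ.+ (1 ℕ.+ 2 ℕ.* m)))
  l₁ = ℕS.solve-∀
  l₂ : ∀ m → 5 ℕ.+ m ℕ.* 8 ≡ 1 ℕ.+ (((1 ℕ.+ 2 ℕ.* m) ℕ.+ (1 ℕ.+ 2 ℕ.* m)) ℕ.+ ((1 ℕ.+ 2 ℕ.* m) ℕ.+ (1 ℕ.+ 2 ℕ.* m)))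
  l₂ = ℕS.solve-∀

Odd : ℤ → Set
Odd X = X ≈ + 1 [ + 2 ]

abs-odd : ∀ {X} → Odd X → ∣ X ∣ ≡ odd (half X)
abs-odd (mod (+ m) refl) = trans (cong ∣_∣ (abs⁺ 1 2 m)) (trans (lem m) (cong odd (sym (trans (cong half (abs⁺ 1 2 m)) (trans (cong ⌊_/2⌋ (lem m)) (⌊odd/2⌋ m))))))
  where
  lem : ∀ m → 1 ℕ.+ m ℕ.* 2 ≡ 1 ℕ.+ (m ℕ.+ m)
  lem = ℕS.solve-∀
abs-odd (mod -[1+ m ] refl) = trans (cong ∣_∣ e) (trans (lem m) (cong odd (sym (trans (cong half e) (trans (cong ⌊_/2⌋ (lem m)) (⌊odd/2⌋ m))))))
  where
  e = abs⁻ 1 1 2 m refl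
  lem : ∀ m → ∣ - (+ (1 ℕ.+ m ℕ.* 2)) ∣ ≡ 1 ℕ.+ (m ℕ.+ m)
  lem m = lem′ m where
    lem′ : ∀ m → 1 ℕ.+ m ℕ.* 2 ≡ 1 ℕ.+ (m ℕ.+ m)
    lem′ = ℕS.solve-∀

-- The symbol (a/|X|). The sign of X is dropped here; it is recovered as the value at a = - 1.
𝕁 : ℤ → ℤ → Sign
𝕁 a X = Schering.jacobi (half X) a

≈-abs : ∀ {a b X} → a ≈ b [ X ] → a ≈ b [ + ∣ X ∣ ]
≈-abs {X = + n} e = e
≈-abs {b = b} {X = -[1+ n ]} (mod q refl) = mod (- q) (lem b q (+ suc n))
  where
  lem : ∀ b q x → b + q * (- x) ≡ b + (- q) * x
  lem = solve-∀

Coprime-abs : ∀ {a X} → Coprimeᴿ a X → Coprimeᴿ a (+ ∣ X ∣)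
Coprime-abs {X = + n} c = c
Coprime-abs {a} {X = -[1+ n ]} (bez {s} {t} e) = bez {s = s} {t = - t} (trans (lem s a t (+ suc n)) e)
  where
  lem : ∀ s a t x → s * a + - t * x ≡ s * a + t * (- x)
  lem = solve-∀

module _ {X : ℤ} (oX : Odd X) where

  private
    ∣X∣ : + ∣ X ∣ ≡ + odd (half X)
    ∣X∣ = cong +_ (abs-odd oX)

    cop : ∀ {a} → Coprimeᴿ a X → Coprimeᴿ a (+ odd (half X))
    cop {a} c = subst (Coprimeᴿ a) ∣X∣ (Coprime-abs {a} {X} c)

  𝕁-cong : ∀ {a b} → a ≈ b [ X ] → 𝕁 a X ≡ 𝕁 b X
  𝕁-cong {a} {b} e = Schering.jacobi-cong (half X) (subst (a ≈ b [_]) ∣X∣ (≈-abs {X = X} e))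

  𝕁-* : ∀ {a b} → Coprimeᴿ a X → Coprimeᴿ b X → 𝕁 (a * b) X ≡ 𝕁 a X Sign.* 𝕁 b X
  𝕁-* {a} {b} ca cb = Schering.jacobi-* (half X) (cop {a} ca) (cop {b} cb)

  𝕁-1 : 𝕁 (+ 1) X ≡ Sign.+
  𝕁-1 = Schering.jacobi-1 (half X)

  𝕁-sq : ∀ {a} → Coprimeᴿ a X → 𝕁 (a * a) X ≡ Sign.+
  𝕁-sq {a} c = trans (𝕁-* {a} {a} c c) (Signₚ.s*s≡+ (𝕁 a X))

  𝕁-sq-* : ∀ {a b} → Coprimeᴿ a X → Coprimeᴿ b X → 𝕁 (a * a * b) X ≡ 𝕁 b X
  𝕁-sq-* {a} {b} ca cb = trans (𝕁-* {a * a} {b} (Coprime-*ˡ {a} {a} {X} ca ca) cb) (cong (Sign._* 𝕁 b X) (𝕁-sq {a} ca))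

-- For X ≡ 1 (mod 4) the absolute value is 1 or 3 modulo 4 according to the sign. Every positivity
-- proof for an unknown modulus below rests on this.
𝕁-neg1-1[4] : ∀ {X} → X ≈ + 1 [ + 4 ] → 𝕁 -1ℤ X ≡ sign X
𝕁-neg1-1[4] {X} e with shape-1[4] e
... | pos m s h rewrite s = trans (Schering.jacobi-neg1 (half X)) (trans (cong alternate h) (trans (alternate-+ m m) (alternate-double m)))
... | neg m s h rewrite s = trans (Schering.jacobi-neg1 (half X)) (trans (cong alternate h) (cong (Sign.- Sign.*_) (trans (alternate-+ m m) (alternate-double m))))

half-neg : ∀ X → half (- X) ≡ half X
half-neg X = cong ⌊_/2⌋ (ℤₚ.∣-i∣≡∣i∣ X)

𝕁-neg : ∀ a X → 𝕁 a (- X) ≡ 𝕁 a X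
𝕁-neg a X = cong (λ h → Schering.jacobi h a) (half-neg X)

𝕁-2-1[8] : ∀ {X} → X ≈ + 1 [ + 8 ] → 𝕁 (+ 2) X ≡ Sign.+
𝕁-2-1[8] {X} e with shape-1[8] e
... | pos m _ h = trans (Schering.jacobi-2 (half X) (2 ℕ.* m) (2 ℕ.* m) (sym h)
      (ℕₚ.≤-reflexive (trans (lem m) (sym h))) (ℕₚ.≤-trans (ℕₚ.≤-reflexive (trans h (sym (lem m)))) (ℕₚ.n≤1+n _)))
    (trans (cong (λ z → alternate (m ℕ.+ z)) (ℕₚ.+-identityʳ m)) (trans (alternate-+ m m) (alternate-double m)))
  where
  lem : ∀ m → 2 ℕ.* (2 ℕ.* m) ≡ 2 ℕ.* m ℕ.+ 2 ℕ.* m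
  lem = ℕS.solve-∀
... | neg m _ h = trans (Schering.jacobi-2 (half X) (suc (2 ℕ.* m)) (suc (suc (2 ℕ.* m))) (sym h)
      (ℕₚ.≤-trans (ℕₚ.n≤1+n _) (ℕₚ.≤-reflexive (trans (lem m) (sym h)))) (ℕₚ.≤-reflexive (trans h (sym (lem m)))))
    (trans (sym (Signₚ.*-assoc Sign.- Sign.- (alternate (2 ℕ.* m)))) (trans (cong (λ z → alternate (m ℕ.+ z)) (ℕₚ.+-identityʳ m)) (trans (alternate-+ m m) (alternate-double m))))
  where
  lem : ∀ m → 1 ℕ.+ 2 ℕ.* (1 ℕ.+ 2 ℕ.* m) ≡ (1 ℕ.+ 2 ℕ.* m) ℕ.+ (2 ℕ.+ 2 ℕ.* m)
  lem = ℕS.solve-∀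

𝕁-2-3[8] : ∀ {X} → X ≈ + 3 [ + 8 ] → 𝕁 (+ 2) X ≡ Sign.-
𝕁-2-3[8] {X} e with shape-3[8] e
... | pos m _ h = trans (Schering.jacobi-2 (half X) (2 ℕ.* m) (suc (2 ℕ.* m)) (sym h)
      (ℕₚ.≤-trans (ℕₚ.n≤1+n _) (ℕₚ.≤-reflexive (trans (lem m) (sym h)))) (ℕₚ.≤-reflexive (trans h (sym (lem m)))))
    (cong (Sign.- Sign.*_) (trans (cong (λ z → alternate (m ℕ.+ z)) (ℕₚ.+-identityʳ m)) (trans (alternate-+ m m) (alternate-double m))))
  where
  lem : ∀ m → 1 ℕ.+ 2 ℕ.* (2 ℕ.* m) ≡ 2 ℕ.* m ℕ.+ (1 ℕ.+ 2 ℕ.* m)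
  lem = ℕS.solve-∀
... | neg m _ h = trans (Schering.jacobi-2 (half X) (suc (2 ℕ.* m)) (suc (2 ℕ.* m)) (sym h)
      (ℕₚ.≤-reflexive (trans (lem m) (sym h))) (ℕₚ.≤-trans (ℕₚ.≤-reflexive (trans h (sym (lem m)))) (ℕₚ.n≤1+n _)))
    (cong (Sign.- Sign.*_) (trans (cong (λ z → alternate (m ℕ.+ z)) (ℕₚ.+-identityʳ m)) (trans (alternate-+ m m) (alternate-double m))))
  where
  lem : ∀ m → 2 ℕ.* (1 ℕ.+ 2 ℕ.* m) ≡ (1 ℕ.+ 2 ℕ.* m) ℕ.+ (1 ℕ.+ 2 ℕ.* m)
  lem = ℕS.solve-∀

neg-≈ : ∀ {a b m} → a ≈ b [ m ] → - a ≈ - b [ m ]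
neg-≈ {a} {b} {m} (mod k e) = mod (- k) (trans (cong -_ e) (lem b k m))
  where
  lem : ∀ b k m → - (b + k * m) ≡ - b + - k * m
  lem = solve-∀

1[4]⇒odd : ∀ {X} → X ≈ + 1 [ + 4 ] → Odd X
1[4]⇒odd (mod q refl) = mod (q * + 2) (cong (λ z → + 1 + z) (sym (ℤₚ.*-assoc q (+ 2) (+ 2))))

∏-const-even : ∀ m s → ∏ {m ℕ.+ m} (λ _ → s) ≡ Sign.+
∏-const-even m s = trans (∏-threshold m m refl s s _ (λ _ _ → refl) (λ _ _ → refl)) (Signₚ.s*s≡+ (∏ {m} (λ _ → s)))

𝕁-abs-reciprocity : ∀ X n → Odd X → Odd (+ n) → Coprimeᴿ (+ n) X →
  𝕁 (+ n) X Sign.* 𝕁 (+ ∣ X ∣) (+ n) ≡ ∏ {half X} (λ _ → alternate (half (+ n)))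
𝕁-abs-reciprocity X n oX oN c =
  subst₂ (λ x y → Schering.jacobi (half X) (+ x) Sign.* Schering.jacobi (half (+ n)) (+ y) ≡ ∏ {half X} (λ _ → alternate (half (+ n))))
    (sym (abs-odd oN)) (sym (abs-odd oX))
    (reciprocity (half X) (half (+ n)) (subst₂ Coprimeᴿ (cong +_ (abs-odd oN)) (cong +_ (abs-odd oX)) (Coprime-abs {+ n} {X} c)))

private
  unsquare : ∀ s t u → s Sign.* t ≡ u → s ≡ u Sign.* t
  unsquare s t u refl = sym (trans (Signₚ.*-assoc s t t) (trans (cong (s Sign.*_) (Signₚ.s*s≡+ t)) (Signₚ.*-identityʳ s)))

  abs-pos : ∀ X → sign X ≡ Sign.+ → + ∣ X ∣ ≡ X
  abs-pos (+ _) _ = refl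

  abs-neg : ∀ X → sign X ≡ Sign.- → -1ℤ * + ∣ X ∣ ≡ X
  abs-neg -[1+ n ] _ = cong -[1+_] (ℕₚ.+-identityʳ n)

  ∏-const-odd : ∀ m s → ∏ {suc (m ℕ.+ m)} (λ _ → s) ≡ s
  ∏-const-odd m s = trans (cong (s Sign.*_) (∏-const-even m s)) (Signₚ.*-identityʳ s)

-- No sign condition on X: for X < 0 the factor (−1/n) compensates the sign in the reciprocity law.
𝕁-reciprocity : ∀ {X n} → X ≈ + 1 [ + 4 ] → Odd (+ n) → Coprimeᴿ (+ n) X → 𝕁 (+ n) X ≡ 𝕁 X (+ n)
𝕁-reciprocity {X} {n} e oN c = by-sign (shape-1[4] e)
  where
  oX = 1[4]⇒odd e
  A = alternate (half (+ n))
  law = unsquare (𝕁 (+ n) X) (𝕁 (+ ∣ X ∣) (+ n)) (∏ {half X} (λ _ → A)) (𝕁-abs-reciprocity X n oX oN c)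
  by-sign : Shape X (λ m → m ℕ.+ m) (λ m → suc (m ℕ.+ m)) → 𝕁 (+ n) X ≡ 𝕁 X (+ n)
  by-sign (pos m s h) = begin
    𝕁 (+ n) X                                     ≡⟨ law ⟩
    ∏ {half X} (λ _ → A) Sign.* 𝕁 (+ ∣ X ∣) (+ n) ≡⟨ cong (Sign._* 𝕁 (+ ∣ X ∣) (+ n)) (trans (cong (λ z → ∏ {z} (λ _ → A)) h) (∏-const-even m A)) ⟩
    𝕁 (+ ∣ X ∣) (+ n)                             ≡⟨ cong (λ z → 𝕁 z (+ n)) (abs-pos X s) ⟩
    𝕁 X (+ n)                                     ∎
    where open ≡-Reasoning
  by-sign (neg m s h) = begin
    𝕁 (+ n) X                                     ≡⟨ law ⟩
    ∏ {half X} (λ _ → A) Sign.* 𝕁 (+ ∣ X ∣) (+ n) ≡⟨ cong (Sign._* 𝕁 (+ ∣ X ∣) (+ n)) (trans (cong (λ z → ∏ {z} (λ _ → A)) h) (∏-const-odd m A)) ⟩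
    A Sign.* 𝕁 (+ ∣ X ∣) (+ n)                    ≡⟨ cong (Sign._* 𝕁 (+ ∣ X ∣) (+ n)) (sym (Schering.jacobi-neg1 (half (+ n)))) ⟩
    𝕁 -1ℤ (+ n) Sign.* 𝕁 (+ ∣ X ∣) (+ n)          ≡⟨ sym (𝕁-* {+ n} oN { -1ℤ} {+ ∣ X ∣} (bez {s = -1ℤ} {t = + 0} refl)
                                                       (Coprime-sym {+ n} {+ ∣ X ∣} (Coprime-abs {+ n} {X} c))) ⟩
    𝕁 (-1ℤ * + ∣ X ∣) (+ n)                     ≡⟨ cong (λ z → 𝕁 z (+ n)) (abs-neg X s) ⟩
    𝕁 X (+ n)                                     ∎
    where open ≡-Reasoning

-- Gaussian integers

infix 5 _+i_
record 𝔾 : Set where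
  constructor _+i_
  field re im : ℤ
open 𝔾 public

infixl 6 _+ᵍ_
infixl 7 _*ᵍ_
infix 8 -ᵍ_
_+ᵍ_ _*ᵍ_ : 𝔾 → 𝔾 → 𝔾
(a +i b) +ᵍ (c +i d) = a + c +i b + d
(a +i b) *ᵍ (c +i d) = a * c - b * d +i a * d + b * c
-ᵍ_ : 𝔾 → 𝔾
-ᵍ (a +i b) = - a +i - b

ι : ℤ → 𝔾
ι a = a +i + 0

0ᵍ 1ᵍ 𝕚 : 𝔾
0ᵍ = + 0 +i + 0
1ᵍ = + 1 +i + 0
𝕚 = + 0 +i + 1

conj : 𝔾 → 𝔾
conj (a +i b) = a +i - b

norm : 𝔾 → ℤ
norm (a +i b) = a * a + b * b

private
  assoc-re : ∀ a b c d e f → (a * c - b * d) * e - (a * d + b * c) * f ≡ a * (c * e - d * f) - b * (c * f + d * e)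
  assoc-re = solve-∀
  assoc-im : ∀ a b c d e f → (a * c - b * d) * f + (a * d + b * c) * e ≡ a * (c * f + d * e) + b * (c * e - d * f)
  assoc-im = solve-∀
  comm-re : ∀ a b c d → a * c - b * d ≡ c * a - d * b
  comm-re = solve-∀
  comm-im : ∀ a b c d → a * d + b * c ≡ c * b + d * a
  comm-im = solve-∀
  dist-re : ∀ a b c d e f → a * (c + e) - b * (d + f) ≡ (a * c - b * d) + (a * e - b * f)
  dist-re = solve-∀
  dist-im : ∀ a b c d e f → a * (d + f) + b * (c + e) ≡ (a * d + b * c) + (a * f + b * e)
  dist-im = solve-∀
  id-re : ∀ a b → + 1 * a - + 0 * b ≡ a
  id-re = solve-∀
  id-im : ∀ a b → + 1 * b + + 0 * a ≡ b
  id-im = solve-∀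

*ᵍ-comm : ∀ x y → x *ᵍ y ≡ y *ᵍ x
*ᵍ-comm (a +i b) (c +i d) = cong₂ _+i_ (comm-re a b c d) (comm-im a b c d)

*ᵍ-identityˡ : ∀ x → 1ᵍ *ᵍ x ≡ x
*ᵍ-identityˡ (a +i b) = cong₂ _+i_ (id-re a b) (id-im a b)

*ᵍ-distribˡ : ∀ x y z → x *ᵍ (y +ᵍ z) ≡ x *ᵍ y +ᵍ x *ᵍ z
*ᵍ-distribˡ (a +i b) (c +i d) (e +i f) = cong₂ _+i_ (dist-re a b c d e f) (dist-im a b c d e f)

𝔾-isCommutativeRing : IsCommutativeRing _≡_ _+ᵍ_ _*ᵍ_ -ᵍ_ 0ᵍ 1ᵍ
𝔾-isCommutativeRing = record
  { isRing = record
    { +-isAbelianGroup = record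
      { isGroup = record
        { isMonoid = record
          { isSemigroup = record
            { isMagma = record { isEquivalence = isEquivalence ; ∙-cong = cong₂ _+ᵍ_ }
            ; assoc = λ x y z → cong₂ _+i_ (ℤₚ.+-assoc (re x) (re y) (re z)) (ℤₚ.+-assoc (im x) (im y) (im z)) }
          ; identity = (λ x → cong₂ _+i_ (ℤₚ.+-identityˡ (re x)) (ℤₚ.+-identityˡ (im x)))
                     , (λ x → cong₂ _+i_ (ℤₚ.+-identityʳ (re x)) (ℤₚ.+-identityʳ (im x))) }
        ; inverse = (λ x → cong₂ _+i_ (ℤₚ.+-inverseˡ (re x)) (ℤₚ.+-inverseˡ (im x)))
                  , (λ x → cong₂ _+i_ (ℤₚ.+-inverseʳ (re x)) (ℤₚ.+-inverseʳ (im x)))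
        ; ⁻¹-cong = cong -ᵍ_ }
      ; comm = λ x y → cong₂ _+i_ (ℤₚ.+-comm (re x) (re y)) (ℤₚ.+-comm (im x) (im y)) }
    ; *-cong = cong₂ _*ᵍ_
    ; *-assoc = λ { (a +i b) (c +i d) (e +i f) → cong₂ _+i_ (assoc-re a b c d e f) (assoc-im a b c d e f) }
    ; *-identity = *ᵍ-identityˡ , (λ x → trans (*ᵍ-comm x 1ᵍ) (*ᵍ-identityˡ x))
    ; distrib = *ᵍ-distribˡ , (λ x y z → trans (*ᵍ-comm (y +ᵍ z) x)
        (trans (*ᵍ-distribˡ x y z) (cong₂ _+ᵍ_ (*ᵍ-comm x y) (*ᵍ-comm x z)))) }
  ; *-comm = *ᵍ-comm }

𝔾-commutativeRing : CommutativeRing 0ℓ 0ℓ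
𝔾-commutativeRing = record { isCommutativeRing = 𝔾-isCommutativeRing }

module 𝔾ₚ = CommutativeRing 𝔾-commutativeRing

𝔾-ring : AlmostCommutativeRing 0ℓ 0ℓ
𝔾-ring = fromCommutativeRing 𝔾-commutativeRing λ { (ℤ.+0 +i ℤ.+0) → just refl ; _ → nothing }

open import Algebra.Properties.CommutativeSemiring.Exp 𝔾ₚ.commutativeSemiring
  using () renaming (_^_ to _^ᵍ_) public

module G = RingArith 𝔾-isCommutativeRing _^ᵍ_ (λ _ → refl) (λ _ _ → refl)

norm-* : ∀ x y → norm (x *ᵍ y) ≡ norm x * norm y
norm-* (a +i b) (c +i d) = lem a b c d
  where
  lem : ∀ a b c d → (a * c - b * d) * (a * c - b * d) + (a * d + b * c) * (a * d + b * c) ≡ (a * a + b * b) * (c * c + d * d)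
  lem = solve-∀

norm-^ : ∀ x n → norm (x ^ᵍ n) ≡ norm x ^ n
norm-^ x zero    = refl
norm-^ x (suc n) = trans (norm-* x (x ^ᵍ n)) (cong (norm x *_) (norm-^ x n))

conj-* : ∀ x y → conj (x *ᵍ y) ≡ conj x *ᵍ conj y
conj-* (a +i b) (c +i d) = cong₂ _+i_ (l₁ a b c d) (l₂ a b c d)
  where
  l₁ : ∀ a b c d → a * c - b * d ≡ a * c - (- b) * (- d)
  l₁ = solve-∀
  l₂ : ∀ a b c d → - (a * d + b * c) ≡ a * (- d) + (- b) * c
  l₂ = solve-∀

conj-^ : ∀ x n → conj (x ^ᵍ n) ≡ conj x ^ᵍ n
conj-^ x zero    = refl
conj-^ x (suc n) = trans (conj-* x (x ^ᵍ n)) (cong (conj x *ᵍ_) (conj-^ x n))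

*-conj : ∀ x → x *ᵍ conj x ≡ ι (norm x)
*-conj (a +i b) = cong₂ _+i_ (l₁ a b) (l₂ a b)
  where
  l₁ : ∀ a b → a * a - b * (- b) ≡ a * a + b * b
  l₁ = solve-∀
  l₂ : ∀ a b → a * (- b) + b * a ≡ + 0
  l₂ = solve-∀

ι-* : ∀ a b → ι a *ᵍ ι b ≡ ι (a * b)
ι-* a b = cong₂ _+i_ (l₁ a b) (l₂ a b)
  where
  l₁ : ∀ a b → a * b - + 0 * + 0 ≡ a * b
  l₁ = solve-∀
  l₂ : ∀ a b → a * + 0 + + 0 * b ≡ + 0
  l₂ = solve-∀

ι-^ : ∀ a n → ι a ^ᵍ n ≡ ι (a ^ n)
ι-^ a zero    = refl
ι-^ a (suc n) = trans (cong (ι a *ᵍ_) (ι-^ a n)) (ι-* a (a ^ n))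

x*ι : ∀ x n → x *ᵍ ι n ≡ (re x * n +i im x * n)
x*ι (a +i b) n = cong₂ _+i_ (l₁ a b n) (l₂ a b n)
  where
  l₁ : ∀ a b n → a * n - b * + 0 ≡ a * n
  l₁ = solve-∀
  l₂ : ∀ a b n → a * + 0 + b * n ≡ b * n
  l₂ = solve-∀

normℕ : 𝔾 → ℕ
normℕ (a +i b) = ∣ a ∣ ℕ.* ∣ a ∣ ℕ.+ ∣ b ∣ ℕ.* ∣ b ∣

square-abs : ∀ a → a * a ≡ + (∣ a ∣ ℕ.* ∣ a ∣)
square-abs (+ n)    = sym (ℤₚ.pos-* n n)
square-abs -[1+ n ] = refl

+normℕ : ∀ x → norm x ≡ + normℕ x
+normℕ (a +i b) = cong₂ _+_ (square-abs a) (square-abs b)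

normℕ-* : ∀ x y → normℕ (x *ᵍ y) ≡ normℕ x ℕ.* normℕ y
normℕ-* x y = ℤₚ.+-injective (trans (sym (+normℕ (x *ᵍ y))) (trans (norm-* x y)
  (trans (cong₂ _*_ (+normℕ x) (+normℕ y)) (sym (ℤₚ.pos-* (normℕ x) (normℕ y))))))

sum-zero : ∀ {m n} → m ℕ.+ n ≡ 0 → (m ≡ 0) × (n ≡ 0)
sum-zero {zero} {zero} _ = refl , refl

normℕ≡0 : ∀ {x} → normℕ x ≡ 0 → x ≡ 0ᵍ
normℕ≡0 {a +i b} e = cong₂ _+i_ (root a (proj₁ (sum-zero e))) (root b (proj₂ (sum-zero {∣ a ∣ ℕ.* ∣ a ∣} e)))
  where
  root : ∀ a → ∣ a ∣ ℕ.* ∣ a ∣ ≡ 0 → a ≡ + 0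
  root a e with ℕₚ.m*n≡0⇒m≡0∨n≡0 ∣ a ∣ e
  ... | inj₁ z = ℤₚ.∣i∣≡0⇒i≡0 z
  ... | inj₂ z = ℤₚ.∣i∣≡0⇒i≡0 z

zeroᵍ? : ∀ x → x ≡ 0ᵍ ⊎ x ≢ 0ᵍ
zeroᵍ? x with normℕ x ℕ.≟ 0
... | yes e = inj₁ (normℕ≡0 e)
... | no ¬e = inj₂ λ { refl → ¬e refl }

cancelᵍ : ∀ d a b → d ≢ 0ᵍ → a *ᵍ d ≡ b *ᵍ d → a ≡ b
cancelᵍ d a b d≢0 e = cong₂ _+i_ (cancel (re a) (re b) (cong re scaled)) (cancel (im a) (im b) (cong im scaled))
  where
  n≢0 : norm d ≢ + 0
  n≢0 z = d≢0 (normℕ≡0 (ℤₚ.+-injective (trans (sym (+normℕ d)) z)))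
  cancel : ∀ x y → x * norm d ≡ y * norm d → x ≡ y
  cancel x y = ℤₚ.*-cancelʳ-≡ x y (norm d) {{ℤ.≢-nonZero n≢0}}
  assoc = IsCommutativeRing.*-assoc 𝔾-isCommutativeRing
  scaled : (re a * norm d +i im a * norm d) ≡ (re b * norm d +i im b * norm d)
  scaled = trans (sym (x*ι a (norm d))) (trans (cong (a *ᵍ_) (sym (*-conj d))) (trans (sym (assoc a d (conj d)))
    (trans (cong (_*ᵍ conj d) e) (trans (assoc b d (conj d)) (trans (cong (b *ᵍ_) (*-conj d)) (x*ι b (norm d)))))))

round : ∀ m n .{{_ : ℕ.NonZero n}} → ∃ λ q → 2 ℕ.* ∣ m - q * + n ∣ ℕ.≤ n
round m n@(suc n-1) = q , ℕₚ.≤-trans (ℕₚ.≤-reflexive (trans (sym (ℤₚ.abs-* (+ 2) (m - q * + n))) (cong ∣_∣ main)))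
    (bound r (n%ℕd<d (+ 2 * m + + n) (n ℕ.+ n)))
  where
  -- ⌊m/n + 1/2⌋, the integer nearest to m/n.
  q = (+ 2 * m + + n) /ℕ (n ℕ.+ n)
  r = (+ 2 * m + + n) %ℕ (n ℕ.+ n)
  lem : ∀ m n q → + 2 * (m - q * n) ≡ (+ 2 * m + n) - n - q * (n + n)
  lem = solve-∀
  lem₂ : ∀ r n q → (r + q * (n + n)) - n - q * (n + n) ≡ r - n
  lem₂ = solve-∀
  main : + 2 * (m - q * + n) ≡ + r - + n
  main = trans (lem m (+ n) q) (trans (cong (λ z → z - + n - q * (+ n + + n)) (a≡a%ℕn+[a/ℕn]*n (+ 2 * m + + n) (n ℕ.+ n))) (lem₂ (+ r) (+ n) q))
  bound : ∀ r → r ℕ.< n ℕ.+ n → ∣ + r - + n ∣ ℕ.≤ n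
  bound r l with ℕₚ.≤-total r n
  ... | inj₁ r≤n = ℕₚ.≤-trans (ℕₚ.≤-reflexive (trans (cong ∣_∣ (ℤₚ.m-n≡m⊖n r n)) (ℤₚ.∣⊖∣-≤ r≤n))) (ℕₚ.m∸n≤m n r)
  ... | inj₂ n≤r = ℕₚ.≤-trans (ℕₚ.≤-reflexive (cong ∣_∣ (trans (ℤₚ.m-n≡m⊖n r n) (ℤₚ.⊖-≥ n≤r))))
        (ℕₚ.≤-trans (ℕₚ.∸-monoˡ-≤ n (ℕₚ.<⇒≤ l)) (ℕₚ.≤-reflexive (ℕₚ.m+n∸n≡m n n)))

normℕ-conj : ∀ y → normℕ (conj y) ≡ normℕ y
normℕ-conj (a +i b) = cong (λ z → ∣ a ∣ ℕ.* ∣ a ∣ ℕ.+ z ℕ.* z) (ℤₚ.∣-i∣≡∣i∣ b)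

private
  residual-conj : ∀ x y κ → (x +ᵍ -ᵍ (κ *ᵍ y)) *ᵍ conj y ≡ x *ᵍ conj y +ᵍ -ᵍ (re κ * + normℕ y +i im κ * + normℕ y)
  residual-conj x y κ = trans (dist x κ y (conj y))
    (cong (λ z → x *ᵍ conj y +ᵍ -ᵍ z) (trans (cong (κ *ᵍ_) (trans (*-conj y) (cong ι (+normℕ y)))) (x*ι κ (+ normℕ y))))
    where
    dist : ∀ x κ y c → (x +ᵍ -ᵍ (κ *ᵍ y)) *ᵍ c ≡ x *ᵍ c +ᵍ -ᵍ (κ *ᵍ (y *ᵍ c))
    dist = RS.solve-∀ 𝔾-ring

  residual-norm : ∀ x y κ → normℕ (x +ᵍ -ᵍ (κ *ᵍ y)) ℕ.* normℕ y
    ≡ normℕ (x *ᵍ conj y +ᵍ -ᵍ (re κ * + normℕ y +i im κ * + normℕ y))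
  residual-norm x y κ = trans (cong (normℕ (x +ᵍ -ᵍ (κ *ᵍ y)) ℕ.*_) (sym (normℕ-conj y)))
    (trans (sym (normℕ-* (x +ᵍ -ᵍ (κ *ᵍ y)) (conj y))) (cong normℕ (residual-conj x y κ)))

  half-square-bound : ∀ a b N n → 0 ℕ.< n → 2 ℕ.* a ℕ.≤ n → 2 ℕ.* b ℕ.≤ n → N ℕ.* n ≡ a ℕ.* a ℕ.+ b ℕ.* b → N ℕ.< n
  half-square-bound a b N n 0<n la lb e = ℕₚ.*-cancelʳ-< n N n (ℕₚ.*-cancelˡ-< 4 (N ℕ.* n) (n ℕ.* n) (ℕₚ.≤-<-trans 4N≤
      (ℕₚ.<-≤-trans (ℕₚ.m<m+n (n ℕ.* n ℕ.+ n ℕ.* n) (ℕₚ.<-≤-trans (ℕₚ.*-mono-< 0<n 0<n) (ℕₚ.m≤m+n (n ℕ.* n) (n ℕ.* n))))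
        (ℕₚ.≤-reflexive (lem₂ (n ℕ.* n))))))
    where
    lem : ∀ a b → 4 ℕ.* (a ℕ.* a ℕ.+ b ℕ.* b) ≡ 2 ℕ.* a ℕ.* (2 ℕ.* a) ℕ.+ 2 ℕ.* b ℕ.* (2 ℕ.* b)
    lem = ℕS.solve-∀
    lem₂ : ∀ a → (a ℕ.+ a) ℕ.+ (a ℕ.+ a) ≡ 4 ℕ.* a
    lem₂ = ℕS.solve-∀
    4N≤ : 4 ℕ.* (N ℕ.* n) ℕ.≤ n ℕ.* n ℕ.+ n ℕ.* n
    4N≤ = ℕₚ.≤-trans (ℕₚ.≤-reflexive (trans (cong (4 ℕ.*_) e) (lem a b)))
      (ℕₚ.+-mono-≤ (ℕₚ.*-mono-≤ la la) (ℕₚ.*-mono-≤ lb lb))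

  decompose : ∀ x z → x ≡ z +ᵍ (x +ᵍ -ᵍ z)
  decompose (a +i b) (c +i d) = cong₂ _+i_ (lem a c) (lem b d)
    where
    lem : ∀ a c → a ≡ c + (a + - c)
    lem = solve-∀

-- The exact quotient is x ȳ / N(y). Rounding both coordinates leaves errors of at most 1/2, so the
-- remainder has norm at most N(y)/2.
divideᵍ : ∀ x y → y ≢ 0ᵍ → ∃ λ κ → ∃ λ ρ → (x ≡ κ *ᵍ y +ᵍ ρ) × (normℕ ρ ℕ.< normℕ y)
divideᵍ x y y≢0 = divide-at (x *ᵍ conj y) refl (round (re (x *ᵍ conj y)) (normℕ y) {{nz}}) (round (im (x *ᵍ conj y)) (normℕ y) {{nz}})
  where
  nz : ℕ.NonZero (normℕ y)
  nz = ℕ.≢-nonZero (λ e → y≢0 (normℕ≡0 e))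
  divide-at : ∀ p → x *ᵍ conj y ≡ p → (∃ λ q → 2 ℕ.* ∣ re p - q * + normℕ y ∣ ℕ.≤ normℕ y) →
    (∃ λ q → 2 ℕ.* ∣ im p - q * + normℕ y ∣ ℕ.≤ normℕ y) →
    ∃ λ κ → ∃ λ ρ → (x ≡ κ *ᵍ y +ᵍ ρ) × (normℕ ρ ℕ.< normℕ y)
  divide-at p e (q₁ , b₁) (q₂ , b₂) = (q₁ +i q₂) , x +ᵍ -ᵍ ((q₁ +i q₂) *ᵍ y) , decompose x ((q₁ +i q₂) *ᵍ y) ,
    half-square-bound ∣ re p - q₁ * + normℕ y ∣ ∣ im p - q₂ * + normℕ y ∣ (normℕ (x +ᵍ -ᵍ ((q₁ +i q₂) *ᵍ y))) (normℕ y)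
      (ℕ.>-nonZero⁻¹ (normℕ y) {{nz}}) b₁ b₂
      (trans (residual-norm x y (q₁ +i q₂)) (cong (λ z → normℕ (z +ᵍ -ᵍ (q₁ * + normℕ y +i q₂ * + normℕ y))) e))

open G.Euclid normℕ zeroᵍ? divideᵍ public using () renaming (gcd to gcdsᵍ)

-- Coprime factors of powers in ℤ and in ℤ[i]

zeroℤ? : ∀ (x : ℤ) → x ≡ + 0 ⊎ x ≢ + 0
zeroℤ? x with x ℤ.≟ + 0
... | yes e = inj₁ e
... | no ¬e = inj₂ ¬e

cancelℤ : ∀ (d a b : ℤ) → d ≢ + 0 → a * d ≡ b * d → a ≡ b
cancelℤ d a b d≢0 = ℤₚ.*-cancelʳ-≡ a b d {{ℤ.≢-nonZero d≢0}}

divideℤ : ∀ (x y : ℤ) → y ≢ + 0 → ∃ λ κ → ∃ λ ρ → (x ≡ κ * y + ρ) × (∣ ρ ∣ ℕ.< ∣ y ∣)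
divideℤ x (+ zero) y≢0 = ⊥-elim (y≢0 refl)
divideℤ x (+ suc n) _ = x /ℕ suc n , + (x %ℕ suc n) ,
  trans (a≡a%ℕn+[a/ℕn]*n x (suc n)) (ℤₚ.+-comm (+ (x %ℕ suc n)) (x /ℕ suc n * + suc n)) , n%ℕd<d x (suc n)
divideℤ x -[1+ n ] _ = - (x /ℕ suc n) , + (x %ℕ suc n) ,
  trans (a≡a%ℕn+[a/ℕn]*n x (suc n)) (lem (+ (x %ℕ suc n)) (x /ℕ suc n) (+ suc n)) , n%ℕd<d x (suc n)
  where
  lem : ∀ r q n → r + q * n ≡ (- q) * (- n) + r
  lem = solve-∀

gcdsℤ : ∀ (x y : ℤ) → GCDᴿ x y
gcdsℤ = Euclid.gcd ∣_∣ zeroℤ? divideℤ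

∣ᴿ⇒∣ : ∀ {a b : ℤ} → a ∣ᴿ b → ∣ a ∣ ℕ∣.∣ ∣ b ∣
∣ᴿ⇒∣ {a} (div q e) = ℕ∣.divides ∣ q ∣ (trans (cong ∣_∣ e) (ℤₚ.abs-* q a))

equal-abs : ∀ {x y : ℤ} → ∣ x ∣ ≡ ∣ y ∣ → x ≡ y ⊎ x ≡ - y
equal-abs {+ m}      {+ n}      refl = inj₁ refl
equal-abs {+ m}      { -[1+ n ]} refl = inj₂ refl
equal-abs { -[1+ m ]} {+ n}      refl = inj₂ refl
equal-abs { -[1+ m ]} { -[1+ n ]} refl = inj₁ refl

fromCoprime : ∀ {x y : ℤ} → Coprime x y → Coprimeᴿ x y
fromCoprime {x} {y} c with gcdsℤ x y
... | gcdᴿ {d} {s} {t} {x′} {y′} b ex ey with equal-abs {d} {+ 1} (c (∣ᴿ⇒∣ (div x′ ex) , ∣ᴿ⇒∣ (div y′ ey)))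
...   | inj₁ e = bez {s = s} {t} (trans b e)
...   | inj₂ e = bez {s = - s} {t = - t} (trans (lem s x t y) (cong -_ (trans b e)))
  where
  lem : ∀ s x t y → - s * x + - t * y ≡ - (s * x + t * y)
  lem = solve-∀

coprime-product-power : ∀ {x y z} n → x ≢ + 0 → Coprimeᴿ x y → x * y ≡ z ^ suc n →
  ∃ λ d → x ≡ d ^ suc n ⊎ x ≡ - (d ^ suc n)
coprime-product-power {x} {y} {z} n x≢0 c e with coprime-factor-of-power cancelℤ gcdsℤ {x} {y} {z} n x≢0 c e
... | d , p , q = d , equal-abs (ℕ∣.∣-antisym (∣ᴿ⇒∣ p) (∣ᴿ⇒∣ q))

neg-^-odd : ∀ x h → (- x) ^ odd h ≡ - (x ^ odd h)
neg-^-odd x h = trans (cong ((- x) *_) even) (sym (ℤₚ.neg-distribˡ-* x (x ^ (h ℕ.+ h))))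
  where
  sq : ∀ x → (- x) * (- x) ≡ x * x
  sq = solve-∀
  even : (- x) ^ (h ℕ.+ h) ≡ x ^ (h ℕ.+ h)
  even = trans (^-+ (- x) h h) (trans (sym (^-distrib (- x) (- x) h)) (trans (cong (_^ h) (sq x))
    (trans (^-distrib x x h) (sym (^-+ x h h)))))

coprime-product-odd-power : ∀ {x y z} h → x ≢ + 0 → Coprimeᴿ x y → x * y ≡ z ^ odd h → ∃ λ d → x ≡ d ^ odd h
coprime-product-odd-power {x} {y} {z} h x≢0 c e with coprime-product-power {x} {y} {z} (h ℕ.+ h) x≢0 c e
... | d , inj₁ p = d , p
... | d , inj₂ p = - d , trans p (sym (neg-^-odd d h))

unit-^4 : ∀ e → normℕ e ≡ 1 → e ^ᵍ 4 ≡ 1ᵍ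
unit-^4 (+ 0 +i + 1)         _ = refl
unit-^4 (+ 0 +i -[1+ 0 ])    _ = refl
unit-^4 (+ 1 +i + 0)         _ = refl
unit-^4 (-[1+ 0 ] +i + 0)    _ = refl
unit-^4 (+ 0 +i + 0)         ()
unit-^4 (+ 0 +i + suc (suc b)) ()
unit-^4 (+ 0 +i -[1+ suc b ]) ()
unit-^4 (+ 1 +i + suc b) e = ⊥-elim (absurd b e)
  where
  absurd : ∀ b → 1 ℕ.+ (suc b ℕ.* suc b) ≢ 1
  absurd b ()
unit-^4 (+ 1 +i -[1+ b ]) ()
unit-^4 (+ suc (suc a) +i b) ()
unit-^4 (-[1+ 0 ] +i + suc b) ()
unit-^4 (-[1+ 0 ] +i -[1+ b ]) ()
unit-^4 (-[1+ suc a ] +i b) ()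

-- The square of an odd n is 1 modulo 4 and e⁴ = 1, so e to the power n² is e. Thus every unit of
-- ℤ[i] is an n-th power and can be absorbed into a root.
unit-root : ∀ e h → normℕ e ≡ 1 → e ≡ (e ^ᵍ odd h) ^ᵍ odd h
unit-root e h n = sym (trans (sym (G.^-* e (odd h) (odd h))) (trans (cong (e ^ᵍ_) (lem h))
  (trans (cong (e *ᵍ_) (trans (G.^-* e (h ℕ.* h ℕ.+ h) 4) (trans (cong (_^ᵍ (h ℕ.* h ℕ.+ h)) (unit-^4 e n)) (G.1^ (h ℕ.* h ℕ.+ h)))))
    (trans (*ᵍ-comm e 1ᵍ) (*ᵍ-identityˡ e)))))
  where
  lem : ∀ h → (1 ℕ.+ (h ℕ.+ h)) ℕ.* (1 ℕ.+ (h ℕ.+ h)) ≡ 1 ℕ.+ (h ℕ.* h ℕ.+ h) ℕ.* 4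
  lem = ℕS.solve-∀

-- 2 and the odd norm αᾱ both lie in the ideal generated by α and ᾱ.
coprime-conj : ∀ X Y → Coprimeᴿ X Y → Odd (X * X + Y * Y) → G.Coprimeᴿ (X +i Y) (conj (X +i Y))
coprime-conj X Y (bez {s} {t} e) (mod k eN) = G.bez {s = ᾱ +ᵍ -ᵍ (ι k *ᵍ s′)} {t = -ᵍ (ι k *ᵍ t′)} (begin
    (ᾱ +ᵍ -ᵍ (ι k *ᵍ s′)) *ᵍ α +ᵍ (-ᵍ (ι k *ᵍ t′)) *ᵍ ᾱ ≡⟨ lem₁ α ᾱ (ι k) s′ t′ ⟩
    α *ᵍ ᾱ +ᵍ -ᵍ (ι k *ᵍ (s′ *ᵍ α +ᵍ t′ *ᵍ ᾱ)) ≡⟨ cong₂ (λ u v → u +ᵍ -ᵍ (ι k *ᵍ v)) (trans (*-conj α) (cong ι eN)) two ⟩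
    ι (+ 1 + k * + 2) +ᵍ -ᵍ (ι k *ᵍ ι (+ 2)) ≡⟨ cong₂ _+i_ (l₃ k) (l₄ k) ⟩
    1ᵍ ∎)
  where
  open ≡-Reasoning
  α = X +i Y
  ᾱ = conj α
  s′ = s +i - t
  t′ = s +i t
  lem₁ : ∀ α β k s t → (β +ᵍ -ᵍ (k *ᵍ s)) *ᵍ α +ᵍ (-ᵍ (k *ᵍ t)) *ᵍ β ≡ α *ᵍ β +ᵍ -ᵍ (k *ᵍ (s *ᵍ α +ᵍ t *ᵍ β))
  lem₁ = RS.solve-∀ 𝔾-ring
  two : s′ *ᵍ α +ᵍ t′ *ᵍ ᾱ ≡ ι (+ 2)
  two = cong₂ _+i_ (trans (l₁ s t X Y) (cong (+ 2 *_) e)) (l₂ s t X Y)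
    where
    l₁ : ∀ s t X Y → (s * X - (- t) * Y) + (s * X - t * (- Y)) ≡ + 2 * (s * X + t * Y)
    l₁ = solve-∀
    l₂ : ∀ s t X Y → (s * Y + (- t) * X) + (s * (- Y) + t * X) ≡ + 0
    l₂ = solve-∀
  l₃ : ∀ k → (+ 1 + k * + 2) + - (k * + 2 - + 0 * + 0) ≡ + 1
  l₃ = solve-∀
  l₄ : ∀ k → + 0 + - (k * + 0 + + 0 * + 2) ≡ + 0
  l₄ = solve-∀

private
  associate-of-power : ∀ α d h → α ≢ 0ᵍ → α G.∣ᴿ (d ^ᵍ odd h) → (d ^ᵍ odd h) G.∣ᴿ α → ∃ λ z → α ≡ z ^ᵍ odd h
  associate-of-power α d h α≢0 (G.div u eu) (G.div v ev) = v ^ᵍ odd h *ᵍ d , sym (begin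
      (v ^ᵍ odd h *ᵍ d) ^ᵍ odd h              ≡⟨ G.^-distrib (v ^ᵍ odd h) d (odd h) ⟩
      (v ^ᵍ odd h) ^ᵍ odd h *ᵍ d ^ᵍ odd h     ≡⟨ cong (_*ᵍ d ^ᵍ odd h) (sym (unit-root v h unit)) ⟩
      v *ᵍ d ^ᵍ odd h                         ≡⟨ sym ev ⟩
      α                                       ∎)
    where
    open ≡-Reasoning
    vu : v *ᵍ u ≡ 1ᵍ
    vu = cancelᵍ α (v *ᵍ u) 1ᵍ α≢0 (trans (𝔾ₚ.*-assoc v u α)
      (trans (cong (v *ᵍ_) (sym eu)) (trans (sym ev) (sym (*ᵍ-identityˡ α)))))
    unit : normℕ v ≡ 1
    unit = ℕₚ.m*n≡1⇒m≡1 (normℕ v) (normℕ u) (trans (sym (normℕ-* v u)) (cong normℕ vu))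

sum-of-squares-power : ∀ X Y a h → X * X + Y * Y ≡ a ^ odd h → Coprimeᴿ X Y → Odd (X * X + Y * Y) →
  ∃ λ z → (X +i Y) ≡ z ^ᵍ odd h
sum-of-squares-power X Y a h e c o = by-cases (zeroᵍ? (X +i Y))
  where
  by-cases : (X +i Y) ≡ 0ᵍ ⊎ (X +i Y) ≢ 0ᵍ → ∃ λ z → (X +i Y) ≡ z ^ᵍ odd h
  by-cases (inj₁ z) = 0ᵍ , trans z (sym (𝔾ₚ.zeroˡ (0ᵍ ^ᵍ (h ℕ.+ h))))
  by-cases (inj₂ α≢0) = associate-of-power (X +i Y) (proj₁ power) h α≢0 (proj₁ (proj₂ power)) (proj₂ (proj₂ power))
    where
    product : (X +i Y) *ᵍ conj (X +i Y) ≡ ι a ^ᵍ odd h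
    product = trans (*-conj (X +i Y)) (trans (cong ι e) (sym (ι-^ a (odd h))))
    power : ∃ λ d → ((X +i Y) G.∣ᴿ (d ^ᵍ odd h)) × ((d ^ᵍ odd h) G.∣ᴿ (X +i Y))
    power = G.coprime-factor-of-power cancelᵍ gcdsᵍ {X +i Y} {conj (X +i Y)} {ι a} (h ℕ.+ h) α≢0 (coprime-conj X Y c o) product

-- The Frobenius congruence

nC0≡1 : ∀ n → n choose 0 ≡ 1
nC0≡1 n = trans (nCk≡nC[n∸k] {0} {n} z≤n) (nCn≡1 n)

absorption : ∀ n k → suc k ℕ.* (suc n choose suc k) ≡ suc n ℕ.* (n choose k)
absorption zero zero = refl
absorption zero (suc k) = trans (cong (suc (suc k) ℕ.*_) (k>n⇒nCk≡0 {suc zero} {suc (suc k)} (s≤s (s≤s z≤n))))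
  (trans (ℕₚ.*-zeroʳ (suc (suc k))) (sym (trans (ℕₚ.*-identityˡ (0 choose suc k)) (k>n⇒nCk≡0 {zero} {suc k} (s≤s z≤n)))))
absorption (suc n) zero = trans (ℕₚ.*-identityˡ _) (trans (sym (nCk+nC[k+1]≡[n+1]C[k+1] (suc n) 0))
  (trans (cong ((suc n choose 0) ℕ.+_) (trans (sym (ℕₚ.*-identityˡ (suc n choose 1))) (absorption n zero)))
    (trans (cong₂ (λ a b → a ℕ.+ suc n ℕ.* b) (nC0≡1 (suc n)) (nC0≡1 n)) (sym (cong (λ b → suc (suc n) ℕ.* b) (nC0≡1 (suc n)))))))
absorption (suc n) (suc k) = begin
  suc (suc k) ℕ.* (suc (suc n) choose suc (suc k))               ≡⟨ cong (suc (suc k) ℕ.*_) (sym (nCk+nC[k+1]≡[n+1]C[k+1] (suc n) (suc k))) ⟩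
  suc (suc k) ℕ.* (c₁ ℕ.+ (suc n choose suc (suc k)))            ≡⟨ l₁ k c₁ (suc n choose suc (suc k)) ⟩
  c₁ ℕ.+ (suc k ℕ.* c₁ ℕ.+ suc (suc k) ℕ.* (suc n choose suc (suc k))) ≡⟨ cong (c₁ ℕ.+_) (cong₂ ℕ._+_ (absorption n k) (absorption n (suc k))) ⟩
  c₁ ℕ.+ (suc n ℕ.* (n choose k) ℕ.+ suc n ℕ.* (n choose suc k))      ≡⟨ cong (c₁ ℕ.+_) (sym (ℕₚ.*-distribˡ-+ (suc n) (n choose k) (n choose suc k))) ⟩
  c₁ ℕ.+ suc n ℕ.* ((n choose k) ℕ.+ (n choose suc k))                ≡⟨ cong (λ z → c₁ ℕ.+ suc n ℕ.* z) (nCk+nC[k+1]≡[n+1]C[k+1] n k) ⟩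
  suc (suc n) ℕ.* c₁                                        ∎
  where
  open ≡-Reasoning
  c₁ = suc n choose suc k
  l₁ : ∀ k c d → (2 ℕ.+ k) ℕ.* (c ℕ.+ d) ≡ c ℕ.+ ((1 ℕ.+ k) ℕ.* c ℕ.+ (2 ℕ.+ k) ℕ.* d)
  l₁ = ℕS.solve-∀

prime-∣-binomial : ∀ n k → Prime (suc n) → suc k ℕ.< suc n → suc n ℕ∣.∣ (suc n choose suc k)
prime-∣-binomial n k pr k<n with euclidsLemma (suc k) (suc n choose suc k) pr (ℕ∣.divides (n choose k) (trans (absorption n k) (ℕₚ.*-comm (suc n) (n choose k))))
... | inj₁ d = ⊥-elim (ℕₚ.<⇒≱ k<n (ℕ∣.∣⇒≤ d))
... | inj₂ d = d

module Frobenius {A : Set} {_⊞_ _⊠_ : A → A → A} {⊟_ : A → A} {0# 1# : A}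
  (isCR : IsCommutativeRing _≡_ _⊞_ _⊠_ ⊟_ 0# 1#) (x y : A) where

  private
    CR : CommutativeRing 0ℓ 0ℓ
    CR = record { isCommutativeRing = isCR }

    module CR = CommutativeRing CR
    import Algebra.Properties.CommutativeSemiring.Binomial CR.commutativeSemiring as Bin
    open import Algebra.Properties.Semiring.Exp CR.semiring using () renaming (_^_ to _↑_)
    open import Algebra.Properties.Semiring.Sum CR.semiring using (sum; sum-init-last)
    open import Algebra.Properties.Semiring.Mult CR.semiring using (×-assoc-*; ×-assocˡ) renaming (_×_ to _⊗_)
    open import Data.Vec.Functional using (init; last)

    n-multiple : ∀ n z → n ⊗ z ≡ z ⊠ (n ⊗ 1#)
    n-multiple n z = trans (cong (n ⊗_) (sym (CR.*-identityˡ z))) (trans (sym (×-assoc-* n 1# z)) (CR.*-comm (n ⊗ 1#) z))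

    sum-multiple : ∀ {m} n (t : Fin n → A) → (∀ k → ∃ λ q → t k ≡ q ⊠ m) → ∃ λ q → sum t ≡ q ⊠ m
    sum-multiple {m} zero    t p = 0# , sym (CR.zeroˡ m)
    sum-multiple {m} (suc n) t p with p Fin.zero | sum-multiple n (λ k → t (Fin.suc k)) (λ k → p (Fin.suc k))
    ... | q , e | q′ , e′ = q ⊞ q′ , trans (cong₂ _⊞_ e e′) (sym (CR.distribʳ m q q′))

    module _ (n : ℕ) (pr : Prime (suc (suc n))) where
      r = suc (suc n)
      T = Bin.binomialTerm x y r

      expansion : (x ⊞ y) ↑ r ≡ T Fin.zero ⊞ (sum (init (λ k → T (Fin.suc k))) ⊞ last (λ k → T (Fin.suc k)))
      expansion = trans (Bin.theorem r x y) (cong (T Fin.zero ⊞_) (sum-init-last (λ k → T (Fin.suc k))))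

      first-term : T Fin.zero ≡ y ↑ r
      first-term = trans (cong (_⊗ (1# ⊠ (y ↑ r))) (nC0≡1 r)) (trans (CR.+-identityʳ (1# ⊠ (y ↑ r))) (CR.*-identityˡ (y ↑ r)))

      last-term : last (λ k → T (Fin.suc k)) ≡ x ↑ r
      last-term = trans (cong (λ j → (r choose suc j) ⊗ ((x ↑ suc j) ⊠ (y ↑ (suc n ℕ.∸ j)))) (Finₚ.toℕ-fromℕ (suc n)))
        (trans (cong₂ (λ c d → c ⊗ ((x ↑ r) ⊠ (y ↑ d))) (nCn≡1 r) (ℕₚ.n∸n≡0 (suc n)))
          (trans (CR.+-identityʳ ((x ↑ r) ⊠ 1#)) (CR.*-identityʳ (x ↑ r))))

      multiple-term : ∀ c b → r ℕ∣.∣ c → ∃ λ q → c ⊗ b ≡ q ⊠ (r ⊗ 1#)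
      multiple-term c b (ℕ∣.divides q e) = q ⊗ b , trans (cong (_⊗ b) (trans e (ℕₚ.*-comm q r)))
        (trans (sym (×-assocˡ b r q)) (n-multiple r (q ⊗ b)))

      middle : ∀ k → ∃ λ q → init (λ k → T (Fin.suc k)) k ≡ q ⊠ (r ⊗ 1#)
      middle k = multiple-term (r choose suc (toℕ (Fin.inject₁ k))) (Bin.binomial x y r (Fin.suc (Fin.inject₁ k)))
        (prime-∣-binomial (suc n) (toℕ (Fin.inject₁ k)) pr
          (s≤s (ℕₚ.≤-trans (ℕₚ.≤-reflexive (cong suc (Finₚ.toℕ-inject₁ k))) (Finₚ.toℕ<n k))))

      collect : ∀ L a b c d m → L ≡ a ⊞ (b ⊞ c) → a ≡ d → (∃ λ q → b ≡ q ⊠ m) → ∃ λ q → L ≡ (c ⊞ d) ⊞ (q ⊠ m)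
      collect L a b c d m refl refl (q , refl) = q , trans (CR.+-comm d ((q ⊠ m) ⊞ c))
        (trans (cong (_⊞ d) (CR.+-comm (q ⊠ m) c)) (trans (CR.+-assoc c (q ⊠ m) d)
          (trans (cong (c ⊞_) (CR.+-comm (q ⊠ m) d)) (sym (CR.+-assoc c d (q ⊠ m))))))

      power-of-sum : ∃ λ q → (x ⊞ y) ↑ r ≡ ((x ↑ r) ⊞ (y ↑ r)) ⊞ (q ⊠ (r ⊗ 1#))
      power-of-sum = subst (λ z → ∃ λ q → (x ⊞ y) ↑ r ≡ (z ⊞ (y ↑ r)) ⊞ (q ⊠ (r ⊗ 1#))) last-term
        (collect ((x ⊞ y) ↑ r) (T Fin.zero) (sum (init (λ k → T (Fin.suc k)))) (last (λ k → T (Fin.suc k))) (y ↑ r) (r ⊗ 1#)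
          expansion first-term (sum-multiple (suc n) (init (λ k → T (Fin.suc k))) middle))

  frobenius : ∀ r → Prime r → ∃ λ q → (x ⊞ y) ↑ r ≡ ((x ↑ r) ⊞ (y ↑ r)) ⊞ (q ⊠ (r ⊗ 1#))
  frobenius (suc (suc n)) pr = power-of-sum n pr

ι-multiple : ∀ n → Algebra.Definitions.RawMonoid._×_ 𝔾ₚ.+-rawMonoid n 1ᵍ ≡ ι (+ n)
ι-multiple zero    = refl
ι-multiple (suc n) = trans (cong (1ᵍ +ᵍ_) (ι-multiple n)) (cong₂ _+i_ (sym (ℤₚ.pos-+ 1 n)) refl)

private
  multiple⇒≈ : ∀ L R {z} m → z ≡ m → (∃ λ q → L ≡ R +ᵍ q *ᵍ z) → L G.≈ R [ m ]
  multiple⇒≈ L R m refl (q , e) = G.mod q e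

frobenius : ∀ x y r → Prime r → (x +ᵍ y) ^ᵍ r G.≈ x ^ᵍ r +ᵍ y ^ᵍ r [ ι (+ r) ]
frobenius x y r pr = multiple⇒≈ ((x +ᵍ y) ^ᵍ r) (x ^ᵍ r +ᵍ y ^ᵍ r) (ι (+ r)) (ι-multiple r)
  (Frobenius.frobenius 𝔾-isCommutativeRing x y r pr)

-- The forms Re ± Im and congruences for powers

-- This is Re((1 - s i) α). Being ℤ-linear, it carries congruences modulo a rational integer from
-- ℤ[i] to ℤ.
E : Sign → 𝔾 → ℤ
E s α = re α + σ s * im α

E-≈ : ∀ s {α β m} → α G.≈ β [ ι m ] → E s α ≈ E s β [ m ]
E-≈ s {α} {β} {m} (G.mod γ e) = mod (re γ + σ s * im γ)
  (trans (cong (E s) e) (trans (cong (λ z → E s (β +ᵍ z)) (x*ι γ m)) (lem (re β) (im β) (re γ) (im γ) (σ s) m)))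
  where
  lem : ∀ b b′ g g′ s m → (b + g * m) + s * (b′ + g′ * m) ≡ (b + s * b′) + (g + s * g′) * m
  lem = solve-∀

E-ι : ∀ s n → E s (ι n) ≡ n
E-ι s n = trans (cong (λ x → n + x) (ℤₚ.*-zeroʳ (σ s))) (ℤₚ.+-identityʳ n)

E-ι* : ∀ s n α → E s (ι n *ᵍ α) ≡ n * E s α
E-ι* s n (a +i b) = lem n a b (σ s)
  where
  lem : ∀ n a b s → (n * a - + 0 * b) + s * (n * b + + 0 * a) ≡ n * (a + s * b)
  lem = solve-∀

-- If Re α ≡ − s Im α then α ≡ Re α · (1 − s i), whose square is − 2 s i (Re α)².
square-mod-E : ∀ s α → α *ᵍ α G.≈ (+ 0 +i - σ s) *ᵍ ι (norm α) [ ι (E s α) ]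
square-mod-E Sign.+ (C +i S) = G.mod ((C - S) +i (C + + 1 * S)) (cong₂ _+i_ (l₁ C S) (l₂ C S))
  where
  l₁ : ∀ C S → C * C - S * S ≡ (+ 0 * (C * C + S * S) - - (+ 1) * + 0) + ((C - S) * (C + + 1 * S) - (C + + 1 * S) * + 0)
  l₁ = solve-∀
  l₂ : ∀ C S → C * S + S * C ≡ (+ 0 * + 0 + - (+ 1) * (C * C + S * S)) + ((C - S) * + 0 + (C + + 1 * S) * (C + + 1 * S))
  l₂ = solve-∀
square-mod-E Sign.- (C +i S) = G.mod ((C + S) +i - (C + - (+ 1) * S)) (cong₂ _+i_ (l₁ C S) (l₂ C S))
  where
  l₁ : ∀ C S → C * C - S * S ≡ (+ 0 * (C * C + S * S) - - (- (+ 1)) * + 0) + ((C + S) * (C + - (+ 1) * S) - - (C + - (+ 1) * S) * + 0)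
  l₁ = solve-∀
  l₂ : ∀ C S → C * S + S * C ≡ (+ 0 * + 0 + - (- (+ 1)) * (C * C + S * S)) + ((C + S) * + 0 + - (C + - (+ 1) * S) * (C + - (+ 1) * S))
  l₂ = solve-∀

real-≈ : ∀ {u w m} → w ≈ + 0 [ m ] → (u +i w) G.≈ ι u [ ι m ]
real-≈ {u} {w} {m} (mod k e) = G.mod (+ 0 +i k) (cong₂ _+i_ (l₁ u k m) (trans e (l₂ k m)))
  where
  l₁ : ∀ u k m → u ≡ u + (+ 0 * m - k * + 0)
  l₁ = solve-∀
  l₂ : ∀ k m → + 0 + k * m ≡ + 0 + (+ 0 * + 0 + k * m)
  l₂ = solve-∀

ι-cong-≈ : ∀ {a b m} → a ≈ b [ m ] → ι a G.≈ ι b [ ι m ]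
ι-cong-≈ {a} {b} {m} (mod k e) = G.mod (ι k) (trans (cong ι e) (cong₂ _+i_ (l₁ b k m) (l₂ k m)))
  where
  l₁ : ∀ b k m → b + k * m ≡ b + (k * m - + 0 * + 0)
  l₁ = solve-∀
  l₂ : ∀ k m → + 0 ≡ + 0 + (k * + 0 + + 0 * m)
  l₂ = solve-∀

ι-suc : ∀ n → 1ᵍ +ᵍ ι (+ n) ≡ ι (+ suc n)
ι-suc n = refl

imaginary-square-∣ : ∀ v → ι (v * v) G.∣ᴿ ((𝕚 *ᵍ ι v) *ᵍ (𝕚 *ᵍ ι v))
imaginary-square-∣ v = G.div (ι -1ℤ) (trans (lem 𝕚 (ι v)) (cong (ι -1ℤ *ᵍ_) (ι-* v v)))
  where
  lem : ∀ i v → (i *ᵍ v) *ᵍ (i *ᵍ v) ≡ (i *ᵍ i) *ᵍ (v *ᵍ v)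
  lem = RS.solve-∀ 𝔾-ring

-- Meant for δ = iv with v a rational integer, whose square is - v²: the formula then holds modulo
-- v², and after division by v a congruence modulo v remains.
first-order : ∀ β δ n → (β +ᵍ δ) ^ᵍ suc n G.≈ β ^ᵍ suc n +ᵍ ι (+ suc n) *ᵍ (β ^ᵍ n *ᵍ δ) [ δ *ᵍ δ ]
first-order β δ zero = G.≡⇒≈ (trans (𝔾ₚ.*-identityʳ (β +ᵍ δ)) (sym (cong₂ _+ᵍ_ (𝔾ₚ.*-identityʳ β)
  (trans (*ᵍ-identityˡ (1ᵍ *ᵍ δ)) (*ᵍ-identityˡ δ)))))
first-order β δ (suc n) = G.≈-trans (G.*-congˡ-≈ (β +ᵍ δ) (first-order β δ n))
  (G.mod (ι (+ suc n) *ᵍ β ^ᵍ n) (trans (lem β δ (β ^ᵍ n) (ι (+ suc n)))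
    (cong (λ z → β ^ᵍ suc (suc n) +ᵍ z *ᵍ (β ^ᵍ suc n *ᵍ δ) +ᵍ ι (+ suc n) *ᵍ β ^ᵍ n *ᵍ (δ *ᵍ δ))
      (ι-suc (suc n)))))
  where
  lem : ∀ β δ b c → (β +ᵍ δ) *ᵍ (β *ᵍ b +ᵍ c *ᵍ (b *ᵍ δ)) ≡ β *ᵍ (β *ᵍ b) +ᵍ (1ᵍ +ᵍ c) *ᵍ (β *ᵍ b *ᵍ δ) +ᵍ c *ᵍ b *ᵍ (δ *ᵍ δ)
  lem = RS.solve-∀ 𝔾-ring

pow-split : ∀ z k m t → z ^ᵍ (k ℕ.* m ℕ.+ t) ≡ (z ^ᵍ m) ^ᵍ k *ᵍ z ^ᵍ t
pow-split z k m t = trans (G.^-+ z (k ℕ.* m) t) (cong (_*ᵍ z ^ᵍ t) (G.^-* z k m))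

pow-odd : ∀ x h → x ^ odd h ≡ x * (x ^ h * x ^ h)
pow-odd x h = cong (x *_) (^-+ x h h)

-- Parity, residues modulo 8 and rules for the symbol

∣ᴿ⇒≈0 : ∀ {d a} → d ∣ᴿ a → a ≈ + 0 [ d ]
∣ᴿ⇒≈0 {d} (div k e) = mod k (trans e (sym (ℤₚ.+-identityˡ (k * d))))

≈0⇒∣ᴿ : ∀ {d a} → a ≈ + 0 [ d ] → d ∣ᴿ a
≈0⇒∣ᴿ {d} (mod k e) = div k (trans e (ℤₚ.+-identityˡ (k * d)))

odd⇒coprime-2 : ∀ {X} → Odd X → Coprimeᴿ (+ 2) X
odd⇒coprime-2 {X} (mod k e) = bez {s = - k} {t = + 1} (trans (cong (λ z → - k * + 2 + + 1 * z) e) (lem k))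
  where
  lem : ∀ k → - k * + 2 + + 1 * (+ 1 + k * + 2) ≡ + 1
  lem = solve-∀

parity : ∀ k → k ≈ + 0 [ + 2 ] ⊎ Odd k
parity k = by-residue (k %ℕ 2) (n%ℕd<d k 2) (a≡a%ℕn+[a/ℕn]*n k 2)
  where
  by-residue : ∀ r → r ℕ.< 2 → k ≡ + r + (k /ℕ 2) * + 2 → k ≈ + 0 [ + 2 ] ⊎ Odd k
  by-residue zero          _             e = inj₁ (mod (k /ℕ 2) e)
  by-residue (suc zero)    _             e = inj₂ (mod (k /ℕ 2) e)
  by-residue (suc (suc _)) (s≤s (s≤s ())) e

≉ : ∀ {m n} N .{{_ : ℕ.NonZero N}} → m ℕ.% N ≢ n ℕ.% N → + m ≈ + n [ + N ] → ⊥
≉ N ne e = ne (residue-cong {N} e)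

even-not-odd : ∀ {X} → X ≈ + 0 [ + 2 ] → Odd X → ⊥
even-not-odd e o = ≉ {0} {1} 2 (λ ()) (≈-trans (≈-sym e) o)

odd≢0 : ∀ {X} → Odd X → X ≢ + 0
odd≢0 o e = even-not-odd (≡⇒≈ e) o

odd-square : ∀ {X} → Odd X → X * X ≈ + 1 [ + 8 ]
odd-square {X} (mod k e) = even-or-odd k (trans (cong₂ _*_ e e) (lem k))
  where
  lem : ∀ k → (+ 1 + k * + 2) * (+ 1 + k * + 2) ≡ + 1 + (k * (k + + 1)) * + 4
  lem = solve-∀
  even-or-odd : ∀ k → X * X ≡ + 1 + (k * (k + + 1)) * + 4 → X * X ≈ + 1 [ + 8 ]
  even-or-odd k e with parity k
  ... | inj₁ (mod j refl) = mod (j * (j * + 2 + + 1)) (trans e (l₁ j))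
    where
    l₁ : ∀ j → + 1 + ((+ 0 + j * + 2) * ((+ 0 + j * + 2) + + 1)) * + 4 ≡ + 1 + (j * (j * + 2 + + 1)) * + 8
    l₁ = solve-∀
  ... | inj₂ (mod j refl) = mod ((+ 1 + j * + 2) * (j + + 1)) (trans e (l₂ j))
    where
    l₂ : ∀ j → + 1 + ((+ 1 + j * + 2) * ((+ 1 + j * + 2) + + 1)) * + 4 ≡ + 1 + ((+ 1 + j * + 2) * (j + + 1)) * + 8
    l₂ = solve-∀

8⇒4 : ∀ {a b} → a ≈ b [ + 8 ] → a ≈ b [ + 4 ]
8⇒4 {a} {b} (mod k e) = mod (k * + 2) (trans e (cong (λ z → b + z) (sym (ℤₚ.*-assoc k (+ 2) (+ 4)))))

4⇒2 : ∀ {a b} → a ≈ b [ + 4 ] → a ≈ b [ + 2 ]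
4⇒2 {a} {b} (mod k e) = mod (k * + 2) (trans e (cong (λ z → b + z) (sym (ℤₚ.*-assoc k (+ 2) (+ 2)))))

𝕁-^ : ∀ {a X} k → Odd X → Coprimeᴿ a X → 𝕁 a X ≡ Sign.+ → 𝕁 (a ^ k) X ≡ Sign.+
𝕁-^ {a} {X} zero    oX c e = 𝕁-1 {X} oX
𝕁-^ {a} {X} (suc k) oX c e = trans (𝕁-* {X} oX {a} {a ^ k} c (Coprime-^ˡ {a} {X} k c)) (cong₂ Sign._*_ e (𝕁-^ {a} {X} k oX c e))

-- Powers of a with (a/X) = 1 do not affect symbols, so reductions of E(zʳ) need to be known only up
-- to such powers.
𝕁-transfer : ∀ {a b c X} e f → Odd X → Coprimeᴿ a X → 𝕁 a X ≡ Sign.+ → Coprimeᴿ b X → Coprimeᴿ c X →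
  a ^ e * b ≈ a ^ f * c [ X ] → 𝕁 b X ≡ 𝕁 c X
𝕁-transfer {a} {b} {c} {X} e f oX ca ja cb cc p = trans (sym (strip b e cb)) (trans (𝕁-cong {X} oX p) (strip c f cc))
  where
  strip : ∀ d e → Coprimeᴿ d X → 𝕁 (a ^ e * d) X ≡ 𝕁 d X
  strip d e cd = trans (𝕁-* {X} oX {a ^ e} {d} (Coprime-^ˡ {a} {X} e ca) cd) (cong (Sign._* 𝕁 d X) (𝕁-^ {a} {X} e oX ca ja))

𝕁-neg-num : ∀ {a X} → Odd X → Coprimeᴿ a X → 𝕁 (- a) X ≡ 𝕁 -1ℤ X Sign.* 𝕁 a X
𝕁-neg-num {a} {X} oX c = trans (cong (λ z → 𝕁 z X) (sym (ℤₚ.-1*i≡-i a))) (𝕁-* {X} oX { -1ℤ} {a} coprime-neg1 c)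
  where
  coprime-neg1 : Coprimeᴿ -1ℤ X
  coprime-neg1 = bez {s = -1ℤ} {t = + 0} (cong (λ z → + 1 + z) (ℤₚ.*-zeroˡ X))

coprime-neg : ∀ {a X} → Coprimeᴿ a X → Coprimeᴿ (- a) X
coprime-neg {a} {X} (bez {s} {t} e) = bez {s = - s} {t = t} (trans (lem s a t X) e)
  where
  lem : ∀ s a t X → - s * - a + t * X ≡ s * a + t * X
  lem = solve-∀

coprime-neg-mod : ∀ {a X} → Coprimeᴿ a X → Coprimeᴿ a (- X)
coprime-neg-mod {a} {X} (bez {s} {t} e) = bez {s = s} {t = - t} (trans (lem s a t X) e)
  where
  lem : ∀ s a t X → s * a + - t * - X ≡ s * a + t * X
  lem = solve-∀

odd-neg : ∀ {X} → Odd X → Odd (- X)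
odd-neg o = ≈-trans (neg-≈ o) (mod -1ℤ refl)

even-neg : ∀ {X} → X ≈ + 0 [ + 2 ] → - X ≈ + 0 [ + 2 ]
even-neg = neg-≈

-- Reciprocity needs one positive entry. Here it is X ≡ 1 (mod 4), for which (-1/X) = 1, so that N
-- may be negative.
𝕁-reciprocity⁺ : ∀ {X N} → X ≈ + 1 [ + 4 ] → sign X ≡ Sign.+ → Odd N → Coprimeᴿ N X → 𝕁 N X ≡ 𝕁 X N
𝕁-reciprocity⁺ {X} {+ n} e s oN c = 𝕁-reciprocity e oN c
𝕁-reciprocity⁺ {X} { -[1+ n ]} e s oN c = trans (𝕁-neg-num {+ suc n} {X} (1[4]⇒odd e) c′)
  (trans (cong (Sign._* 𝕁 (+ suc n) X) (trans (𝕁-neg1-1[4] e) s)) (𝕁-reciprocity {X} {suc n} e (odd-neg oN) c′))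
  where
  c′ = coprime-neg { -[1+ n ]} {X} c

𝕁-reciprocity-pos : ∀ {X} N → sign N ≡ Sign.+ → X ≈ + 1 [ + 4 ] → Odd N → Coprimeᴿ N X → 𝕁 N X ≡ 𝕁 X N
𝕁-reciprocity-pos (+ n) _ e o c = 𝕁-reciprocity e o c

𝕁-neg1-3[4] : ∀ {X} → X ≈ + 3 [ + 4 ] → sign X ≡ Sign.+ → X ≢ + 0 → 𝕁 -1ℤ X ≡ Sign.-
𝕁-neg1-3[4] {X} e s X≢0 = trans (sym (𝕁-neg -1ℤ X)) (trans (𝕁-neg1-1[4] (≈-trans (neg-≈ e) (mod -1ℤ refl))) (sign-neg X s X≢0))
  where
  sign-neg : ∀ X → sign X ≡ Sign.+ → X ≢ + 0 → sign (- X) ≡ Sign.-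
  sign-neg (+ zero)  _ ≢0 = ⊥-elim (≢0 refl)
  sign-neg (+ suc n) _ _  = refl

𝕁-2-7[8] : ∀ {X} → X ≈ + 7 [ + 8 ] → 𝕁 (+ 2) X ≡ Sign.+
𝕁-2-7[8] {X} e = trans (sym (𝕁-neg (+ 2) X)) (𝕁-2-1[8] (≈-trans (neg-≈ e) (mod -1ℤ refl)))

𝕁-2-5[8] : ∀ {X} → X ≈ + 5 [ + 8 ] → 𝕁 (+ 2) X ≡ Sign.-
𝕁-2-5[8] {X} e = trans (sym (𝕁-neg (+ 2) X)) (𝕁-2-3[8] (≈-trans (neg-≈ e) (mod -1ℤ refl)))

G-mod-∣ : ∀ {α β m n} → n G.∣ᴿ m → α G.≈ β [ m ] → α G.≈ β [ n ]
G-mod-∣ {α} {β} {m} {n} (G.div c e) (G.mod q p) = G.mod (q *ᵍ c) (trans p (cong (β +ᵍ_)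
  (trans (cong (q *ᵍ_) e) (sym (𝔾ₚ.*-assoc q c n)))))

-- Symbols attached to z = u + iw with u + w = q

module Coordinates (u w : ℤ) (q : ℕ) (u+w : u + w ≡ + q) (cuw : Coprimeᴿ u w) (ou : Odd u) (w4 : w ≈ + 0 [ + 4 ]) where

  z z̄ : 𝔾
  z = u +i w
  z̄ = conj z

  -- `V` and `M` come from the factorisation Re z³ + Im z³ = (u - w)(u² + 4uw + w²), while Re z + Im
  -- z is `Q` and Re z - Im z is - `V`.
  a Q V M : ℤ
  a = norm z
  Q = + q
  V = w - u
  M = u * u + + 4 * (u * w) + w * w

  cwu : Coprimeᴿ w u
  cwu = Coprime-sym {u} {w} cuw

  u²≈1 : u * u ≈ + 1 [ + 8 ]
  u²≈1 = odd-square ou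

  w≈0[2] : w ≈ + 0 [ + 2 ]
  w≈0[2] = 4⇒2 w4

  oQ : Odd Q
  oQ = ≈-trans (≡⇒≈ (sym u+w)) (+-cong-≈ ou w≈0[2])

  a≈1 : a ≈ + 1 [ + 8 ]
  a≈1 = +-cong-≈ u²≈1 (square w4)
    where
    square : w ≈ + 0 [ + 4 ] → w * w ≈ + 0 [ + 8 ]
    square (mod k e) = mod (+ 2 * (k * k)) (trans (cong₂ _*_ e e) (lem k))
      where
      lem : ∀ k → (+ 0 + k * + 4) * (+ 0 + k * + 4) ≡ + 0 + (+ 2 * (k * k)) * + 8
      lem = solve-∀

  a≈1[4] : a ≈ + 1 [ + 4 ]
  a≈1[4] = 8⇒4 a≈1

  oa : Odd a
  oa = 4⇒2 a≈1[4]

  sign-a : sign a ≡ Sign.+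
  sign-a = cong sign (+normℕ z)

  V-alt : V ≡ + 2 * w - Q
  V-alt = trans (lem u w) (cong (λ x → + 2 * w - x) u+w)
    where
    lem : ∀ u w → w - u ≡ + 2 * w - (u + w)
    lem = solve-∀

  V≈-Q : V ≈ - Q [ + 8 ]
  V≈-Q = ≈-trans (≡⇒≈ V-alt) (double w4)
    where
    double : w ≈ + 0 [ + 4 ] → + 2 * w - Q ≈ - Q [ + 8 ]
    double (mod k e) = mod k (trans (cong (λ x → + 2 * x - Q) e) (lem k Q))
      where
      lem : ∀ k Q → + 2 * (+ 0 + k * + 4) - Q ≡ - Q + k * + 8
      lem = solve-∀

  oV : Odd V
  oV = ≈-trans (4⇒2 (8⇒4 V≈-Q)) (odd-neg oQ)

  Q≈w[u] : Q ≈ w [ u ]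
  Q≈w[u] = mod (+ 1) (trans (sym u+w) (lem u w))
    where
    lem : ∀ u w → u + w ≡ w + + 1 * u
    lem = solve-∀

  cuQ : Coprimeᴿ u Q
  cuQ = Coprime-sym {Q} {u} (Coprime-≈ {Q} {w} {u} Q≈w[u] cwu)

  cuV : Coprimeᴿ u V
  cuV = Coprime-sym {V} {u} (Coprime-≈ {V} {w} {u} (mod -1ℤ (lem u w)) cwu)
    where
    lem : ∀ u w → w - u ≡ w + -1ℤ * u
    lem = solve-∀

  a≈w²[u] : a ≈ w * w [ u ]
  a≈w²[u] = mod u (ℤₚ.+-comm (u * u) (w * w))

  cau : Coprimeᴿ a u
  cau = Coprime-≈ {a} {w * w} {u} a≈w²[u] (Coprime-*ˡ {w} {w} {u} cwu cwu)

  cua : Coprimeᴿ u a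
  cua = Coprime-sym {a} {u} cau

  c2a : Coprimeᴿ (+ 2) a
  c2a = odd⇒coprime-2 oa

  𝕁2a : 𝕁 (+ 2) a ≡ Sign.+
  𝕁2a = 𝕁-2-1[8] a≈1

  -- After reciprocity a is the square w² modulo u.
  𝕁ua : 𝕁 u a ≡ Sign.+
  𝕁ua = trans (𝕁-reciprocity⁺ {a} {u} a≈1[4] sign-a ou cua) (trans (𝕁-cong {u} ou a≈w²[u]) (𝕁-sq {u} ou {w} cwu))

  twice-square : ∀ m → Odd m → Coprimeᴿ u m → Coprimeᴿ (u * u * + 2) m
  twice-square m om c = Coprime-*ˡ {u * u} {+ 2} {m} (Coprime-*ˡ {u} {u} {m} c c) (odd⇒coprime-2 om)

  𝕁-twice-square : ∀ m → Odd m → Coprimeᴿ u m → 𝕁 (u * u * + 2) m ≡ 𝕁 (+ 2) m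
  𝕁-twice-square m om c = 𝕁-sq-* {m} om {u} {+ 2} c (odd⇒coprime-2 om)

  a≈2u²[Q] : a ≈ u * u * + 2 [ Q ]
  a≈2u²[Q] = mod (w - u) (trans (lem u w) (cong (λ x → u * u * + 2 + (w - u) * x) u+w))
    where
    lem : ∀ u w → u * u + w * w ≡ u * u * + 2 + (w - u) * (u + w)
    lem = solve-∀

  a≈2u²[V] : a ≈ u * u * + 2 [ V ]
  a≈2u²[V] = mod (u + w) (lem u w)
    where
    lem : ∀ u w → u * u + w * w ≡ u * u * + 2 + (u + w) * (w - u)
    lem = solve-∀

  cQa : Coprimeᴿ Q a
  cQa = Coprime-sym {a} {Q} (Coprime-≈ {a} {u * u * + 2} {Q} a≈2u²[Q] (twice-square Q oQ cuQ))

  cVa : Coprimeᴿ V a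
  cVa = Coprime-sym {a} {V} (Coprime-≈ {a} {u * u * + 2} {V} a≈2u²[V] (twice-square V oV cuV))

  𝕁Qa : 𝕁 Q a ≡ 𝕁 (+ 2) Q
  𝕁Qa = trans (𝕁-reciprocity⁺ {a} {Q} a≈1[4] sign-a oQ cQa) (trans (𝕁-cong {Q} oQ a≈2u²[Q]) (𝕁-twice-square Q oQ cuQ))

  𝕁Va : 𝕁 V a ≡ 𝕁 (+ 2) V
  𝕁Va = trans (𝕁-reciprocity⁺ {a} {V} a≈1[4] sign-a oV cVa) (trans (𝕁-cong {V} oV a≈2u²[V]) (𝕁-twice-square V oV cuV))

  z-mod-V : z G.≈ ι u *ᵍ (+ 1 +i + 1) [ ι V ]
  z-mod-V = G.mod 𝕚 (cong₂ _+i_ (l₁ u w) (l₂ u w))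
    where
    l₁ : ∀ u w → u ≡ (u * + 1 - + 0 * + 1) + (+ 0 * (w - u) - + 1 * + 0)
    l₁ = solve-∀
    l₂ : ∀ u w → w ≡ (u * + 1 + + 0 * + 1) + (+ 0 * + 0 + + 1 * (w - u))
    l₂ = solve-∀

  z-mod-Q : z ≡ ι u *ᵍ (+ 1 +i -[1+ 0 ]) +ᵍ 𝕚 *ᵍ ι Q
  z-mod-Q = cong₂ _+i_ (l₁ u Q) (trans (l₂ u w) (cong (λ x → (u * -[1+ 0 ] + + 0 * + 1) + (+ 0 * + 0 + + 1 * x)) u+w))
    where
    l₁ : ∀ u Q → u ≡ (u * + 1 - + 0 * -[1+ 0 ]) + (+ 0 * Q - + 1 * + 0)
    l₁ = solve-∀
    l₂ : ∀ u w → w ≡ (u * -[1+ 0 ] + + 0 * + 1) + (+ 0 * + 0 + + 1 * (u + w))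
    l₂ = solve-∀

  -- Modulo a the square of z is 2u z.
  power-mod-a : ∀ n → z ^ᵍ suc n G.≈ ι ((+ 2 * u) ^ n) *ᵍ z [ ι a ]
  power-mod-a zero = G.≡⇒≈ (*ᵍ-comm z 1ᵍ)
  power-mod-a (suc n) = G.≈-trans (G.*-congˡ-≈ z (power-mod-a n))
    (G.≈-trans (G.≡⇒≈ (swap z (ι b)))
    (G.≈-trans (G.*-congˡ-≈ (ι b) z²)
      (G.≡⇒≈ (trans (swap′ (ι b) (ι (+ 2 * u)) z) (cong (_*ᵍ z) (ι-* (+ 2 * u) b))))))
    where
    b = (+ 2 * u) ^ n
    swap : ∀ z b → z *ᵍ (b *ᵍ z) ≡ b *ᵍ (z *ᵍ z)
    swap = RS.solve-∀ 𝔾-ring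
    swap′ : ∀ b c z → b *ᵍ (c *ᵍ z) ≡ (c *ᵍ b) *ᵍ z
    swap′ = RS.solve-∀ 𝔾-ring
    z² : z *ᵍ z G.≈ ι (+ 2 * u) *ᵍ z [ ι a ]
    z² = G.mod (ι -1ℤ) (cong₂ _+i_ (l₁ u w) (l₂ u w))
      where
      l₁ : ∀ u w → u * u - w * w ≡ (+ 2 * u * u - + 0 * w) + (-1ℤ * (u * u + w * w) - + 0 * + 0)
      l₁ = solve-∀
      l₂ : ∀ u w → u * w + w * u ≡ (+ 2 * u * w + + 0 * u) + (-1ℤ * + 0 + + 0 * (u * u + w * w))
      l₂ = solve-∀

  E-z-+ : E Sign.+ z ≡ Q
  E-z-+ = trans (cong (λ x → u + x) (ℤₚ.*-identityˡ w)) u+w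

  E-z-- : E Sign.- z ≡ - V
  E-z-- = lem u w
    where
    lem : ∀ u w → u + - (+ 1) * w ≡ - (w - u)
    lem = solve-∀

  coprime-E-z : ∀ s → Coprimeᴿ (E s z) a
  coprime-E-z Sign.+ = subst (λ x → Coprimeᴿ x a) (sym E-z-+) cQa
  coprime-E-z Sign.- = subst (λ x → Coprimeᴿ x a) (sym E-z--) (coprime-neg {V} {a} cVa)

  𝕁-E-z : ∀ s → 𝕁 (+ 2) Q ≡ Sign.+ → 𝕁 (+ 2) V ≡ Sign.+ → 𝕁 (E s z) a ≡ Sign.+
  𝕁-E-z Sign.+ 2Q 2V = trans (cong (λ x → 𝕁 x a) E-z-+) (trans 𝕁Qa 2Q)
  𝕁-E-z Sign.- 2Q 2V = trans (cong (λ x → 𝕁 x a) E-z--) (trans (𝕁-neg-num {V} {a} oa cVa)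
    (cong₂ Sign._*_ (trans (𝕁-neg1-1[4] a≈1[4]) sign-a) (trans 𝕁Va 2V)))

  coprime-2u : Coprimeᴿ (+ 2 * u) a
  coprime-2u = Coprime-*ˡ {+ 2} {u} {a} c2a cua

  𝕁2u : 𝕁 (+ 2 * u) a ≡ Sign.+
  𝕁2u = trans (𝕁-* {a} oa {+ 2} {u} c2a cua) (cong₂ Sign._*_ 𝕁2a 𝕁ua)

  module _ (s : Sign) (n : ℕ) where
    private
      b = (+ 2 * u) ^ n
      X = E s (z ^ᵍ suc n)
      X≈ : X ≈ b * E s z [ a ]
      X≈ = ≈-trans (E-≈ s {z ^ᵍ suc n} {ι b *ᵍ z} {a} (power-mod-a n)) (≡⇒≈ (E-ι* s b z))
      cb : Coprimeᴿ b a
      cb = Coprime-^ˡ {+ 2 * u} {a} n coprime-2u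

    coprime-a : Coprimeᴿ a X
    coprime-a = Coprime-sym {X} {a} (Coprime-≈ {X} {b * E s z} {a} X≈ (Coprime-*ˡ {b} {E s z} {a} cb (coprime-E-z s)))

    -- By reciprocity this is (X/a), and X ≡ (2u)ⁿ E s z modulo a. Since (2u/a) = 1, only (Q/a) =
    -- (2/Q) or (- V/a) = (2/V) is left.
    𝕁-a : 𝕁 (+ 2) Q ≡ Sign.+ → 𝕁 (+ 2) V ≡ Sign.+ → X ≈ + 1 [ + 4 ] → 𝕁 a X ≡ Sign.+
    𝕁-a 2Q 2V X≈1 = trans (𝕁-reciprocity-pos a sign-a X≈1 oa coprime-a)
      (trans (𝕁-cong {a} oa X≈) (trans (𝕁-* {a} oa {b} {E s z} cb (coprime-E-z s))
        (cong₂ Sign._*_ (𝕁-^ {+ 2 * u} {a} n oa coprime-2u 𝕁2u) (𝕁-E-z s 2Q 2V))))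

  Q≢0 : Q ≢ + 0
  Q≢0 = odd≢0 oQ

  𝕁-neg1-Q : Q ≈ + 3 [ + 4 ] → 𝕁 -1ℤ Q ≡ Sign.-
  𝕁-neg1-Q e = 𝕁-neg1-3[4] e refl Q≢0

  conclude : ∀ {r} ε e f γ c {X} → E ε (z ^ᵍ r) ≡ Q → ι (a ^ e) *ᵍ z ^ᵍ r G.≈ ι (a ^ f) *ᵍ γ [ ι X ] → E ε γ ≡ c →
    a ^ e * Q ≈ a ^ f * c [ X ]
  conclude {r} ε e f γ c {X} hyp p Eγ = ≈-trans (≡⇒≈ (trans (cong (λ x → a ^ e * x) (sym hyp)) (sym (E-ι* ε (a ^ e) (z ^ᵍ r)))))
    (≈-trans (E-≈ ε {ι (a ^ e) *ᵍ z ^ᵍ r} {ι (a ^ f) *ᵍ γ} {X} p)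
      (≡⇒≈ (trans (E-ι* ε (a ^ f) γ) (cong (λ x → a ^ f * x) Eγ))))

𝕚⁻ : 𝔾
𝕚⁻ = + 0 +i -[1+ 0 ]

odd-mod-4 : ∀ {X} → Odd X → X ≈ + 1 [ + 4 ] ⊎ X ≈ + 3 [ + 4 ]
odd-mod-4 {X} (mod k e) = by-parity (parity k)
  where
  by-parity : k ≈ + 0 [ + 2 ] ⊎ Odd k → X ≈ + 1 [ + 4 ] ⊎ X ≈ + 3 [ + 4 ]
  by-parity (inj₁ (mod j e′)) = inj₁ (mod j (trans e (trans (cong (λ x → + 1 + x * + 2) e′) (lem j))))
    where
    lem : ∀ j → + 1 + (+ 0 + j * + 2) * + 2 ≡ + 1 + j * + 4
    lem = solve-∀
  by-parity (inj₂ (mod j e′)) = inj₂ (mod j (trans e (trans (cong (λ x → + 1 + x * + 2) e′) (lem j))))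
    where
    lem : ∀ j → + 1 + (+ 1 + j * + 2) * + 2 ≡ + 3 + j * + 4
    lem = solve-∀

3-mod-8 : ∀ {X} → X ≈ + 3 [ + 4 ] → X ≈ + 3 [ + 8 ] ⊎ X ≈ + 7 [ + 8 ]
3-mod-8 {X} (mod k e) = by-parity (parity k)
  where
  by-parity : k ≈ + 0 [ + 2 ] ⊎ Odd k → X ≈ + 3 [ + 8 ] ⊎ X ≈ + 7 [ + 8 ]
  by-parity (inj₁ (mod j e′)) = inj₁ (mod j (trans e (trans (cong (λ x → + 3 + x * + 4) e′) (lem j))))
    where
    lem : ∀ j → + 3 + (+ 0 + j * + 2) * + 4 ≡ + 3 + j * + 8
    lem = solve-∀
  by-parity (inj₂ (mod j e′)) = inj₂ (mod j (trans e (trans (cong (λ x → + 3 + x * + 4) e′) (lem j))))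
    where
    lem : ∀ j → + 3 + (+ 1 + j * + 2) * + 4 ≡ + 7 + j * + 8
    lem = solve-∀

unit-pow : ∀ {α m} I b k → α G.≈ I *ᵍ ι b [ m ] → α ^ᵍ k G.≈ I ^ᵍ k *ᵍ ι (b ^ k) [ m ]
unit-pow I b k p = G.≈-trans (G.^-cong-≈ k p) (G.≡⇒≈ (trans (G.^-distrib I (ι b) k) (cong (I ^ᵍ k *ᵍ_) (ι-^ b k))))

scaled-pow : ∀ u J b n k ρ → J ^ᵍ n ≡ ι b → (ι u *ᵍ J) ^ᵍ (k ℕ.* n ℕ.+ ρ) ≡ ι (u ^ (k ℕ.* n ℕ.+ ρ) * b ^ k) *ᵍ J ^ᵍ ρ
scaled-pow u J b n k ρ e = trans (G.^-distrib (ι u) J (k ℕ.* n ℕ.+ ρ)) (trans (cong₂ _*ᵍ_ (ι-^ u (k ℕ.* n ℕ.+ ρ))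
    (trans (pow-split J k n ρ) (cong (_*ᵍ J ^ᵍ ρ) (trans (cong (_^ᵍ k) e) (ι-^ b k)))))
  (trans (sym (𝔾ₚ.*-assoc (ι U) (ι (b ^ k)) (J ^ᵍ ρ))) (cong (_*ᵍ J ^ᵍ ρ) (ι-* U (b ^ k)))))
  where U = u ^ (k ℕ.* n ℕ.+ ρ)

16^ : ∀ k → (+ 16) ^ k ≡ (+ 4) ^ k * (+ 4) ^ k
16^ k = ^-distrib (+ 4) (+ 4) k

-- The residue of q modulo 4 or 8 and the sign of w - u

module Signs (u w : ℤ) (q : ℕ) (u+w : u + w ≡ + q) (cuw : Coprimeᴿ u w) (ou : Odd u) (w4 : w ≈ + 0 [ + 4 ])
  (r : ℕ) (crQ : Coprimeᴿ (+ r) (+ q)) (nonresidue : 𝕁 (+ q) (+ r) ≡ Sign.-) where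

  open Coordinates u w q u+w cuw ou w4

  Q≈2u[V] : Q ≈ + 2 * u [ V ]
  Q≈2u[V] = mod (+ 1) (trans (sym u+w) (lem u w))
    where
    lem : ∀ u w → u + w ≡ + 2 * u + + 1 * (w - u)
    lem = solve-∀

  c2uV : Coprimeᴿ (+ 2 * u) V
  c2uV = Coprime-*ˡ {+ 2} {u} {V} (odd⇒coprime-2 oV) cuV

  -- Its square 4 · 16ᵏ · u²ʰ is the square to be split off from u^(r - 1) (1 ± i)^(8k) when (r -
  -- 1)/2 is h.
  root : ℕ → ℕ → ℤ
  root k h = + 2 * ((+ 4) ^ k * u ^ h)

  coprime-root : ∀ {m} k h → Odd m → Coprimeᴿ u m → Coprimeᴿ (root k h) m
  coprime-root {m} k h om c = Coprime-*ˡ {+ 2} {(+ 4) ^ k * u ^ h} {m} c2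
    (Coprime-*ˡ {(+ 4) ^ k} {u ^ h} {m} (Coprime-^ˡ {+ 4} {m} k (Coprime-*ˡ {+ 2} {+ 2} {m} c2 c2)) (Coprime-^ˡ {u} {m} h c))
    where
    c2 = odd⇒coprime-2 om

  -- Modulo V one has z ≡ u(1 + i), where (1 + i)⁸ = 16, and Q = 2u + V.
  evaluate-V : ∀ ε k ρ → E ε (z ^ᵍ (k ℕ.* 8 ℕ.+ ρ)) ≡ Q →
    u ^ (k ℕ.* 8 ℕ.+ ρ) * (+ 16) ^ k * E ε ((+ 1 +i + 1) ^ᵍ ρ) ≈ + 2 * u [ V ]
  evaluate-V ε k ρ hyp = ≈-trans (≈-sym (≈-trans (E-≈ ε {z ^ᵍ (k ℕ.* 8 ℕ.+ ρ)} {(ι u *ᵍ (+ 1 +i + 1)) ^ᵍ (k ℕ.* 8 ℕ.+ ρ)} {V} (G.^-cong-≈ (k ℕ.* 8 ℕ.+ ρ) z-mod-V))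
      (≡⇒≈ (trans (cong (E ε) (scaled-pow u (+ 1 +i + 1) (+ 16) 8 k ρ refl)) (E-ι* ε (u ^ (k ℕ.* 8 ℕ.+ ρ) * (+ 16) ^ k) ((+ 1 +i + 1) ^ᵍ ρ))))))
    (≈-trans (≡⇒≈ hyp) Q≈2u[V])

  -- With β = u(1 − i) and δ = iQ the term βʳ does not contribute, which leaves the first-order term.
  evaluate-Q : ∀ ε n γ c → (ι u *ᵍ (+ 1 +i -[1+ 0 ])) ^ᵍ n ≡ ι c *ᵍ γ →
    E ε (γ *ᵍ (ι u *ᵍ (+ 1 +i -[1+ 0 ]))) ≡ + 0 → E ε (γ *ᵍ (𝕚 *ᵍ ι Q)) ≡ Q → E ε (z ^ᵍ suc n) ≡ Q → + suc n * c ≈ + 1 [ Q ]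
  evaluate-Q ε n γ c βⁿ vanish lead hyp = cancel (≈-trans (≡⇒≈ (sym hyp)) (≈-trans (E-≈ ε {z ^ᵍ suc n} {β ^ᵍ suc n +ᵍ ι (+ suc n) *ᵍ (β ^ᵍ n *ᵍ δ)} {Q * Q}
      (G-mod-∣ (imaginary-square-∣ Q) (subst (λ x → x ^ᵍ suc n G.≈ β ^ᵍ suc n +ᵍ ι (+ suc n) *ᵍ (β ^ᵍ n *ᵍ δ) [ δ *ᵍ δ ]) (sym z-mod-Q) (first-order β δ n)))) (≡⇒≈ value)))
    where
    β = ι u *ᵍ (+ 1 +i -[1+ 0 ])
    δ = 𝕚 *ᵍ ι Q
    value : E ε (β ^ᵍ suc n +ᵍ ι (+ suc n) *ᵍ (β ^ᵍ n *ᵍ δ)) ≡ + suc n * c * Q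
    value = trans (cong (E ε) (trans (cong (λ x → β *ᵍ x +ᵍ ι (+ suc n) *ᵍ (x *ᵍ δ)) βⁿ) (regroup β (ι c) γ (ι (+ suc n)) δ)))
      (trans (E-+ (ι c *ᵍ (γ *ᵍ β)) (ι (+ suc n) *ᵍ (ι c *ᵍ (γ *ᵍ δ))))
      (trans (cong₂ _+_ (trans (E-ι* ε c (γ *ᵍ β)) (cong (λ x → c * x) vanish))
          (trans (E-ι* ε (+ suc n) (ι c *ᵍ (γ *ᵍ δ))) (cong (λ x → + suc n * x) (trans (E-ι* ε c (γ *ᵍ δ)) (cong (λ x → c * x) lead)))))
        (arith c (+ suc n) Q)))
      where
      regroup : ∀ β c γ n δ → β *ᵍ (c *ᵍ γ) +ᵍ n *ᵍ ((c *ᵍ γ) *ᵍ δ) ≡ c *ᵍ (γ *ᵍ β) +ᵍ n *ᵍ (c *ᵍ (γ *ᵍ δ))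
      regroup = RS.solve-∀ 𝔾-ring
      arith : ∀ c n Q → c * + 0 + n * (c * Q) ≡ n * c * Q
      arith = solve-∀
      E-+ : ∀ α β → E ε (α +ᵍ β) ≡ E ε α + E ε β
      E-+ (a +i b) (c +i d) = lem a b c d (σ ε)
        where
        lem : ∀ a b c d s → (a + c) + s * (b + d) ≡ (a + s * b) + (c + s * d)
        lem = solve-∀
    cancel : Q ≈ + suc n * c * Q [ Q * Q ] → + suc n * c ≈ + 1 [ Q ]
    cancel (mod k e) = ≈-sym (mod k (cancelℤ Q (+ 1) (+ suc n * c + k * Q) Q≢0 (trans (ℤₚ.*-identityˡ Q) (trans e (lem (+ suc n * c) k Q)))))
      where
      lem : ∀ x k Q → x * Q + k * (Q * Q) ≡ (x + k * Q) * Q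
      lem = solve-∀

  module Case5 (k : ℕ) (r≡ : r ≡ k ℕ.* 8 ℕ.+ 5) (hyp : E Sign.+ (z ^ᵍ r) ≡ Q) where

    h = k ℕ.* 4 ℕ.+ 2

    h+h : ∀ k → k ℕ.* 8 ℕ.+ 4 ≡ (k ℕ.* 4 ℕ.+ 2) ℕ.+ (k ℕ.* 4 ℕ.+ 2)
    h+h = ℕS.solve-∀

    hyp′ : E Sign.+ (z ^ᵍ (k ℕ.* 8 ℕ.+ 5)) ≡ Q
    hyp′ = subst (λ x → E Sign.+ (z ^ᵍ x) ≡ Q) r≡ hyp

    u^n : u ^ (k ℕ.* 8 ℕ.+ 4) ≡ u ^ h * u ^ h
    u^n = trans (cong (u ^_) (h+h k)) (^-+ u h h)

    -- As (1 - i)⁴ = - 4, the coefficient c with r c ≡ 1 (mod q) is - 1 times a square.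
    minus-r-residue : 𝕁 (- (+ r)) Q ≡ Sign.+
    minus-r-residue = trans (sym (𝕁-sq-* {Q} oQ {root k h} { - (+ r)} (coprime-root {Q} k h oQ cuQ) (coprime-neg {+ r} {Q} crQ)))
      (trans (𝕁-cong {Q} oQ (≈-trans (≡⇒≈ rearrange) (evaluate-Q Sign.+ (k ℕ.* 8 ℕ.+ 4) 1ᵍ c power vanish lead
        (subst (λ x → E Sign.+ (z ^ᵍ x) ≡ Q) (ℕₚ.+-suc (k ℕ.* 8) 4) hyp′)))) (𝕁-1 {Q} oQ))
      where
      c = u ^ (k ℕ.* 8 ℕ.+ 4) * (+ 16) ^ k * -[1+ 3 ]
      power : (ι u *ᵍ (+ 1 +i -[1+ 0 ])) ^ᵍ (k ℕ.* 8 ℕ.+ 4) ≡ ι c *ᵍ 1ᵍ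
      power = trans (scaled-pow u (+ 1 +i -[1+ 0 ]) (+ 16) 8 k 4 refl) (trans (ι-* (u ^ (k ℕ.* 8 ℕ.+ 4) * (+ 16) ^ k) -[1+ 3 ]) (sym (𝔾ₚ.*-identityʳ (ι c))))
      vanish : E Sign.+ (1ᵍ *ᵍ (ι u *ᵍ (+ 1 +i -[1+ 0 ]))) ≡ + 0
      vanish = lem u
        where
        lem : ∀ u → (+ 1 * (u * + 1 - + 0 * -[1+ 0 ]) - + 0 * (u * -[1+ 0 ] + + 0 * + 1)) + + 1 * (+ 1 * (u * -[1+ 0 ] + + 0 * + 1) + + 0 * (u * + 1 - + 0 * -[1+ 0 ])) ≡ + 0
        lem = solve-∀
      lead : E Sign.+ (1ᵍ *ᵍ (𝕚 *ᵍ ι Q)) ≡ Q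
      lead = lem Q
        where
        lem : ∀ Q → (+ 1 * (+ 0 * Q - + 1 * + 0) - + 0 * (+ 0 * + 0 + + 1 * Q)) + + 1 * (+ 1 * (+ 0 * + 0 + + 1 * Q) + + 0 * (+ 0 * Q - + 1 * + 0)) ≡ Q
        lem = solve-∀
      rearrange : root k h * root k h * - (+ r) ≡ + suc (k ℕ.* 8 ℕ.+ 4) * c
      rearrange = trans (cong (λ x → root k h * root k h * - (+ x)) (trans r≡ (ℕₚ.+-suc (k ℕ.* 8) 4)))
        (trans (lem ((+ 4) ^ k) (u ^ h) (+ suc (k ℕ.* 8 ℕ.+ 4)))
          (cong₂ (λ x y → + suc (k ℕ.* 8 ℕ.+ 4) * (x * y * -[1+ 3 ])) (sym u^n) (sym (16^ k))))
        where
        lem : ∀ t s n → (+ 2 * (t * s)) * (+ 2 * (t * s)) * - n ≡ n * (s * s * (t * t) * -[1+ 3 ])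
        lem = solve-∀

    r≈1 : + r ≈ + 1 [ + 4 ]
    r≈1 = mod (+ (k ℕ.* 2 ℕ.+ 1)) (trans (cong +_ (trans r≡ (lem k))) (trans (ℤₚ.pos-+ 1 ((k ℕ.* 2 ℕ.+ 1) ℕ.* 4)) (cong (λ x → + 1 + x) (ℤₚ.pos-* (k ℕ.* 2 ℕ.+ 1) 4))))
      where
      lem : ∀ k → k ℕ.* 8 ℕ.+ 5 ≡ 1 ℕ.+ (k ℕ.* 2 ℕ.+ 1) ℕ.* 4
      lem = ℕS.solve-∀

    -- Since r ≡ 1 (mod 4), reciprocity gives (r/q) = (q/r) = - 1; then (- r/q) = 1 forces (-1/q) =
    -- - 1.
    Q≈3 : Q ≈ + 3 [ + 4 ]
    Q≈3 = by-cases (odd-mod-4 oQ)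
      where
      𝕁rQ : 𝕁 (+ r) Q ≡ Sign.-
      𝕁rQ = trans (sym (𝕁-reciprocity {+ r} {q} r≈1 oQ (Coprime-sym {+ r} {Q} crQ))) nonresidue
      by-cases : Q ≈ + 1 [ + 4 ] ⊎ Q ≈ + 3 [ + 4 ] → Q ≈ + 3 [ + 4 ]
      by-cases (inj₂ e) = e
      by-cases (inj₁ e) = ⊥-elim (+≢- (trans (sym minus-r-residue) (trans (𝕁-neg-num {+ r} {Q} oQ crQ) (cong₂ Sign._*_ (𝕁-neg1-1[4] e) 𝕁rQ))))

    -- Re + Im of (1 + i)⁵ is - 8, so modulo V a square times - 2u equals 2u. Hence (-1/V) = 1,
    -- where V ≡ - q ≡ 1 (mod 4).
    sign-V : sign V ≡ Sign.+
    sign-V = trans (sym (𝕁-neg1-1[4] V≈1)) (cancel-sign (𝕁 -1ℤ V) (𝕁 (+ 2 * u) V)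
      (trans (sym (𝕁-neg-num {+ 2 * u} {V} oV c2uV)) (trans (sym (𝕁-sq-* {V} oV {root k h} { - (+ 2 * u)} (coprime-root {V} k h oV cuV) (coprime-neg {+ 2 * u} {V} c2uV)))
        (𝕁-cong {V} oV (≈-trans (≡⇒≈ rearrange) (evaluate-V Sign.+ k 5 hyp′))))))
      where
      V≈1 : V ≈ + 1 [ + 4 ]
      V≈1 = ≈-trans (8⇒4 V≈-Q) (≈-trans (neg-≈ Q≈3) (mod -1ℤ refl))
      rearrange : root k h * root k h * - (+ 2 * u) ≡ u ^ (k ℕ.* 8 ℕ.+ 5) * (+ 16) ^ k * -[1+ 7 ]
      rearrange = trans (lem ((+ 4) ^ k) (u ^ h) u)
        (cong₂ (λ x y → x * y * -[1+ 7 ]) (sym (trans (cong (u ^_) (ℕₚ.+-suc (k ℕ.* 8) 4)) (cong (λ x → u * x) u^n))) (sym (16^ k)))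
        where
        lem : ∀ t s u → (+ 2 * (t * s)) * (+ 2 * (t * s)) * - (+ 2 * u) ≡ u * (s * s) * (t * t) * -[1+ 7 ]
        lem = solve-∀

  module Case3 (k : ℕ) (r≡ : r ≡ k ℕ.* 8 ℕ.+ 3) (hyp : E Sign.- (z ^ᵍ r) ≡ Q) (Q≈±1 : Q ≈ + 1 [ + 8 ] ⊎ Q ≈ + 7 [ + 8 ]) where

    h = k ℕ.* 4 ℕ.+ 1

    h+h : ∀ k → k ℕ.* 8 ℕ.+ 2 ≡ (k ℕ.* 4 ℕ.+ 1) ℕ.+ (k ℕ.* 4 ℕ.+ 1)
    h+h = ℕS.solve-∀

    hyp′ : E Sign.- (z ^ᵍ (k ℕ.* 8 ℕ.+ 3)) ≡ Q
    hyp′ = subst (λ x → E Sign.- (z ^ᵍ x) ≡ Q) r≡ hyp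

    u^n : u ^ (k ℕ.* 8 ℕ.+ 2) ≡ u ^ h * u ^ h
    u^n = trans (cong (u ^_) (h+h k)) (^-+ u h h)

    halfroot = (+ 4) ^ k * u ^ h

    coprime-halfroot : ∀ {m} → Odd m → Coprimeᴿ u m → Coprimeᴿ halfroot m
    coprime-halfroot {m} om c = Coprime-∣ˡ {halfroot} {root k h} {m} (div (+ 2) refl) (coprime-root {m} k h om c)

    𝕁2Q : 𝕁 (+ 2) Q ≡ Sign.+
    𝕁2Q = by-cases Q≈±1
      where
      by-cases : Q ≈ + 1 [ + 8 ] ⊎ Q ≈ + 7 [ + 8 ] → 𝕁 (+ 2) Q ≡ Sign.+
      by-cases (inj₁ e) = 𝕁-2-1[8] e
      by-cases (inj₂ e) = 𝕁-2-7[8] e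

    -- As (1 - i)² = - 2i, and Re - Im of (- i)(iq) is q, the coefficient of r is now twice a
    -- square.
    twice-r-residue : 𝕁 (+ 2 * + r) Q ≡ Sign.+
    twice-r-residue = trans (sym (𝕁-sq-* {Q} oQ {halfroot} {+ 2 * + r} (coprime-halfroot {Q} oQ cuQ)
        (Coprime-*ˡ {+ 2} {+ r} {Q} (odd⇒coprime-2 oQ) crQ)))
      (trans (𝕁-cong {Q} oQ (≈-trans (≡⇒≈ rearrange) (evaluate-Q Sign.- (k ℕ.* 8 ℕ.+ 2) 𝕚⁻ c power vanish lead
        (subst (λ x → E Sign.- (z ^ᵍ x) ≡ Q) (ℕₚ.+-suc (k ℕ.* 8) 2) hyp′)))) (𝕁-1 {Q} oQ))
      where
      b = u ^ (k ℕ.* 8 ℕ.+ 2) * (+ 16) ^ k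
      c = b * + 2
      power : (ι u *ᵍ (+ 1 +i -[1+ 0 ])) ^ᵍ (k ℕ.* 8 ℕ.+ 2) ≡ ι c *ᵍ 𝕚⁻
      power = trans (scaled-pow u (+ 1 +i -[1+ 0 ]) (+ 16) 8 k 2 refl)
        (trans (sym (𝔾ₚ.*-assoc (ι b) (ι (+ 2)) 𝕚⁻)) (cong (_*ᵍ 𝕚⁻) (ι-* b (+ 2))))
      vanish : E Sign.- (𝕚⁻ *ᵍ (ι u *ᵍ (+ 1 +i -[1+ 0 ]))) ≡ + 0
      vanish = lem u
        where
        lem : ∀ u → (+ 0 * (u * + 1 - + 0 * -[1+ 0 ]) - -[1+ 0 ] * (u * -[1+ 0 ] + + 0 * + 1)) + - (+ 1) * (+ 0 * (u * -[1+ 0 ] + + 0 * + 1) + -[1+ 0 ] * (u * + 1 - + 0 * -[1+ 0 ])) ≡ + 0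
        lem = solve-∀
      lead : E Sign.- (𝕚⁻ *ᵍ (𝕚 *ᵍ ι Q)) ≡ Q
      lead = lem Q
        where
        lem : ∀ Q → (+ 0 * (+ 0 * Q - + 1 * + 0) - -[1+ 0 ] * (+ 0 * + 0 + + 1 * Q)) + - (+ 1) * (+ 0 * (+ 0 * + 0 + + 1 * Q) + -[1+ 0 ] * (+ 0 * Q - + 1 * + 0)) ≡ Q
        lem = solve-∀
      rearrange : halfroot * halfroot * (+ 2 * + r) ≡ + suc (k ℕ.* 8 ℕ.+ 2) * c
      rearrange = trans (cong (λ x → halfroot * halfroot * (+ 2 * + x)) (trans r≡ (ℕₚ.+-suc (k ℕ.* 8) 2)))
        (trans (lem ((+ 4) ^ k) (u ^ h) (+ suc (k ℕ.* 8 ℕ.+ 2)))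
          (cong₂ (λ x y → + suc (k ℕ.* 8 ℕ.+ 2) * (x * y * + 2)) (sym u^n) (sym (16^ k))))
        where
        lem : ∀ t s n → (t * s) * (t * s) * (+ 2 * n) ≡ n * (s * s * (t * t) * + 2)
        lem = solve-∀

    𝕁rQ : 𝕁 (+ r) Q ≡ Sign.+
    𝕁rQ = trans (sym (cong (Sign._* 𝕁 (+ r) Q) 𝕁2Q)) (trans (sym (𝕁-* {Q} oQ {+ 2} {+ r} (odd⇒coprime-2 oQ) crQ)) twice-r-residue)

    or : Odd (+ r)
    or = mod (+ (k ℕ.* 4 ℕ.+ 1)) (trans (cong +_ (trans r≡ (lem k))) (trans (ℤₚ.pos-+ 1 ((k ℕ.* 4 ℕ.+ 1) ℕ.* 2)) (cong (λ x → + 1 + x) (ℤₚ.pos-* (k ℕ.* 4 ℕ.+ 1) 2))))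
      where
      lem : ∀ k → k ℕ.* 8 ℕ.+ 3 ≡ 1 ℕ.+ (k ℕ.* 4 ℕ.+ 1) ℕ.* 2
      lem = ℕS.solve-∀

    -- For q ≡ 1 (mod 8) reciprocity would turn (r/q) = 1 into (q/r) = 1.
    Q≈7 : Q ≈ + 7 [ + 8 ]
    Q≈7 = by-cases Q≈±1
      where
      by-cases : Q ≈ + 1 [ + 8 ] ⊎ Q ≈ + 7 [ + 8 ] → Q ≈ + 7 [ + 8 ]
      by-cases (inj₂ e) = e
      by-cases (inj₁ e) = ⊥-elim (+≢- (trans (sym 𝕁rQ) (trans (𝕁-reciprocity {Q} {r} (8⇒4 e) or crQ) nonresidue)))

    V≈1 : V ≈ + 1 [ + 8 ]
    V≈1 = ≈-trans V≈-Q (≈-trans (neg-≈ Q≈7) (mod -1ℤ refl))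

    -- Re - Im of (1 + i)³ is - 4, so (- u/V) = (2u/V), and V ≡ 1 (mod 8) removes the 2.
    sign-V : sign V ≡ Sign.+
    sign-V = trans (sym (𝕁-neg1-1[4] (8⇒4 V≈1))) (cancel-sign (𝕁 -1ℤ V) (𝕁 u V)
      (trans (sym (𝕁-neg-num {u} {V} oV cuV)) (trans (sym (𝕁-sq-* {V} oV {root k h} { - u} (coprime-root {V} k h oV cuV) (coprime-neg {u} {V} cuV)))
        (trans (𝕁-cong {V} oV (≈-trans (≡⇒≈ rearrange) (evaluate-V Sign.- k 3 hyp′)))
          (trans (𝕁-* {V} oV {+ 2} {u} (odd⇒coprime-2 oV) cuV) (cong (Sign._* 𝕁 u V) (𝕁-2-1[8] V≈1)))))))
      where
      rearrange : root k h * root k h * - u ≡ u ^ (k ℕ.* 8 ℕ.+ 3) * (+ 16) ^ k * -[1+ 3 ]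
      rearrange = trans (lem ((+ 4) ^ k) (u ^ h) u)
        (cong₂ (λ x y → x * y * -[1+ 3 ]) (sym (trans (cong (u ^_) (ℕₚ.+-suc (k ℕ.* 8) 2)) (cong (λ x → u * x) u^n))) (sym (16^ k)))
        where
        lem : ∀ t s u → (+ 2 * (t * s)) * (+ 2 * (t * s)) * - u ≡ u * (s * s) * (t * t) * -[1+ 3 ]
        lem = solve-∀

-- Contradictions modulo Re zⁿ ± Im zⁿ

-- The exponents start at 8 because (1 ± i)⁸ = 16 makes z⁸, and with it every later power, the
-- square of a rational integer modulo Q and modulo V.
8·2^ : ℕ → ℕ
8·2^ zero    = 8
8·2^ (suc j) = 8·2^ j ℕ.+ 8·2^ j

8·2^-suc : ∀ j → ∃ λ i → 8·2^ j ≡ suc i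
8·2^-suc zero = 7 , refl
8·2^-suc (suc j) with 8·2^-suc j
... | i , e = i ℕ.+ 8·2^ j , cong (ℕ._+ 8·2^ j) e

J^4k+ : ∀ J k ρ → J ^ᵍ 4 ≡ 1ᵍ → J ^ᵍ (k ℕ.* 4 ℕ.+ ρ) ≡ J ^ᵍ ρ
J^4k+ J k ρ e = trans (pow-split J k 4 ρ) (trans (cong (_*ᵍ J ^ᵍ ρ) (trans (cong (_^ᵍ k) e) (G.1^ k))) (*ᵍ-identityˡ (J ^ᵍ ρ)))

module Contradictions (u w : ℤ) (q : ℕ) (u+w : u + w ≡ + q) (cuw : Coprimeᴿ u w) (ou : Odd u) (w4 : w ≈ + 0 [ + 4 ])
  (Q≈3 : + q ≈ + 3 [ + 4 ]) (V>0 : sign (w - u) ≡ Sign.+) where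

  open Coordinates u w q u+w cuw ou w4

  private
    -1-Q : 𝕁 -1ℤ Q ≡ Sign.-
    -1-Q = 𝕁-neg1-Q Q≈3

  shift-up : ∀ {X} J n m t r → z ^ᵍ (n ℕ.+ n) G.≈ J *ᵍ ι (a ^ n) [ ι X ] → r ≡ m ℕ.* (n ℕ.+ n) ℕ.+ t →
    ι (a ^ 0) *ᵍ z ^ᵍ r G.≈ ι (a ^ (m ℕ.* n)) *ᵍ (J ^ᵍ m *ᵍ z ^ᵍ t) [ ι X ]
  shift-up {X} J n m t r p refl = G.≈-trans (G.≡⇒≈ (trans (*ᵍ-identityˡ (z ^ᵍ (m ℕ.* (n ℕ.+ n) ℕ.+ t))) (pow-split z m (n ℕ.+ n) t)))
    (G.≈-trans (G.*-congʳ-≈ (z ^ᵍ t) (unit-pow J (a ^ n) m p))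
      (G.≡⇒≈ (trans (lem (J ^ᵍ m) (ι ((a ^ n) ^ m)) (z ^ᵍ t)) (cong (λ x → ι x *ᵍ (J ^ᵍ m *ᵍ z ^ᵍ t)) (sym (^-* a m n))))))
    where
    lem : ∀ j b z → (j *ᵍ b) *ᵍ z ≡ b *ᵍ (j *ᵍ z)
    lem = RS.solve-∀ 𝔾-ring

  -- An exponent t below a multiple of 2n is reached by multiplying with zᵗ z̄ᵗ = aᵗ, which replaces
  -- a division by zᵗ.
  shift-down : ∀ {X} J n m t r → z ^ᵍ (n ℕ.+ n) G.≈ J *ᵍ ι (a ^ n) [ ι X ] → t ℕ.+ r ≡ m ℕ.* (n ℕ.+ n) →
    ι (a ^ t) *ᵍ z ^ᵍ r G.≈ ι (a ^ (m ℕ.* n)) *ᵍ (J ^ᵍ m *ᵍ z̄ ^ᵍ t) [ ι X ]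
  shift-down {X} J n m t r p e = G.≈-trans (G.≡⇒≈ (trans (cong (_*ᵍ z ^ᵍ r) (sym zz̄)) (trans (swap (z ^ᵍ t) (z̄ ^ᵍ t) (z ^ᵍ r))
      (cong (z̄ ^ᵍ t *ᵍ_) (trans (sym (G.^-+ z t r)) (trans (cong (z ^ᵍ_) e) (G.^-* z m (n ℕ.+ n))))))))
    (G.≈-trans (G.*-congˡ-≈ (z̄ ^ᵍ t) (unit-pow J (a ^ n) m p))
      (G.≡⇒≈ (trans (lem (J ^ᵍ m) (ι ((a ^ n) ^ m)) (z̄ ^ᵍ t)) (cong (λ x → ι x *ᵍ (J ^ᵍ m *ᵍ z̄ ^ᵍ t)) (sym (^-* a m n))))))
    where
    zz̄ : z ^ᵍ t *ᵍ z̄ ^ᵍ t ≡ ι (a ^ t)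
    zz̄ = trans (sym (G.^-distrib z z̄ t)) (trans (cong (_^ᵍ t) (*-conj z)) (ι-^ a t))
    swap : ∀ a b c → (a *ᵍ b) *ᵍ c ≡ b *ᵍ (a *ᵍ c)
    swap = RS.solve-∀ 𝔾-ring
    lem : ∀ j b z → z *ᵍ (j *ᵍ b) ≡ b *ᵍ (j *ᵍ z)
    lem = RS.solve-∀ 𝔾-ring

  double-power : ∀ s n → z ^ᵍ (n ℕ.+ n) G.≈ (+ 0 +i - σ s) *ᵍ ι (a ^ n) [ ι (E s (z ^ᵍ n)) ]
  double-power s n = G.≈-trans (G.≡⇒≈ (G.^-+ z n n)) (G.≈-trans (square-mod-E s (z ^ᵍ n))
    (G.≡⇒≈ (cong (λ x → (+ 0 +i - σ s) *ᵍ ι x) (norm-^ z n))))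

  -- r ≡ 5, 11 (mod 16), with the modulus Re z² + Im z²

  module Modulus₂ where

    X = E Sign.+ (z ^ᵍ 2)

    X-poly : X ≡ u * u + + 2 * (u * w) - w * w
    X-poly = lem u w
      where
      lem : ∀ u w → (u * (u * + 1 - w * + 0) - w * (u * + 0 + w * + 1)) + + 1 * (u * (u * + 0 + w * + 1) + w * (u * + 1 - w * + 0)) ≡ u * u + + 2 * (u * w) - w * w
      lem = solve-∀

    X≈1 : X ≈ + 1 [ + 4 ]
    X≈1 = ≈-trans (≡⇒≈ X-poly) (X≈u² w4)
      where
      X≈u² : w ≈ + 0 [ + 4 ] → u * u + + 2 * (u * w) - w * w ≈ + 1 [ + 4 ]
      X≈u² (mod k e) = ≈-trans (mod (+ 2 * (u * k) - + 4 * (k * k)) (trans (cong (λ x → u * u + + 2 * (u * x) - x * x) e) (lem u k))) (8⇒4 u²≈1)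
        where
        lem : ∀ u k → u * u + + 2 * (u * (+ 0 + k * + 4)) - (+ 0 + k * + 4) * (+ 0 + k * + 4) ≡ u * u + (+ 2 * (u * k) - + 4 * (k * k)) * + 4
        lem = solve-∀

    oX = 1[4]⇒odd X≈1

    X-mod-Q : X ≈ - (u * u * + 2) [ Q ]
    X-mod-Q = ≈-trans (≡⇒≈ X-poly) (mod (+ 3 * u - w) (trans (lem u w) (cong (λ x → - (u * u * + 2) + (+ 3 * u - w) * x) u+w)))
      where
      lem : ∀ u w → u * u + + 2 * (u * w) - w * w ≡ - (u * u * + 2) + (+ 3 * u - w) * (u + w)
      lem = solve-∀

    X-mod-V : X ≈ u * u * + 2 [ V ]
    X-mod-V = ≈-trans (≡⇒≈ X-poly) (mod (- (w - u)) (lem u w))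
      where
      lem : ∀ u w → u * u + + 2 * (u * w) - w * w ≡ u * u * + 2 + - (w - u) * (w - u)
      lem = solve-∀

    cQX : Coprimeᴿ Q X
    cQX = Coprime-sym {X} {Q} (Coprime-≈ {X} { - (u * u * + 2)} {Q} X-mod-Q (coprime-neg {u * u * + 2} {Q} (twice-square Q oQ cuQ)))

    cVX : Coprimeᴿ V X
    cVX = Coprime-sym {X} {V} (Coprime-≈ {X} {u * u * + 2} {V} X-mod-V (twice-square V oV cuV))

    -- Reciprocity gives (Q/X) = (- 2/Q) = - (2/Q) and, as V > 0, (V/X) = (2/V). But V ≡ - Q (mod 8)
    -- makes (2/V) equal to (2/Q).
    distinct : 𝕁 Q X ≢ 𝕁 V X
    distinct e = by-cases (3-mod-8 Q≈3)
      where
      left : 𝕁 Q X ≡ Sign.- Sign.* 𝕁 (+ 2) Q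
      left = trans (𝕁-reciprocity-pos Q refl X≈1 oQ cQX) (trans (𝕁-cong {Q} oQ X-mod-Q)
        (trans (𝕁-neg-num {u * u * + 2} {Q} oQ (twice-square Q oQ cuQ)) (cong₂ Sign._*_ -1-Q (𝕁-twice-square Q oQ cuQ))))
      right : 𝕁 V X ≡ 𝕁 (+ 2) V
      right = trans (𝕁-reciprocity-pos V V>0 X≈1 oV cVX) (trans (𝕁-cong {V} oV X-mod-V) (𝕁-twice-square V oV cuV))
      both : Sign.- Sign.* 𝕁 (+ 2) Q ≡ 𝕁 (+ 2) V
      both = trans (sym left) (trans e right)
      by-cases : Q ≈ + 3 [ + 8 ] ⊎ Q ≈ + 7 [ + 8 ] → ⊥
      by-cases (inj₁ e) = +≢- (trans (trans (cong (Sign.- Sign.*_) (sym (𝕁-2-3[8] e))) both) (𝕁-2-5[8] (≈-trans V≈-Q (≈-trans (neg-≈ e) (mod -1ℤ refl)))))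
      by-cases (inj₂ e) = +≢- (trans (sym (𝕁-2-1[8] (≈-trans V≈-Q (≈-trans (neg-≈ e) (mod -1ℤ refl))))) (trans (sym both) (cong (Sign.- Sign.*_) (𝕁-2-7[8] e))))

    -- Here r = 4m + 1 with m ≡ 1 (mod 4), so zʳ ≡ - i a²ᵐ z, and Re + Im of - iz is w - u. The
    -- power of a is a square.
    case-5 : ∀ k r → r ≡ k ℕ.* 16 ℕ.+ 5 → E Sign.+ (z ^ᵍ r) ≡ Q → ⊥
    case-5 k r r≡ hyp = distinct (𝕁-transfer {a ^ 2} {Q} {V} {X} 0 (k ℕ.* 4 ℕ.+ 1) oX ca² 𝕁a² cQX cVX
      (≈-trans (conclude {r} Sign.+ 0 ((k ℕ.* 4 ℕ.+ 1) ℕ.* 2) (𝕚⁻ *ᵍ z ^ᵍ 1) V {X} hyp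
        (G.≈-trans (shift-up {X} 𝕚⁻ 2 (k ℕ.* 4 ℕ.+ 1) 1 r (double-power Sign.+ 2) (trans r≡ (lem k)))
          (G.≡⇒≈ (cong (λ x → ι (a ^ ((k ℕ.* 4 ℕ.+ 1) ℕ.* 2)) *ᵍ (x *ᵍ z ^ᵍ 1)) (J^4k+ 𝕚⁻ k 1 refl))))
        (value u w))
      (≡⇒≈ (cong (_* V) (^-* a (k ℕ.* 4 ℕ.+ 1) 2)))))
      where
      lem : ∀ k → k ℕ.* 16 ℕ.+ 5 ≡ (k ℕ.* 4 ℕ.+ 1) ℕ.* 4 ℕ.+ 1
      lem = ℕS.solve-∀
      ca² : Coprimeᴿ (a ^ 2) X
      ca² = Coprime-^ˡ {a} {X} 2 (coprime-a Sign.+ 1)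
      𝕁a² : 𝕁 (a ^ 2) X ≡ Sign.+
      𝕁a² = trans (cong (λ x → 𝕁 (a * x) X) (ℤₚ.*-identityʳ a)) (𝕁-sq {X} oX {a} (coprime-a Sign.+ 1))
      value : ∀ u w → (+ 0 * (u * + 1 - w * + 0) - -[1+ 0 ] * (u * + 0 + w * + 1)) + + 1 * (+ 0 * (u * + 0 + w * + 1) + -[1+ 0 ] * (u * + 1 - w * + 0)) ≡ w - u
      value = solve-∀

    -- Here r + 1 = 4m with m ≡ 3 (mod 4), so a zʳ ≡ i a²ᵐ z̄, and Re - Im of i z̄ is w - u. An odd
    -- power of a survives, so (a/X) = 1 is required, and with it (2/Q) = (2/V) = 1.
    case-11 : ∀ k r → r ≡ k ℕ.* 16 ℕ.+ 11 → E Sign.- (z ^ᵍ r) ≡ Q → 𝕁 (+ 2) Q ≡ Sign.+ → 𝕁 (+ 2) V ≡ Sign.+ → ⊥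
    case-11 k r r≡ hyp 2Q 2V = distinct (𝕁-transfer {a} {Q} {V} {X} 1 ((k ℕ.* 4 ℕ.+ 3) ℕ.* 2) oX (coprime-a Sign.+ 1) (𝕁-a Sign.+ 1 2Q 2V X≈1) cQX cVX
      (conclude {r} Sign.- 1 ((k ℕ.* 4 ℕ.+ 3) ℕ.* 2) (𝕚 *ᵍ z̄ ^ᵍ 1) V {X} hyp
        (G.≈-trans (shift-down {X} 𝕚⁻ 2 (k ℕ.* 4 ℕ.+ 3) 1 r (double-power Sign.+ 2) (trans (cong suc r≡) (lem k)))
          (G.≡⇒≈ (cong (λ x → ι (a ^ ((k ℕ.* 4 ℕ.+ 3) ℕ.* 2)) *ᵍ (x *ᵍ z̄ ^ᵍ 1)) (J^4k+ 𝕚⁻ k 3 refl))))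
        (value u w)))
      where
      lem : ∀ k → 1 ℕ.+ (k ℕ.* 16 ℕ.+ 11) ≡ (k ℕ.* 4 ℕ.+ 3) ℕ.* 4
      lem = ℕS.solve-∀
      value : ∀ u w → (+ 0 * (u * + 1 - - w * + 0) - + 1 * (u * + 0 + - w * + 1)) + - (+ 1) * (+ 0 * (u * + 0 + - w * + 1) + + 1 * (u * + 1 - - w * + 0)) ≡ w - u
      value = solve-∀

  -- r ≡ 3, 13 (mod 16): r = m · 8 · 2ʲ⁺¹ ± 3 with m odd, and the modulus is Re zⁿ ± Im zⁿ for n = 8 · 2ʲ

  module Modulus₃ (Q≈7 : Q ≈ + 7 [ + 8 ]) (w8 : w ≈ + 0 [ + 8 ]) where

    𝕁2Q : 𝕁 (+ 2) Q ≡ Sign.+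
    𝕁2Q = 𝕁-2-7[8] Q≈7

    V≈1 : V ≈ + 1 [ + 8 ]
    V≈1 = ≈-trans V≈-Q (≈-trans (neg-≈ Q≈7) (mod -1ℤ refl))

    𝕁2V : 𝕁 (+ 2) V ≡ Sign.+
    𝕁2V = 𝕁-2-1[8] V≈1

    M≈1 : M ≈ + 1 [ + 8 ]
    M≈1 = ≈-trans (M≈u² w8) u²≈1
      where
      M≈u² : w ≈ + 0 [ + 8 ] → M ≈ u * u [ + 8 ]
      M≈u² (mod k e) = mod (+ 4 * (u * k) + + 8 * (k * k)) (trans (cong (λ x → u * u + + 4 * (u * x) + x * x) e) (lem u k))
        where
        lem : ∀ u k → u * u + + 4 * (u * (+ 0 + k * + 8)) + (+ 0 + k * + 8) * (+ 0 + k * + 8) ≡ u * u + (+ 4 * (u * k) + + 8 * (k * k)) * + 8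
        lem = solve-∀

    M≈1[4] = 8⇒4 M≈1
    oM = 1[4]⇒odd M≈1[4]

    𝕁2M : 𝕁 (+ 2) M ≡ Sign.+
    𝕁2M = 𝕁-2-1[8] M≈1

    M≈-2u²[Q] : M ≈ - (u * u * + 2) [ Q ]
    M≈-2u²[Q] = mod (+ 3 * u + w) (trans (lem u w) (cong (λ x → - (u * u * + 2) + (+ 3 * u + w) * x) u+w))
      where
      lem : ∀ u w → u * u + + 4 * (u * w) + w * w ≡ - (u * u * + 2) + (+ 3 * u + w) * (u + w)
      lem = solve-∀

    cQM : Coprimeᴿ Q M
    cQM = Coprime-sym {M} {Q} (Coprime-≈ {M} { - (u * u * + 2)} {Q} M≈-2u²[Q] (coprime-neg {u * u * + 2} {Q} (twice-square Q oQ cuQ)))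

    𝕁QM : 𝕁 Q M ≡ Sign.-
    𝕁QM = trans (𝕁-reciprocity {M} {q} M≈1[4] oQ cQM) (trans (𝕁-cong {Q} oQ M≈-2u²[Q])
      (trans (𝕁-neg-num {u * u * + 2} {Q} oQ (twice-square Q oQ cuQ)) (cong₂ Sign._*_ -1-Q (trans (𝕁-twice-square Q oQ cuQ) 𝕁2Q))))

    M≈2Q²[a] : M ≈ Q * Q * + 2 [ a ]
    M≈2Q²[a] = mod -1ℤ (trans (lem u w) (cong (λ x → x * x * + 2 + -1ℤ * a) u+w))
      where
      lem : ∀ u w → u * u + + 4 * (u * w) + w * w ≡ (u + w) * (u + w) * + 2 + -1ℤ * (u * u + w * w)
      lem = solve-∀

    caM : Coprimeᴿ a M
    caM = Coprime-sym {M} {a} (Coprime-≈ {M} {Q * Q * + 2} {a} M≈2Q²[a]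
      (Coprime-*ˡ {Q * Q} {+ 2} {a} (Coprime-*ˡ {Q} {Q} {a} cQa cQa) c2a))

    𝕁aM : 𝕁 a M ≡ Sign.+
    𝕁aM = trans (𝕁-reciprocity-pos a sign-a M≈1[4] oa caM) (trans (𝕁-cong {a} oa M≈2Q²[a]) (trans (𝕁-sq-* {a} oa {Q} {+ 2} cQa c2a) 𝕁2a))

    E-cube : E Sign.+ (z ^ᵍ 3) ≡ - V * M
    E-cube = lem u w
      where
      lem : ∀ u w → (u * (u * (u * + 1 - w * + 0) - w * (u * + 0 + w * + 1)) - w * (u * (u * + 0 + w * + 1) + w * (u * + 1 - w * + 0)))
        + + 1 * (u * (u * (u * + 0 + w * + 1) + w * (u * + 1 - w * + 0)) + w * (u * (u * + 1 - w * + 0) - w * (u * + 0 + w * + 1)))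
        ≡ - (w - u) * (u * u + + 4 * (u * w) + w * w)
      lem = solve-∀

    -- M divides Re z³ + Im z³, so the congruence for the square of z³ descends from that number to
    -- M.
    sixth-power : z ^ᵍ 6 G.≈ 𝕚⁻ *ᵍ ι (a ^ 3) [ ι M ]
    sixth-power = G-mod-∣ (G.div (ι (- V)) (trans (cong ι E-cube) (sym (ι-* (- V) M)))) (double-power Sign.+ 3)

    -- E (z ^ r) = Q is congruent to − Q times a power of a, so −1 is a residue modulo M.
    sign-M-from : ∀ e f → a ^ e * Q ≈ a ^ f * - Q [ M ] → sign M ≡ Sign.+
    sign-M-from e f p = trans (sym (𝕁-neg1-1[4] M≈1[4])) (cancel-sign (𝕁 -1ℤ M) (𝕁 Q M)
      (sym (trans (𝕁-transfer {a} {Q} { - Q} {M} e f oM caM 𝕁aM cQM (coprime-neg {Q} {M} cQM) p) (𝕁-neg-num {Q} {M} oM cQM))))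

    sign-M-up : ∀ ε k ρ r → r ≡ (k ℕ.* 4 ℕ.+ ρ) ℕ.* 6 ℕ.+ 1 → E ε (z ^ᵍ r) ≡ Q → E ε (𝕚⁻ ^ᵍ ρ *ᵍ z ^ᵍ 1) ≡ - Q → sign M ≡ Sign.+
    sign-M-up ε k ρ r r≡ hyp value = sign-M-from 0 ((k ℕ.* 4 ℕ.+ ρ) ℕ.* 3)
      (conclude {r} ε 0 ((k ℕ.* 4 ℕ.+ ρ) ℕ.* 3) (𝕚⁻ ^ᵍ ρ *ᵍ z ^ᵍ 1) (- Q) {M} hyp
        (G.≈-trans (shift-up {M} 𝕚⁻ 3 (k ℕ.* 4 ℕ.+ ρ) 1 r sixth-power r≡)
          (G.≡⇒≈ (cong (λ x → ι (a ^ ((k ℕ.* 4 ℕ.+ ρ) ℕ.* 3)) *ᵍ (x *ᵍ z ^ᵍ 1)) (J^4k+ 𝕚⁻ k ρ refl)))) value)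

    sign-M-down : ∀ ε k ρ r → suc r ≡ (k ℕ.* 4 ℕ.+ ρ) ℕ.* 6 → E ε (z ^ᵍ r) ≡ Q → E ε (𝕚⁻ ^ᵍ ρ *ᵍ z̄ ^ᵍ 1) ≡ - Q → sign M ≡ Sign.+
    sign-M-down ε k ρ r r≡ hyp value = sign-M-from 1 ((k ℕ.* 4 ℕ.+ ρ) ℕ.* 3)
      (conclude {r} ε 1 ((k ℕ.* 4 ℕ.+ ρ) ℕ.* 3) (𝕚⁻ ^ᵍ ρ *ᵍ z̄ ^ᵍ 1) (- Q) {M} hyp
        (G.≈-trans (shift-down {M} 𝕚⁻ 3 (k ℕ.* 4 ℕ.+ ρ) 1 r sixth-power r≡)
          (G.≡⇒≈ (cong (λ x → ι (a ^ ((k ℕ.* 4 ℕ.+ ρ) ℕ.* 3)) *ᵍ (x *ᵍ z̄ ^ᵍ 1)) (J^4k+ 𝕚⁻ k ρ refl)))) value)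

    private
      -[u+w] : ∀ {x} → x ≡ - (u + w) → x ≡ - Q
      -[u+w] e = trans e (cong -_ u+w)

      z¹ : z ^ᵍ 1 ≡ z
      z¹ = 𝔾ₚ.*-identityʳ z

      z̄¹ : z̄ ^ᵍ 1 ≡ z̄
      z̄¹ = 𝔾ₚ.*-identityʳ z̄

    sign-M-5 : ∀ k r → r ≡ k ℕ.* 24 ℕ.+ 5 → E Sign.+ (z ^ᵍ r) ≡ Q → sign M ≡ Sign.+
    sign-M-5 k r r≡ hyp = sign-M-down Sign.+ k 1 r (trans (cong suc r≡) (lem k)) hyp
        (-[u+w] (trans (cong (λ x → E Sign.+ (𝕚⁻ *ᵍ x)) z̄¹) (value u w)))
      where
      lem : ∀ k → 1 ℕ.+ (k ℕ.* 24 ℕ.+ 5) ≡ (k ℕ.* 4 ℕ.+ 1) ℕ.* 6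
      lem = ℕS.solve-∀
      value : ∀ u w → (+ 0 * u - -[1+ 0 ] * (- w)) + + 1 * (+ 0 * (- w) + -[1+ 0 ] * u) ≡ - (u + w)
      value = solve-∀

    sign-M-11 : ∀ k r → r ≡ k ℕ.* 24 ℕ.+ 11 → E Sign.- (z ^ᵍ r) ≡ Q → sign M ≡ Sign.+
    sign-M-11 k r r≡ hyp = sign-M-down Sign.- k 2 r (trans (cong suc r≡) (lem k)) hyp
        (-[u+w] (trans (cong (λ x → E Sign.- ((-[1+ 0 ] +i + 0) *ᵍ x)) z̄¹) (value u w)))
      where
      lem : ∀ k → 1 ℕ.+ (k ℕ.* 24 ℕ.+ 11) ≡ (k ℕ.* 4 ℕ.+ 2) ℕ.* 6
      lem = ℕS.solve-∀
      value : ∀ u w → (-[1+ 0 ] * u - + 0 * (- w)) + - (+ 1) * (-[1+ 0 ] * (- w) + + 0 * u) ≡ - (u + w)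
      value = solve-∀

    sign-M-13 : ∀ k r → r ≡ k ℕ.* 24 ℕ.+ 13 → E Sign.+ (z ^ᵍ r) ≡ Q → sign M ≡ Sign.+
    sign-M-13 k r r≡ hyp = sign-M-up Sign.+ k 2 r (trans r≡ (lem k)) hyp
        (-[u+w] (trans (cong (λ x → E Sign.+ ((-[1+ 0 ] +i + 0) *ᵍ x)) z¹) (value u w)))
      where
      lem : ∀ k → k ℕ.* 24 ℕ.+ 13 ≡ (k ℕ.* 4 ℕ.+ 2) ℕ.* 6 ℕ.+ 1
      lem = ℕS.solve-∀
      value : ∀ u w → (-[1+ 0 ] * u - + 0 * w) + + 1 * (-[1+ 0 ] * w + + 0 * u) ≡ - (u + w)
      value = solve-∀

    sign-M-19 : ∀ k r → r ≡ k ℕ.* 24 ℕ.+ 19 → E Sign.- (z ^ᵍ r) ≡ Q → sign M ≡ Sign.+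
    sign-M-19 k r r≡ hyp = sign-M-up Sign.- k 3 r (trans r≡ (lem k)) hyp
        (-[u+w] (trans (cong (λ x → E Sign.- ((+ 0 +i + 1) *ᵍ x)) z¹) (value u w)))
      where
      lem : ∀ k → k ℕ.* 24 ℕ.+ 19 ≡ (k ℕ.* 4 ℕ.+ 3) ℕ.* 6 ℕ.+ 1
      lem = ℕS.solve-∀
      value : ∀ u w → (+ 0 * u - + 1 * w) + - (+ 1) * (+ 0 * w + + 1 * u) ≡ - (u + w)
      value = solve-∀

    module _ (M>0 : sign M ≡ Sign.+) where

      M≈w²[u] : M ≈ w * w [ u ]
      M≈w²[u] = mod (u + + 4 * w) (lem u w)
        where
        lem : ∀ u w → u * u + + 4 * (u * w) + w * w ≡ w * w + (u + + 4 * w) * u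
        lem = solve-∀

      cuM : Coprimeᴿ u M
      cuM = Coprime-sym {M} {u} (Coprime-≈ {M} {w * w} {u} M≈w²[u] (Coprime-*ˡ {w} {w} {u} cwu cwu))

      𝕁uM : 𝕁 u M ≡ Sign.+
      𝕁uM = trans (𝕁-reciprocity⁺ {M} {u} M≈1[4] M>0 ou cuM) (trans (𝕁-cong {u} ou M≈w²[u]) (𝕁-sq {u} ou {w} cwu))

      M≈u²[w] : M ≈ u * u [ w ]
      M≈u²[w] = mod (+ 4 * u + w) (lem u w)
        where
        lem : ∀ u w → u * u + + 4 * (u * w) + w * w ≡ u * u + (+ 4 * u + w) * w
        lem = solve-∀

      cwM : Coprimeᴿ w M
      cwM = Coprime-sym {M} {w} (Coprime-≈ {M} {u * u} {w} M≈u²[w] (Coprime-*ˡ {u} {u} {w} cuw cuw))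

      -1-M : 𝕁 -1ℤ M ≡ Sign.+
      -1-M = trans (𝕁-neg1-1[4] M≈1[4]) M>0

      c2M : Coprimeᴿ (+ 2) M
      c2M = odd⇒coprime-2 oM

      -- As w is even, reciprocity does not apply to it. Instead a = M - 4uw gives (a/M) = (- uw/M),
      -- where every other symbol is known.
      𝕁wM : 𝕁 w M ≡ Sign.+
      𝕁wM = trans (sym (cong (Sign._* 𝕁 w M) 𝕁uM)) (trans (sym (𝕁-* {M} oM {u} {w} cuM cwM))
        (trans (sym (𝕁-sq-* {M} oM {+ 2} {u * w} c2M cuwM))
        (trans (sym (trans (𝕁-neg-num {+ 2 * + 2 * (u * w)} {M} oM (Coprime-*ˡ {+ 2 * + 2} {u * w} {M} (Coprime-*ˡ {+ 2} {+ 2} {M} c2M c2M) cuwM)) (cong (Sign._* 𝕁 (+ 2 * + 2 * (u * w)) M) -1-M)))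
          (trans (𝕁-cong {M} oM (≈-sym (mod {a} { - (+ 2 * + 2 * (u * w))} (+ 1) (lem u w)))) 𝕁aM))))
        where
        cuwM : Coprimeᴿ (u * w) M
        cuwM = Coprime-*ˡ {u} {w} {M} cuM cwM
        lem : ∀ u w → u * u + w * w ≡ - (+ 2 * + 2 * (u * w)) + + 1 * (u * u + + 4 * (u * w) + w * w)
        lem = solve-∀

      minus-2yQ : ∀ y → Coprimeᴿ y M → 𝕁 y M ≡ Sign.+ → Coprimeᴿ (- (+ 2 * (y * Q))) M × 𝕁 (- (+ 2 * (y * Q))) M ≡ Sign.-
      minus-2yQ y cy e = coprime-neg {+ 2 * (y * Q)} {M} c , trans (𝕁-neg-num {+ 2 * (y * Q)} {M} oM c)
        (cong₂ Sign._*_ -1-M (trans (𝕁-* {M} oM {+ 2} {y * Q} c2M cyQ) (cong₂ Sign._*_ 𝕁2M (trans (𝕁-* {M} oM {y} {Q} cy cQM) (cong₂ Sign._*_ e 𝕁QM)))))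
        where
        cyQ = Coprime-*ˡ {y} {Q} {M} cy cQM
        c = Coprime-*ˡ {+ 2} {y * Q} {M} c2M cyQ

      square-powers : ∀ {m} c → Coprimeᴿ c m → z ^ᵍ 8 G.≈ ι (c * c) [ ι m ] → ∀ j → ∃ λ b → Coprimeᴿ b m × (z ^ᵍ 8·2^ j G.≈ ι (b * b) [ ι m ])
      square-powers {m} c cm p zero = c , cm , p
      square-powers {m} c cm p (suc j) = next (square-powers {m} c cm p j)
        where
        next : (∃ λ b → Coprimeᴿ b m × (z ^ᵍ 8·2^ j G.≈ ι (b * b) [ ι m ])) → ∃ λ b → Coprimeᴿ b m × (z ^ᵍ 8·2^ (suc j) G.≈ ι (b * b) [ ι m ])
        next (b , cb , e) = b * b , Coprime-*ˡ {b} {b} {m} cb cb ,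
          G.≈-trans (G.≡⇒≈ (G.^-+ z (8·2^ j) (8·2^ j))) (G.≈-trans (G.*-cong-≈ e e) (G.≡⇒≈ (ι-* (b * b) (b * b))))

      module _ (s : Sign) (j : ℕ) where

        X = E s (z ^ᵍ 8·2^ j)

        X≈1 : X ≈ + 1 [ + 4 ]
        X≈1 = ≈-trans (E-≈ s {z ^ᵍ 8·2^ j} {ι (+ 1)} {+ 4} (ones j)) (≡⇒≈ (E-ι s (+ 1)))
          where
          z≈u : z G.≈ ι u [ ι (+ 4) ]
          z≈u = real-≈ w4
          ones : ∀ j → z ^ᵍ 8·2^ j G.≈ ι (+ 1) [ ι (+ 4) ]
          ones zero = G.≈-trans (G.^-cong-≈ 8 z≈u) (G.≈-trans (G.≡⇒≈ (ι-^ u 8))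
            (ι-cong-≈ (≈-trans (≡⇒≈ (^-* u 4 2)) (≈-trans (^-cong-≈ 4 (≈-trans (≡⇒≈ (cong (u *_) (ℤₚ.*-identityʳ u))) (8⇒4 u²≈1))) (≡⇒≈ (1^ 4))))))
          ones (suc j) = G.≈-trans (G.≡⇒≈ (G.^-+ z (8·2^ j) (8·2^ j))) (G.≈-trans (G.*-cong-≈ (ones j) (ones j)) (G.≡⇒≈ refl))

        oX = 1[4]⇒odd X≈1

        square-residue : ∀ {m} c → Odd m → Coprimeᴿ c m → z ^ᵍ 8 G.≈ ι (c * c) [ ι m ] → Coprimeᴿ m X × 𝕁 X m ≡ Sign.+
        square-residue {m} c om cm p = by (square-powers {m} c cm p j)
          where
          by : (∃ λ b → Coprimeᴿ b m × (z ^ᵍ 8·2^ j G.≈ ι (b * b) [ ι m ])) → Coprimeᴿ m X × 𝕁 X m ≡ Sign.+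
          by (b , cb , e) = Coprime-sym {X} {m} (Coprime-≈ {X} {b * b} {m} X≈ (Coprime-*ˡ {b} {b} {m} cb cb)) , trans (𝕁-cong {m} om X≈) (𝕁-sq {m} om {b} cb)
            where
            X≈ : X ≈ b * b [ m ]
            X≈ = ≈-trans (E-≈ s {z ^ᵍ 8·2^ j} {ι (b * b)} {m} e) (≡⇒≈ (E-ι s (b * b)))

        root₈ = + 4 * u ^ 4

        eighth : ∀ {m} J → J ^ᵍ 8 ≡ ι (+ 16) → z G.≈ ι u *ᵍ J [ ι m ] → z ^ᵍ 8 G.≈ ι (root₈ * root₈) [ ι m ]
        eighth J e p = G.≈-trans (G.^-cong-≈ 8 p) (G.≡⇒≈ (trans (G.^-distrib (ι u) J 8) (trans (cong₂ _*ᵍ_ (ι-^ u 8) e)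
          (trans (ι-* (u ^ 8) (+ 16)) (cong ι (trans (cong (_* + 16) (^-+ u 4 4)) (lem (u ^ 4))))))))
          where
          lem : ∀ x → x * x * + 16 ≡ (+ 4 * x) * (+ 4 * x)
          lem = solve-∀

        coprime-root₈ : ∀ {m} → Odd m → Coprimeᴿ u m → Coprimeᴿ root₈ m
        coprime-root₈ {m} om c = Coprime-*ˡ {+ 4} {u ^ 4} {m} (Coprime-*ˡ {+ 2} {+ 2} {m} (odd⇒coprime-2 om) (odd⇒coprime-2 om)) (Coprime-^ˡ {u} {m} 4 c)

        at-Q : Coprimeᴿ Q X × 𝕁 X Q ≡ Sign.+
        at-Q = square-residue {Q} root₈ oQ (coprime-root₈ {Q} oQ cuQ) (eighth {Q} (+ 1 +i -[1+ 0 ]) refl (G.mod 𝕚 z-mod-Q))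

        at-V : Coprimeᴿ V X × 𝕁 X V ≡ Sign.+
        at-V = square-residue {V} root₈ oV (coprime-root₈ {V} oV cuV) (eighth {V} (+ 1 +i + 1) refl z-mod-V)

        -- Modulo M: z⁴ ≡ − i a z̄², hence z^(8·2ʲ) is alternately − i aᵏ z² and i aᵏ z̄².
        fourth : z ^ᵍ 2 *ᵍ z ^ᵍ 2 G.≈ (𝕚⁻ *ᵍ ι a) *ᵍ z̄ ^ᵍ 2 [ ι M ]
        fourth = G.mod ((a - + 2 * (u * w)) +i (u * u - w * w)) (cong₂ _+i_ (l₁ u w) (l₂ u w))
          where
          l₁ : ∀ u w → (u * (u * + 1 - w * + 0) - w * (u * + 0 + w * + 1)) * (u * (u * + 1 - w * + 0) - w * (u * + 0 + w * + 1))
                - (u * (u * + 0 + w * + 1) + w * (u * + 1 - w * + 0)) * (u * (u * + 0 + w * + 1) + w * (u * + 1 - w * + 0))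
             ≡ ((+ 0 * (u * u + w * w) - -[1+ 0 ] * + 0) * (u * (u * + 1 - - w * + 0) - - w * (u * + 0 + - w * + 1))
                - (+ 0 * + 0 + -[1+ 0 ] * (u * u + w * w)) * (u * (u * + 0 + - w * + 1) + - w * (u * + 1 - - w * + 0)))
               + (((u * u + w * w) - + 2 * (u * w)) * (u * u + + 4 * (u * w) + w * w) - (u * u - w * w) * + 0)
          l₁ = solve-∀
          l₂ : ∀ u w → (u * (u * + 1 - w * + 0) - w * (u * + 0 + w * + 1)) * (u * (u * + 0 + w * + 1) + w * (u * + 1 - w * + 0))
                + (u * (u * + 0 + w * + 1) + w * (u * + 1 - w * + 0)) * (u * (u * + 1 - w * + 0) - w * (u * + 0 + w * + 1))
             ≡ ((+ 0 * (u * u + w * w) - -[1+ 0 ] * + 0) * (u * (u * + 0 + - w * + 1) + - w * (u * + 1 - - w * + 0))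
                + (+ 0 * + 0 + -[1+ 0 ] * (u * u + w * w)) * (u * (u * + 1 - - w * + 0) - - w * (u * + 0 + - w * + 1)))
               + (((u * u + w * w) - + 2 * (u * w)) * + 0 + (u * u - w * w) * (u * u + + 4 * (u * w) + w * w))
          l₂ = solve-∀

        fourth-conj : z̄ ^ᵍ 2 *ᵍ z̄ ^ᵍ 2 G.≈ (𝕚 *ᵍ ι a) *ᵍ z ^ᵍ 2 [ ι M ]
        fourth-conj = conj-≈ fourth
          where
          conj-+ : ∀ x y → conj (x +ᵍ y) ≡ conj x +ᵍ conj y
          conj-+ (a +i b) (c +i d) = cong₂ _+i_ refl (ℤₚ.neg-distrib-+ b d)
          conj-conj : ∀ x → conj (conj x) ≡ x
          conj-conj (a +i b) = cong₂ _+i_ refl (ℤₚ.neg-involutive b)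
          conj-≈ : z ^ᵍ 2 *ᵍ z ^ᵍ 2 G.≈ (𝕚⁻ *ᵍ ι a) *ᵍ z̄ ^ᵍ 2 [ ι M ] → z̄ ^ᵍ 2 *ᵍ z̄ ^ᵍ 2 G.≈ (𝕚 *ᵍ ι a) *ᵍ z ^ᵍ 2 [ ι M ]
          conj-≈ (G.mod γ e) = G.mod (conj γ) (trans (sym (trans (conj-* (z ^ᵍ 2) (z ^ᵍ 2)) (cong₂ _*ᵍ_ (conj-^ z 2) (conj-^ z 2))))
            (trans (cong conj e) (trans (conj-+ ((𝕚⁻ *ᵍ ι a) *ᵍ z̄ ^ᵍ 2) (γ *ᵍ ι M))
              (cong₂ _+ᵍ_ (trans (conj-* (𝕚⁻ *ᵍ ι a) (z̄ ^ᵍ 2)) (cong₂ _*ᵍ_ (conj-* 𝕚⁻ (ι a)) (trans (conj-^ z̄ 2) (cong (_^ᵍ 2) (conj-conj z)))))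
                (conj-* γ (ι M))))))

        data PowerMod-M (n : ℕ) : Set where
          minus : ∀ k → z ^ᵍ n G.≈ (ι (a ^ k) *ᵍ 𝕚⁻) *ᵍ z ^ᵍ 2 [ ι M ] → PowerMod-M n
          plus  : ∀ k → z ^ᵍ n G.≈ (ι (a ^ k) *ᵍ 𝕚) *ᵍ z̄ ^ᵍ 2 [ ι M ] → PowerMod-M n

        private
          doubled : ∀ k i i′ x y → i *ᵍ i ≡ ι -1ℤ → ι -1ℤ *ᵍ i ≡ i′ → x *ᵍ x G.≈ (i *ᵍ ι a) *ᵍ y [ ι M ] →
            ((ι (a ^ k) *ᵍ i) *ᵍ x) *ᵍ ((ι (a ^ k) *ᵍ i) *ᵍ x) G.≈ (ι (a ^ suc (k ℕ.+ k)) *ᵍ i′) *ᵍ y [ ι M ]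
          doubled k i i′ x y i² ii p = G.≈-trans (G.≡⇒≈ (lem₁ (ι (a ^ k)) i x)) (G.≈-trans (G.*-congˡ-≈ ((ι (a ^ k) *ᵍ ι (a ^ k)) *ᵍ (i *ᵍ i)) p)
            (G.≡⇒≈ (trans (lem₂ (ι (a ^ k)) i (ι a) y) (cong (_*ᵍ y) (cong₂ _*ᵍ_
              (trans (cong (ι a *ᵍ_) (trans (ι-* (a ^ k) (a ^ k)) (cong ι (sym (^-+ a k k))))) (ι-* a (a ^ (k ℕ.+ k))))
              (trans (cong (_*ᵍ i) i²) ii))))))
            where
            lem₁ : ∀ b i x → ((b *ᵍ i) *ᵍ x) *ᵍ ((b *ᵍ i) *ᵍ x) ≡ ((b *ᵍ b) *ᵍ (i *ᵍ i)) *ᵍ (x *ᵍ x)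
            lem₁ = RS.solve-∀ 𝔾-ring
            lem₂ : ∀ b i a y → ((b *ᵍ b) *ᵍ (i *ᵍ i)) *ᵍ ((i *ᵍ a) *ᵍ y) ≡ ((a *ᵍ (b *ᵍ b)) *ᵍ ((i *ᵍ i) *ᵍ i)) *ᵍ y
            lem₂ = RS.solve-∀ 𝔾-ring

        double : ∀ {n} → PowerMod-M n → PowerMod-M (n ℕ.+ n)
        double {n} (minus k p) = plus (suc (k ℕ.+ k)) (G.≈-trans (G.≡⇒≈ (G.^-+ z n n)) (G.≈-trans (G.*-cong-≈ p p)
          (doubled k 𝕚⁻ 𝕚 (z ^ᵍ 2) (z̄ ^ᵍ 2) refl refl fourth)))
        double {n} (plus k p) = minus (suc (k ℕ.+ k)) (G.≈-trans (G.≡⇒≈ (G.^-+ z n n)) (G.≈-trans (G.*-cong-≈ p p)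
          (doubled k 𝕚 𝕚⁻ (z̄ ^ᵍ 2) (z ^ᵍ 2) refl refl fourth-conj)))

        eighth-mod-M : PowerMod-M 8
        eighth-mod-M = minus 3 (G.≈-trans (G.≡⇒≈ (trans (G.^-+ z 4 4) (cong₂ _*ᵍ_ (G.^-+ z 2 2) (G.^-+ z 2 2))))
          (G.≈-trans (G.*-cong-≈ fourth fourth)
          (G.≈-trans (G.≡⇒≈ (lem₁ 𝕚⁻ (ι a) (z̄ ^ᵍ 2)))
          (G.≈-trans (G.*-congˡ-≈ ((ι a *ᵍ ι a) *ᵍ (𝕚⁻ *ᵍ 𝕚⁻)) fourth-conj)
            (G.≡⇒≈ (trans (lem₂ (ι a) 𝕚⁻ 𝕚 (z ^ᵍ 2)) (cong (λ x → (x *ᵍ 𝕚⁻) *ᵍ z ^ᵍ 2) a³)))))))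
          where
          a³ : ι a *ᵍ (ι a *ᵍ ι a) ≡ ι (a ^ 3)
          a³ = trans (cong (ι a *ᵍ_) (cong (ι a *ᵍ_) (sym (𝔾ₚ.*-identityʳ (ι a))))) (ι-^ a 3)
          lem₁ : ∀ i a y → ((i *ᵍ a) *ᵍ y) *ᵍ ((i *ᵍ a) *ᵍ y) ≡ ((a *ᵍ a) *ᵍ (i *ᵍ i)) *ᵍ (y *ᵍ y)
          lem₁ = RS.solve-∀ 𝔾-ring
          lem₂ : ∀ a i j x → ((a *ᵍ a) *ᵍ (i *ᵍ i)) *ᵍ ((j *ᵍ a) *ᵍ x) ≡ ((a *ᵍ (a *ᵍ a)) *ᵍ ((i *ᵍ i) *ᵍ j)) *ᵍ x
          lem₂ = RS.solve-∀ 𝔾-ring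

        power-mod-M : ∀ j → PowerMod-M (8·2^ j)
        power-mod-M zero    = eighth-mod-M
        power-mod-M (suc j) = double (power-mod-M j)

        -- For either sign s and either shape of zⁿ, X is modulo M a power of a times - 2uQ or -
        -- 2wQ. Of the symbols of - 1, 2, u, w, a and Q over M only (Q/M) = (- 2/Q) is - 1.
        at-M : Coprimeᴿ M X × 𝕁 X M ≡ Sign.-
        at-M = by (power-mod-M j)
          where
          finish : ∀ k y → Coprimeᴿ y M → 𝕁 y M ≡ Sign.+ → X ≈ a ^ k * - (+ 2 * (y * Q)) [ M ] → Coprimeᴿ M X × 𝕁 X M ≡ Sign.-
          finish k y cy jy p = Coprime-sym {X} {M} (Coprime-≈ {X} {a ^ k * - (+ 2 * (y * Q))} {M} p (Coprime-*ˡ {a ^ k} { - (+ 2 * (y * Q))} {M} cak (proj₁ (minus-2yQ y cy jy)))) ,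
            trans (𝕁-cong {M} oM p) (trans (𝕁-* {M} oM {a ^ k} { - (+ 2 * (y * Q))} cak (proj₁ (minus-2yQ y cy jy)))
              (cong₂ Sign._*_ (𝕁-^ {a} {M} k oM caM 𝕁aM) (proj₂ (minus-2yQ y cy jy))))
            where
            cak = Coprime-^ˡ {a} {M} k caM
          C S : ℤ
          C = u * u - w * w
          S = + 2 * (u * w)
          S+C : S + C ≈ - (+ 2 * (w * Q)) [ M ]
          S+C = mod (+ 1) (trans (lem u w) (cong (λ x → - (+ 2 * (w * x)) + + 1 * M) u+w))
            where
            lem : ∀ u w → + 2 * (u * w) + (u * u - w * w) ≡ - (+ 2 * (w * (u + w))) + + 1 * (u * u + + 4 * (u * w) + w * w)
            lem = solve-∀
          S-C : S - C ≈ - (+ 2 * (u * Q)) [ M ]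
          S-C = mod (+ 1) (trans (lem u w) (cong (λ x → - (+ 2 * (u * x)) + + 1 * M) u+w))
            where
            lem : ∀ u w → + 2 * (u * w) - (u * u - w * w) ≡ - (+ 2 * (u * (u + w))) + + 1 * (u * u + + 4 * (u * w) + w * w)
            lem = solve-∀
          expand : ∀ k γ c → E s γ ≡ c → z ^ᵍ 8·2^ j G.≈ ι (a ^ k) *ᵍ γ [ ι M ] → X ≈ a ^ k * c [ M ]
          expand k γ c e p = ≈-trans (E-≈ s {z ^ᵍ 8·2^ j} {ι (a ^ k) *ᵍ γ} {M} p) (≡⇒≈ (trans (E-ι* s (a ^ k) γ) (cong (λ x → a ^ k * x) e)))
          E-minus : ∀ s → E s (𝕚⁻ *ᵍ z ^ᵍ 2) ≡ S - σ s * C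
          E-minus s = lem u w (σ s)
            where
            lem : ∀ u w s → (+ 0 * (u * (u * + 1 - w * + 0) - w * (u * + 0 + w * + 1)) - -[1+ 0 ] * (u * (u * + 0 + w * + 1) + w * (u * + 1 - w * + 0)))
              + s * (+ 0 * (u * (u * + 0 + w * + 1) + w * (u * + 1 - w * + 0)) + -[1+ 0 ] * (u * (u * + 1 - w * + 0) - w * (u * + 0 + w * + 1)))
              ≡ + 2 * (u * w) - s * (u * u - w * w)
            lem = solve-∀
          E-plus : ∀ s → E s (𝕚 *ᵍ z̄ ^ᵍ 2) ≡ S + σ s * C
          E-plus s = lem u w (σ s)
            where
            lem : ∀ u w s → (+ 0 * (u * (u * + 1 - - w * + 0) - - w * (u * + 0 + - w * + 1)) - + 1 * (u * (u * + 0 + - w * + 1) + - w * (u * + 1 - - w * + 0)))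
              + s * (+ 0 * (u * (u * + 0 + - w * + 1) + - w * (u * + 1 - - w * + 0)) + + 1 * (u * (u * + 1 - - w * + 0) - - w * (u * + 0 + - w * + 1)))
              ≡ + 2 * (u * w) + s * (u * u - w * w)
            lem = solve-∀
          scale : ∀ k c d → c ≈ d [ M ] → X ≈ a ^ k * c [ M ] → X ≈ a ^ k * d [ M ]
          scale k c d p e = ≈-trans e (*-congˡ-≈ (a ^ k) p)
          either : ∀ k → X ≈ a ^ k * (S + C) [ M ] ⊎ X ≈ a ^ k * (S - C) [ M ] → Coprimeᴿ M X × 𝕁 X M ≡ Sign.-
          either k (inj₁ e) = finish k w cwM 𝕁wM (scale k (S + C) (- (+ 2 * (w * Q))) S+C e)
          either k (inj₂ e) = finish k u cuM 𝕁uM (scale k (S - C) (- (+ 2 * (u * Q))) S-C e)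
          S+1C : S + σ Sign.+ * C ≡ S + C
          S+1C = cong (λ x → S + x) (ℤₚ.*-identityˡ C)
          S-1C : S - σ Sign.+ * C ≡ S - C
          S-1C = cong (λ x → S - x) (ℤₚ.*-identityˡ C)
          S+-1C : S + σ Sign.- * C ≡ S - C
          S+-1C = cong (λ x → S + x) (ℤₚ.-1*i≡-i C)
          S--1C : S - σ Sign.- * C ≡ S + C
          S--1C = trans (cong (λ x → S - x) (ℤₚ.-1*i≡-i C)) (cong (λ x → S + x) (ℤₚ.neg-involutive C))
          choose-minus : ∀ t → S - σ t * C ≡ S + C ⊎ S - σ t * C ≡ S - C
          choose-minus Sign.+ = inj₂ S-1C
          choose-minus Sign.- = inj₁ S--1C
          choose-plus : ∀ t → S + σ t * C ≡ S + C ⊎ S + σ t * C ≡ S - C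
          choose-plus Sign.+ = inj₁ S+1C
          choose-plus Sign.- = inj₂ S+-1C
          by : PowerMod-M (8·2^ j) → Coprimeᴿ M X × 𝕁 X M ≡ Sign.-
          by (minus k p) = either k (pick (choose-minus s))
            where
            p′ = G.≈-trans p (G.≡⇒≈ (𝔾ₚ.*-assoc (ι (a ^ k)) 𝕚⁻ (z ^ᵍ 2)))
            pick : S - σ s * C ≡ S + C ⊎ S - σ s * C ≡ S - C → X ≈ a ^ k * (S + C) [ M ] ⊎ X ≈ a ^ k * (S - C) [ M ]
            pick (inj₁ e) = inj₁ (expand k (𝕚⁻ *ᵍ z ^ᵍ 2) (S + C) (trans (E-minus s) e) p′)
            pick (inj₂ e) = inj₂ (expand k (𝕚⁻ *ᵍ z ^ᵍ 2) (S - C) (trans (E-minus s) e) p′)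
          by (plus k p) = either k (pick (choose-plus s))
            where
            p′ = G.≈-trans p (G.≡⇒≈ (𝔾ₚ.*-assoc (ι (a ^ k)) 𝕚 (z̄ ^ᵍ 2)))
            pick : S + σ s * C ≡ S + C ⊎ S + σ s * C ≡ S - C → X ≈ a ^ k * (S + C) [ M ] ⊎ X ≈ a ^ k * (S - C) [ M ]
            pick (inj₁ e) = inj₁ (expand k (𝕚 *ᵍ z̄ ^ᵍ 2) (S + C) (trans (E-plus s) e) p′)
            pick (inj₂ e) = inj₂ (expand k (𝕚 *ᵍ z̄ ^ᵍ 2) (S - C) (trans (E-plus s) e) p′)

        symbols-at-a : Coprimeᴿ a X × 𝕁 a X ≡ Sign.+
        symbols-at-a = by (8·2^-suc j)
          where
          by : (∃ λ i → 8·2^ j ≡ suc i) → Coprimeᴿ a X × 𝕁 a X ≡ Sign.+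
          by (i , e) = subst (λ m → E s (z ^ᵍ m) ≈ + 1 [ + 4 ] → Coprimeᴿ a (E s (z ^ᵍ m)) × 𝕁 a (E s (z ^ᵍ m)) ≡ Sign.+) (sym e)
            (λ X≈1 → coprime-a s i , 𝕁-a s i 𝕁2Q 𝕁2V X≈1) X≈1

        -- Reciprocity gives (Q/X) = (V/X) = 1 but (M/X) = - 1, so no powers of a can make Q and VM
        -- congruent.
        contradiction-mod-X : ∀ e f → a ^ e * Q ≈ a ^ f * (V * M) [ X ] → ⊥
        contradiction-mod-X e f p = +≢- (trans (sym (trans (𝕁-reciprocity-pos Q refl X≈1 oQ (proj₁ at-Q)) (proj₂ at-Q)))
          (trans (𝕁-transfer {a} {Q} {V * M} {X} e f oX (proj₁ symbols-at-a) (proj₂ symbols-at-a) (proj₁ at-Q) (Coprime-*ˡ {V} {M} {X} (proj₁ at-V) (proj₁ at-M)) p)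
            (trans (𝕁-* {X} oX {V} {M} (proj₁ at-V) (proj₁ at-M)) (cong₂ Sign._*_
              (trans (𝕁-reciprocity-pos V V>0 X≈1 oV (proj₁ at-V)) (proj₂ at-V))
              (trans (𝕁-reciprocity-pos M M>0 X≈1 oM (proj₁ at-M)) (proj₂ at-M))))))

      E-cube-conj : E Sign.+ (𝕚⁻ *ᵍ z̄ ^ᵍ 3) ≡ V * M
      E-cube-conj = lem u w
        where
        lem : ∀ u w → (+ 0 * (u * (u * (u * + 1 - - w * + 0) - - w * (u * + 0 + - w * + 1)) - - w * (u * (u * + 0 + - w * + 1) + - w * (u * + 1 - - w * + 0)))
            - -[1+ 0 ] * (u * (u * (u * + 0 + - w * + 1) + - w * (u * + 1 - - w * + 0)) + - w * (u * (u * + 1 - - w * + 0) - - w * (u * + 0 + - w * + 1))))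
          + + 1 * (+ 0 * (u * (u * (u * + 0 + - w * + 1) + - w * (u * + 1 - - w * + 0)) + - w * (u * (u * + 1 - - w * + 0) - - w * (u * + 0 + - w * + 1)))
            + -[1+ 0 ] * (u * (u * (u * + 1 - - w * + 0) - - w * (u * + 0 + - w * + 1)) - - w * (u * (u * + 0 + - w * + 1) + - w * (u * + 1 - - w * + 0))))
          ≡ (w - u) * (u * u + + 4 * (u * w) + w * w)
        lem = solve-∀

      E-cube-i : E Sign.- (𝕚 *ᵍ z ^ᵍ 3) ≡ V * M
      E-cube-i = lem u w
        where
        lem : ∀ u w → (+ 0 * (u * (u * (u * + 1 - w * + 0) - w * (u * + 0 + w * + 1)) - w * (u * (u * + 0 + w * + 1) + w * (u * + 1 - w * + 0)))
            - + 1 * (u * (u * (u * + 0 + w * + 1) + w * (u * + 1 - w * + 0)) + w * (u * (u * + 1 - w * + 0) - w * (u * + 0 + w * + 1))))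
          + - (+ 1) * (+ 0 * (u * (u * (u * + 0 + w * + 1) + w * (u * + 1 - w * + 0)) + w * (u * (u * + 1 - w * + 0) - w * (u * + 0 + w * + 1)))
            + + 1 * (u * (u * (u * + 1 - w * + 0) - w * (u * + 0 + w * + 1)) - w * (u * (u * + 0 + w * + 1) + w * (u * + 1 - w * + 0))))
          ≡ (w - u) * (u * u + + 4 * (u * w) + w * w)
        lem = solve-∀

      -- The exponent 3 is left over, and Re - Im of i z³ is - (Re z³ + Im z³) = VM.
      up : ∀ s j m r → (+ 0 +i - σ s) ^ᵍ m ≡ 𝕚 → r ≡ m ℕ.* 8·2^ (suc j) ℕ.+ 3 → E Sign.- (z ^ᵍ r) ≡ Q → ⊥
      up s j m r J r≡ hyp = contradiction-mod-X s j 0 (m ℕ.* 8·2^ j)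
        (conclude {r} Sign.- 0 (m ℕ.* 8·2^ j) (𝕚 *ᵍ z ^ᵍ 3) (V * M) {E s (z ^ᵍ 8·2^ j)} hyp
          (G.≈-trans (shift-up {E s (z ^ᵍ 8·2^ j)} (+ 0 +i - σ s) (8·2^ j) m 3 r (double-power s (8·2^ j)) r≡)
            (G.≡⇒≈ (cong (λ x → ι (a ^ (m ℕ.* 8·2^ j)) *ᵍ (x *ᵍ z ^ᵍ 3)) J))) E-cube-i)

      -- The exponent - 3 is left over, that is z̄³ up to a³, and Re + Im of - i z̄³ is again - (Re
      -- z³ + Im z³) = VM.
      down : ∀ s j m r → (+ 0 +i - σ s) ^ᵍ m ≡ 𝕚⁻ → 3 ℕ.+ r ≡ m ℕ.* 8·2^ (suc j) → E Sign.+ (z ^ᵍ r) ≡ Q → ⊥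
      down s j m r J r≡ hyp = contradiction-mod-X s j 3 (m ℕ.* 8·2^ j)
        (conclude {r} Sign.+ 3 (m ℕ.* 8·2^ j) (𝕚⁻ *ᵍ z̄ ^ᵍ 3) (V * M) {E s (z ^ᵍ 8·2^ j)} hyp
          (G.≈-trans (shift-down {E s (z ^ᵍ 8·2^ j)} (+ 0 +i - σ s) (8·2^ j) m 3 r (double-power s (8·2^ j)) r≡)
            (G.≡⇒≈ (cong (λ x → ι (a ^ (m ℕ.* 8·2^ j)) *ᵍ (x *ᵍ z̄ ^ᵍ 3)) J))) E-cube-conj)

-- The cases r > 3 by the residue of r modulo 16

-- The power of 2 in 16k determines the exponent n = 8 · 2ʲ of the modulus. The odd part m is
-- recorded modulo 4 because its class selects the sign s for which (∓ i)ᵐ is the unit required by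
-- `up` and `down`.
dyadic : ∀ k → 0 ℕ.< k → ∃ λ j → ∃ λ m → ∃ λ t → (k ℕ.* 16 ≡ m ℕ.* 8·2^ (suc j)) × (m ≡ t ℕ.* 4 ℕ.+ 1 ⊎ m ≡ t ℕ.* 4 ℕ.+ 3)
dyadic = <-rec _ step
  where
  P : ℕ → Set
  P k = 0 ℕ.< k → ∃ λ j → ∃ λ m → ∃ λ t → (k ℕ.* 16 ≡ m ℕ.* 8·2^ (suc j)) × (m ≡ t ℕ.* 4 ℕ.+ 1 ⊎ m ≡ t ℕ.* 4 ℕ.+ 3)
  double : ∀ k → P k → 0 ℕ.< k → P (k ℕ.* 2)
  double k p 0<k _ = lift (p 0<k)
    where
    lift : (∃ λ j → ∃ λ m → ∃ λ t → (k ℕ.* 16 ≡ m ℕ.* 8·2^ (suc j)) × (m ≡ t ℕ.* 4 ℕ.+ 1 ⊎ m ≡ t ℕ.* 4 ℕ.+ 3)) →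
      ∃ λ j → ∃ λ m → ∃ λ t → (k ℕ.* 2 ℕ.* 16 ≡ m ℕ.* 8·2^ (suc j)) × (m ≡ t ℕ.* 4 ℕ.+ 1 ⊎ m ≡ t ℕ.* 4 ℕ.+ 3)
    lift (j , m , t , e , o) = suc j , m , t , trans (lem₁ k) (trans (cong (ℕ._* 2) e) (lem₂ m (8·2^ (suc j)))) , o
      where
      lem₁ : ∀ k → k ℕ.* 2 ℕ.* 16 ≡ k ℕ.* 16 ℕ.* 2
      lem₁ = ℕS.solve-∀
      lem₂ : ∀ m n → m ℕ.* n ℕ.* 2 ≡ m ℕ.* (n ℕ.+ n)
      lem₂ = ℕS.solve-∀
  step : ∀ k → (∀ {l} → l ℕ.< k → P l) → P k
  step k rec 0<k = by (k ℕ.% 4) (k ℕ./ 4) (ℕD.m%n<n k 4) (ℕD.m≡m%n+[m/n]*n k 4)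
    where
    by : ∀ ρ t → ρ ℕ.< 4 → k ≡ ρ ℕ.+ t ℕ.* 4 → ∃ λ j → ∃ λ m → ∃ λ t → (k ℕ.* 16 ≡ m ℕ.* 8·2^ (suc j)) × (m ≡ t ℕ.* 4 ℕ.+ 1 ⊎ m ≡ t ℕ.* 4 ℕ.+ 3)
    by 1 t _ e = 0 , k , t , refl , inj₁ (trans e (ℕₚ.+-comm 1 (t ℕ.* 4)))
    by 3 t _ e = 0 , k , t , refl , inj₂ (trans e (ℕₚ.+-comm 3 (t ℕ.* 4)))
    by 0 zero _ e = ⊥-elim (ℕₚ.<⇒≢ 0<k (sym e))
    by 0 (suc t) _ e = subst P (sym e′) (double (suc t ℕ.* 2) (rec (subst (suc t ℕ.* 2 ℕ.<_) (sym e′) (ℕₚ.m<m*n (suc t ℕ.* 2) 2 (s≤s (s≤s z≤n))))) (s≤s z≤n)) 0<k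
      where
      e′ : k ≡ suc t ℕ.* 2 ℕ.* 2
      e′ = trans e (lem t)
        where
        lem : ∀ t → (1 ℕ.+ t) ℕ.* 4 ≡ (1 ℕ.+ t) ℕ.* 2 ℕ.* 2
        lem = ℕS.solve-∀
    by 2 t _ e = subst P (sym e′) (double (suc (t ℕ.* 2)) (rec (subst (suc (t ℕ.* 2) ℕ.<_) (sym e′) (ℕₚ.m<m*n (suc (t ℕ.* 2)) 2 (s≤s (s≤s z≤n))))) (s≤s z≤n)) 0<k
      where
      e′ : k ≡ suc (t ℕ.* 2) ℕ.* 2
      e′ = trans e (lem t)
        where
        lem : ∀ t → 2 ℕ.+ t ℕ.* 4 ≡ (1 ℕ.+ t ℕ.* 2) ℕ.* 2
        lem = ℕS.solve-∀
    by (suc (suc (suc (suc _)))) t (s≤s (s≤s (s≤s (s≤s ())))) e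

private
  cube-or-fifth-power-fixed : (i : Fin 32) →
    ((toℕ i ℕ.^ 3) ℕ.% 32 ≡ toℕ i ⊎ (toℕ i ℕ.^ 5) ℕ.% 32 ≡ toℕ i) → toℕ i ℕ.% 2 ≡ 1 → toℕ i ℕ.% 8 ≡ 1 ⊎ toℕ i ℕ.% 8 ≡ 7
  cube-or-fifth-power-fixed = from-yes (Finₚ.all? {32} (λ i →
    ((((toℕ i ℕ.^ 3) ℕ.% 32) ℕ.≟ toℕ i) ⊎-dec (((toℕ i ℕ.^ 5) ℕ.% 32) ℕ.≟ toℕ i)) →-dec
    (((toℕ i ℕ.% 2) ℕ.≟ 1) →-dec (((toℕ i ℕ.% 8) ℕ.≟ 1) ⊎-dec ((toℕ i ℕ.% 8) ℕ.≟ 7)))))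

divisor-mod : ∀ {a b} d m → a ≈ b [ + d * + m ] → a ≈ b [ + m ]
divisor-mod {a} {b} d m (mod k e) = mod (k * + d) (trans e (cong (λ x → b + x) (sym (ℤₚ.*-assoc k (+ d) (+ m)))))

pos-^ : ∀ m e → (+ m) ^ e ≡ + (m ℕ.^ e)
pos-^ m zero    = refl
pos-^ m (suc e) = trans (cong (λ x → + m * x) (pos-^ m e)) (sym (ℤₚ.pos-* m (m ℕ.^ e)))

residue-≈ : ∀ a m .{{_ : ℕ.NonZero m}} → a ≈ + (a %ℕ m) [ + m ]
residue-≈ a m = mod (a /ℕ m) (a≡a%ℕn+[a/ℕn]*n a m)

-- Modulo 16 every odd u satisfies u⁵ ≡ u, so for the exponent 5 the modulus 32 is the first power
-- of 2 that carries information.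
fixed-mod-32 : ∀ u → Odd u → u ^ 3 ≈ u [ + 32 ] ⊎ u ^ 5 ≈ u [ + 32 ] → u ≈ + 1 [ + 8 ] ⊎ u ≈ + 7 [ + 8 ]
fixed-mod-32 u ou fixed = conclude (subst (λ x → x ℕ.% 8 ≡ 1 ⊎ x ℕ.% 8 ≡ 7) i≡ (cube-or-fifth-power-fixed i (hyps fixed) odd-i))
  where
  ρ = u %ℕ 32
  ρ<32 = n%ℕd<d u 32
  i = fromℕ< ρ<32
  i≡ : toℕ i ≡ ρ
  i≡ = Finₚ.toℕ-fromℕ< ρ<32
  u≈ρ : u ≈ + ρ [ + 32 ]
  u≈ρ = residue-≈ u 32
  power : ∀ e → u ^ e ≈ u [ + 32 ] → (toℕ i ℕ.^ e) ℕ.% 32 ≡ toℕ i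
  power e p = trans (cong (λ x → (x ℕ.^ e) ℕ.% 32) i≡) (trans (residue-cong (≈-trans (≡⇒≈ (sym (pos-^ ρ e))) (≈-trans (^-cong-≈ e (≈-sym u≈ρ)) (≈-trans p u≈ρ))))
    (trans (ℕD.m<n⇒m%n≡m ρ<32) (sym i≡)))
  hyps : u ^ 3 ≈ u [ + 32 ] ⊎ u ^ 5 ≈ u [ + 32 ] → (toℕ i ℕ.^ 3) ℕ.% 32 ≡ toℕ i ⊎ (toℕ i ℕ.^ 5) ℕ.% 32 ≡ toℕ i
  hyps (inj₁ p) = inj₁ (power 3 p)
  hyps (inj₂ p) = inj₂ (power 5 p)
  odd-i : toℕ i ℕ.% 2 ≡ 1
  odd-i = trans (cong (ℕ._% 2) i≡) (residue-cong {2} (≈-trans (≈-sym (divisor-mod 16 2 u≈ρ)) ou))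
  conclude : ρ ℕ.% 8 ≡ 1 ⊎ ρ ℕ.% 8 ≡ 7 → u ≈ + 1 [ + 8 ] ⊎ u ≈ + 7 [ + 8 ]
  conclude (inj₁ e) = inj₁ (≈-trans (divisor-mod 4 8 u≈ρ) (≈-trans (residue-≈ (+ ρ) 8) (≡⇒≈ (cong +_ e))))
  conclude (inj₂ e) = inj₂ (≈-trans (divisor-mod 4 8 u≈ρ) (≈-trans (residue-≈ (+ ρ) 8) (≡⇒≈ (cong +_ e))))

odd-eighth-power : ∀ {u} → Odd u → u ^ 8 ≈ + 1 [ + 32 ]
odd-eighth-power {u} ou = ≈-trans (≡⇒≈ (trans (^-+ u 4 4) (cong₂ _*_ (^-+ u 2 2) (^-+ u 2 2)))) (from-square (≈-trans (≡⇒≈ (cong (u *_) (ℤₚ.*-identityʳ u))) (odd-square ou)))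
  where
  from-square : ∀ {x} → x ≈ + 1 [ + 8 ] → (x * x) * (x * x) ≈ + 1 [ + 32 ]
  from-square {x} (mod k e) = mod (k + + 12 * (k * k) + + 64 * (k * (k * k)) + + 128 * (k * (k * (k * k)))) (trans (cong₂ _*_ (cong₂ _*_ e e) (cong₂ _*_ e e)) (lem k))
    where
    lem : ∀ k → ((+ 1 + k * + 8) * (+ 1 + k * + 8)) * ((+ 1 + k * + 8) * (+ 1 + k * + 8))
      ≡ + 1 + (k + + 12 * (k * k) + + 64 * (k * (k * k)) + + 128 * (k * (k * (k * k)))) * + 32
    lem = solve-∀

-- u + w = q is the linear factor of Re z^r ± Im z^r = q.
module _ (u w : ℤ) (q : ℕ) (u+w : u + w ≡ + q) (cuw : Coprimeᴿ u w) (ou : Odd u)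
  (r : ℕ) (crQ : Coprimeᴿ (+ r) (+ q)) (nonresidue : 𝕁 (+ q) (+ r) ≡ Sign.-) where

  private
    z = u +i w
    Q = + q

    4|32 : w ≈ + 0 [ + 32 ] → w ≈ + 0 [ + 4 ]
    4|32 = divisor-mod 8 4

  -- With 32 dividing w, both q = u + w ≡ u and q = E(zʳ) ≡ uʳ hold modulo 32, and u⁸ ≡ 1 reduces
  -- the exponent r to ρ.
  q-mod-8 : ∀ ε k ρ → ρ ≡ 3 ⊎ ρ ≡ 5 → r ≡ k ℕ.* 8 ℕ.+ ρ → w ≈ + 0 [ + 32 ] → E ε (z ^ᵍ r) ≡ Q → Q ≈ + 1 [ + 8 ] ⊎ Q ≈ + 7 [ + 8 ]
  q-mod-8 ε k ρ ρ≡ r≡ w32 hyp = transport (fixed-mod-32 u ou (fixed ρ≡ power))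
    where
    Q≈u : Q ≈ u [ + 32 ]
    Q≈u = ≈-trans (≡⇒≈ (sym u+w)) (≈-trans (+-cong-≈ (≈-refl {a = u}) w32) (≡⇒≈ (ℤₚ.+-identityʳ u)))
    transport : u ≈ + 1 [ + 8 ] ⊎ u ≈ + 7 [ + 8 ] → Q ≈ + 1 [ + 8 ] ⊎ Q ≈ + 7 [ + 8 ]
    transport (inj₁ e) = inj₁ (≈-trans (divisor-mod 4 8 Q≈u) e)
    transport (inj₂ e) = inj₂ (≈-trans (divisor-mod 4 8 Q≈u) e)
    z≈u : z G.≈ ι u [ ι (+ 32) ]
    z≈u = real-≈ w32
    power : u ^ ρ ≈ u [ + 32 ]
    power = ≈-trans (≈-sym (≈-trans (≡⇒≈ (trans (cong (u ^_) r≡) (trans (^-+ u (k ℕ.* 8) ρ) (cong (_* u ^ ρ) (^-* u k 8)))))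
        (≈-trans (*-congʳ-≈ (u ^ ρ) (≈-trans (^-cong-≈ k (odd-eighth-power ou)) (≡⇒≈ (1^ k)))) (≡⇒≈ (ℤₚ.*-identityˡ (u ^ ρ))))))
      (≈-trans (≈-sym (≈-trans (≡⇒≈ (sym hyp)) (≈-trans (E-≈ ε {z ^ᵍ r} {ι (u ^ r)} {+ 32} (G.≈-trans (G.^-cong-≈ r z≈u) (G.≡⇒≈ (ι-^ u r)))) (≡⇒≈ (E-ι ε (u ^ r)))))) Q≈u)
    fixed : ρ ≡ 3 ⊎ ρ ≡ 5 → u ^ ρ ≈ u [ + 32 ] → u ^ 3 ≈ u [ + 32 ] ⊎ u ^ 5 ≈ u [ + 32 ]
    fixed (inj₁ refl) p = inj₁ p
    fixed (inj₂ refl) p = inj₂ p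

  private
    seven : Q ≈ + 3 [ + 4 ] → Q ≈ + 1 [ + 8 ] ⊎ Q ≈ + 7 [ + 8 ] → Q ≈ + 7 [ + 8 ]
    seven _ (inj₂ e) = e
    seven Q≈3 (inj₁ e) = ⊥-elim (absurd (residue-cong {4} (≈-trans (≈-sym Q≈3) (8⇒4 e))))
      where
      absurd : 3 ≢ 1
      absurd ()

    three : Q ≈ + 7 [ + 8 ] → Q ≈ + 3 [ + 4 ]
    three e = ≈-trans (8⇒4 e) (mod (+ 1) refl)

  -- For r = 5 the guaranteed power 2^(r - 3) is only 4, so this case has to manage with 4 dividing
  -- w.
  no-solution-5[16] : ∀ k → r ≡ k ℕ.* 16 ℕ.+ 5 → w ≈ + 0 [ + 4 ] → E Sign.+ (z ^ᵍ r) ≡ Q → ⊥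
  no-solution-5[16] k r≡ w4 hyp = C.Modulus₂.case-5 k r r≡ hyp
    where
    lem : ∀ k → k ℕ.* 16 ℕ.+ 5 ≡ k ℕ.* 2 ℕ.* 8 ℕ.+ 5
    lem = ℕS.solve-∀
    module S = Signs.Case5 u w q u+w cuw ou w4 r crQ nonresidue (k ℕ.* 2) (trans r≡ (lem k)) hyp
    module C = Contradictions u w q u+w cuw ou w4 S.Q≈3 S.sign-V

  no-solution-11[16] : ∀ k → r ≡ k ℕ.* 16 ℕ.+ 11 → w ≈ + 0 [ + 32 ] → E Sign.- (z ^ᵍ r) ≡ Q → ⊥
  no-solution-11[16] k r≡ w32 hyp = C.Modulus₂.case-11 k r r≡ hyp S.𝕁2Q (𝕁-2-1[8] S.V≈1)
    where
    r≡′ : r ≡ (k ℕ.* 2 ℕ.+ 1) ℕ.* 8 ℕ.+ 3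
    r≡′ = trans r≡ (lem k)
      where
      lem : ∀ k → k ℕ.* 16 ℕ.+ 11 ≡ (k ℕ.* 2 ℕ.+ 1) ℕ.* 8 ℕ.+ 3
      lem = ℕS.solve-∀
    module S = Signs.Case3 u w q u+w cuw ou (4|32 w32) r crQ nonresidue (k ℕ.* 2 ℕ.+ 1) r≡′ hyp
      (q-mod-8 Sign.- (k ℕ.* 2 ℕ.+ 1) 3 (inj₁ refl) r≡′ w32 hyp)
    module C = Contradictions u w q u+w cuw ou (4|32 w32) (three S.Q≈7) S.sign-V

  -- Here r + 3 is a multiple of 16, so the exponent is approached from above. The class of r modulo
  -- 24 enters through z⁶ modulo M, which decides the sign of M.
  no-solution-13[16] : ∀ k → r ≡ k ℕ.* 16 ℕ.+ 13 → w ≈ + 0 [ + 32 ] → E Sign.+ (z ^ᵍ r) ≡ Q →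
    (∃ λ l → r ≡ l ℕ.* 24 ℕ.+ 5 ⊎ r ≡ l ℕ.* 24 ℕ.+ 13) → ⊥
  no-solution-13[16] k r≡ w32 hyp (l , mod24) = finish (dyadic (suc k) (s≤s z≤n))
    where
    r≡′ : r ≡ (k ℕ.* 2 ℕ.+ 1) ℕ.* 8 ℕ.+ 5
    r≡′ = trans r≡ (lem k)
      where
      lem : ∀ k → k ℕ.* 16 ℕ.+ 13 ≡ (k ℕ.* 2 ℕ.+ 1) ℕ.* 8 ℕ.+ 5
      lem = ℕS.solve-∀
    module S = Signs.Case5 u w q u+w cuw ou (4|32 w32) r crQ nonresidue (k ℕ.* 2 ℕ.+ 1) r≡′ hyp
    Q≈7 = seven S.Q≈3 (q-mod-8 Sign.+ (k ℕ.* 2 ℕ.+ 1) 5 (inj₂ refl) r≡′ w32 hyp)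
    module C = Contradictions u w q u+w cuw ou (4|32 w32) S.Q≈3 S.sign-V
    module C₃ = C.Modulus₃ Q≈7 (divisor-mod 4 8 w32)
    M>0 : sign (u * u + + 4 * (u * w) + w * w) ≡ Sign.+
    M>0 = by mod24
      where
      by : r ≡ l ℕ.* 24 ℕ.+ 5 ⊎ r ≡ l ℕ.* 24 ℕ.+ 13 → sign (u * u + + 4 * (u * w) + w * w) ≡ Sign.+
      by (inj₁ e) = C₃.sign-M-5 l r e hyp
      by (inj₂ e) = C₃.sign-M-13 l r e hyp
    3+r : 3 ℕ.+ r ≡ suc k ℕ.* 16
    3+r = trans (cong (3 ℕ.+_) r≡) (lem k)
      where
      lem : ∀ k → 3 ℕ.+ (k ℕ.* 16 ℕ.+ 13) ≡ (1 ℕ.+ k) ℕ.* 16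
      lem = ℕS.solve-∀
    finish : (∃ λ j → ∃ λ m → ∃ λ t → (suc k ℕ.* 16 ≡ m ℕ.* 8·2^ (suc j)) × (m ≡ t ℕ.* 4 ℕ.+ 1 ⊎ m ≡ t ℕ.* 4 ℕ.+ 3)) → ⊥
    finish (j , m , t , e , inj₁ m≡) = C₃.down M>0 Sign.+ j m r (trans (cong (𝕚⁻ ^ᵍ_) m≡) (J^4k+ 𝕚⁻ t 1 refl)) (trans 3+r e) hyp
    finish (j , m , t , e , inj₂ m≡) = C₃.down M>0 Sign.- j m r (trans (cong (𝕚 ^ᵍ_) m≡) (J^4k+ 𝕚 t 3 refl)) (trans 3+r e) hyp

  -- Here r - 3 is a multiple of 16. It must be positive to have an odd part, hence `suc k`; r = 3
  -- is treated by the cubic argument.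
  no-solution-3[16] : ∀ k → r ≡ suc k ℕ.* 16 ℕ.+ 3 → w ≈ + 0 [ + 32 ] → E Sign.- (z ^ᵍ r) ≡ Q →
    (∃ λ l → r ≡ l ℕ.* 24 ℕ.+ 11 ⊎ r ≡ l ℕ.* 24 ℕ.+ 19) → ⊥
  no-solution-3[16] k r≡ w32 hyp (l , mod24) = finish (dyadic (suc k) (s≤s z≤n))
    where
    r≡′ : r ≡ (suc k ℕ.* 2) ℕ.* 8 ℕ.+ 3
    r≡′ = trans r≡ (lem k)
      where
      lem : ∀ k → (1 ℕ.+ k) ℕ.* 16 ℕ.+ 3 ≡ ((1 ℕ.+ k) ℕ.* 2) ℕ.* 8 ℕ.+ 3
      lem = ℕS.solve-∀
    module S = Signs.Case3 u w q u+w cuw ou (4|32 w32) r crQ nonresidue (suc k ℕ.* 2) r≡′ hyp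
      (q-mod-8 Sign.- (suc k ℕ.* 2) 3 (inj₁ refl) r≡′ w32 hyp)
    module C = Contradictions u w q u+w cuw ou (4|32 w32) (three S.Q≈7) S.sign-V
    module C₃ = C.Modulus₃ S.Q≈7 (divisor-mod 4 8 w32)
    M>0 : sign (u * u + + 4 * (u * w) + w * w) ≡ Sign.+
    M>0 = by mod24
      where
      by : r ≡ l ℕ.* 24 ℕ.+ 11 ⊎ r ≡ l ℕ.* 24 ℕ.+ 19 → sign (u * u + + 4 * (u * w) + w * w) ≡ Sign.+
      by (inj₁ e) = C₃.sign-M-11 l r e hyp
      by (inj₂ e) = C₃.sign-M-19 l r e hyp
    finish : (∃ λ j → ∃ λ m → ∃ λ t → (suc k ℕ.* 16 ≡ m ℕ.* 8·2^ (suc j)) × (m ≡ t ℕ.* 4 ℕ.+ 1 ⊎ m ≡ t ℕ.* 4 ℕ.+ 3)) → ⊥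
    finish (j , m , t , e , inj₁ m≡) = C₃.up M>0 Sign.- j m r (trans (cong (𝕚 ^ᵍ_) m≡) (J^4k+ 𝕚 t 1 refl)) (trans r≡ (cong (ℕ._+ 3) e)) hyp
    finish (j , m , t , e , inj₂ m≡) = C₃.up M>0 Sign.+ j m r (trans (cong (𝕚⁻ ^ᵍ_) m≡) (J^4k+ 𝕚⁻ t 3 refl)) (trans r≡ (cong (ℕ._+ 3) e)) hyp

-- The quartic n² = X⁴ + 3X²Y² + 3Y⁴ and the curve Y² = X³ - 1

mod-3 : ∀ a → a ≈ + 0 [ + 3 ] ⊎ a ≈ + 1 [ + 3 ] ⊎ a ≈ + 2 [ + 3 ]
mod-3 a = by (a %ℕ 3) (n%ℕd<d a 3) (residue-≈ a 3)
  where
  by : ∀ r → r ℕ.< 3 → a ≈ + r [ + 3 ] → a ≈ + 0 [ + 3 ] ⊎ a ≈ + 1 [ + 3 ] ⊎ a ≈ + 2 [ + 3 ]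
  by 0 _ e = inj₁ e
  by 1 _ e = inj₂ (inj₁ e)
  by 2 _ e = inj₂ (inj₂ e)
  by (suc (suc (suc _))) (s≤s (s≤s (s≤s ()))) e

3-divides-product : ∀ a b → a * b ≈ + 0 [ + 3 ] → a ≈ + 0 [ + 3 ] ⊎ b ≈ + 0 [ + 3 ]
3-divides-product a b e = by (mod-3 a) (mod-3 b)
  where
  excluded : ∀ {i j} → (i ℕ.* j) ℕ.% 3 ≢ 0 → a ≈ + i [ + 3 ] → b ≈ + j [ + 3 ] → ⊥
  excluded {i} {j} ne p q = ≉ 3 ne (≈-trans (≡⇒≈ (ℤₚ.pos-* i j)) (≈-trans (≈-sym (*-cong-≈ p q)) e))
  by : a ≈ + 0 [ + 3 ] ⊎ a ≈ + 1 [ + 3 ] ⊎ a ≈ + 2 [ + 3 ] → b ≈ + 0 [ + 3 ] ⊎ b ≈ + 1 [ + 3 ] ⊎ b ≈ + 2 [ + 3 ] → a ≈ + 0 [ + 3 ] ⊎ b ≈ + 0 [ + 3 ]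
  by (inj₁ p) _ = inj₁ p
  by (inj₂ _) (inj₁ q) = inj₂ q
  by (inj₂ (inj₁ p)) (inj₂ (inj₁ q)) = ⊥-elim (excluded {1} {1} (λ ()) p q)
  by (inj₂ (inj₁ p)) (inj₂ (inj₂ q)) = ⊥-elim (excluded {1} {2} (λ ()) p q)
  by (inj₂ (inj₂ p)) (inj₂ (inj₁ q)) = ⊥-elim (excluded {2} {1} (λ ()) p q)
  by (inj₂ (inj₂ p)) (inj₂ (inj₂ q)) = ⊥-elim (excluded {2} {2} (λ ()) p q)

3-sum-of-squares : ∀ a b → a * a + b * b ≈ + 0 [ + 3 ] → (a ≈ + 0 [ + 3 ]) × (b ≈ + 0 [ + 3 ])
3-sum-of-squares a b e = by (mod-3 a) (mod-3 b)
  where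
  excluded : ∀ {i j} → (i ℕ.* i ℕ.+ j ℕ.* j) ℕ.% 3 ≢ 0 → a ≈ + i [ + 3 ] → b ≈ + j [ + 3 ] → ⊥
  excluded {i} {j} ne p q = ≉ 3 ne (≈-trans (≡⇒≈ (trans (ℤₚ.pos-+ (i ℕ.* i) (j ℕ.* j)) (cong₂ _+_ (ℤₚ.pos-* i i) (ℤₚ.pos-* j j))))
    (≈-trans (≈-sym (+-cong-≈ (*-cong-≈ p p) (*-cong-≈ q q))) e))
  by : a ≈ + 0 [ + 3 ] ⊎ a ≈ + 1 [ + 3 ] ⊎ a ≈ + 2 [ + 3 ] → b ≈ + 0 [ + 3 ] ⊎ b ≈ + 1 [ + 3 ] ⊎ b ≈ + 2 [ + 3 ] → (a ≈ + 0 [ + 3 ]) × (b ≈ + 0 [ + 3 ])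
  by (inj₁ p) (inj₁ q) = p , q
  by (inj₁ p) (inj₂ (inj₁ q)) = ⊥-elim (excluded {0} {1} (λ ()) p q)
  by (inj₁ p) (inj₂ (inj₂ q)) = ⊥-elim (excluded {0} {2} (λ ()) p q)
  by (inj₂ (inj₁ p)) (inj₁ q) = ⊥-elim (excluded {1} {0} (λ ()) p q)
  by (inj₂ (inj₁ p)) (inj₂ (inj₁ q)) = ⊥-elim (excluded {1} {1} (λ ()) p q)
  by (inj₂ (inj₁ p)) (inj₂ (inj₂ q)) = ⊥-elim (excluded {1} {2} (λ ()) p q)
  by (inj₂ (inj₂ p)) (inj₁ q) = ⊥-elim (excluded {2} {0} (λ ()) p q)
  by (inj₂ (inj₂ p)) (inj₂ (inj₁ q)) = ⊥-elim (excluded {2} {1} (λ ()) p q)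
  by (inj₂ (inj₂ p)) (inj₂ (inj₂ q)) = ⊥-elim (excluded {2} {2} (λ ()) p q)

coprime-not-both : ∀ {a b} N .{{_ : ℕ.NonZero N}} → 1 ℕ.% N ≢ 0 ℕ.% N → Coprimeᴿ a b → a ≈ + 0 [ + N ] → b ≈ + 0 [ + N ] → ⊥
coprime-not-both {a} {b} N ne (bez {s} {t} e) p q = ≉ N ne (≈-trans (≡⇒≈ (sym e)) (≈-trans (+-cong-≈ (*-congˡ-≈ s p) (*-congˡ-≈ t q))
  (≡⇒≈ (cong₂ _+_ (ℤₚ.*-zeroʳ s) (ℤₚ.*-zeroʳ t)))))

sum-of-squares-zero : ∀ a b → a * a + b * b ≡ + 0 → a ≡ + 0
sum-of-squares-zero a b e = cong re (normℕ≡0 {a +i b} (ℤₚ.+-injective (trans (sym (+normℕ (a +i b))) e)))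

definite-form-zero : ∀ a b c → a * a + b * b + + 3 * (c * c) ≡ + 0 → (a ≡ + 0) × (c ≡ + 0)
definite-form-zero a b c e = cong re (normℕ≡0 {a +i b} (proj₁ zeros)) , cong im (normℕ≡0 {+ 0 +i c} (three (proj₂ zeros)))
  where
  zeros : (normℕ (a +i b) ≡ 0) × (3 ℕ.* (∣ c ∣ ℕ.* ∣ c ∣) ≡ 0)
  zeros = sum-zero (ℤₚ.+-injective (trans (ℤₚ.pos-+ (normℕ (a +i b)) (3 ℕ.* (∣ c ∣ ℕ.* ∣ c ∣)))
    (trans (cong₂ _+_ (sym (+normℕ (a +i b))) (trans (ℤₚ.pos-* 3 (∣ c ∣ ℕ.* ∣ c ∣)) (cong (λ x → + 3 * x) (sym (square-abs c))))) e)))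
  three : 3 ℕ.* (∣ c ∣ ℕ.* ∣ c ∣) ≡ 0 → ∣ c ∣ ℕ.* ∣ c ∣ ≡ 0
  three z = proj₁ (sum-zero z)

product-zero : ∀ a b → a * b ≡ + 0 → a ≡ + 0 ⊎ b ≡ + 0
product-zero a b = ℤₚ.i*j≡0⇒i≡0∨j≡0 a

square-zero : ∀ a → a * a ≡ + 0 → a ≡ + 0
square-zero a e = reduce (product-zero a a e)

ℕ-square-injective : ∀ m n → m ℕ.* m ≡ n ℕ.* n → m ≡ n
ℕ-square-injective m n e = ℕₚ.≤-antisym (le m n e) (le n m (sym e))
  where
  le : ∀ m n → m ℕ.* m ≡ n ℕ.* n → m ℕ.≤ n
  le m n e = ℕₚ.≮⇒≥ (λ n<m → ℕₚ.<⇒≢ (ℕₚ.*-mono-< n<m n<m) (sym e))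

equal-squares : ∀ a b → a * a ≡ b * b → ∣ a ∣ ≡ ∣ b ∣
equal-squares a b e = ℕ-square-injective ∣ a ∣ ∣ b ∣ (ℤₚ.+-injective (trans (sym (square-abs a)) (trans e (square-abs b))))

abs-square : ∀ a b → ∣ a ∣ ≡ ∣ b ∣ → a * a ≡ b * b
abs-square a b e = trans (square-abs a) (trans (cong (λ n → + (n ℕ.* n)) e) (sym (square-abs b)))

private
  fourth : ∀ s → s ^ 4 ≡ (s * s) * (s * s)
  fourth = lem
    where
    lem : ∀ s → s * (s * (s * (s * + 1))) ≡ (s * s) * (s * s)
    lem = solve-∀

-- Coprimality makes each factor a fourth power up to sign, and the signs agree because the product
-- y⁴ is positive.
fourth-power-factors : ∀ P Q y → Coprimeᴿ P Q → P * Q ≡ (y * y) * (y * y) → y ≢ + 0 →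
  ∃ λ s → ∃ λ t → (∣ y ∣ ≡ ∣ s * t ∣) ×
    ((P ≡ (s * s) * (s * s)) × (Q ≡ (t * t) * (t * t)) ⊎ (P ≡ - ((s * s) * (s * s))) × (Q ≡ - ((t * t) * (t * t))))
fourth-power-factors P Q y c e y≢0 = by (coprime-product-power {P} {Q} {y} 3 P≢0 c (trans e (sym (fourth y))))
    (coprime-product-power {Q} {P} {y} 3 Q≢0 (Coprime-sym {P} {Q} c) (trans (ℤₚ.*-comm Q P) (trans e (sym (fourth y)))))
  where
  y⁴≢0 : (y * y) * (y * y) ≢ + 0
  y⁴≢0 z = y≢0 (square-zero y (square-zero (y * y) z))
  P≢0 : P ≢ + 0
  P≢0 z = y⁴≢0 (trans (sym e) (trans (cong (_* Q) z) (ℤₚ.*-zeroˡ Q)))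
  Q≢0 : Q ≢ + 0
  Q≢0 z = y⁴≢0 (trans (sym e) (trans (cong (P *_) z) (ℤₚ.*-zeroʳ P)))
  Goal = ∃ λ s → ∃ λ t → (∣ y ∣ ≡ ∣ s * t ∣) ×
    ((P ≡ (s * s) * (s * s)) × (Q ≡ (t * t) * (t * t)) ⊎ (P ≡ - ((s * s) * (s * s))) × (Q ≡ - ((t * t) * (t * t))))
  same : ∀ s t → (y * y) * (y * y) ≡ (s * s) * (s * s) * ((t * t) * (t * t)) → ∣ y ∣ ≡ ∣ s * t ∣
  same s t q = by-sign (equal-abs (equal-squares (y * y) ((s * t) * (s * t)) (trans q (lem s t))))
    where
    lem : ∀ s t → (s * s) * (s * s) * ((t * t) * (t * t)) ≡ ((s * t) * (s * t)) * ((s * t) * (s * t))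
    lem = solve-∀
    by-sign : y * y ≡ (s * t) * (s * t) ⊎ y * y ≡ - ((s * t) * (s * t)) → ∣ y ∣ ≡ ∣ s * t ∣
    by-sign (inj₁ p) = equal-squares y (s * t) p
    by-sign (inj₂ p) = ⊥-elim (y≢0 (sum-of-squares-zero y (s * t) (trans (cong (_+ (s * t) * (s * t)) p) (ℤₚ.+-inverseˡ ((s * t) * (s * t))))))
  opposite : ∀ s t → (y * y) * (y * y) ≡ - ((s * s) * (s * s) * ((t * t) * (t * t))) → ⊥
  opposite s t q = y⁴≢0 (trans (cong ((y * y) *_) (sum-of-squares-zero (y * y) ((s * t) * (s * t)) (trans (cong (_+ ((s * t) * (s * t)) * ((s * t) * (s * t))) q) (lem s t)))) (ℤₚ.*-zeroʳ (y * y)))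
    where
    lem : ∀ s t → - ((s * s) * (s * s) * ((t * t) * (t * t))) + ((s * t) * (s * t)) * ((s * t) * (s * t)) ≡ + 0
    lem = solve-∀
  by : (∃ λ s → P ≡ s ^ 4 ⊎ P ≡ - (s ^ 4)) → (∃ λ t → Q ≡ t ^ 4 ⊎ Q ≡ - (t ^ 4)) → Goal
  by (s , inj₁ p) (t , inj₁ q) = s , t , same s t (trans (sym e) (cong₂ _*_ p′ q′)) , inj₁ (p′ , q′)
    where
    p′ = trans p (fourth s)
    q′ = trans q (fourth t)
  by (s , inj₂ p) (t , inj₂ q) = s , t , same s t (trans (sym e) (trans (cong₂ _*_ p′ q′) (lem ((s * s) * (s * s)) ((t * t) * (t * t))))) , inj₂ (p′ , q′)
    where
    p′ = trans p (cong -_ (fourth s))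
    q′ = trans q (cong -_ (fourth t))
    lem : ∀ a b → - a * - b ≡ a * b
    lem = solve-∀
  by (s , inj₁ p) (t , inj₂ q) = ⊥-elim (opposite s t (trans (sym e) (trans (cong₂ _*_ (trans p (fourth s)) (trans q (cong -_ (fourth t)))) (lem ((s * s) * (s * s)) ((t * t) * (t * t))))))
    where
    lem : ∀ a b → a * - b ≡ - (a * b)
    lem = solve-∀
  by (s , inj₂ p) (t , inj₁ q) = ⊥-elim (opposite s t (trans (sym e) (trans (cong₂ _*_ (trans p (cong -_ (fourth s))) (trans q (fourth t))) (lem ((s * s) * (s * s)) ((t * t) * (t * t))))))
    where
    lem : ∀ a b → - a * b ≡ - (a * b)
    lem = solve-∀

-- Up to exchanging (P, Q) with (−Q, −P), 3 divides P.
three-times-fourth-power : ∀ P Q y D → P * Q ≡ + 3 * ((y * y) * (y * y)) → Q - P ≡ D → Coprimeᴿ D y → y ≢ + 0 →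
  ∃ λ s → ∃ λ t → (∣ y ∣ ≡ ∣ s * t ∣) × Coprimeᴿ s t ×
    ((D ≡ (t * t) * (t * t) - + 3 * ((s * s) * (s * s))) × (P + Q ≡ (t * t) * (t * t) + + 3 * ((s * s) * (s * s)) ⊎ P + Q ≡ - ((t * t) * (t * t) + + 3 * ((s * s) * (s * s))))
    ⊎ (D ≡ + 3 * ((s * s) * (s * s)) - (t * t) * (t * t)) × (P + Q ≡ (t * t) * (t * t) + + 3 * ((s * s) * (s * s)) ⊎ P + Q ≡ - ((t * t) * (t * t) + + 3 * ((s * s) * (s * s)))))
three-times-fourth-power P Q y D e d c y≢0 = by (3-divides-product P Q (mod ((y * y) * (y * y)) (trans e (trans (ℤₚ.*-comm (+ 3) ((y * y) * (y * y))) (sym (ℤₚ.+-identityˡ _))))))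
  where
  y⁴ = (y * y) * (y * y)
  Sum : ℤ → ℤ → ℤ → ℤ → Set
  Sum P Q s t = P + Q ≡ (t * t) * (t * t) + + 3 * ((s * s) * (s * s)) ⊎ P + Q ≡ - ((t * t) * (t * t) + + 3 * ((s * s) * (s * s)))
  Goal : ℤ → ℤ → Set
  Goal P Q = ∃ λ s → ∃ λ t → (∣ y ∣ ≡ ∣ s * t ∣) × Coprimeᴿ s t ×
    ((D ≡ (t * t) * (t * t) - + 3 * ((s * s) * (s * s))) × Sum P Q s t ⊎ (D ≡ + 3 * ((s * s) * (s * s)) - (t * t) * (t * t)) × Sum P Q s t)
  coprime-factors : ∀ P₂ Q → P₂ * Q ≡ y⁴ → Q - + 3 * P₂ ≡ D → Coprimeᴿ P₂ Q
  coprime-factors P₂ Q e d = from-bezout (Coprime-sym {y⁴} {D} (Coprime-*ˡ {y * y} {y * y} {D} (Coprime-*ˡ {y} {y} {D} c′ c′) (Coprime-*ˡ {y} {y} {D} c′ c′)))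
    where
    c′ = Coprime-sym {D} {y} c
    from-bezout : Coprimeᴿ D y⁴ → Coprimeᴿ P₂ Q
    from-bezout (bez {s} {t} b) = bez {s = - (+ 3) * s + t * Q} {t = s} (trans (lem s t P₂ Q) (trans (cong₂ (λ x y → s * x + t * y) d e) b))
      where
      lem : ∀ s t P Q → (- (+ 3) * s + t * Q) * P + s * Q ≡ s * (Q - + 3 * P) + t * (P * Q)
      lem = solve-∀
  fourth-coprime : ∀ s t → Coprimeᴿ ((s * s) * (s * s)) ((t * t) * (t * t)) → Coprimeᴿ s t
  fourth-coprime s t c = Coprime-sym {t} {s} (Coprime-∣ˡ {t} {(t * t) * (t * t)} {s} (div ((t * t) * t) (l t))
    (Coprime-sym {s} {(t * t) * (t * t)} (Coprime-∣ˡ {s} {(s * s) * (s * s)} {(t * t) * (t * t)} (div ((s * s) * s) (l s)) c)))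
    where
    l : ∀ s → (s * s) * (s * s) ≡ (s * s) * s * s
    l = solve-∀
  core : ∀ P₂ Q → P₂ * Q ≡ y⁴ → Q - + 3 * P₂ ≡ D → Goal (+ 3 * P₂) Q
  core P₂ Q e d = from (fourth-power-factors P₂ Q y cPQ e y≢0)
    where
    cPQ = coprime-factors P₂ Q e d
    from : (∃ λ s → ∃ λ t → (∣ y ∣ ≡ ∣ s * t ∣) ×
      ((P₂ ≡ (s * s) * (s * s)) × (Q ≡ (t * t) * (t * t)) ⊎ (P₂ ≡ - ((s * s) * (s * s))) × (Q ≡ - ((t * t) * (t * t))))) → Goal (+ 3 * P₂) Q
    from (s , t , ay , inj₁ (p , q)) = s , t , ay , fourth-coprime s t (subst₂ Coprimeᴿ p q cPQ) ,
      inj₁ (trans (sym d) (cong₂ (λ x y → x - + 3 * y) q p) , inj₁ (trans (cong₂ (λ x y → + 3 * x + y) p q) (ℤₚ.+-comm (+ 3 * ((s * s) * (s * s))) ((t * t) * (t * t)))))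
    from (s , t , ay , inj₂ (p , q)) = s , t , ay , fourth-coprime s t (subst₂ Coprimeᴿ (trans (cong -_ p) (ℤₚ.neg-involutive _)) (trans (cong -_ q) (ℤₚ.neg-involutive _))
        (coprime-neg {P₂} { - Q} (coprime-neg-mod {P₂} {Q} cPQ))) ,
      inj₂ (trans (sym d) (trans (cong₂ (λ x y → x - + 3 * y) q p) (l₁ ((s * s) * (s * s)) ((t * t) * (t * t)))) ,
        inj₂ (trans (cong₂ (λ x y → + 3 * x + y) p q) (l₂ ((s * s) * (s * s)) ((t * t) * (t * t)))))
      where
      l₁ : ∀ a b → - b - + 3 * - a ≡ + 3 * a - b
      l₁ = solve-∀
      l₂ : ∀ a b → + 3 * - a + - b ≡ - (b + + 3 * a)
      l₂ = solve-∀
  cancel3 : ∀ x → + 3 * x ≡ + 3 * y⁴ → x ≡ y⁴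
  cancel3 x = ℤₚ.*-cancelˡ-≡ (+ 3) x y⁴
  by : P ≈ + 0 [ + 3 ] ⊎ Q ≈ + 0 [ + 3 ] → Goal P Q
  by (inj₁ (mod k p)) = subst (λ x → Goal x Q) (sym P≡) (core k Q (cancel3 (k * Q) (trans (sym (trans (cong (_* Q) P≡) (ℤₚ.*-assoc (+ 3) k Q))) e)) (trans (cong (λ x → Q - x) (sym P≡)) d))
    where
    P≡ : P ≡ + 3 * k
    P≡ = trans p (trans (ℤₚ.+-identityˡ (k * + 3)) (ℤₚ.*-comm k (+ 3)))
  by (inj₂ (mod k q)) = flip (core (- k) (- P) (cancel3 (- k * - P) (trans (l₁ k P) (trans (cong (P *_) (sym Q≡)) e))) (trans (l₂ k P) (trans (cong (λ x → x - P) (sym Q≡)) d)))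
    where
    Q≡ : Q ≡ + 3 * k
    Q≡ = trans q (trans (ℤₚ.+-identityˡ (k * + 3)) (ℤₚ.*-comm k (+ 3)))
    l₁ : ∀ k P → + 3 * (- k * - P) ≡ P * (+ 3 * k)
    l₁ = solve-∀
    l₂ : ∀ k P → - P - + 3 * - k ≡ + 3 * k - P
    l₂ = solve-∀
    l₃ : ∀ k P → P + + 3 * k ≡ - (+ 3 * - k + - P)
    l₃ = solve-∀
    negate : ∀ {s t} → Sum (+ 3 * - k) (- P) s t → Sum P Q s t
    negate (inj₁ x) = inj₂ (trans (cong (λ x → P + x) Q≡) (trans (l₃ k P) (cong -_ x)))
    negate (inj₂ x) = inj₁ (trans (cong (λ x → P + x) Q≡) (trans (l₃ k P) (trans (cong -_ x) (ℤₚ.neg-involutive _))))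
    flip : Goal (+ 3 * - k) (- P) → Goal P Q
    flip (s , t , ay , c , inj₁ (x , y)) = s , t , ay , c , inj₁ (x , negate {s} {t} y)
    flip (s , t , ay , c , inj₂ (x , y)) = s , t , ay , c , inj₂ (x , negate {s} {t} y)

private
  -- For odd Y the right-hand side is 3 modulo 4, whatever the parity of X.
  not-both-squares : ∀ {X Y n} → n * n ≡ X * X * (X * X) + + 3 * (X * X * (Y * Y)) + + 3 * (Y * Y * (Y * Y)) → Odd Y → ⊥
  not-both-squares {X} {Y} {n} e oY = by (parity X) (parity n)
    where
    Y² : Y * Y ≈ + 1 [ + 4 ]
    Y² = 8⇒4 (odd-square oY)
    even-square : ∀ {a} → a ≈ + 0 [ + 2 ] → a * a ≈ + 0 [ + 4 ]
    even-square (mod k refl) = mod (k * k) (lem k)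
      where
      lem : ∀ k → (+ 0 + k * + 2) * (+ 0 + k * + 2) ≡ + 0 + k * k * + 4
      lem = solve-∀
    value : ∀ {i} → X * X ≈ i [ + 4 ] → n * n ≈ i * i + + 3 * (i * + 1) + + 3 * (+ 1 * + 1) [ + 4 ]
    value p = ≈-trans (≡⇒≈ e) (+-cong-≈ (+-cong-≈ (*-cong-≈ p p) (*-congˡ-≈ (+ 3) (*-cong-≈ p Y²))) (*-congˡ-≈ (+ 3) (*-cong-≈ Y² Y²)))
    by : X ≈ + 0 [ + 2 ] ⊎ Odd X → n ≈ + 0 [ + 2 ] ⊎ Odd n → ⊥
    by (inj₁ x) (inj₁ y) = ≉ {3} {0} 4 (λ ()) (≈-trans (≈-sym (value (even-square x))) (even-square y))
    by (inj₁ x) (inj₂ y) = ≉ {3} {1} 4 (λ ()) (≈-trans (≈-sym (value (even-square x))) (8⇒4 (odd-square y)))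
    by (inj₂ x) (inj₁ y) = ≉ {7} {0} 4 (λ ()) (≈-trans (≈-sym (value (8⇒4 (odd-square x)))) (even-square y))
    by (inj₂ x) (inj₂ y) = ≉ {7} {1} 4 (λ ()) (≈-trans (≈-sym (value (8⇒4 (odd-square x)))) (8⇒4 (odd-square y)))

  Quartic : ℤ → ℤ → ℤ → Set
  Quartic X Y n = n * n ≡ X * X * (X * X) + + 3 * (X * X * (Y * Y)) + + 3 * (Y * Y * (Y * Y))

  squares-product : ∀ y s t → ∣ y ∣ ≡ ∣ s * t ∣ → y * y ≡ (s * s) * (t * t)
  squares-product y s t e = trans (abs-square y (s * t) e) (lem s t)
    where
    lem : ∀ s t → s * t * (s * t) ≡ (s * s) * (t * t)
    lem = solve-∀

  -- With T = t² − 3s² the hypothesis reads T² − X² = 12 s⁴.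
  second-descent : ∀ X s t → X * X + + 6 * ((s * s) * (t * t)) ≡ (t * t) * (t * t) - + 3 * ((s * s) * (s * s)) →
    Odd X → Coprimeᴿ X s → s ≢ + 0 →
    ∃ λ e → ∃ λ f → (∣ s ∣ ≡ ∣ e * f ∣) × Coprimeᴿ e f × Quartic f e t
  second-descent X s t eq oX c s≢0 = by (parity T)
    where
    T = t * t - + 3 * (s * s)
    T² : T * T ≡ X * X + + 12 * ((s * s) * (s * s))
    T² = trans (lem s t) (trans (cong (λ x → x - + 6 * ((s * s) * (t * t)) + + 12 * ((s * s) * (s * s))) (sym eq)) (lem₂ X s t))
      where
      lem : ∀ s t → (t * t - + 3 * (s * s)) * (t * t - + 3 * (s * s)) ≡ ((t * t) * (t * t) - + 3 * ((s * s) * (s * s))) - + 6 * ((s * s) * (t * t)) + + 12 * ((s * s) * (s * s))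
      lem = solve-∀
      lem₂ : ∀ X s t → X * X + + 6 * ((s * s) * (t * t)) - + 6 * ((s * s) * (t * t)) + + 12 * ((s * s) * (s * s)) ≡ X * X + + 12 * ((s * s) * (s * s))
      lem₂ = solve-∀
    Goal = ∃ λ e → ∃ λ f → (∣ s ∣ ≡ ∣ e * f ∣) × Coprimeᴿ e f × Quartic f e t
    odd-T : Odd T → Goal
    odd-T (mod i eT) = halves oX
      where
      halves : Odd X → Goal
      -- The factors are (T - X)/2 and (T + X)/2, with T = 1 + 2i and X = 1 + 2j.
      halves (mod j eX) = from (three-times-fourth-power (i - j) (+ 1 + i + j) s X product difference c s≢0)
        where
        product : (i - j) * (+ 1 + i + j) ≡ + 3 * ((s * s) * (s * s))
        product = ℤₚ.*-cancelˡ-≡ (+ 4) ((i - j) * (+ 1 + i + j)) (+ 3 * ((s * s) * (s * s))) (trans (l₁ i j)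
          (trans (cong₂ (λ a b → a * a - b * b) (sym eT) (sym eX)) (trans (cong (λ a → a - X * X) T²) (l₂ X ((s * s) * (s * s))))))
          where
          l₁ : ∀ i j → + 4 * ((i - j) * (+ 1 + i + j)) ≡ (+ 1 + i * + 2) * (+ 1 + i * + 2) - (+ 1 + j * + 2) * (+ 1 + j * + 2)
          l₁ = solve-∀
          l₂ : ∀ X a → X * X + + 12 * a - X * X ≡ + 4 * (+ 3 * a)
          l₂ = solve-∀
        difference : (+ 1 + i + j) - (i - j) ≡ X
        difference = trans (l i j) (sym eX)
          where
          l : ∀ i j → (+ 1 + i + j) - (i - j) ≡ + 1 + j * + 2
          l = solve-∀
        sum≡T : (i - j) + (+ 1 + i + j) ≡ T
        sum≡T = trans (l i j) (sym eT)
          where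
          l : ∀ i j → (i - j) + (+ 1 + i + j) ≡ + 1 + i * + 2
          l = solve-∀
        Sum : ℤ → ℤ → Set
        Sum e f = (i - j) + (+ 1 + i + j) ≡ (f * f) * (f * f) + + 3 * ((e * e) * (e * e)) ⊎ (i - j) + (+ 1 + i + j) ≡ - ((f * f) * (f * f) + + 3 * ((e * e) * (e * e)))
        build : ∀ e f → ∣ s ∣ ≡ ∣ e * f ∣ → Sum e f → Quartic f e t
        build e f as (inj₁ p) = trans (l₁ t (s * s)) (trans (cong₂ (λ a b → a + + 3 * b) (trans (sym sum≡T) p) (squares-product s e f as)) (l₂ e f))
          where
          l₁ : ∀ t S → t * t ≡ (t * t - + 3 * S) + + 3 * S
          l₁ = solve-∀
          l₂ : ∀ e f → (f * f) * (f * f) + + 3 * ((e * e) * (e * e)) + + 3 * ((e * e) * (f * f)) ≡ f * f * (f * f) + + 3 * (f * f * (e * e)) + + 3 * (e * e * (e * e))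
          l₂ = solve-∀
        -- The other sign makes t² + f⁴ - 3e²f² + 3e⁴ vanish, and four times this is (2t)² + (2f² -
        -- 3e²)² + 3e⁴. So e = 0, and s = ± ef = 0.
        build e f as (inj₂ p) = ⊥-elim (s≢0 s≡0)
          where
          t² : t * t ≡ - ((f * f) * (f * f) + + 3 * ((e * e) * (e * e))) + + 3 * ((e * e) * (f * f))
          t² = trans (l t (s * s)) (cong₂ (λ a b → a + + 3 * b) (trans (sym sum≡T) p) (squares-product s e f as))
            where
            l : ∀ t S → t * t ≡ (t * t - + 3 * S) + + 3 * S
            l = solve-∀
          e≡0 : e ≡ + 0
          e≡0 = square-zero e (proj₂ (definite-form-zero (+ 2 * t) (+ 2 * (f * f) - + 3 * (e * e)) (e * e)
            (trans (l₁ e f t) (trans (cong (λ a → + 4 * (a + (f * f) * (f * f) - + 3 * ((e * e) * (f * f)) + + 3 * ((e * e) * (e * e)))) t²) (l₂ (e * e) (f * f))))))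
            where
            l₁ : ∀ e f t → (+ 2 * t) * (+ 2 * t) + (+ 2 * (f * f) - + 3 * (e * e)) * (+ 2 * (f * f) - + 3 * (e * e)) + + 3 * ((e * e) * (e * e))
              ≡ + 4 * (t * t + (f * f) * (f * f) - + 3 * ((e * e) * (f * f)) + + 3 * ((e * e) * (e * e)))
            l₁ = solve-∀
            l₂ : ∀ x y → + 4 * ((- (y * y + + 3 * (x * x)) + + 3 * (x * y)) + y * y - + 3 * (x * y) + + 3 * (x * x)) ≡ + 0
            l₂ = solve-∀
          s≡0 : s ≡ + 0
          s≡0 = ℤₚ.∣i∣≡0⇒i≡0 (trans as (cong ∣_∣ (trans (cong (_* f) e≡0) (ℤₚ.*-zeroˡ f))))
        from : _ → Goal
        from (e , f , as , cef , inj₁ (_ , σ)) = e , f , as , cef , build e f as σ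
        from (e , f , as , cef , inj₂ (_ , σ)) = e , f , as , cef , build e f as σ
    by : T ≈ + 0 [ + 2 ] ⊎ Odd T → Goal
    by (inj₂ o) = odd-T o
    by (inj₁ (mod i eT)) = ⊥-elim (odd-square-not-even oX)
      where
      odd-square-not-even : Odd X → ⊥
      odd-square-not-even o = ≉ {1} {0} 2 (λ ()) (≈-trans (≈-sym (4⇒2 (8⇒4 (odd-square o)))) (mod (+ 2 * (i * i) - + 6 * ((s * s) * (s * s))) (trans (l₁ (X * X) ((s * s) * (s * s))) (trans (cong (λ a → a - + 12 * ((s * s) * (s * s))) (trans (sym T²) (cong₂ _*_ eT eT))) (l₂ i ((s * s) * (s * s)))))))
        where
        l₁ : ∀ x a → x ≡ (x + + 12 * a) - + 12 * a
        l₁ = solve-∀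
        l₂ : ∀ i a → (+ 0 + i * + 2) * (+ 0 + i * + 2) - + 12 * a ≡ + 0 + (+ 2 * (i * i) - + 6 * a) * + 2
        l₂ = solve-∀

  -- (n − X² − 6y²) (n + X² + 6y²) = 12 y⁴
  first-descent : ∀ X y n → n * n ≡ X * X * (X * X) + + 12 * (X * X * (y * y)) + + 48 * (y * y * (y * y)) → Odd X → Coprimeᴿ X y → y ≢ + 0 →
    ∃ λ s → ∃ λ t → (∣ y ∣ ≡ ∣ s * t ∣) × X * X + + 6 * ((s * s) * (t * t)) ≡ (t * t) * (t * t) - + 3 * ((s * s) * (s * s))
  first-descent X y n eq oX c y≢0 = halves (8⇒4 (odd-square oX)) (parity n)
    where
    Goal = ∃ λ s → ∃ λ t → (∣ y ∣ ≡ ∣ s * t ∣) × X * X + + 6 * ((s * s) * (t * t)) ≡ (t * t) * (t * t) - + 3 * ((s * s) * (s * s))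
    D = X * X + + 6 * (y * y)
    cD : Coprimeᴿ D y
    cD = Coprime-≈ {D} {X * X} {y} (mod (+ 6 * y) (cong (λ x → X * X + x) (sym (ℤₚ.*-assoc (+ 6) y y)))) (Coprime-*ˡ {X} {X} {y} c c)
    halves : X * X ≈ + 1 [ + 4 ] → n ≈ + 0 [ + 2 ] ⊎ Odd n → Goal
    halves (mod j eX) (inj₁ (mod i en)) = ⊥-elim (≉ {1} {0} 2 (λ ()) (≈-trans (≈-sym X⁴≈1) X⁴≈0))
      where
      X⁴≈1 : X * X * (X * X) ≈ + 1 [ + 2 ]
      X⁴≈1 = 4⇒2 (*-cong-≈ (8⇒4 (odd-square oX)) (8⇒4 (odd-square oX)))
      X⁴≈0 : X * X * (X * X) ≈ + 0 [ + 2 ]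
      X⁴≈0 = mod (+ 2 * (i * i) - + 6 * (X * X * (y * y)) - + 24 * (y * y * (y * y))) (trans (l₁ (X * X * (X * X)) (X * X * (y * y)) (y * y * (y * y)))
        (trans (cong (λ x → x - + 12 * (X * X * (y * y)) - + 48 * (y * y * (y * y))) (trans (sym eq) (cong₂ _*_ en en))) (l₂ i (X * X * (y * y)) (y * y * (y * y)))))
        where
        l₁ : ∀ a b c → a ≡ (a + + 12 * b + + 48 * c) - + 12 * b - + 48 * c
        l₁ = solve-∀
        l₂ : ∀ i b c → (+ 0 + i * + 2) * (+ 0 + i * + 2) - + 12 * b - + 48 * c ≡ + 0 + (+ 2 * (i * i) - + 6 * b - + 24 * c) * + 2
        l₂ = solve-∀
    halves (mod j eX) (inj₂ (mod i en)) = from (three-times-fourth-power P Q y D product difference cD y≢0)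
      where
      -- P and Q are (n ∓ (X² + 6y²))/2, where n = 1 + 2i and X² = 1 + 4j.
      P = i - + 2 * j - + 3 * (y * y)
      Q = i + + 1 + + 2 * j + + 3 * (y * y)
      product : P * Q ≡ + 3 * ((y * y) * (y * y))
      product = ℤₚ.*-cancelˡ-≡ (+ 4) (P * Q) (+ 3 * ((y * y) * (y * y))) (trans (l₁ i j (y * y)) (trans (cong₂ (λ a b → a * a - (b + + 6 * (y * y)) * (b + + 6 * (y * y))) (sym en) (sym eX))
        (trans (cong (λ a → a - (X * X + + 6 * (y * y)) * (X * X + + 6 * (y * y))) eq) (l₂ (X * X) (y * y)))))
        where
        l₁ : ∀ i j Y → + 4 * ((i - + 2 * j - + 3 * Y) * (i + + 1 + + 2 * j + + 3 * Y)) ≡ (+ 1 + i * + 2) * (+ 1 + i * + 2) - ((+ 1 + j * + 4) + + 6 * Y) * ((+ 1 + j * + 4) + + 6 * Y)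
        l₁ = solve-∀
        l₂ : ∀ x Y → (x * x + + 12 * (x * Y) + + 48 * (Y * Y)) - (x + + 6 * Y) * (x + + 6 * Y) ≡ + 4 * (+ 3 * (Y * Y))
        l₂ = solve-∀
      difference : Q - P ≡ D
      difference = trans (l i j (y * y)) (cong (λ x → x + + 6 * (y * y)) (sym eX))
        where
        l : ∀ i j Y → (i + + 1 + + 2 * j + + 3 * Y) - (i - + 2 * j - + 3 * Y) ≡ (+ 1 + j * + 4) + + 6 * Y
        l = solve-∀
      from : _ → Goal
      from (s , t , ay , _ , inj₁ (d , _)) = s , t , ay , trans (cong (λ x → X * X + + 6 * x) (sym (squares-product y s t ay))) d
      -- The other sign gives X² + t⁴ ≡ 0 (mod 3). Then 3 divides both X and t, contrary to the
      -- coprimality of X and y = ± st.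
      from (s , t , ay , _ , inj₂ (d , _)) = ⊥-elim (coprime-not-both {X} {(s * s) * (t * t)} 3 (λ ()) cst X≈0 st≈0)
        where
        cst : Coprimeᴿ X ((s * s) * (t * t))
        cst = subst (Coprimeᴿ X) (squares-product y s t ay) (Coprime-*ʳ {y} {y} {X} c c)
        both = 3-sum-of-squares X (t * t) (mod ((s * s) * (s * s) - + 2 * (y * y)) (trans (l₁ (X * X) (y * y) ((t * t) * (t * t)))
          (trans (cong (λ x → x - + 6 * (y * y) + (t * t) * (t * t)) d) (l₂ (y * y) ((s * s) * (s * s)) ((t * t) * (t * t))))))
          where
          l₁ : ∀ x Y b → x + b ≡ (x + + 6 * Y) - + 6 * Y + b
          l₁ = solve-∀
          l₂ : ∀ Y a b → (+ 3 * a - b) - + 6 * Y + b ≡ + 0 + (a - + 2 * Y) * + 3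
          l₂ = solve-∀
        X≈0 = proj₁ both
        st≈0 : (s * s) * (t * t) ≈ + 0 [ + 3 ]
        st≈0 = ≈-trans (*-congˡ-≈ (s * s) (proj₂ both)) (≡⇒≈ (ℤₚ.*-zeroʳ (s * s)))

-- Infinite descent on |Y|. Modulo 4, Y is even; with Y = 2y the two descents give y = ± st and s =
-- ± ef and return to the same equation for (f, e), where |e| ≤ |s| ≤ |y| < |Y|.
quartic : ∀ X Y n → Coprimeᴿ X Y → n * n ≡ X * X * (X * X) + + 3 * (X * X * (Y * Y)) + + 3 * (Y * Y * (Y * Y)) → Y ≡ + 0
quartic X Y n c e = descend X Y n c e (<-wellFounded ∣ Y ∣)
  where
  descend : ∀ X Y n → Coprimeᴿ X Y → Quartic X Y n → Acc ℕ._<_ ∣ Y ∣ → Y ≡ + 0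
  descend X Y n c e (acc rec) = by (zeroℤ? Y) (parity Y) (parity X)
    where
    by : Y ≡ + 0 ⊎ Y ≢ + 0 → Y ≈ + 0 [ + 2 ] ⊎ Odd Y → X ≈ + 0 [ + 2 ] ⊎ Odd X → Y ≡ + 0
    by (inj₁ z) _ _ = z
    by (inj₂ _) (inj₂ oY) _ = ⊥-elim (not-both-squares {X} {Y} {n} e oY)
    by (inj₂ _) (inj₁ eY) (inj₁ eX) = ⊥-elim (coprime-not-both {X} {Y} 2 (λ ()) c eX eY)
    by (inj₂ Y≢0) (inj₁ (mod y eY)) (inj₂ oX) = ⊥-elim (loop (first-descent X y n (trans e (trans (cong (λ Y → X * X * (X * X) + + 3 * (X * X * (Y * Y)) + + 3 * (Y * Y * (Y * Y))) Y≡) (lem X y))) oX cXy y≢0))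
      where
      Y≡ : Y ≡ y * + 2
      Y≡ = trans eY (ℤₚ.+-identityˡ (y * + 2))
      lem : ∀ X y → X * X * (X * X) + + 3 * (X * X * (y * + 2 * (y * + 2))) + + 3 * (y * + 2 * (y * + 2) * (y * + 2 * (y * + 2))) ≡ X * X * (X * X) + + 12 * (X * X * (y * y)) + + 48 * (y * y * (y * y))
      lem = solve-∀
      y≢0 : y ≢ + 0
      y≢0 z = Y≢0 (trans Y≡ (trans (cong (_* + 2) z) refl))
      cXy : Coprimeᴿ X y
      cXy = Coprime-sym {y} {X} (Coprime-∣ˡ {y} {Y} {X} (div (+ 2) (trans Y≡ (ℤₚ.*-comm y (+ 2)))) (Coprime-sym {X} {Y} c))
      nonzero-left : ∀ a b c → a ≢ + 0 → ∣ a ∣ ≡ ∣ b * c ∣ → (b ≢ + 0) × (c ≢ + 0)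
      nonzero-left a b c a≢0 e = (λ z → a≢0 (ℤₚ.∣i∣≡0⇒i≡0 (trans e (cong ∣_∣ (trans (cong (_* c) z) (ℤₚ.*-zeroˡ c)))))) ,
        (λ z → a≢0 (ℤₚ.∣i∣≡0⇒i≡0 (trans e (cong ∣_∣ (trans (cong (b *_) z) (ℤₚ.*-zeroʳ b))))))
      ≤-product : ∀ a b c → c ≢ + 0 → ∣ a ∣ ≡ ∣ b * c ∣ → ∣ b ∣ ℕ.≤ ∣ a ∣
      ≤-product a b c c≢0 e = ℕₚ.≤-trans (ℕₚ.m≤m*n ∣ b ∣ ∣ c ∣ {{ℕ.≢-nonZero (λ z → c≢0 (ℤₚ.∣i∣≡0⇒i≡0 z))}}) (ℕₚ.≤-reflexive (trans (sym (ℤₚ.abs-* b c)) (sym e)))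
      loop : (∃ λ s → ∃ λ t → (∣ y ∣ ≡ ∣ s * t ∣) × X * X + + 6 * ((s * s) * (t * t)) ≡ (t * t) * (t * t) - + 3 * ((s * s) * (s * s))) → ⊥
      loop (s , t , ay , eq) = again (second-descent X s t eq oX cXs (proj₁ st≢0))
        where
        st≢0 = nonzero-left y s t y≢0 ay
        cXs : Coprimeᴿ X s
        cXs = Coprime-sym {s} {X} (Coprime-∣ˡ {s} {y * y} {X} (div (s * (t * t)) (trans (squares-product y s t ay) (l s t))) (Coprime-sym {X} {y * y} (Coprime-*ʳ {y} {y} {X} cXy cXy)))
          where
          l : ∀ s t → (s * s) * (t * t) ≡ s * (t * t) * s
          l = solve-∀
        again : (∃ λ e → ∃ λ f → (∣ s ∣ ≡ ∣ e * f ∣) × Coprimeᴿ e f × Quartic f e t) → ⊥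
        again (e , f , as , cef , q) = proj₁ ef≢0 (descend f e t (Coprime-sym {e} {f} cef) q (rec smaller))
          where
          ef≢0 = nonzero-left s e f (proj₁ st≢0) as
          smaller : ∣ e ∣ ℕ.< ∣ Y ∣
          smaller = ℕₚ.≤-<-trans (ℕₚ.≤-trans (≤-product s e f (proj₂ ef≢0) as) (≤-product y s t (proj₂ st≢0) ay))
            (ℕₚ.<-≤-trans (ℕₚ.m<m*n ∣ y ∣ 2 {{ℕ.≢-nonZero (λ z → y≢0 (ℤₚ.∣i∣≡0⇒i≡0 z))}} (s≤s (s≤s z≤n)))
              (ℕₚ.≤-reflexive (trans (sym (ℤₚ.abs-* y (+ 2))) (cong ∣_∣ (sym Y≡)))))

-- The rational points of y² = x³ − 1.
cube-minus-sixth-power : ∀ a c A → a * (a * a) ≡ c * (c * c) * (c * (c * c)) + A * A → Coprimeᴿ a c → c ≢ + 0 → A ≡ + 0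
cube-minus-sixth-power a c A e cac c≢0 = by-zero (zeroℤ? A)
  where
  k₀ = a - c * c
  W = k₀ * k₀ + + 3 * (a * (c * c))
  factor : k₀ * W ≡ A * A
  factor = trans (l₁ a c) (trans (cong (λ x → x - c * (c * c) * (c * (c * c))) e) (l₂ (c * (c * c) * (c * (c * c))) (A * A)))
    where
    l₁ : ∀ a c → (a - c * c) * ((a - c * c) * (a - c * c) + + 3 * (a * (c * c))) ≡ a * (a * a) - c * (c * c) * (c * (c * c))
    l₁ = solve-∀
    l₂ : ∀ x y → x + y - x ≡ y
    l₂ = solve-∀
  ca : Coprimeᴿ k₀ a
  ca = Coprime-sym {a} {k₀} (unneg (Coprime-sym { - k₀} {a} (Coprime-≈ { - k₀} {c * c} {a} (mod -1ℤ (l a c)) (Coprime-*ˡ {c} {c} {a} (Coprime-sym {a} {c} cac) (Coprime-sym {a} {c} cac)))))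
    where
    l : ∀ a c → - (a - c * c) ≡ c * c + -1ℤ * a
    l = solve-∀
    unneg : Coprimeᴿ a (- k₀) → Coprimeᴿ a k₀
    unneg p = subst (Coprimeᴿ a) (ℤₚ.neg-involutive k₀) (coprime-neg-mod {a} { - k₀} p)
  cc : Coprimeᴿ k₀ c
  cc = Coprime-≈ {k₀} {a} {c} (mod (- c) (l a c)) cac
    where
    l : ∀ a c → a - c * c ≡ a + - c * c
    l = solve-∀
  by-zero : A ≡ + 0 ⊎ A ≢ + 0 → A ≡ + 0
  by-zero (inj₁ z) = z
  by-zero (inj₂ A≢0) = ⊥-elim (by (mod-3 k₀))
    where
    squares : ∀ P R x → Coprimeᴿ P R → P * R ≡ x * x → x ≢ + 0 → (∃ λ m → P ≡ m * m ⊎ P ≡ - (m * m)) × (∃ λ m → R ≡ m * m ⊎ R ≡ - (m * m))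
    squares P R x c e x≢0 = tidy P (coprime-product-power {P} {R} {x} 1 P≢0 c e′) , tidy R (coprime-product-power {R} {P} {x} 1 R≢0 (Coprime-sym {P} {R} c) (trans (ℤₚ.*-comm R P) e′))
      where
      e′ : P * R ≡ x * (x * + 1)
      e′ = trans e (cong (x *_) (sym (ℤₚ.*-identityʳ x)))
      P≢0 : P ≢ + 0
      P≢0 z = x≢0 (square-zero x (trans (sym e) (trans (cong (_* R) z) (ℤₚ.*-zeroˡ R))))
      R≢0 : R ≢ + 0
      R≢0 z = x≢0 (square-zero x (trans (sym e) (trans (cong (P *_) z) (ℤₚ.*-zeroʳ P))))
      tidy : ∀ P → (∃ λ d → P ≡ d * (d * + 1) ⊎ P ≡ - (d * (d * + 1))) → ∃ λ m → P ≡ m * m ⊎ P ≡ - (m * m)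
      tidy P (d , inj₁ p) = d , inj₁ (trans p (cong (d *_) (ℤₚ.*-identityʳ d)))
      tidy P (d , inj₂ p) = d , inj₂ (trans p (cong (λ x → - (d * x)) (ℤₚ.*-identityʳ d)))
    -- W = k² + 3k c² + 3c⁴ ≥ 0 excludes the negative signs
    positive : ∀ k y m → m ≢ + 0 → k * k + + 3 * ((y + k) * y) ≡ - (m * m) → ⊥
    positive k y m m≢0 e = m≢0 (ℤₚ.*-cancelˡ-≡ (+ 2) m (+ 0) (proj₁ (definite-form-zero (+ 2 * m) (+ 2 * k + + 3 * y) y
        (trans (l₁ k y m) (trans (cong (λ x → + 4 * (x + m * m)) e) (l₂ (m * m)))))))
      where
      l₁ : ∀ k y m → (+ 2 * m) * (+ 2 * m) + (+ 2 * k + + 3 * y) * (+ 2 * k + + 3 * y) + + 3 * (y * y) ≡ + 4 * ((k * k + + 3 * ((y + k) * y)) + m * m)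
      l₁ = solve-∀
      l₂ : ∀ M → + 4 * (- M + M) ≡ + 0
      l₂ = solve-∀
    by : k₀ ≈ + 0 [ + 3 ] ⊎ k₀ ≈ + 1 [ + 3 ] ⊎ k₀ ≈ + 2 [ + 3 ] → ⊥
    -- If 3 does not divide k₀, the factors are coprime: k₀ = m² and W = n². With a = m² + c² this
    -- is the quartic for (X, Y) = (m, c).
    by (inj₂ r) = from (squares k₀ W A cW factor A≢0)
      where
      c3 : Coprimeᴿ k₀ (+ 3)
      c3 = from-residue r
        where
        from-residue : k₀ ≈ + 1 [ + 3 ] ⊎ k₀ ≈ + 2 [ + 3 ] → Coprimeᴿ k₀ (+ 3)
        from-residue (inj₁ p) = Coprime-≈ {k₀} {+ 1} {+ 3} p (bez {s = + 1} {t = + 0} refl)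
        from-residue (inj₂ p) = Coprime-≈ {k₀} {+ 2} {+ 3} p (bez {s = -1ℤ} {t = + 1} refl)
      cW : Coprimeᴿ k₀ W
      cW = Coprime-sym {W} {k₀} (Coprime-≈ {W} {+ 3 * (a * (c * c))} {k₀} (mod k₀ (ℤₚ.+-comm (k₀ * k₀) (+ 3 * (a * (c * c)))))
        (Coprime-sym {k₀} {+ 3 * (a * (c * c))} (Coprime-*ʳ {+ 3} {a * (c * c)} {k₀} c3 (Coprime-*ʳ {a} {c * c} {k₀} ca (Coprime-*ʳ {c} {c} {k₀} cc cc)))))
      from : _ → ⊥
      from ((m , inj₁ p) , (n , inj₁ q)) = c≢0 (quartic m c n (Coprime-sym {c} {m} (Coprime-sym {m} {c} (Coprime-∣ˡ {m} {k₀} {c} (div m p) cc)))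
          (trans (sym q) (trans (cong₂ (λ k a → k * k + + 3 * (a * (c * c))) p a≡) (l m c))))
        where
        a≡ : a ≡ m * m + c * c
        a≡ = trans (l₁ a (c * c)) (cong (λ x → x + c * c) p)
          where
          l₁ : ∀ a C → a ≡ (a - C) + C
          l₁ = solve-∀
        l : ∀ m c → m * m * (m * m) + + 3 * ((m * m + c * c) * (c * c)) ≡ m * m * (m * m) + + 3 * (m * m * (c * c)) + + 3 * (c * c * (c * c))
        l = solve-∀
      from (_ , (n , inj₂ q)) = positive k₀ (c * c) n n≢0 (trans (cong (λ x → k₀ * k₀ + + 3 * (x * (c * c))) (l₁ a (c * c))) q)
        where
        l₁ : ∀ a C → C + (a - C) ≡ a
        l₁ = solve-∀
        n≢0 : n ≢ + 0
        n≢0 z = A≢0 (square-zero A (trans (sym factor) (trans (cong (k₀ *_) (trans q (cong (λ x → - (x * x)) z))) (ℤₚ.*-zeroʳ k₀))))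
      from ((m , inj₂ p) , (n , inj₁ q)) = A≢0 (sum-of-squares-zero A (m * n) (trans (cong (_+ m * n * (m * n)) (trans (sym factor) (cong₂ _*_ p q))) (l m n)))
        where
        l : ∀ m n → - (m * m) * (n * n) + m * n * (m * n) ≡ + 0
        l = solve-∀
    -- If k₀ = 3k, then A = 3B and W = 3R with kR = B². Now k = m², R = n² and a = c² + 3m², which
    -- is the same quartic with the roles exchanged, (X, Y) = (c, m).
    by (inj₁ (mod k ek)) = finish (reduce (3-divides-product A A (mod (k * W) (trans (sym factor) (trans (cong (_* W) ek) (l k W))))))
      where
      l : ∀ k W → (+ 0 + k * + 3) * W ≡ + 0 + k * W * + 3
      l = solve-∀
      k₀≡ : k₀ ≡ k * + 3
      k₀≡ = trans ek (ℤₚ.+-identityˡ (k * + 3))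
      R = + 3 * (k * k) + a * (c * c)
      finish : A ≈ + 0 [ + 3 ] → ⊥
      finish (mod B eB) = from (squares k R B cR kR B≢0)
        where
        A≡ : A ≡ B * + 3
        A≡ = trans eB (ℤₚ.+-identityˡ (B * + 3))
        B≢0 : B ≢ + 0
        B≢0 z = A≢0 (trans A≡ (trans (cong (_* + 3) z) refl))
        kR : k * R ≡ B * B
        kR = ℤₚ.*-cancelˡ-≡ (+ 9) (k * R) (B * B) (trans (l₁ k (a * (c * c))) (trans (cong (λ x → x * (x * x + + 3 * (a * (c * c)))) (sym k₀≡)) (trans factor (trans (cong₂ _*_ A≡ A≡) (l₂ B)))))
          where
          l₁ : ∀ k x → + 9 * (k * (+ 3 * (k * k) + x)) ≡ k * + 3 * (k * + 3 * (k * + 3) + + 3 * x)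
          l₁ = solve-∀
          l₂ : ∀ B → B * + 3 * (B * + 3) ≡ + 9 * (B * B)
          l₂ = solve-∀
        k∣k₀ : k ∣ᴿ k₀
        k∣k₀ = div (+ 3) (trans k₀≡ (ℤₚ.*-comm k (+ 3)))
        cka = Coprime-∣ˡ {k} {k₀} {a} k∣k₀ ca
        ckc = Coprime-∣ˡ {k} {k₀} {c} k∣k₀ cc
        cR : Coprimeᴿ k R
        cR = Coprime-sym {R} {k} (Coprime-≈ {R} {a * (c * c)} {k} (mod (+ 3 * k) (l₁ k (a * (c * c)))) (Coprime-sym {k} {a * (c * c)} (Coprime-*ʳ {a} {c * c} {k} cka (Coprime-*ʳ {c} {c} {k} ckc ckc))))
          where
          l₁ : ∀ k x → + 3 * (k * k) + x ≡ x + + 3 * k * k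
          l₁ = solve-∀
        a≡ : a ≡ c * c + k * + 3
        a≡ = trans (l₁ a (c * c)) (cong (λ x → c * c + x) k₀≡)
          where
          l₁ : ∀ a C → a ≡ C + (a - C)
          l₁ = solve-∀
        from : _ → ⊥
        from ((m , inj₁ p) , (n , inj₁ q)) = B≢0 (square-zero B (trans (sym kR) (trans (cong (_* R) k≡0) (ℤₚ.*-zeroˡ R))))
          where
          m≡0 : m ≡ + 0
          m≡0 = quartic c m n (Coprime-sym {m} {c} (Coprime-∣ˡ {m} {k} {c} (div m p) ckc)) (trans (sym q) (trans (cong₂ (λ k a → + 3 * (k * k) + a * (c * c)) p (trans a≡ (cong (λ k → c * c + k * + 3) p))) (l₁ m c)))
            where
            l₁ : ∀ m c → + 3 * (m * m * (m * m)) + (c * c + m * m * + 3) * (c * c) ≡ c * c * (c * c) + + 3 * (c * c * (m * m)) + + 3 * (m * m * (m * m))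
            l₁ = solve-∀
          k≡0 : k ≡ + 0
          k≡0 = trans p (cong (λ x → x * x) m≡0)
        from (_ , (n , inj₂ q)) = B≢0 (square-zero B (trans (sym kR) (trans (cong (k *_) (trans q (cong (λ x → - (x * x)) n≡0))) (ℤₚ.*-zeroʳ k))))
          where
          n≡0 : n ≡ + 0
          n≡0 = ℤₚ.*-cancelˡ-≡ (+ 2) n (+ 0) (proj₁ (definite-form-zero (+ 2 * n) (+ 2 * (c * c) + + 3 * k) k
              (trans (l₁ k (c * c) n) (trans (cong (λ x → + 4 * (x + n * n)) (trans (cong (λ a → + 3 * (k * k) + a * (c * c)) (sym a≡)) q)) (l₂ (n * n))))))
            where
            l₁ : ∀ k C n → (+ 2 * n) * (+ 2 * n) + (+ 2 * C + + 3 * k) * (+ 2 * C + + 3 * k) + + 3 * (k * k) ≡ + 4 * ((+ 3 * (k * k) + (C + k * + 3) * C) + n * n)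
            l₁ = solve-∀
            l₂ : ∀ N → + 4 * (- N + N) ≡ + 0
            l₂ = solve-∀
        from ((m , inj₂ p) , (n , inj₁ q)) = B≢0 (sum-of-squares-zero B (m * n) (trans (cong (_+ m * n * (m * n)) (trans (sym kR) (cong₂ _*_ p q))) (l₁ m n)))
          where
          l₁ : ∀ m n → - (m * m) * (n * n) + m * n * (m * n) ≡ + 0
          l₁ = solve-∀

-- Translation to and from the divisibility used in the theorem

from-∣ : ∀ {a b m} → m ∣ (a - b) → a ≈ b [ m ]
from-∣ {a} {b} {m} d = by (ℤS.∣ᵤ⇒∣ {m} {a - b} d)
  where
  by : m ℤS.∣ (a - b) → a ≈ b [ m ]
  by (ℤS.divides k e) = mod k (trans (lem a b) (cong (λ x → b + x) e))
    where
    lem : ∀ a b → a ≡ b + (a - b)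
    lem = solve-∀

toCoprime : ∀ {x y} → Coprimeᴿ x y → Coprime x y
toCoprime {x} {y} (bez {s} {t} e) {d} (dx , dy) = ℕ∣.∣1⇒≡1 (ℤS.∣⇒∣ᵤ {+ d} {+ 1}
  (subst ((+ d) ℤS.∣_) e (ℤS.∣m∣n⇒∣m+n (ℤS.∣n⇒∣m*n s (ℤS.∣ᵤ⇒∣ {+ d} {x} dx)) (ℤS.∣n⇒∣m*n t (ℤS.∣ᵤ⇒∣ {+ d} {y} dy)))))

-- Primes

prime≢1 : ∀ {p} → Prime p → p ≢ 1
prime≢1 pr refl with prime⇒nonTrivial pr
... | ()

prime-dichotomy : ∀ {p} → Prime p → ∀ x → (+ p) ∣ᴿ x ⊎ Coprimeᴿ x (+ p)
prime-dichotomy {p} pr x = by (gcdsℤ x (+ p))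
  where
  by : GCDᴿ x (+ p) → (+ p) ∣ᴿ x ⊎ Coprimeᴿ x (+ p)
  by (gcdᴿ {d} {s} {t} {x′} {p′} b ex ep) = split (prime⇒irreducible pr (∣ᴿ⇒∣ {d} {+ p} (div p′ ep)))
    where
    split : ∣ d ∣ ≡ 1 ⊎ ∣ d ∣ ≡ p → (+ p) ∣ᴿ x ⊎ Coprimeᴿ x (+ p)
    split (inj₁ e) = inj₂ (unit (equal-abs {d} {+ 1} e))
      where
      unit : d ≡ + 1 ⊎ d ≡ - (+ 1) → Coprimeᴿ x (+ p)
      unit (inj₁ d1) = bez {s = s} {t} (trans b d1)
      unit (inj₂ d1) = bez {s = - s} { - t} (trans (lem s x t (+ p)) (cong -_ (trans b d1)))
        where
        lem : ∀ s x t p → - s * x + - t * p ≡ - (s * x + t * p)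
        lem = solve-∀
    split (inj₂ e) = inj₁ (associate (equal-abs {d} {+ p} e))
      where
      associate : d ≡ + p ⊎ d ≡ - (+ p) → (+ p) ∣ᴿ x
      associate (inj₁ dp) = div x′ (trans ex (cong (x′ *_) dp))
      associate (inj₂ dp) = div (- x′) (trans ex (trans (cong (x′ *_) dp) (lem x′ (+ p))))
        where
        lem : ∀ x p → x * - p ≡ - x * p
        lem = solve-∀

prime-∣-* : ∀ {p} → Prime p → ∀ a b → (+ p) ∣ᴿ (a * b) → (+ p) ∣ᴿ a ⊎ (+ p) ∣ᴿ b
prime-∣-* {p} pr a b d = by (prime-dichotomy pr a)
  where
  by : (+ p) ∣ᴿ a ⊎ Coprimeᴿ a (+ p) → (+ p) ∣ᴿ a ⊎ (+ p) ∣ᴿ b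
  by (inj₁ x) = inj₁ x
  by (inj₂ c) = inj₂ (Coprime-∣* {+ p} {a} {b} (Coprime-sym {a} {+ p} c) d)

∤1 : ∀ {p} → Prime p → (+ p) ∣ᴿ (+ 1) → ⊥
∤1 {p} pr d = prime≢1 pr (ℕ∣.∣1⇒≡1 (∣ᴿ⇒∣ {+ p} {+ 1} d))

prime-∣-^ : ∀ {p} → Prime p → ∀ a n → (+ p) ∣ᴿ (a ^ n) → (+ p) ∣ᴿ a
prime-∣-^ pr a zero d = ⊥-elim (∤1 pr d)
prime-∣-^ {p} pr a (suc n) d = by (prime-∣-* pr a (a ^ n) d)
  where
  by : (+ p) ∣ᴿ a ⊎ (+ p) ∣ᴿ (a ^ n) → (+ p) ∣ᴿ a
  by (inj₁ x) = x
  by (inj₂ y) = prime-∣-^ pr a n y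

prime-∣-prime : ∀ {p q} → Prime p → Prime q → (+ p) ∣ᴿ (+ q) → p ≡ q
prime-∣-prime {p} {q} pp pq d = by (prime⇒irreducible pq (∣ᴿ⇒∣ {+ p} {+ q} d))
  where
  by : p ≡ 1 ⊎ p ≡ q → p ≡ q
  by (inj₁ e) = ⊥-elim (prime≢1 pp e)
  by (inj₂ e) = e

coprime-both-∣ : ∀ {p x y} → Prime p → Coprimeᴿ x y → (+ p) ∣ᴿ x → (+ p) ∣ᴿ y → ⊥
coprime-both-∣ {p} {x} {y} pr (bez {s} {t} e) (div a ea) (div b eb) = ∤1 pr (div (s * a + t * b)
  (trans (sym e) (trans (cong₂ (λ x y → s * x + t * y) ea eb) (lem s a t b (+ p)))))
  where
  lem : ∀ s a t b p → s * (a * p) + t * (b * p) ≡ (s * a + t * b) * p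
  lem = solve-∀

divides-prime : ∀ {q} v → Prime q → v ∣ᴿ (+ q) → (v ≡ + 1 ⊎ v ≡ - (+ 1)) ⊎ (v ≡ + q ⊎ v ≡ - (+ q))
divides-prime {q} v pr d = by (prime⇒irreducible pr (∣ᴿ⇒∣ {v} {+ q} d))
  where
  by : ∣ v ∣ ≡ 1 ⊎ ∣ v ∣ ≡ q → (v ≡ + 1 ⊎ v ≡ - (+ 1)) ⊎ (v ≡ + q ⊎ v ≡ - (+ q))
  by (inj₁ e) = inj₁ (equal-abs {v} {+ 1} e)
  by (inj₂ e) = inj₂ (equal-abs {v} {+ q} e)

odd-prime : ∀ {q} → Prime q → q ≢ 2 → Odd (+ q)
odd-prime {q} pr q≢2 = by (parity (+ q))
  where
  by : (+ q) ≈ + 0 [ + 2 ] ⊎ Odd (+ q) → Odd (+ q)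
  by (inj₂ o) = o
  by (inj₁ (mod k e)) = ⊥-elim (split (prime⇒irreducible pr {2} (∣ᴿ⇒∣ {+ 2} {+ q} (div k (trans e (ℤₚ.+-identityˡ (k * + 2)))))))
    where
    split : 2 ≡ 1 ⊎ 2 ≡ q → ⊥
    split (inj₁ ())
    split (inj₂ 2≡q) = q≢2 (sym 2≡q)

odd-* : ∀ {a b} → Odd a → Odd b → Odd (a * b)
odd-* p q = *-cong-≈ p q

odd-^ : ∀ {a} n → Odd a → Odd (a ^ n)
odd-^ n p = ≈-trans (^-cong-≈ n p) (≡⇒≈ (1^ n))

odd-base : ∀ {a} n → Odd (a ^ suc n) → Odd a
odd-base {a} n o = by (parity a)
  where
  by : a ≈ + 0 [ + 2 ] ⊎ Odd a → Odd a
  by (inj₂ p) = p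
  by (inj₁ p) = ⊥-elim (even-not-odd (≈-trans (*-congʳ-≈ (a ^ n) p) (≡⇒≈ (ℤₚ.*-zeroˡ (a ^ n)))) o)

-- The class of r modulo 8 and the powers of q modulo r

data Class (r : ℕ) : Set where
  three : ∀ k → r ≡ k ℕ.* 8 ℕ.+ 3 → Class r
  five  : ∀ k → r ≡ k ℕ.* 8 ℕ.+ 5 → Class r

classify : ∀ r → (+ r) ≈ + 3 [ + 8 ] ⊎ (+ r) ≈ - (+ 3) [ + 8 ] → Class r
classify r e = by (r ℕ.% 8) (r ℕ./ 8) (ℕD.m≡m%n+[m/n]*n r 8) (residue e)
  where
  residue : (+ r) ≈ + 3 [ + 8 ] ⊎ (+ r) ≈ - (+ 3) [ + 8 ] → r ℕ.% 8 ≡ 3 ⊎ r ℕ.% 8 ≡ 5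
  residue (inj₁ p) = inj₁ (residue-cong {8} p)
  residue (inj₂ p) = inj₂ (residue-cong {8} p)
  by : ∀ ρ t → r ≡ ρ ℕ.+ t ℕ.* 8 → ρ ≡ 3 ⊎ ρ ≡ 5 → Class r
  by ρ t e (inj₁ refl) = three t (trans e (ℕₚ.+-comm 3 (t ℕ.* 8)))
  by ρ t e (inj₂ refl) = five t (trans e (ℕₚ.+-comm 5 (t ℕ.* 8)))

class-half : ∀ {r} → Class r → ∃ λ h → r ≡ odd h
class-half (three k e) = k ℕ.* 4 ℕ.+ 1 , trans e (lem k)
  where
  lem : ∀ k → k ℕ.* 8 ℕ.+ 3 ≡ 1 ℕ.+ ((k ℕ.* 4 ℕ.+ 1) ℕ.+ (k ℕ.* 4 ℕ.+ 1))
  lem = ℕS.solve-∀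
class-half (five k e) = k ℕ.* 4 ℕ.+ 2 , trans e (lem k)
  where
  lem : ∀ k → k ℕ.* 8 ℕ.+ 5 ≡ 1 ℕ.+ ((k ℕ.* 4 ℕ.+ 2) ℕ.+ (k ℕ.* 4 ℕ.+ 2))
  lem = ℕS.solve-∀

pos-linear : ∀ c d k → + (k ℕ.* d ℕ.+ c) ≈ + c [ + d ]
pos-linear c d k = mod (+ k) (trans (cong +_ (ℕₚ.+-comm (k ℕ.* d) c)) (trans (ℤₚ.pos-+ c (k ℕ.* d)) (cong (λ x → + c + x) (ℤₚ.pos-* k d))))

class-𝕁2 : ∀ {r} → Class r → 𝕁 (+ 2) (+ r) ≡ Sign.-
class-𝕁2 (three k refl) = 𝕁-2-3[8] (pos-linear 3 8 k)
class-𝕁2 (five k refl) = 𝕁-2-5[8] (pos-linear 5 8 k)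

class-odd : ∀ {r} → Class r → Odd (+ r)
class-odd (three k refl) = ≈-trans (divisor-mod 4 2 (pos-linear 3 8 k)) (mod (+ 1) refl)
class-odd (five k refl) = ≈-trans (divisor-mod 4 2 (pos-linear 5 8 k)) (mod (+ 2) refl)

-- This is ε = (-1)^((r - 1)/2), so that ε r ≡ 1 (mod 4) and iʳ = ε i.
sign-of : ∀ {r} → Class r → Sign
sign-of (three _ _) = Sign.-
sign-of (five _ _)  = Sign.+

class-signed : ∀ {r} (c : Class r) → σ (sign-of c) * + r ≈ + 1 [ + 4 ]
class-signed (three k refl) = ≈-trans (*-congˡ-≈ -1ℤ (divisor-mod 2 4 (pos-linear 3 8 k))) (mod -1ℤ refl)
class-signed (five k refl) = ≈-trans (*-congˡ-≈ (+ 1) (divisor-mod 2 4 (pos-linear 5 8 k))) (mod (+ 1) refl)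

class-unit-power : ∀ {r} (c : Class r) J → J ^ᵍ 4 ≡ 1ᵍ → (J ^ᵍ r ≡ J ^ᵍ 3 × sign-of c ≡ Sign.-) ⊎ (J ^ᵍ r ≡ J ^ᵍ 1 × sign-of c ≡ Sign.+)
class-unit-power (three k refl) J e = inj₁ (trans (cong (J ^ᵍ_) (lem k)) (J^4k+ J (k ℕ.* 2) 3 e) , refl)
  where
  lem : ∀ k → k ℕ.* 8 ℕ.+ 3 ≡ k ℕ.* 2 ℕ.* 4 ℕ.+ 3
  lem = ℕS.solve-∀
class-unit-power (five k refl) J e = inj₂ (trans (cong (J ^ᵍ_) (lem k)) (J^4k+ J (k ℕ.* 2 ℕ.+ 1) 1 e) , refl)
  where
  lem : ∀ k → k ℕ.* 8 ℕ.+ 5 ≡ (k ℕ.* 2 ℕ.+ 1) ℕ.* 4 ℕ.+ 1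
  lem = ℕS.solve-∀

small-class : ∀ {r} → Class r → r ℕ.≤ 3 → r ≡ 3
small-class (three zero e) _ = e
small-class (three (suc k) refl) (s≤s (s≤s (s≤s ())))
small-class (five zero refl) (s≤s (s≤s (s≤s ())))
small-class (five (suc k) refl) (s≤s (s≤s (s≤s ())))

-- Of the generator property of q only the fact that 2 is a power of q modulo r is needed.
module Generator {q r : ℕ} (c : Class r) (cqr : Coprimeᴿ (+ q) (+ r)) (two-power : ∃ λ k → + 2 ≈ (+ q) ^ k [ + r ]) where

  -- Were (q/r) = 1, the power of q congruent to 2 would also have symbol 1, but (2/r) = - 1 for r ≡
  -- ± 3 (mod 8).
  nonresidue : 𝕁 (+ q) (+ r) ≡ Sign.-
  nonresidue = by (𝕁 (+ q) (+ r)) refl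
    where
    by : ∀ s → 𝕁 (+ q) (+ r) ≡ s → s ≡ Sign.-
    by Sign.- _ = refl
    by Sign.+ e = ⊥-elim (+≢- (trans (sym (𝕁-^ {+ q} {+ r} (proj₁ two-power) (class-odd c) cqr e))
      (trans (sym (𝕁-cong {+ r} (class-odd c) (proj₂ two-power))) (class-𝕁2 c))))

  -- Powers of ± 1 are ± 1, so 2 ≡ ± 1 (mod r), and r divides 1 or 3.
  plus-minus-one : (+ q) ≈ + 1 [ + r ] ⊎ (+ q) ≈ - (+ 1) [ + r ] → r ≡ 3
  plus-minus-one e = small-class c (by e)
    where
    k = proj₁ two-power
    minus-one-power : ∀ k → (- (+ 1)) ^ k ≡ + 1 ⊎ (- (+ 1)) ^ k ≡ - (+ 1)
    minus-one-power zero = inj₁ refl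
    minus-one-power (suc k) with minus-one-power k
    ... | inj₁ p = inj₂ (cong (λ x → - (+ 1) * x) p)
    ... | inj₂ p = inj₁ (cong (λ x → - (+ 1) * x) p)
    bound : ∀ {d} → + 2 ≈ d [ + r ] → ∀ n .{{_ : ℕ.NonZero n}} → + n ≡ + 2 - d → n ℕ.≤ 3 → r ℕ.≤ 3
    bound {d} (mod j e) n nd n≤3 = ℕₚ.≤-trans (ℕ∣.∣⇒≤ (∣ᴿ⇒∣ {+ r} {+ n} (div j (trans nd (trans (cong (λ x → x - d) e) (lem d (j * + r))))))) n≤3
      where
      lem : ∀ d x → d + x - d ≡ x
      lem = solve-∀
    one : + 2 ≈ + 1 [ + r ] → r ℕ.≤ 3
    one p = bound p 1 refl (s≤s z≤n)
    minus : + 2 ≈ - (+ 1) [ + r ] → r ℕ.≤ 3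
    minus p = bound p 3 refl (s≤s (s≤s (s≤s z≤n)))
    by : (+ q) ≈ + 1 [ + r ] ⊎ (+ q) ≈ - (+ 1) [ + r ] → r ℕ.≤ 3
    by (inj₁ p) = one (≈-trans (proj₂ two-power) (≈-trans (^-cong-≈ k p) (≡⇒≈ (1^ k))))
    by (inj₂ p) = sign-cases (minus-one-power k)
      where
      sign-cases : (- (+ 1)) ^ k ≡ + 1 ⊎ (- (+ 1)) ^ k ≡ - (+ 1) → r ℕ.≤ 3
      sign-cases (inj₁ e) = one (≈-trans (proj₂ two-power) (≈-trans (^-cong-≈ k p) (≡⇒≈ e)))
      sign-cases (inj₂ e) = minus (≈-trans (proj₂ two-power) (≈-trans (^-cong-≈ k p) (≡⇒≈ e)))

im-≈ : ∀ {α β m} → α G.≈ β [ ι m ] → im α ≈ im β [ m ]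
im-≈ {α} {β} {m} (G.mod γ e) = mod (im γ) (trans (cong im e) (trans (cong (λ z → im (β +ᵍ z)) (x*ι γ m)) refl))

re-≈ : ∀ {α β m} → α G.≈ β [ ι m ] → re α ≈ re β [ m ]
re-≈ {α} {β} {m} (G.mod γ e) = mod (re γ) (trans (cong re e) (trans (cong (λ z → re (β +ᵍ z)) (x*ι γ m)) refl))

cartesian : ∀ u v → (u +i v) ≡ ι u +ᵍ 𝕚 *ᵍ ι v
cartesian u v = cong₂ _+i_ (l₁ u v) (l₂ v)
  where
  l₁ : ∀ u v → u ≡ u + (+ 0 * v - + 1 * + 0)
  l₁ = solve-∀
  l₂ : ∀ v → v ≡ + 0 + (+ 0 * + 0 + + 1 * v)
  l₂ = solve-∀

frobenius-cartesian : ∀ u v r → Prime r → (u +i v) ^ᵍ r G.≈ ι u ^ᵍ r +ᵍ (𝕚 *ᵍ ι v) ^ᵍ r [ ι (+ r) ]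
frobenius-cartesian u v r pr = subst (λ x → x ^ᵍ r G.≈ ι u ^ᵍ r +ᵍ (𝕚 *ᵍ ι v) ^ᵍ r [ ι (+ r) ]) (sym (cartesian u v)) (frobenius (ι u) (𝕚 *ᵍ ι v) r pr)

im-first-order : ∀ u v n → im ((u +i v) ^ᵍ suc n) ≈ + suc n * u ^ n * v [ v * v ]
im-first-order u v n = ≈-trans (im-≈ {(u +i v) ^ᵍ suc n} {ι u ^ᵍ suc n +ᵍ ι (+ suc n) *ᵍ (ι u ^ᵍ n *ᵍ δ)} {v * v}
    (G-mod-∣ (imaginary-square-∣ v) (subst (λ x → x ^ᵍ suc n G.≈ ι u ^ᵍ suc n +ᵍ ι (+ suc n) *ᵍ (ι u ^ᵍ n *ᵍ δ) [ δ *ᵍ δ ]) (sym (cartesian u v)) (first-order (ι u) δ n))))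
  (≡⇒≈ (trans (cong im (cong₂ (λ x y → x +ᵍ ι (+ suc n) *ᵍ (y *ᵍ δ)) (ι-^ u (suc n)) (ι-^ u n))) (lem (u ^ suc n) (+ suc n) (u ^ n) v)))
  where
  δ = 𝕚 *ᵍ ι v
  lem : ∀ U n b v → + 0 + (n * (b * (+ 0 * + 0 + + 1 * v) + + 0 * (+ 0 * v - + 1 * + 0)) + + 0 * (b * (+ 0 * v - + 1 * + 0) - + 0 * (+ 0 * + 0 + + 1 * v))) ≡ n * b * v
  lem = solve-∀

negation-distinct : ∀ {Q} → Odd Q → - Q ≈ Q [ + 4 ] → ⊥
negation-distinct {Q} (mod j o) (mod k e) = ≉ {1} {0} 2 (λ ()) (mod (- k - j) (cancel
    (trans (l₁ j) (trans (cong (λ x → x + x) (sym o)) (trans (l₂ Q) (trans (cong (λ x → Q - x) e) (l₃ Q k)))))))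
  where
  l₁ : ∀ j → + 2 * (+ 1 + j * + 2) ≡ (+ 1 + j * + 2) + (+ 1 + j * + 2)
  l₁ = solve-∀
  l₂ : ∀ Q → Q + Q ≡ Q - - Q
  l₂ = solve-∀
  l₃ : ∀ Q k → Q - (Q + k * + 4) ≡ + 2 * (- k * + 2)
  l₃ = solve-∀
  cancel : + 2 * (+ 1 + j * + 2) ≡ + 2 * (- k * + 2) → + 1 ≡ + 0 + (- k - j) * + 2
  cancel e = trans (l₄ j) (trans (cong (λ x → x - j * + 2) (ℤₚ.*-cancelˡ-≡ (+ 2) (+ 1 + j * + 2) (- k * + 2) e)) (l₅ k j))
    where
    l₄ : ∀ j → + 1 ≡ (+ 1 + j * + 2) - j * + 2
    l₄ = solve-∀
    l₅ : ∀ k j → - k * + 2 - j * + 2 ≡ + 0 + (- k - j) * + 2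
    l₅ = solve-∀

-- x even: Im (u + iv)ʳ = q

module EvenCase {q r : ℕ} (pq : Prime q) (oQ : Odd (+ q)) (c : Class r) (pr : Prime r) (crQ : Coprimeᴿ (+ r) (+ q))
  (nonresidue : 𝕁 (+ q) (+ r) ≡ Sign.-) (plus-minus-one : (+ q) ≈ + 1 [ + r ] ⊎ (+ q) ≈ - (+ 1) [ + r ] → r ≡ 3)
  (u v : ℤ) (eu : u ≈ + 0 [ + 2 ]) (ov : Odd v) (Q≡ : im ((u +i v) ^ᵍ r) ≡ + q) where

  private
    Q = + q
    z = u +i v
    h = proj₁ (class-half c)
    r≡ : r ≡ odd h
    r≡ = proj₂ (class-half c)

    Q≢0 : Q ≢ + 0
    Q≢0 = odd≢0 oQ

  -- Modulo v the number z is real, and so is zʳ.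
  v∣Q : v ∣ᴿ Q
  v∣Q = ≈0⇒∣ᴿ (≈-trans (≡⇒≈ (sym Q≡)) (im-≈ {z ^ᵍ r} {ι (u ^ r)} {v} (G.≈-trans (G.^-cong-≈ r z≈u) (G.≡⇒≈ (ι-^ u r)))))
    where
    z≈u : z G.≈ ι u [ ι v ]
    z≈u = G.mod 𝕚 (cartesian u v)

  -- modulo 4 the square of z is −1
  sign-mod-4 : σ (sign-of c) * v ≈ Q [ + 4 ]
  sign-mod-4 = ≈-sym (≈-trans (≡⇒≈ (sym Q≡)) (power c))
    where
    z² : z *ᵍ z G.≈ ι -1ℤ [ ι (+ 4) ]
    z² = by eu (8⇒4 (odd-square ov))
      where
      by : u ≈ + 0 [ + 2 ] → v * v ≈ + 1 [ + 4 ] → z *ᵍ z G.≈ ι -1ℤ [ ι (+ 4) ]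
      by (mod i ei) (mod j ej) = G.mod ((i * i - j) +i (i * v)) (cong₂ _+i_
          (trans (cong₂ (λ a b → a * a - b) ei ej) (l₁ i j v)) (trans (cong (λ a → a * v + v * a) ei) (l₂ i j v)))
        where
        l₁ : ∀ i j v → (+ 0 + i * + 2) * (+ 0 + i * + 2) - (+ 1 + j * + 4) ≡ -1ℤ + ((i * i - j) * + 4 - i * v * + 0)
        l₁ = solve-∀
        l₂ : ∀ i j v → (+ 0 + i * + 2) * v + v * (+ 0 + i * + 2) ≡ + 0 + ((i * i - j) * + 0 + i * v * + 4)
        l₂ = solve-∀
    z^ : ∀ m → z ^ᵍ (m ℕ.* 2 ℕ.+ 1) G.≈ (ι -1ℤ) ^ᵍ m *ᵍ z [ ι (+ 4) ]
    z^ m = G.≈-trans (G.≡⇒≈ (trans (pow-split z m 2 1) (cong₂ (λ x y → x ^ᵍ m *ᵍ y) (cong (z *ᵍ_) z¹) z¹))) (G.*-congʳ-≈ z (G.^-cong-≈ m z²))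
      where
      z¹ : z ^ᵍ 1 ≡ z
      z¹ = 𝔾ₚ.*-identityʳ z
    power : (c : Class r) → im (z ^ᵍ r) ≈ σ (sign-of c) * v [ + 4 ]
    power (three k refl) = ≈-trans (im-≈ {z ^ᵍ (k ℕ.* 8 ℕ.+ 3)} {ι -1ℤ *ᵍ z} {+ 4} (G.≈-trans (G.≡⇒≈ (cong (z ^ᵍ_) (l k))) (G.≈-trans (z^ (k ℕ.* 4 ℕ.+ 1))
        (G.≡⇒≈ (cong (_*ᵍ z) (J^4k+ (ι -1ℤ) k 1 refl)))))) (≡⇒≈ (l₂ u v))
      where
      l : ∀ k → k ℕ.* 8 ℕ.+ 3 ≡ (k ℕ.* 4 ℕ.+ 1) ℕ.* 2 ℕ.+ 1
      l = ℕS.solve-∀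
      l₂ : ∀ u v → -1ℤ * v + + 0 * u ≡ - (+ 1) * v
      l₂ = solve-∀
    power (five k refl) = ≈-trans (im-≈ {z ^ᵍ (k ℕ.* 8 ℕ.+ 5)} {1ᵍ *ᵍ z} {+ 4} (G.≈-trans (G.≡⇒≈ (cong (z ^ᵍ_) (l k))) (G.≈-trans (z^ (k ℕ.* 4 ℕ.+ 2))
        (G.≡⇒≈ (cong (_*ᵍ z) (J^4k+ (ι -1ℤ) k 2 refl)))))) (≡⇒≈ (l₂ u v))
      where
      l : ∀ k → k ℕ.* 8 ℕ.+ 5 ≡ (k ℕ.* 4 ℕ.+ 2) ℕ.* 2 ℕ.+ 1
      l = ℕS.solve-∀
      l₂ : ∀ u v → + 1 * v + + 0 * u ≡ + 1 * v
      l₂ = solve-∀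

  -- v = ± q forces the sign, and then ± r is a square modulo q
  not-Q : v ≡ Q ⊎ v ≡ - Q → ⊥
  not-Q v≡ = contradiction (v≡εQ v≡ sign-mod-4)
    where
    ε = σ (sign-of c)
    v≡εQ : v ≡ Q ⊎ v ≡ - Q → σ (sign-of c) * v ≈ Q [ + 4 ] → v ≡ ε * Q
    v≡εQ = by (sign-of c)
      where
      by : ∀ s → v ≡ Q ⊎ v ≡ - Q → σ s * v ≈ Q [ + 4 ] → v ≡ σ s * Q
      by Sign.+ (inj₁ e) _ = trans e (sym (ℤₚ.*-identityˡ Q))
      by Sign.+ (inj₂ e) p = ⊥-elim (negation-distinct oQ (≈-trans (≡⇒≈ (sym (trans (ℤₚ.*-identityˡ v) e))) p))
      by Sign.- (inj₁ e) p = ⊥-elim (negation-distinct oQ (≈-trans (≡⇒≈ (sym (trans (ℤₚ.-1*i≡-i v) (cong -_ e)))) p))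
      by Sign.- (inj₂ e) _ = trans e (sym (ℤₚ.-1*i≡-i Q))
    ε² : ε * ε ≡ + 1
    ε² = by (sign-of c)
      where
      by : ∀ s → σ s * σ s ≡ + 1
      by Sign.+ = refl
      by Sign.- = refl
    contradiction : v ≡ ε * Q → ⊥
    contradiction v≡ = +≢- (trans (sym residue) (trans (sym (𝕁-reciprocity {ε * + r} {q} (class-signed c) oQ (Coprime-sym {ε * + r} {Q} cεr))) (trans (strip (sign-of c)) nonresidue)))
      where
      U = u ^ h
      first : Q ≈ + r * (U * U) * (ε * Q) [ Q * Q ]
      first = ≈-trans (≡⇒≈ (sym Q≡)) (subst₂ (λ x m → im (z ^ᵍ r) ≈ x [ m ]) value modulus
        (subst (λ n → im (z ^ᵍ n) ≈ + suc (h ℕ.+ h) * u ^ (h ℕ.+ h) * v [ v * v ]) (sym r≡) (im-first-order u v (h ℕ.+ h))))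
        where
        value : + suc (h ℕ.+ h) * u ^ (h ℕ.+ h) * v ≡ + r * (U * U) * (ε * Q)
        value = cong₂ _*_ (cong₂ _*_ (cong +_ (sym r≡)) (^-+ u h h)) v≡
        modulus : v * v ≡ Q * Q
        modulus = trans (cong₂ _*_ v≡ v≡) (trans (l ε Q) (trans (cong (_* (Q * Q)) ε²) (ℤₚ.*-identityˡ (Q * Q))))
          where
          l : ∀ ε Q → ε * Q * (ε * Q) ≡ ε * ε * (Q * Q)
          l = solve-∀
      unit : U * U * (ε * + r) ≈ + 1 [ Q ]
      unit = cancel first
        where
        cancel : Q ≈ + r * (U * U) * (ε * Q) [ Q * Q ] → U * U * (ε * + r) ≈ + 1 [ Q ]
        cancel (mod k e) = ≈-sym (mod k (cancelℤ Q (+ 1) (U * U * (ε * + r) + k * Q) Q≢0 (trans (ℤₚ.*-identityˡ Q) (trans e (l (+ r) (U * U) ε Q k)))))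
          where
          l : ∀ r U ε Q k → r * U * (ε * Q) + k * (Q * Q) ≡ (U * (ε * r) + k * Q) * Q
          l = solve-∀
      cU : Coprimeᴿ U Q
      cU = Coprime-∣ˡ {U} {U * U * (ε * + r)} {Q} (div (U * (ε * + r)) (l U (ε * + r))) (Coprime-≈ {U * U * (ε * + r)} {+ 1} {Q} unit (Coprime-1 {Q}))
        where
        l : ∀ U x → U * U * x ≡ U * x * U
        l = solve-∀
      cεr : Coprimeᴿ (ε * + r) Q
      cεr = Coprime-∣ˡ {ε * + r} {U * U * (ε * + r)} {Q} (div (U * U) refl) (Coprime-≈ {U * U * (ε * + r)} {+ 1} {Q} unit (Coprime-1 {Q}))
      residue : 𝕁 (ε * + r) Q ≡ Sign.+
      residue = trans (sym (𝕁-sq-* {Q} oQ {U} {ε * + r} cU cεr)) (trans (𝕁-cong {Q} oQ unit) (𝕁-1 {Q} oQ))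
      strip : ∀ s → 𝕁 Q (σ s * + r) ≡ 𝕁 Q (+ r)
      strip Sign.+ = cong (𝕁 Q) (ℤₚ.*-identityˡ (+ r))
      strip Sign.- = trans (cong (𝕁 Q) (ℤₚ.-1*i≡-i (+ r))) (𝕁-neg Q (+ r))

  -- Modulo r the power splits as uʳ + (iv)ʳ by Frobenius, with imaginary part ± 1; so q ≡ ± 1 (mod
  -- r).
  unit-v : v ≡ + 1 ⊎ v ≡ - (+ 1) → r ≡ 3
  unit-v v≡ = plus-minus-one (from (unit v≡))
    where
    unit : v ≡ + 1 ⊎ v ≡ - (+ 1) → im ((𝕚 *ᵍ ι v) ^ᵍ r) ≡ + 1 ⊎ im ((𝕚 *ᵍ ι v) ^ᵍ r) ≡ - (+ 1)
    unit (inj₁ refl) = by (class-unit-power c 𝕚 refl)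
      where
      by : (𝕚 ^ᵍ r ≡ 𝕚 ^ᵍ 3 × sign-of c ≡ Sign.-) ⊎ (𝕚 ^ᵍ r ≡ 𝕚 ^ᵍ 1 × sign-of c ≡ Sign.+) → im (𝕚 ^ᵍ r) ≡ + 1 ⊎ im (𝕚 ^ᵍ r) ≡ - (+ 1)
      by (inj₁ (e , _)) = inj₂ (cong im e)
      by (inj₂ (e , _)) = inj₁ (cong im e)
    unit (inj₂ refl) = by (class-unit-power c 𝕚⁻ refl)
      where
      by : (𝕚⁻ ^ᵍ r ≡ 𝕚⁻ ^ᵍ 3 × sign-of c ≡ Sign.-) ⊎ (𝕚⁻ ^ᵍ r ≡ 𝕚⁻ ^ᵍ 1 × sign-of c ≡ Sign.+) → im (𝕚⁻ ^ᵍ r) ≡ + 1 ⊎ im (𝕚⁻ ^ᵍ r) ≡ - (+ 1)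
      by (inj₁ (e , _)) = inj₁ (cong im e)
      by (inj₂ (e , _)) = inj₂ (cong im e)
    frob : Q ≈ im ((𝕚 *ᵍ ι v) ^ᵍ r) [ + r ]
    frob = ≈-trans (≡⇒≈ (sym Q≡)) (≈-trans (im-≈ {z ^ᵍ r} {ι u ^ᵍ r +ᵍ (𝕚 *ᵍ ι v) ^ᵍ r} {+ r}
      (frobenius-cartesian u v r pr))
      (≡⇒≈ (trans (cong (λ x → im (x +ᵍ (𝕚 *ᵍ ι v) ^ᵍ r)) (ι-^ u r)) (ℤₚ.+-identityˡ (im ((𝕚 *ᵍ ι v) ^ᵍ r))))))
    from : im ((𝕚 *ᵍ ι v) ^ᵍ r) ≡ + 1 ⊎ im ((𝕚 *ᵍ ι v) ^ᵍ r) ≡ - (+ 1) → Q ≈ + 1 [ + r ] ⊎ Q ≈ - (+ 1) [ + r ]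
    from (inj₁ e) = inj₁ (≈-trans frob (≡⇒≈ e))
    from (inj₂ e) = inj₂ (≈-trans frob (≡⇒≈ e))

  exceptional : r ≡ 3 × (v ≡ + 1 ⊎ v ≡ - (+ 1))
  exceptional = by (divides-prime v pq v∣Q)
    where
    by : (v ≡ + 1 ⊎ v ≡ - (+ 1)) ⊎ (v ≡ Q ⊎ v ≡ - Q) → r ≡ 3 × (v ≡ + 1 ⊎ v ≡ - (+ 1))
    by (inj₁ e) = unit-v e , e
    by (inj₂ e) = ⊥-elim (not-Q e)

-- The cubic equation left over for even x and r = 3

-- Non-negativity of g² + g at integers, although the polynomial is negative between - 1 and 0; the
-- case analysis below depends on it.
consecutive : ∀ g → ∃ λ m → g * g + g ≡ + m
consecutive (+ n) = n ℕ.* n ℕ.+ n , trans (cong (λ x → x + + n) (sym (ℤₚ.pos-* n n))) (sym (ℤₚ.pos-+ (n ℕ.* n) n))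
consecutive -[1+ n ] = n ℕ.* n ℕ.+ n , trans (lem (+ n)) (trans (cong (λ x → x + + n) (sym (ℤₚ.pos-* n n))) (sym (ℤₚ.pos-+ (n ℕ.* n) n)))
  where
  lem : ∀ n → - (+ 1 + n) * - (+ 1 + n) + - (+ 1 + n) ≡ n * n + n
  lem = solve-∀

private
  naturals-zero : ∀ {a b x y} → a ≡ + x → b ≡ + y → a + b ≡ + 0 → (a ≡ + 0) × (b ≡ + 0)
  naturals-zero {x = x} {y} p q e = trans p (cong +_ (proj₁ zeros)) , trans q (cong +_ (proj₂ zeros))
    where
    zeros : (x ≡ 0) × (y ≡ 0)
    zeros = sum-zero (ℤₚ.+-injective (trans (ℤₚ.pos-+ x y) (trans (cong₂ _+_ (sym p) (sym q)) e)))

  scaled : ∀ k {a n} → a ≡ + n → + k * a ≡ + (k ℕ.* n)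
  scaled k {n = n} e = trans (cong (λ x → + k * x) e) (sym (ℤₚ.pos-* k n))

  added : ∀ {a b m n} → a ≡ + m → b ≡ + n → a + b ≡ + (m ℕ.+ n)
  added {m = m} {n} p q = trans (cong₂ _+_ p q) (sym (ℤₚ.pos-+ m n))

  -- The equation of no-cube below, with w = u − 1 = g − e and c = w + 2e.
  cubic-solutions : ∀ e g → + 3 * (g * (e * g + + 1)) + (e * (e * e) - + 3 * e + + 2) ≡ + 0 → g - e ≡ -1ℤ ⊎ (g - e) ≈ + 0 [ + 2 ]
  cubic-solutions (+ zero) g eq = ⊥-elim (≉ {0} {2} 3 (λ ()) (≈-trans (≡⇒≈ (sym eq)) (mod (g * (+ 0 * g + + 1)) (lem (g * (+ 0 * g + + 1))))))
    where
    lem : ∀ x → + 3 * x + (+ 0 * (+ 0 * + 0) - + 3 * + 0 + + 2) ≡ + 2 + x * + 3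
    lem = solve-∀
  -- For e = 1 + n the term e³ - 3e + 2 = (e - 1)²(e + 2) is n²(n + 3), and g(eg + 1) is ng² + (g² +
  -- g). All summands are non-negative and must vanish. For e ≤ - 2 the negated equation has the
  -- same shape.
  cubic-solutions (+ suc n) g eq = from-n (n-zero n (proj₂ split)) 
    where
    m = proj₁ (consecutive g)
    A = + 3 * (+ n * (g * g) + (g * g + g))
    A≡ : A ≡ + (3 ℕ.* (n ℕ.* (∣ g ∣ ℕ.* ∣ g ∣) ℕ.+ m))
    A≡ = scaled 3 (added (scaled n (square-abs g)) (proj₂ (consecutive g)))
    B = + n * (+ n * (+ n + + 3))
    B≡ : B ≡ + (n ℕ.* (n ℕ.* (n ℕ.+ 3)))
    B≡ = scaled n (scaled n (sym (ℤₚ.pos-+ n 3)))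
    split : (A ≡ + 0) × (B ≡ + 0)
    split = naturals-zero A≡ B≡ (trans (lem (+ n) g) eq)
      where
      lem : ∀ n g → + 3 * (n * (g * g) + (g * g + g)) + n * (n * (n + + 3)) ≡ + 3 * (g * ((+ 1 + n) * g + + 1)) + ((+ 1 + n) * ((+ 1 + n) * (+ 1 + n)) - + 3 * (+ 1 + n) + + 2)
      lem = solve-∀
    n-zero : ∀ n → + n * (+ n * (+ n + + 3)) ≡ + 0 → n ≡ 0
    n-zero zero _ = refl
    n-zero (suc n) ()
    from-n : n ≡ 0 → g - + suc n ≡ -1ℤ ⊎ (g - + suc n) ≈ + 0 [ + 2 ]
    from-n refl = by (product-zero g (g + + 1) (ℤₚ.*-cancelˡ-≡ (+ 3) (g * (g + + 1)) (+ 0) (trans (lem g) (proj₁ split))))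
      where
      lem : ∀ g → + 3 * (g * (g + + 1)) ≡ + 3 * (+ 0 * (g * g) + (g * g + g))
      lem = solve-∀
      by : g ≡ + 0 ⊎ g + + 1 ≡ + 0 → g - + 1 ≡ -1ℤ ⊎ (g - + 1) ≈ + 0 [ + 2 ]
      by (inj₁ z) = inj₁ (cong (λ x → x - + 1) z)
      by (inj₂ z) = inj₂ (mod -1ℤ (trans (lem₂ g) (cong (λ x → x - + 2) z)))
        where
        lem₂ : ∀ g → g - + 1 ≡ (g + + 1) - + 2
        lem₂ = solve-∀
  cubic-solutions -[1+ zero ] g eq = ⊥-elim (≉ {0} {1} 3 (λ ()) (≈-trans (≡⇒≈ (sym eq)) (mod (g * (-1ℤ * g + + 1) + + 1) (lem (g * (-1ℤ * g + + 1))))))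
    where
    lem : ∀ x → + 3 * x + (-1ℤ * (-1ℤ * -1ℤ) - + 3 * -1ℤ + + 2) ≡ + 1 + (x + + 1) * + 3
    lem = solve-∀
  cubic-solutions -[1+ suc n ] g eq = from-n (n-zero n (proj₂ split))
    where
    A = + 3 * (+ suc n * (g * g) + (- g * - g + - g))
    m = proj₁ (consecutive (- g))
    A≡ : A ≡ + (3 ℕ.* (suc n ℕ.* (∣ g ∣ ℕ.* ∣ g ∣) ℕ.+ m))
    A≡ = scaled 3 (added (scaled (suc n) (square-abs g)) (proj₂ (consecutive (- g))))
    B = + n * ((+ n + + 3) * (+ n + + 3))
    B≡ : B ≡ + (n ℕ.* ((n ℕ.+ 3) ℕ.* (n ℕ.+ 3)))
    B≡ = scaled n (trans (cong₂ _*_ (sym (ℤₚ.pos-+ n 3)) (sym (ℤₚ.pos-+ n 3))) (sym (ℤₚ.pos-* (n ℕ.+ 3) (n ℕ.+ 3))))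
    split : (A ≡ + 0) × (B ≡ + 0)
    split = naturals-zero A≡ B≡ (trans (lem (+ n) g) (cong -_ eq))
      where
      lem : ∀ n g → + 3 * ((+ 1 + n) * (g * g) + (- g * - g + - g)) + n * ((n + + 3) * (n + + 3))
        ≡ - (+ 3 * (g * (- (+ 2 + n) * g + + 1)) + (- (+ 2 + n) * (- (+ 2 + n) * - (+ 2 + n)) - + 3 * - (+ 2 + n) + + 2))
      lem = solve-∀
    n-zero : ∀ n → + n * ((+ n + + 3) * (+ n + + 3)) ≡ + 0 → n ≡ 0
    n-zero zero _ = refl
    n-zero (suc n) ()
    from-n : n ≡ 0 → g - -[1+ suc n ] ≡ -1ℤ ⊎ (g - -[1+ suc n ]) ≈ + 0 [ + 2 ]
    from-n refl = inj₂ (mod (+ 1) (cong (λ x → x + + 2) (square-zero g (proj₁ (naturals-zero (square-abs g) (proj₂ (consecutive (- g)))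
      (ℤₚ.*-cancelˡ-≡ (+ 3) (g * g + (- g * - g + - g)) (+ 0) (trans (lem g) (proj₁ split))))))))
      where
      lem : ∀ g → + 3 * (g * g + (- g * - g + - g)) ≡ + 3 * (+ 1 * (g * g) + (- g * - g + - g))
      lem = solve-∀

-- With w = u - 1 the left-hand side is w³ - 6w - 4, and e = (c - w)/2 is integral since c and w are
-- odd. Evenness of u is essential: u = - 1 and u = 3 give the cubes 0 and - 8.
no-cube : ∀ u c → u ≈ + 0 [ + 2 ] → u * (u * u) - + 3 * (u * u) - + 3 * u + + 1 ≡ c * (c * c) → u ≡ + 0
no-cube u c (mod i eu) eq = halve (parity c)
  where
  w = u - + 1
  odd-w : w ≈ + 0 [ + 2 ] → ⊥
  odd-w (mod j e) = ≉ {1} {0} 2 (λ ()) (mod (i - j) (trans (lem u) (trans (cong₂ (λ a b → a - b) eu e) (lem₂ i j))))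
    where
    lem : ∀ u → + 1 ≡ u - (u - + 1)
    lem = solve-∀
    lem₂ : ∀ i j → (+ 0 + i * + 2) - (+ 0 + j * + 2) ≡ + 0 + (i - j) * + 2
    lem₂ = solve-∀
  cube-odd : Odd (c * (c * c))
  cube-odd = ≈-trans (≡⇒≈ (sym eq)) (mod (i * (u * u) - + 3 * (i * u) - + 3 * i) (trans (lem u) (trans (cong (λ x → x * (u * u) - + 3 * (x * u) - + 3 * x + + 1) eu) (lem₂ i u))))
    where
    lem : ∀ u → u * (u * u) - + 3 * (u * u) - + 3 * u + + 1 ≡ u * (u * u) - + 3 * (u * u) - + 3 * u + + 1
    lem = solve-∀
    lem₂ : ∀ i u → (+ 0 + i * + 2) * (u * u) - + 3 * ((+ 0 + i * + 2) * u) - + 3 * (+ 0 + i * + 2) + + 1 ≡ + 1 + (i * (u * u) - + 3 * (i * u) - + 3 * i) * + 2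
    lem₂ = solve-∀
  halve : c ≈ + 0 [ + 2 ] ⊎ Odd c → u ≡ + 0
  halve (inj₁ e) = ⊥-elim (even-not-odd (≈-trans (*-congʳ-≈ (c * c) e) (≡⇒≈ (ℤₚ.*-zeroˡ (c * c)))) cube-odd)
  halve (inj₂ (mod k ec)) = by (cubic-solutions e g equation)
    where
    e = k + + 1 - i
    g = w + e
    c≡ : c ≡ w + + 2 * e
    c≡ = trans ec (trans (lem k i) (cong (λ x → (x - + 1) + + 2 * (k + + 1 - i)) (sym eu)))
      where
      lem : ∀ k i → + 1 + k * + 2 ≡ ((+ 0 + i * + 2) - + 1) + + 2 * (k + + 1 - i)
      lem = solve-∀
    equation : + 3 * (g * (e * g + + 1)) + (e * (e * e) - + 3 * e + + 2) ≡ + 0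
    equation = ℤₚ.*-cancelˡ-≡ (+ 2) (+ 3 * (g * (e * g + + 1)) + (e * (e * e) - + 3 * e + + 2)) (+ 0) (trans (lem u e)
      (trans (cong (λ x → x * (x * x) - (u * (u * u) - + 3 * (u * u) - + 3 * u + + 1)) (sym c≡)) (trans (cong (λ x → c * (c * c) - x) eq) (ℤₚ.+-inverseʳ (c * (c * c))))))
      where
      lem : ∀ u e → + 2 * (+ 3 * ((u - + 1 + e) * (e * (u - + 1 + e) + + 1)) + (e * (e * e) - + 3 * e + + 2))
        ≡ (u - + 1 + + 2 * e) * ((u - + 1 + + 2 * e) * (u - + 1 + + 2 * e)) - (u * (u * u) - + 3 * (u * u) - + 3 * u + + 1)
      lem = solve-∀
    g-e : g - e ≡ w
    g-e = lem w e
      where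
      lem : ∀ w e → w + e - e ≡ w
      lem = solve-∀
    by : g - e ≡ -1ℤ ⊎ (g - e) ≈ + 0 [ + 2 ] → u ≡ + 0
    by (inj₁ p) = trans (lem u) (cong (λ x → x + + 1) (trans (sym g-e) p))
      where
      lem : ∀ u → u ≡ (u - + 1) + + 1
      lem = solve-∀
    by (inj₂ p) = ⊥-elim (odd-w (≈-trans (≡⇒≈ (sym g-e)) p))

-- x odd and r ≠ 3: Re zʳ ± Im zʳ = q for z = u + iw

module OddCase {q r : ℕ} (pq : Prime q) (oQ : Odd (+ q)) (c : Class r) (pr : Prime r) (r≢3 : r ≢ 3) (crQ : Coprimeᴿ (+ r) (+ q))
  (nonresidue : 𝕁 (+ q) (+ r) ≡ Sign.-) (plus-minus-one : (+ q) ≈ + 1 [ + r ] ⊎ (+ q) ≈ - (+ 1) [ + r ] → r ≡ 3)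
  (u w : ℤ) (ou : Odd u) (w4 : w ≈ + 0 [ + 4 ]) (cuw : Coprimeᴿ u w)
  (w32 : 11 ℕ.≤ r → w ≈ + 0 [ + 32 ]) (hyp : E (sign-of c) ((u +i w) ^ᵍ r) ≡ + q) where

  private
    Q = + q
    z = u +i w
    ε = sign-of c
    h = proj₁ (class-half c)
    r≡ : r ≡ odd h
    r≡ = proj₂ (class-half c)

  -- Modulo u + w one has z ≡ u(1 - i). Now (1 - i)³ = - 2 - 2i is killed by Re - Im, (1 - i)⁵ = - 4
  -- + 4i by Re + Im, and (1 - i)⁸ = 16: the sign ε is the one that fits r.
  linear-factor : (u + w) ∣ᴿ Q
  linear-factor = ≈0⇒∣ᴿ (≈-trans (≡⇒≈ (sym hyp)) (≈-trans (E-≈ ε {z ^ᵍ r} {(ι u *ᵍ (+ 1 +i -[1+ 0 ])) ^ᵍ r} {u + w} (G.^-cong-≈ r z≈)) (≡⇒≈ (vanish c))))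
    where
    z≈ : z G.≈ ι u *ᵍ (+ 1 +i -[1+ 0 ]) [ ι (u + w) ]
    z≈ = G.mod 𝕚 (cong₂ _+i_ (l₁ u w) (l₂ u w))
      where
      l₁ : ∀ u w → u ≡ (u * + 1 - + 0 * -[1+ 0 ]) + (+ 0 * (u + w) - + 1 * + 0)
      l₁ = solve-∀
      l₂ : ∀ u w → w ≡ (u * -[1+ 0 ] + + 0 * + 1) + (+ 0 * + 0 + + 1 * (u + w))
      l₂ = solve-∀
    vanish : (c : Class r) → E (sign-of c) ((ι u *ᵍ (+ 1 +i -[1+ 0 ])) ^ᵍ r) ≡ + 0
    vanish (three k refl) = trans (cong (E Sign.-) (scaled-pow u (+ 1 +i -[1+ 0 ]) (+ 16) 8 k 3 refl))
      (trans (E-ι* Sign.- (u ^ (k ℕ.* 8 ℕ.+ 3) * (+ 16) ^ k) ((+ 1 +i -[1+ 0 ]) ^ᵍ 3)) (ℤₚ.*-zeroʳ (u ^ (k ℕ.* 8 ℕ.+ 3) * (+ 16) ^ k)))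
    vanish (five k refl) = trans (cong (E Sign.+) (scaled-pow u (+ 1 +i -[1+ 0 ]) (+ 16) 8 k 5 refl))
      (trans (E-ι* Sign.+ (u ^ (k ℕ.* 8 ℕ.+ 5) * (+ 16) ^ k) ((+ 1 +i -[1+ 0 ]) ^ᵍ 5)) (ℤₚ.*-zeroʳ (u ^ (k ℕ.* 8 ℕ.+ 5) * (+ 16) ^ k)))

  -- With w ≡ 0 and u² ≡ 1 (mod 4), both sides are u. This decides between q and - q as the value of
  -- u + w.
  linear-mod-4 : u + w ≈ Q [ + 4 ]
  linear-mod-4 = ≈-trans (≈-trans (+-cong-≈ (≈-refl {a = u}) w4) (≡⇒≈ (ℤₚ.+-identityʳ u)))
    (≈-sym (≈-trans (≡⇒≈ (sym hyp)) (≈-trans (E-≈ ε {z ^ᵍ r} {ι (u ^ r)} {+ 4} (G.≈-trans (G.^-cong-≈ r (real-≈ w4)) (G.≡⇒≈ (ι-^ u r)))) (≈-trans (≡⇒≈ (E-ι ε (u ^ r))) u^r))))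
    where
    u^r : u ^ r ≈ u [ + 4 ]
    u^r = ≈-trans (≡⇒≈ (trans (cong (u ^_) r≡) (trans (pow-odd u h) (cong (u *_) (sym (^-distrib u u h))))))
      (≈-trans (*-congˡ-≈ u (≈-trans (^-cong-≈ h (8⇒4 (odd-square ou))) (≡⇒≈ (1^ h)))) (≡⇒≈ (ℤₚ.*-identityʳ u)))

  -- Frobenius is used twice: since iʳ = ε i, q = E(zʳ) ≡ uʳ + wʳ ≡ (u + w)ʳ (mod r), so q ≡ ± 1.
  not-unit : u + w ≡ + 1 ⊎ u + w ≡ - (+ 1) → ⊥
  not-unit e = r≢3 (plus-minus-one (from e))
    where
    Q≈ : Q ≈ (u + w) ^ r [ + r ]
    Q≈ = ≈-trans (≡⇒≈ (sym hyp)) (≈-trans (E-≈ ε {z ^ᵍ r} {ι u ^ᵍ r +ᵍ (𝕚 *ᵍ ι w) ^ᵍ r} {+ r}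
        (frobenius-cartesian u w r pr))
      (≈-trans (≡⇒≈ (value (class-unit-power c 𝕚 refl))) (≈-sym (≈-trans (≡⇒≈ (sym (cong re (ι-^ (u + w) r))))
        (re-≈ {ι (u + w) ^ᵍ r} {ι (u ^ r + w ^ r)} {+ r} (G.≈-trans (frobenius (ι u) (ι w) r pr) (G.≡⇒≈ (cong₂ _+ᵍ_ (ι-^ u r) (ι-^ w r)))))))))
      where
      W = w ^ r
      value : (𝕚 ^ᵍ r ≡ 𝕚 ^ᵍ 3 × ε ≡ Sign.-) ⊎ (𝕚 ^ᵍ r ≡ 𝕚 ^ᵍ 1 × ε ≡ Sign.+) → E ε (ι u ^ᵍ r +ᵍ (𝕚 *ᵍ ι w) ^ᵍ r) ≡ u ^ r + w ^ r
      value (inj₁ (i , s)) = trans (cong₂ E s (cong₂ _+ᵍ_ (ι-^ u r) (trans (G.^-distrib 𝕚 (ι w) r) (cong₂ _*ᵍ_ i (ι-^ w r))))) (l (u ^ r) W)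
        where
        l : ∀ U W → (U + (+ 0 * W - -1ℤ * + 0)) + - (+ 1) * (+ 0 + (+ 0 * + 0 + -1ℤ * W)) ≡ U + W
        l = solve-∀
      value (inj₂ (i , s)) = trans (cong₂ E s (cong₂ _+ᵍ_ (ι-^ u r) (trans (G.^-distrib 𝕚 (ι w) r) (cong₂ _*ᵍ_ i (ι-^ w r))))) (l (u ^ r) W)
        where
        l : ∀ U W → (U + (+ 0 * W - + 1 * + 0)) + + 1 * (+ 0 + (+ 0 * + 0 + + 1 * W)) ≡ U + W
        l = solve-∀
    from : u + w ≡ + 1 ⊎ u + w ≡ - (+ 1) → Q ≈ + 1 [ + r ] ⊎ Q ≈ - (+ 1) [ + r ]
    from (inj₁ e) = inj₁ (≈-trans Q≈ (≡⇒≈ (trans (cong (_^ r) e) (1^ r))))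
    from (inj₂ e) = inj₂ (≈-trans Q≈ (≡⇒≈ (trans (cong (_^ r) e) (trans (cong (λ n → (- (+ 1)) ^ n) r≡) (trans (neg-^-odd (+ 1) h) (cong -_ (1^ (odd h))))))))

  u+w : u + w ≡ Q
  u+w = by (divides-prime (u + w) pq linear-factor)
    where
    by : (u + w ≡ + 1 ⊎ u + w ≡ - (+ 1)) ⊎ (u + w ≡ Q ⊎ u + w ≡ - Q) → u + w ≡ Q
    by (inj₁ e) = ⊥-elim (not-unit e)
    by (inj₂ (inj₁ e)) = e
    by (inj₂ (inj₂ e)) = ⊥-elim (negation-distinct oQ (≈-trans (≡⇒≈ (sym e)) linear-mod-4))

  contradiction : ⊥
  contradiction = by-class c hyp
    where
    divisible-by-3 : ∀ k → r ≡ k ℕ.* 3 → ⊥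
    divisible-by-3 k e = split (prime⇒irreducible pr {3} (ℕ∣.divides k e))
      where
      split : 3 ≡ 1 ⊎ 3 ≡ r → ⊥
      split (inj₁ ())
      split (inj₂ e) = r≢3 (sym e)
    large : ∀ k ρ → 3 ℕ.≤ ρ → r ≡ suc k ℕ.* 8 ℕ.+ ρ → w ≈ + 0 [ + 32 ]
    large k ρ l e = w32 (ℕₚ.≤-trans (ℕₚ.+-mono-≤ (ℕₚ.*-monoˡ-≤ 8 (s≤s (z≤n {k}))) l) (ℕₚ.≤-reflexive (sym e)))
    3≤3 : 3 ℕ.≤ 3
    3≤3 = ℕₚ.≤-refl
    3≤5 : 3 ℕ.≤ 5
    3≤5 = s≤s (s≤s (s≤s z≤n))
    -- κ is k modulo 6, which fixes r modulo 48. This shows whether 3 divides r, gives the class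
    -- modulo 16 that selects the modulus X, and the class modulo 24 that decides the sign of M.
    minus : ∀ κ t → κ ℕ.< 6 → r ≡ (κ ℕ.+ t ℕ.* 6) ℕ.* 8 ℕ.+ 3 → E Sign.- (z ^ᵍ r) ≡ Q → ⊥
    minus 0 t _ e hyp = divisible-by-3 (t ℕ.* 16 ℕ.+ 1) (trans e (l t))
      where
      l : ∀ t → (0 ℕ.+ t ℕ.* 6) ℕ.* 8 ℕ.+ 3 ≡ (t ℕ.* 16 ℕ.+ 1) ℕ.* 3
      l = ℕS.solve-∀
    minus 1 t _ e hyp = no-solution-11[16] u w q u+w cuw ou r crQ nonresidue (t ℕ.* 3) (trans e (l t)) (large (t ℕ.* 6) 3 3≤3 e) hyp
      where
      l : ∀ t → (1 ℕ.+ t ℕ.* 6) ℕ.* 8 ℕ.+ 3 ≡ (t ℕ.* 3) ℕ.* 16 ℕ.+ 11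
      l = ℕS.solve-∀
    minus 2 t _ e hyp = no-solution-3[16] u w q u+w cuw ou r crQ nonresidue (t ℕ.* 3) (trans e (l t)) (large (1 ℕ.+ t ℕ.* 6) 3 3≤3 e) hyp (t ℕ.* 2 , inj₂ (trans e (l₂ t)))
      where
      l : ∀ t → (2 ℕ.+ t ℕ.* 6) ℕ.* 8 ℕ.+ 3 ≡ (1 ℕ.+ (t ℕ.* 3)) ℕ.* 16 ℕ.+ 3
      l = ℕS.solve-∀
      l₂ : ∀ t → (2 ℕ.+ t ℕ.* 6) ℕ.* 8 ℕ.+ 3 ≡ t ℕ.* 2 ℕ.* 24 ℕ.+ 19
      l₂ = ℕS.solve-∀
    minus 3 t _ e hyp = divisible-by-3 (t ℕ.* 16 ℕ.+ 9) (trans e (l t))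
      where
      l : ∀ t → (3 ℕ.+ t ℕ.* 6) ℕ.* 8 ℕ.+ 3 ≡ (t ℕ.* 16 ℕ.+ 9) ℕ.* 3
      l = ℕS.solve-∀
    minus 4 t _ e hyp = no-solution-3[16] u w q u+w cuw ou r crQ nonresidue (t ℕ.* 3 ℕ.+ 1) (trans e (l t)) (large (3 ℕ.+ t ℕ.* 6) 3 3≤3 e) hyp (t ℕ.* 2 ℕ.+ 1 , inj₁ (trans e (l₂ t)))
      where
      l : ∀ t → (4 ℕ.+ t ℕ.* 6) ℕ.* 8 ℕ.+ 3 ≡ (1 ℕ.+ (t ℕ.* 3 ℕ.+ 1)) ℕ.* 16 ℕ.+ 3
      l = ℕS.solve-∀
      l₂ : ∀ t → (4 ℕ.+ t ℕ.* 6) ℕ.* 8 ℕ.+ 3 ≡ (t ℕ.* 2 ℕ.+ 1) ℕ.* 24 ℕ.+ 11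
      l₂ = ℕS.solve-∀
    minus 5 t _ e hyp = no-solution-11[16] u w q u+w cuw ou r crQ nonresidue (t ℕ.* 3 ℕ.+ 2) (trans e (l t)) (large (4 ℕ.+ t ℕ.* 6) 3 3≤3 e) hyp
      where
      l : ∀ t → (5 ℕ.+ t ℕ.* 6) ℕ.* 8 ℕ.+ 3 ≡ (t ℕ.* 3 ℕ.+ 2) ℕ.* 16 ℕ.+ 11
      l = ℕS.solve-∀
    minus (suc (suc (suc (suc (suc (suc _)))))) t (s≤s (s≤s (s≤s (s≤s (s≤s (s≤s ())))))) e hyp
    plus : ∀ κ t → κ ℕ.< 6 → r ≡ (κ ℕ.+ t ℕ.* 6) ℕ.* 8 ℕ.+ 5 → E Sign.+ (z ^ᵍ r) ≡ Q → ⊥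
    plus 0 t _ e hyp = no-solution-5[16] u w q u+w cuw ou r crQ nonresidue (t ℕ.* 3) (trans e (l t)) w4 hyp
      where
      l : ∀ t → (0 ℕ.+ t ℕ.* 6) ℕ.* 8 ℕ.+ 5 ≡ (t ℕ.* 3) ℕ.* 16 ℕ.+ 5
      l = ℕS.solve-∀
    plus 1 t _ e hyp = no-solution-13[16] u w q u+w cuw ou r crQ nonresidue (t ℕ.* 3) (trans e (l t)) (large (t ℕ.* 6) 5 3≤5 e) hyp (t ℕ.* 2 , inj₂ (trans e (l₂ t)))
      where
      l : ∀ t → (1 ℕ.+ t ℕ.* 6) ℕ.* 8 ℕ.+ 5 ≡ (t ℕ.* 3) ℕ.* 16 ℕ.+ 13
      l = ℕS.solve-∀
      l₂ : ∀ t → (1 ℕ.+ t ℕ.* 6) ℕ.* 8 ℕ.+ 5 ≡ t ℕ.* 2 ℕ.* 24 ℕ.+ 13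
      l₂ = ℕS.solve-∀
    plus 2 t _ e hyp = divisible-by-3 (t ℕ.* 16 ℕ.+ 7) (trans e (l t))
      where
      l : ∀ t → (2 ℕ.+ t ℕ.* 6) ℕ.* 8 ℕ.+ 5 ≡ (t ℕ.* 16 ℕ.+ 7) ℕ.* 3
      l = ℕS.solve-∀
    plus 3 t _ e hyp = no-solution-13[16] u w q u+w cuw ou r crQ nonresidue (t ℕ.* 3 ℕ.+ 1) (trans e (l t)) (large (2 ℕ.+ t ℕ.* 6) 5 3≤5 e) hyp (t ℕ.* 2 ℕ.+ 1 , inj₁ (trans e (l₂ t)))
      where
      l : ∀ t → (3 ℕ.+ t ℕ.* 6) ℕ.* 8 ℕ.+ 5 ≡ (t ℕ.* 3 ℕ.+ 1) ℕ.* 16 ℕ.+ 13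
      l = ℕS.solve-∀
      l₂ : ∀ t → (3 ℕ.+ t ℕ.* 6) ℕ.* 8 ℕ.+ 5 ≡ (t ℕ.* 2 ℕ.+ 1) ℕ.* 24 ℕ.+ 5
      l₂ = ℕS.solve-∀
    plus 4 t _ e hyp = no-solution-5[16] u w q u+w cuw ou r crQ nonresidue (t ℕ.* 3 ℕ.+ 2) (trans e (l t)) w4 hyp
      where
      l : ∀ t → (4 ℕ.+ t ℕ.* 6) ℕ.* 8 ℕ.+ 5 ≡ (t ℕ.* 3 ℕ.+ 2) ℕ.* 16 ℕ.+ 5
      l = ℕS.solve-∀
    plus 5 t _ e hyp = divisible-by-3 (t ℕ.* 16 ℕ.+ 15) (trans e (l t))
      where
      l : ∀ t → (5 ℕ.+ t ℕ.* 6) ℕ.* 8 ℕ.+ 5 ≡ (t ℕ.* 16 ℕ.+ 15) ℕ.* 3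
      l = ℕS.solve-∀
    plus (suc (suc (suc (suc (suc (suc _)))))) t (s≤s (s≤s (s≤s (s≤s (s≤s (s≤s ())))))) e hyp
    by-class : (c : Class r) → E (sign-of c) (z ^ᵍ r) ≡ Q → ⊥
    by-class (three k e) = minus (k ℕ.% 6) (k ℕ./ 6) (ℕD.m%n<n k 6) (trans e (cong (λ k → k ℕ.* 8 ℕ.+ 3) (ℕD.m≡m%n+[m/n]*n k 6)))
    by-class (five k e)  = plus (k ℕ.% 6) (k ℕ./ 6) (ℕD.m%n<n k 6) (trans e (cong (λ k → k ℕ.* 8 ℕ.+ 5) (ℕD.m≡m%n+[m/n]*n k 6)))

-- Reduction of x⁴ - q⁴ = p yʳ to the preceding equations

coprime-difference-sum : ∀ {x y} → Coprimeᴿ x y → Odd (x + y) → Coprimeᴿ (x - y) (x + y)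
coprime-difference-sum {x} {y} c o = Coprime-≈ {x - y} {+ 2 * x} {x + y} (mod -1ℤ (l₁ x y)) (Coprime-*ˡ {+ 2} {x} {x + y} (odd⇒coprime-2 o)
    (Coprime-sym {x + y} {x} (Coprime-≈ {x + y} {y} {x} (mod (+ 1) (l₂ x y)) (Coprime-sym {x} {y} c))))
  where
  l₁ : ∀ x y → x - y ≡ + 2 * x + - (+ 1) * (x + y)
  l₁ = solve-∀
  l₂ : ∀ x y → x + y ≡ y + + 1 * x
  l₂ = solve-∀

-- Modulo 2 the square of z is its norm, hence 1. So the coordinates of a root inherit the parities
-- of those of the power.
odd-power-mod-2 : ∀ z h → Odd (norm z) → z ^ᵍ odd h G.≈ z [ ι (+ 2) ]
odd-power-mod-2 (u +i v) h (mod k e) = G.≈-trans (G.≡⇒≈ (cong (z *ᵍ_) (trans (G.^-+ z h h) (sym (G.^-distrib z z h)))))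
    (G.≈-trans (G.*-congˡ-≈ z (G.≈-trans (G.^-cong-≈ h z²) (G.≡⇒≈ (G.1^ h)))) (G.≡⇒≈ (𝔾ₚ.*-identityʳ z)))
  where
  z = u +i v
  z² : z *ᵍ z G.≈ 1ᵍ [ ι (+ 2) ]
  z² = G.mod ((k - v * v) +i (u * v)) (cong₂ _+i_ (trans (l₀ u v) (trans (cong (λ n → n - + 2 * (v * v)) e) (l₁ u v k))) (l₂ u v k))
    where
    l₀ : ∀ u v → u * u - v * v ≡ (u * u + v * v) - + 2 * (v * v)
    l₀ = solve-∀
    l₁ : ∀ u v k → (+ 1 + k * + 2) - + 2 * (v * v) ≡ + 1 + ((k - v * v) * + 2 - u * v * + 0)
    l₁ = solve-∀
    l₂ : ∀ u v k → u * v + v * u ≡ + 0 + ((k - v * v) * + 0 + u * v * + 2)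
    l₂ = solve-∀

record PowerRoot (X Y : ℤ) (h : ℕ) : Set where
  constructor root
  field
    u v   : ℤ
    power : (u +i v) ^ᵍ odd h ≡ (X +i Y)
    re-parity : X ≈ u [ + 2 ]
    im-parity : Y ≈ v [ + 2 ]

power-root : ∀ X Y a h → X * X + Y * Y ≡ a ^ odd h → Coprimeᴿ X Y → Odd (X * X + Y * Y) → PowerRoot X Y h
power-root X Y a h e c o = from (sum-of-squares-power X Y a h e c o)
  where
  from : (∃ λ z → (X +i Y) ≡ z ^ᵍ odd h) → PowerRoot X Y h
  from (z , e) = root (re z) (im z) (sym e) (re-≈ {X +i Y} {z} {+ 2} z≈) (im-≈ {X +i Y} {z} {+ 2} z≈)
    where
    odd-norm : Odd (norm z)
    odd-norm = odd-base (h ℕ.+ h) (≈-trans (≡⇒≈ (trans (sym (norm-^ z (odd h))) (cong norm (sym e)))) o)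
    z≈ : (X +i Y) G.≈ z [ ι (+ 2) ]
    z≈ = G.≈-trans (G.≡⇒≈ e) (odd-power-mod-2 z h odd-norm)

coprime-coordinates : ∀ u v X Y n → (u +i v) ^ᵍ suc n ≡ (X +i Y) → Coprimeᴿ X Y → Coprimeᴿ u v
coprime-coordinates u v X Y n e (bez {s} {t} b) = bez {s = s * re γ + t * im γ} {t = t * re γ - s * im γ}
    (trans (lem u v (re γ) (im γ) s t) (trans (cong₂ (λ a b → s * a + t * b) (cong re e) (cong im e)) b))
  where
  γ = (u +i v) ^ᵍ n
  lem : ∀ u v a b s t → (s * a + t * b) * u + (t * a - s * b) * v ≡ s * (u * a - v * b) + t * (u * b + v * a)
  lem = solve-∀

two-power-odd : ∀ {X} n → Odd X → Coprimeᴿ ((+ 2) ^ n) X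
two-power-odd {X} n o = Coprime-^ˡ {+ 2} {X} n (odd⇒coprime-2 o)

two-power-∣ : ∀ m n → m ℕ.≤ n → (+ 2) ^ m ∣ᴿ (+ 2) ^ n
two-power-∣ m n l = div ((+ 2) ^ (n ∸ m)) (trans (cong ((+ 2) ^_) (sym (ℕₚ.m∸n+n≡m l))) (^-+ (+ 2) (n ∸ m) m))

two-power≢0 : ∀ n → (+ 2) ^ n ≢ + 0
two-power≢0 (suc n) e = two-power≢0 n (by (product-zero (+ 2) ((+ 2) ^ n) e))
  where
  by : + 2 ≡ + 0 ⊎ (+ 2) ^ n ≡ + 0 → (+ 2) ^ n ≡ + 0
  by (inj₂ z) = z

-- Im zʳ is Im z times an odd number.
two-power-∣-im : ∀ u v n h → Odd u → v ≈ + 0 [ + 2 ] → (+ 2) ^ n ∣ᴿ im ((u +i v) ^ᵍ odd h) → (+ 2) ^ n ∣ᴿ v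
two-power-∣-im u v n h ou (mod j ev) d = from (im-first-order u v (h ℕ.+ h))
  where
  U = u ^ (h ℕ.+ h)
  R = + odd h
  from : im ((u +i v) ^ᵍ odd h) ≈ R * U * v [ v * v ] → (+ 2) ^ n ∣ᴿ v
  from (mod k e) = Coprime-∣* {(+ 2) ^ n} {R * U + k * v} {v} (two-power-odd n odd-factor) (subst ((+ 2) ^ n ∣ᴿ_) (trans e (l R U v k)) d)
    where
    l : ∀ R U v k → R * U * v + k * (v * v) ≡ (R * U + k * v) * v
    l = solve-∀
    odd-R : Odd R
    odd-R = mod (+ h) (trans (ℤₚ.pos-+ 1 (h ℕ.+ h)) (trans (cong (λ x → + 1 + x) (ℤₚ.pos-+ h h)) (l₂ (+ h))))
      where
      l₂ : ∀ h → + 1 + (h + h) ≡ + 1 + h * + 2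
      l₂ = solve-∀
    odd-factor : Odd (R * U + k * v)
    odd-factor = +-cong-≈ {b = + 1} {d = + 0} (odd-* odd-R (odd-^ (h ℕ.+ h) ou)) (mod (k * j) (trans (cong (λ x → k * x) ev) (l₃ k j)))
      where
      l₃ : ∀ k j → k * (+ 0 + j * + 2) ≡ + 0 + k * j * + 2
      l₃ = solve-∀

cube-cartesian : ∀ u v → (u +i v) ^ᵍ 3 ≡ (u * (u * u) - + 3 * (u * (v * v)) +i + 3 * (u * u) * v - v * (v * v))
cube-cartesian u v = trans (cong (λ x → z *ᵍ (z *ᵍ x)) (𝔾ₚ.*-identityʳ z)) (cong₂ _+i_ (l₁ u v) (l₂ u v))
  where
  z = u +i v
  l₁ : ∀ u v → u * (u * u - v * v) - v * (u * v + v * u) ≡ u * (u * u) - + 3 * (u * (v * v))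
  l₁ = solve-∀
  l₂ : ∀ u v → u * (u * v + v * u) + v * (u * u - v * v) ≡ + 3 * (u * u) * v - v * (v * v)
  l₂ = solve-∀

^3 : ∀ d → d ^ 3 ≡ d * (d * d)
^3 d = cong (λ x → d * (d * x)) (ℤₚ.*-identityʳ d)

-- The integers (Q - x)/2 and (Q + x)/2 have the odd sum Q, so exactly one of them is even. That one
-- becomes B, at the cost of the sign of x.
half-sum-difference : ∀ {x Q} → Odd x → Odd Q → ∃ λ A → ∃ λ B → (A + B ≡ Q) × (A - B ≡ x ⊎ A - B ≡ - x) × (B ≈ + 0 [ + 2 ])
half-sum-difference {x} {Q} (mod j ex) (mod k eQ) = by (parity (k - j))
  where
  by : (k - j) ≈ + 0 [ + 2 ] ⊎ Odd (k - j) → ∃ λ A → ∃ λ B → (A + B ≡ Q) × (A - B ≡ x ⊎ A - B ≡ - x) × (B ≈ + 0 [ + 2 ])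
  by (inj₁ even) = Q - (k - j) , k - j , l₀ Q (k - j) , inj₁ (trans (cong (λ y → y - (k - j) - (k - j)) eQ) (trans (l₁ j k) (sym ex))) , even
    where
    l₀ : ∀ Q B → Q - B + B ≡ Q
    l₀ = solve-∀
    l₁ : ∀ j k → (+ 1 + k * + 2) - (k - j) - (k - j) ≡ + 1 + j * + 2
    l₁ = solve-∀
  by (inj₂ (mod i e)) = Q - (+ 1 + j + k) , + 1 + j + k , l₀ Q (+ 1 + j + k) , inj₂ (trans (cong (λ y → y - (+ 1 + j + k) - (+ 1 + j + k)) eQ) (trans (l₁ j k) (cong -_ (sym ex)))) ,
      mod (+ 1 + i + j) (trans (l₂ j k) (trans (cong (λ y → + 1 + + 2 * j + y) e) (l₃ i j)))
    where
    l₀ : ∀ Q B → Q - B + B ≡ Q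
    l₀ = solve-∀
    l₁ : ∀ j k → (+ 1 + k * + 2) - (+ 1 + j + k) - (+ 1 + j + k) ≡ - (+ 1 + j * + 2)
    l₁ = solve-∀
    l₂ : ∀ j k → + 1 + j + k ≡ + 1 + + 2 * j + (k - j)
    l₂ = solve-∀
    l₃ : ∀ i j → + 1 + + 2 * j + (+ 1 + i * + 2) ≡ + 0 + (+ 1 + i + j) * + 2
    l₃ = solve-∀

-- If A = kp, then Y = - kB and B · (- (A² + B²) k) = y³ with coprime factors. So B is a cube c³,
-- and A² + B² = a³ reads a³ = c⁶ + A².
cubic-odd-case : ∀ {p} (pp : Prime p) A B a y Y → A ≢ + 0 → B ≢ + 0 → Coprimeᴿ A B → A * A + B * B ≡ a ^ 3 → (A * A + B * B) * Y ≡ y ^ 3 → - (A * B) ≡ Y * + p → (+ p) ∣ᴿ A → ⊥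
cubic-odd-case {p} pp A B a y Y A≢0 B≢0 cAB ea ey eY (div k eA) = from (coprime-product-odd-power {B} { - (N * k)} {y} 1 B≢0 cB product)
  where
  P = + p
  N = A * A + B * B
  P≢0 : P ≢ + 0
  P≢0 e = A≢0 (trans eA (trans (cong (λ x → k * x) e) (ℤₚ.*-zeroʳ k)))
  cBN : Coprimeᴿ N B
  cBN = Coprime-≈ {N} {A * A} {B} (mod B refl) (Coprime-*ˡ {A} {A} {B} cAB cAB)
  cB : Coprimeᴿ B (- (N * k))
  cB = coprime-neg-mod {B} {N * k} (Coprime-*ʳ {N} {k} {B} (Coprime-sym {N} {B} cBN) (Coprime-sym {k} {B} (Coprime-∣ˡ {k} {A} {B} (div P (trans eA (ℤₚ.*-comm k P))) cAB)))
  Y≡ : - (k * B) ≡ Y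
  Y≡ = cancelℤ P (- (k * B)) Y P≢0 (trans (l k B P) (trans (cong (λ x → - (x * B)) (sym eA)) eY))
    where
    l : ∀ k B P → - (k * B) * P ≡ - (k * P * B)
    l = solve-∀
  product : B * - (N * k) ≡ y ^ 3
  product = trans (l B N k) (trans (cong (λ x → N * x) Y≡) ey)
    where
    l : ∀ B N k → B * - (N * k) ≡ N * - (k * B)
    l = solve-∀
  from : (∃ λ c → B ≡ c ^ 3) → ⊥
  from (c , eB) = A≢0 (cube-minus-sixth-power a c A (trans (sym (^3 a)) (trans (sym ea) (trans (ℤₚ.+-comm (A * A) (B * B)) (cong (λ x → x * x + A * A) (trans eB (^3 c))))))
      (Coprime-∣ˡ {a} {N} {c} (div (a * a) (trans ea (trans (^3 a) (l a)))) (Coprime-sym {c} {N} (Coprime-∣ˡ {c} {B} {N} (div (c * c) (trans eB (trans (^3 c) (l c)))) (Coprime-sym {N} {B} cBN))))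
      (λ z → B≢0 (trans eB (trans (^3 c) (trans (cong (λ x → x * (c * c)) z) (ℤₚ.*-zeroˡ (c * c)))))))
    where
    l : ∀ a → a * (a * a) ≡ (a * a) * a
    l = solve-∀

-- The coprime numbers x - q and x + q have product b³p, so the one not absorbing p is a cube. For v
-- = 1 both are cubic polynomials in u, because x = u³ - 3u and q = 3u² - 1.
cubic-even-case : ∀ {p q} (pp : Prime p) (pq : Prime q) (oQ : Odd (+ q)) x u v Y b → Coprimeᴿ x (+ q) → x ≈ + 0 [ + 2 ] → u ≈ + 0 [ + 2 ] → (u +i v) ^ᵍ 3 ≡ (x +i + q) →
  v ≡ + 1 ⊎ v ≡ - (+ 1) → x * x - + q * + q ≡ Y * + p → Y ≡ b ^ 3 → ⊥
cubic-even-case {p} {q} pp pq oQ x u v Y b cxQ ex eu ez v≡ eY Yb = by v≡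
  where
  P = + p
  Q = + q
  coordinates : (u * (u * u) - + 3 * (u * (v * v)) +i + 3 * (u * u) * v - v * (v * v)) ≡ (x +i Q)
  coordinates = trans (sym (cube-cartesian u v)) ez
  u² = ∣ u ∣ ℕ.* ∣ u ∣
  3u² : + 3 * (u * u) ≡ + (3 ℕ.* u²)
  3u² = trans (cong (λ a → + 3 * a) (square-abs u)) (sym (ℤₚ.pos-* 3 u²))
  too-small : q ℕ.≤ 1 → ⊥
  too-small l = go q pq l
    where
    go : ∀ q → Prime q → q ℕ.≤ 1 → ⊥
    go zero pq _ = ¬prime[0] pq
    go (suc zero) pq _ = ¬prime[1] pq
    go (suc (suc _)) pq (s≤s ())
  odd-sum : Odd (x + Q)
  odd-sum = +-cong-≈ ex oQ
  odd-difference : Odd (x - Q)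
  odd-difference = +-cong-≈ ex (odd-neg oQ)
  cop : Coprimeᴿ (x - Q) (x + Q)
  cop = coprime-difference-sum cxQ odd-sum
  factored : (x - Q) * (x + Q) ≡ b ^ 3 * P
  factored = trans (l x Q) (trans eY (cong (λ y → y * P) Yb))
    where
    l : ∀ x Q → (x - Q) * (x + Q) ≡ x * x - Q * Q
    l = solve-∀
  P≢0 : P ≢ + 0
  P≢0 e = ¬prime[0] (subst Prime (ℤₚ.+-injective e) pp)
  cube-factor : ∀ f g → f ≢ + 0 → Coprimeᴿ g f → g * f ≡ b ^ 3 * P → P ∣ᴿ g → ∃ λ c → f ≡ c ^ 3
  cube-factor f g f≢0 cgf e (div k eg) = coprime-product-odd-power {f} {k} {b} 1 f≢0 (Coprime-sym {k} {f} (Coprime-∣ˡ {k} {g} {f} (div P (trans eg (ℤₚ.*-comm k P))) cgf))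
      (cancelℤ P (f * k) (b ^ 3) P≢0 (trans (l f k P) (trans (cong (λ y → y * f) (sym eg)) e)))
    where
    l : ∀ f k P → f * k * P ≡ k * P * f
    l = solve-∀
  by : v ≡ + 1 ⊎ v ≡ - (+ 1) → ⊥
  -- For v = - 1 the imaginary part reads q + 3u² = 1.
  by (inj₂ refl) = too-small (ℕₚ.≤-trans (ℕₚ.m≤m+n q (3 ℕ.* u²)) (ℕₚ.≤-reflexive (ℤₚ.+-injective (trans (ℤₚ.pos-+ q (3 ℕ.* u²))
      (trans (cong₂ _+_ (sym (cong im coordinates)) (sym 3u²)) (l u))))))
    where
    l : ∀ u → (+ 3 * (u * u) * - (+ 1) - - (+ 1) * (- (+ 1) * - (+ 1))) + + 3 * (u * u) ≡ + 1
    l = solve-∀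
  by (inj₁ refl) = split (prime-∣-* pp (x - Q) (x + Q) (div (b ^ 3) factored))
    where
    x≡ : x ≡ u * (u * u) - + 3 * (u * (+ 1 * + 1))
    x≡ = sym (cong re coordinates)
    Q≡ : Q ≡ + 3 * (u * u) * + 1 - + 1 * (+ 1 * + 1)
    Q≡ = sym (cong im coordinates)
    from-zero : u ≡ + 0 → ⊥
    from-zero z = absurd (trans Q≡ (cong (λ a → + 3 * (a * a) * + 1 - + 1 * (+ 1 * + 1)) z))
      where
      absurd : + q ≢ - (+ 1)
      absurd ()
    difference : (∃ λ c → x - Q ≡ c ^ 3) → ⊥
    difference (c , e) = from-zero (no-cube u c eu (trans (l u) (trans (cong₂ _-_ (sym x≡) (sym Q≡)) (trans e (^3 c)))))
      where
      l : ∀ u → u * (u * u) - + 3 * (u * u) - + 3 * u + + 1 ≡ (u * (u * u) - + 3 * (u * (+ 1 * + 1))) - (+ 3 * (u * u) * + 1 - + 1 * (+ 1 * + 1))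
      l = solve-∀
    sum : (∃ λ c → x + Q ≡ c ^ 3) → ⊥
    -- The value of u³ - 3u² - 3u + 1 at - u is - (x + q).
    sum (c , e) = from-zero (trans (sym (ℤₚ.neg-involutive u)) (cong -_ (no-cube (- u) (- c) (even-neg eu)
        (trans (l u) (trans (cong -_ (trans (cong₂ _+_ (sym x≡) (sym Q≡)) (trans e (^3 c)))) (l₂ c))))))
      where
      l : ∀ u → - u * (- u * - u) - + 3 * (- u * - u) - + 3 * - u + + 1 ≡ - ((u * (u * u) - + 3 * (u * (+ 1 * + 1))) + (+ 3 * (u * u) * + 1 - + 1 * (+ 1 * + 1)))
      l = solve-∀
      l₂ : ∀ c → - (c * (c * c)) ≡ - c * (- c * - c)
      l₂ = solve-∀
    split : P ∣ᴿ (x - Q) ⊎ P ∣ᴿ (x + Q) → ⊥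
    split (inj₁ d) = sum (cube-factor (x + Q) (x - Q) (odd≢0 odd-sum) cop factored d)
    split (inj₂ d) = difference (cube-factor (x - Q) (x + Q) (odd≢0 odd-difference) (Coprime-sym {x - Q} {x + Q} cop) (trans (ℤₚ.*-comm (x + Q) (x - Q)) factored) d)

class-half⁺ : ∀ {r} → Class r → ∃ λ h → r ≡ odd (suc h)
class-half⁺ (three k e) = k ℕ.* 4 , trans e (lem k)
  where
  lem : ∀ k → k ℕ.* 8 ℕ.+ 3 ≡ 1 ℕ.+ (1 ℕ.+ k ℕ.* 4 ℕ.+ (1 ℕ.+ k ℕ.* 4))
  lem = ℕS.solve-∀
class-half⁺ (five k e) = k ℕ.* 4 ℕ.+ 1 , trans e (lem k)
  where
  lem : ∀ k → k ℕ.* 8 ℕ.+ 5 ≡ 1 ℕ.+ (1 ℕ.+ (k ℕ.* 4 ℕ.+ 1) ℕ.+ (1 ℕ.+ (k ℕ.* 4 ℕ.+ 1)))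
  lem = ℕS.solve-∀

half-bound : ∀ m h → odd m ℕ.≤ odd h → m ℕ.≤ h
half-bound m h l = ℕₚ.≮⇒≥ λ h<m → ℕₚ.<⇒≱ (s≤s (ℕₚ.+-mono-< h<m h<m)) l

module Impossible {p q h : ℕ} (pp : Prime p) (pq : Prime q) (pr : Prime (odd (suc h))) (p≢q : p ≢ q) (oQ : Odd (+ q)) (p3 : (+ p) ≈ + 3 [ + 4 ]) (c : Class (odd (suc h)))
  (crQ : Coprimeᴿ (+ odd (suc h)) (+ q)) (nonresidue : 𝕁 (+ q) (+ odd (suc h)) ≡ Sign.-) (plus-minus-one : (+ q) ≈ + 1 [ + odd (suc h) ] ⊎ (+ q) ≈ - (+ 1) [ + odd (suc h) ] → odd (suc h) ≡ 3)
  (x y : ℤ) (cxy : Coprimeᴿ x y) (equation : x ^ 4 - (+ q) ^ 4 ≡ + p * y ^ odd (suc h)) where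

  private
    r = odd (suc h)
    P = + p
    Q = + q
    X₂ = x * x + Q * Q
    Y₂ = x * x - Q * Q

    P≢0 : P ≢ + 0
    P≢0 e = ¬prime[0] (subst Prime (ℤₚ.+-injective e) pp)

    oP : Odd P
    oP = ≈-trans (4⇒2 p3) (mod (+ 1) refl)

    factored : X₂ * Y₂ ≡ y ^ r * P
    factored = trans (lem x Q) (trans equation (ℤₚ.*-comm P (y ^ r)))
      where
      lem : ∀ x Q → (x * x + Q * Q) * (x * x - Q * Q) ≡ x * (x * (x * (x * + 1))) - Q * (Q * (Q * (Q * + 1)))
      lem = solve-∀

    -- If q divided x it would divide p yʳ, hence y because p ≠ q, contrary to the coprimality of x
    -- and y.
    cxQ : Coprimeᴿ x Q
    cxQ = by (prime-dichotomy pq x)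
      where
      by : Q ∣ᴿ x ⊎ Coprimeᴿ x Q → Coprimeᴿ x Q
      by (inj₂ c) = c
      by (inj₁ d@(div k e)) = ⊥-elim (split (prime-∣-* pq (y ^ r) P (div (X₂ * (x * k - Q)) (trans (sym factored) (trans (cong (λ z → X₂ * (x * z - Q * Q)) e) (lem X₂ x k Q))))))
        where
        lem : ∀ X x k Q → X * (x * (k * Q) - Q * Q) ≡ X * (x * k - Q) * Q
        lem = solve-∀
        split : Q ∣ᴿ (y ^ r) ⊎ Q ∣ᴿ P → ⊥
        split (inj₁ d′) = coprime-both-∣ pq cxy d (prime-∣-^ pq y r d′)
        split (inj₂ d′) = p≢q (sym (prime-∣-prime pq pp d′))

    p∤X₂ : P ∣ᴿ X₂ → ⊥
    p∤X₂ (div k e) = by (prime-dichotomy pp x) (prime-dichotomy pp Q)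
      where
      by : P ∣ᴿ x ⊎ Coprimeᴿ x P → P ∣ᴿ Q ⊎ Coprimeᴿ Q P → ⊥
      by _ (inj₁ d) = p≢q (prime-∣-prime pp pq d)
      by (inj₁ (div j ej)) (inj₂ cQ) = ∤1 pp (from (Coprime-*ˡ {Q} {Q} {P} cQ cQ))
        where
        from : Coprimeᴿ (Q * Q) P → P ∣ᴿ (+ 1)
        from (bez {s} {t} b) = div (s * (k - x * j) + t) (trans (sym b) (trans (lem s t P Q x) (trans (cong (λ z → s * (z - x * x) + t * P) e)
            (trans (cong (λ z → s * (k * P - x * z) + t * P) ej) (lem₂ s t P k x j)))))
          where
          lem : ∀ s t P Q x → s * (Q * Q) + t * P ≡ s * ((x * x + Q * Q) - x * x) + t * P
          lem = solve-∀
          lem₂ : ∀ s t P k x j → s * (k * P - x * (j * P)) + t * P ≡ (s * (k - x * j) + t) * P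
          lem₂ = solve-∀
      by (inj₂ cx) (inj₂ cQ) = +≢- (trans (sym (𝕁-sq {P} oP {x} cx)) (trans (𝕁-cong {P} oP x²≈) (trans (𝕁-sq-* {P} oP {Q} { -1ℤ} cQ (bez {s = -1ℤ} {t = + 0} refl)) (𝕁-neg1-3[4] p3 refl P≢0))))
        where
        x²≈ : x * x ≈ Q * Q * -1ℤ [ P ]
        x²≈ = mod k (trans (lem x Q) (cong (λ z → Q * Q * -1ℤ + z) e))
          where
          lem : ∀ x Q → x * x ≡ Q * Q * - (+ 1) + (x * x + Q * Q)
          lem = solve-∀

    p∣Y₂ : P ∣ᴿ Y₂
    p∣Y₂ = by (prime-∣-* pp X₂ Y₂ (div (y ^ r) factored))
      where
      by : P ∣ᴿ X₂ ⊎ P ∣ᴿ Y₂ → P ∣ᴿ Y₂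
      by (inj₁ d) = ⊥-elim (p∤X₂ d)
      by (inj₂ d) = d

  module _ (Y′ : ℤ) (eY : Y₂ ≡ Y′ * P) where

    private
      product : X₂ * Y′ ≡ y ^ r
      product = cancelℤ P (X₂ * Y′) (y ^ r) P≢0 (trans (ℤₚ.*-assoc X₂ Y′ P) (trans (cong (λ z → X₂ * z) (sym eY)) factored))

    even : x ≈ + 0 [ + 2 ] → ⊥
    even ex = from (coprime-product-odd-power {X₂} {Y′} {y} (suc h) (odd≢0 oX₂) cXY product)
                   (coprime-product-odd-power {Y′} {X₂} {y} (suc h) Y′≢0 (Coprime-sym {X₂} {Y′} cXY) (trans (ℤₚ.*-comm Y′ X₂) product))
      where
      even-square : (x * x) ≈ + 0 [ + 2 ]
      even-square = ≈-trans (*-congʳ-≈ x ex) (≡⇒≈ (ℤₚ.*-zeroˡ x))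
      oX₂ : Odd X₂
      oX₂ = +-cong-≈ {a = x * x} {b = + 0} {c = Q * Q} {d = + 1} even-square (odd-* oQ oQ)
      oY₂ : Odd Y₂
      oY₂ = +-cong-≈ {a = x * x} {b = + 0} {c = - (Q * Q)} {d = + 1} even-square (odd-neg (odd-* oQ oQ))
      Y′≢0 : Y′ ≢ + 0
      Y′≢0 e = odd≢0 oY₂ (trans eY (trans (cong (λ z → z * P) e) (ℤₚ.*-zeroˡ P)))
      cxxQ : Coprimeᴿ (x * x) Q
      cxxQ = Coprime-*ˡ {x} {x} {Q} cxQ cxQ
      cXY : Coprimeᴿ X₂ Y′
      cXY = Coprime-sym {Y′} {X₂} (Coprime-∣ˡ {Y′} {Y₂} {X₂} (div P (trans eY (ℤₚ.*-comm Y′ P)))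
        (coprime-difference-sum {x * x} {Q * Q} (Coprime-*ʳ {Q} {Q} {x * x} cxxQ cxxQ) oX₂))
      from : (∃ λ a → X₂ ≡ a ^ r) → (∃ λ b → Y′ ≡ b ^ r) → ⊥
      from (a , ea) (b , eb) = by (power-root x Q a (suc h) ea cxQ oX₂)
        where
        by : PowerRoot x Q (suc h) → ⊥
        by (root u v e xu Qv) = finish (EvenCase.exceptional pq oQ c pr crQ nonresidue plus-minus-one u v eu (≈-trans (≈-sym Qv) oQ) (cong im e))
          where
          eu : u ≈ + 0 [ + 2 ]
          eu = ≈-trans (≈-sym xu) ex
          finish : r ≡ 3 × (v ≡ + 1 ⊎ v ≡ - (+ 1)) → ⊥
          finish (r3 , v≡) = cubic-even-case pp pq oQ x u v Y′ b cxQ ex eu (subst (λ n → (u +i v) ^ᵍ n ≡ (x +i Q)) r3 e) v≡ eY (trans eb (cong (b ^_) r3))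

    module Odd-x (ox : Odd x) (A B : ℤ) (A+B : A + B ≡ Q) (A-B : A - B ≡ x ⊎ A - B ≡ - x) (eB : B ≈ + 0 [ + 2 ]) where

      private
        N = A * A + B * B
        -- As r = 2(h + 1) + 1, the exponents of T′ and T are r - 3 and r - 1.
        T′ = (+ 2) ^ (h ℕ.+ h)
        T = (+ 2) ^ (suc h ℕ.+ suc h)

        T≡ : T ≡ + 4 * T′
        T≡ = trans (cong (λ z → + 2 * z) (cong ((+ 2) ^_) (ℕₚ.+-suc h h))) (lem T′)
          where
          lem : ∀ T → + 2 * (+ 2 * T) ≡ + 4 * T
          lem = solve-∀

        x² : x * x ≡ (A - B) * (A - B)
        x² = by A-B
          where
          neg-square : ∀ x → x * x ≡ - x * - x
          neg-square = solve-∀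
          by : A - B ≡ x ⊎ A - B ≡ - x → x * x ≡ (A - B) * (A - B)
          by (inj₁ e) = cong₂ _*_ (sym e) (sym e)
          by (inj₂ e) = trans (neg-square x) (cong₂ _*_ (sym e) (sym e))

        X₂≡ : X₂ ≡ + 2 * N
        X₂≡ = trans (cong₂ (λ a b → a + b * b) x² (sym A+B)) (lem A B)
          where
          lem : ∀ A B → (A - B) * (A - B) + (A + B) * (A + B) ≡ + 2 * (A * A + B * B)
          lem = solve-∀

        Y₂≡ : Y₂ ≡ + 4 * - (A * B)
        Y₂≡ = trans (cong₂ (λ a b → a - b * b) x² (sym A+B)) (lem A B)
          where
          lem : ∀ A B → (A - B) * (A - B) - (A + B) * (A + B) ≡ + 4 * - (A * B)
          lem = solve-∀

        oA : Odd A
        oA = ≈-trans (mod (+ 0) (lem A B)) (≈-trans (≡⇒≈ (cong (λ z → z - B) A+B)) (+-cong-≈ {a = Q} {b = + 1} {c = - B} {d = + 0} oQ (even-neg eB)))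
          where
          lem : ∀ A B → A ≡ A + B - B + + 0 * + 2
          lem = solve-∀

        oN : Odd N
        oN = +-cong-≈ {a = A * A} {b = + 1} {c = B * B} {d = + 0} (odd-* oA oA) (≈-trans (*-congʳ-≈ B eB) (≡⇒≈ (ℤₚ.*-zeroˡ B)))

        cAB : Coprimeᴿ A B
        cAB = from cxQ A-B
          where
          from : Coprimeᴿ x Q → A - B ≡ x ⊎ A - B ≡ - x → Coprimeᴿ A B
          from (bez {s} {t} e) (inj₁ d) = bez {s = s + t} {t = t - s} (trans (lem s t A B) (trans (cong₂ (λ a b → s * a + t * b) d A+B) e))
            where
            lem : ∀ s t A B → (s + t) * A + (t - s) * B ≡ s * (A - B) + t * (A + B)
            lem = solve-∀
          from (bez {s} {t} e) (inj₂ d) = bez {s = t - s} {t = t + s} (trans (lem s t A B) (trans (cong₂ (λ a b → - s * a + t * b) d A+B) (trans (lem₂ s t x Q) e)))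
            where
            lem : ∀ s t A B → (t - s) * A + (t + s) * B ≡ - s * (A - B) + t * (A + B)
            lem = solve-∀
            lem₂ : ∀ s t x Q → - s * - x + t * Q ≡ s * x + t * Q
            lem₂ = solve-∀

        cAN : Coprimeᴿ A N
        cAN = Coprime-sym {N} {A} (Coprime-≈ {N} {B * B} {A} (mod A (ℤₚ.+-comm (A * A) (B * B))) (Coprime-*ˡ {B} {B} {A} (Coprime-sym {A} {B} cAB) (Coprime-sym {A} {B} cAB)))

        cBN : Coprimeᴿ B N
        cBN = Coprime-sym {N} {B} (Coprime-≈ {N} {A * A} {B} (mod B refl) (Coprime-*ˡ {A} {A} {B} cAB cAB))

      -- From 2NY′ = yʳ, y is even, and y = 2y₁ contributes the factor 2ʳ = 2T.
      even-root : ∃ λ y₁ → N * Y′ ≡ T * y₁ ^ r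
      even-root = by (parity y)
        where
        by : y ≈ + 0 [ + 2 ] ⊎ Odd y → ∃ λ y₁ → N * Y′ ≡ T * y₁ ^ r
        by (inj₂ oy) = ⊥-elim (even-not-odd (≈-trans (≡⇒≈ (sym product)) (≈-trans (≡⇒≈ (cong (λ z → z * Y′) X₂≡)) (mod (N * Y′) (lem N Y′)))) (odd-^ r oy))
          where
          lem : ∀ N Y → + 2 * N * Y ≡ + 0 + N * Y * + 2
          lem = solve-∀
        by (inj₁ (mod y₁ e)) = y₁ , ℤₚ.*-cancelˡ-≡ (+ 2) (N * Y′) (T * y₁ ^ r) (trans (lem₁ N Y′) (trans (cong (λ z → z * Y′) (sym X₂≡)) (trans product
            (trans (cong (_^ r) (trans e (lem₂ y₁))) (trans (^-distrib (+ 2) y₁ r) (ℤₚ.*-assoc (+ 2) T (y₁ ^ r)))))))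
          where
          lem₁ : ∀ N Y → + 2 * (N * Y) ≡ + 2 * N * Y
          lem₁ = solve-∀
          lem₂ : ∀ y → + 0 + y * + 2 ≡ + 2 * y
          lem₂ = solve-∀

      module _ (y₁ Y : ℤ) (NY′ : N * Y′ ≡ T * y₁ ^ r) (Y′≡ : Y′ ≡ Y * T) where

        private
          NY : N * Y ≡ y₁ ^ r
          NY = cancelℤ T (N * Y) (y₁ ^ r) (two-power≢0 (suc h ℕ.+ suc h)) (trans (ℤₚ.*-assoc N Y T) (trans (cong (λ z → N * z) (sym Y′≡)) (trans NY′ (ℤₚ.*-comm T (y₁ ^ r)))))

          AB≡ : - (A * B) ≡ Y * P * T′
          AB≡ = ℤₚ.*-cancelˡ-≡ (+ 4) (- (A * B)) (Y * P * T′) (trans (sym Y₂≡) (trans eY (trans (cong (λ z → z * P) (trans Y′≡ (cong (λ z → Y * z) T≡))) (lem Y T′ P))))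
            where
            lem : ∀ Y T P → Y * (+ 4 * T) * P ≡ + 4 * (Y * P * T)
            lem = solve-∀

          cNY : Coprimeᴿ N Y
          cNY = Coprime-sym {Y} {N} (Coprime-∣ˡ {Y} { - (A * B)} {N} (div (P * T′) (trans AB≡ (lem Y P T′))) (coprime-neg {A * B} {N} (Coprime-*ˡ {A} {B} {N} cAN cBN)))
            where
            lem : ∀ Y P T → Y * P * T ≡ P * T * Y
            lem = solve-∀

          -- A is odd, so the factor 2^(r - 3) of AB lies entirely in B.
          T′∣B : T′ ∣ᴿ B
          T′∣B = Coprime-∣* {T′} {A} {B} (two-power-odd (h ℕ.+ h) oA) (div (- (Y * P)) (trans (sym (ℤₚ.neg-involutive (A * B))) (trans (cong -_ AB≡) (ℤₚ.neg-distribˡ-* (Y * P) T′))))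

        B≢0 : B ≢ + 0
        B≢0 e = ∤1 pq (from cAB)
          where
          from : Coprimeᴿ A B → Q ∣ᴿ (+ 1)
          from (bez {s} {t} b) = div s (trans (sym b) (trans (cong (λ z → s * A + t * z) e) (trans (lem s t A) (cong (λ z → s * z) (trans (cong (λ z → A + z) (sym e)) A+B)))))
            where
            lem : ∀ s t A → s * A + t * + 0 ≡ s * (A + + 0)
            lem = solve-∀

        cubic : r ≡ 3 → ∀ a → N ≡ a ^ r → ⊥
        cubic r3 a ea = split (prime-∣-* pp A B (div (- Y) (trans (sym (ℤₚ.neg-involutive (A * B))) (trans (cong -_ ABY) (ℤₚ.neg-distribˡ-* Y P)))))
          where
          h≡0 : h ℕ.+ h ≡ 0
          h≡0 = ℕₚ.+-cancelˡ-≡ 3 (h ℕ.+ h) 0 (trans (cong (λ n → 2 ℕ.+ n) (sym (ℕₚ.+-suc h h))) r3)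
          ABY : - (A * B) ≡ Y * P
          ABY = trans AB≡ (trans (cong (λ k → Y * P * (+ 2) ^ k) h≡0) (ℤₚ.*-identityʳ (Y * P)))
          N³ : N ≡ a ^ 3
          N³ = trans ea (cong (a ^_) r3)
          NY³ : N * Y ≡ y₁ ^ 3
          NY³ = trans NY (cong (y₁ ^_) r3)
          comm : B * B + A * A ≡ N
          comm = ℤₚ.+-comm (B * B) (A * A)
          split : P ∣ᴿ A ⊎ P ∣ᴿ B → ⊥
          split (inj₁ d) = cubic-odd-case pp A B a y₁ Y (odd≢0 oA) B≢0 cAB N³ NY³ ABY d
          split (inj₂ d) = cubic-odd-case pp B A a y₁ Y B≢0 (odd≢0 oA) (Coprime-sym {A} {B} cAB) (trans comm N³)
            (trans (cong (λ z → z * Y) comm) NY³) (trans (cong -_ (ℤₚ.*-comm B A)) ABY) d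

        higher : r ≢ 3 → ∀ a → N ≡ a ^ r → ⊥
        higher r≢3 a ea = by (power-root A B′ a (suc h) (trans N′ ea) cAB′ (≈-trans (≡⇒≈ N′) oN))
          where
          ε = σ (sign-of c)
          -- With this sign Re zʳ + ε Im zʳ = A + ε²B = q.
          B′ = ε * B
          ε² : ε * ε ≡ + 1
          ε² = go (sign-of c)
            where
            go : ∀ s → σ s * σ s ≡ + 1
            go Sign.+ = refl
            go Sign.- = refl
          N′ : A * A + B′ * B′ ≡ N
          N′ = trans (lem A B ε) (trans (cong (λ z → A * A + z * (B * B)) ε²) (cong (λ z → A * A + z) (ℤₚ.*-identityˡ (B * B))))
            where
            lem : ∀ A B ε → A * A + ε * B * (ε * B) ≡ A * A + ε * ε * (B * B)
            lem = solve-∀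
          cAB′ : Coprimeᴿ A B′
          cAB′ = Coprime-*ʳ {ε} {B} {A} (bez {s = + 0} {t = ε} (trans (cong (λ z → z + ε * ε) (ℤₚ.*-zeroˡ A)) (trans (ℤₚ.+-identityˡ (ε * ε)) ε²))) cAB
          2≤h : 2 ℕ.≤ suc h
          2≤h = ℕₚ.≰⇒> λ h≤1 → r≢3 (small-class c (s≤s (ℕₚ.+-mono-≤ h≤1 h≤1)))
          by : PowerRoot A B′ (suc h) → ⊥
          by (root u w e Au Bw) = OddCase.contradiction pq oQ c pr r≢3 crQ nonresidue plus-minus-one u w ou
              -- For r ≥ 5 the power 2^(r - 3) contains 2², which is sharp at r = 5; for r ≥ 11 it
              -- contains 2⁸, of which 2⁵ is taken.
              (divides 2 (ℕₚ.+-mono-≤ (ℕₚ.≤-pred 2≤h) (ℕₚ.≤-pred 2≤h)))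
              (coprime-coordinates u w A B′ (suc h ℕ.+ suc h) e cAB′)
              (λ 11≤r → divides 5 (ℕₚ.≤-trans (ℕₚ.m≤m+n 5 3) (ℕₚ.+-mono-≤ (ℕₚ.≤-pred (half-bound 5 (suc h) 11≤r)) (ℕₚ.≤-pred (half-bound 5 (suc h) 11≤r)))))
              (trans (cong (E (sign-of c)) e) (trans (lem A B ε) (trans (cong (λ z → A + z * B) ε²) (trans (cong (λ z → A + z) (ℤₚ.*-identityˡ B)) A+B))))
            where
            lem : ∀ A B ε → A + ε * (ε * B) ≡ A + ε * ε * B
            lem = solve-∀
            ou : Odd u
            ou = ≈-trans (≈-sym Au) oA
            ew : w ≈ + 0 [ + 2 ]
            ew = ≈-trans (≈-sym Bw) (≈-trans (*-congˡ-≈ ε eB) (≡⇒≈ (ℤₚ.*-zeroʳ ε)))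
            T′∣im : T′ ∣ᴿ im ((u +i w) ^ᵍ r)
            T′∣im = subst (T′ ∣ᴿ_) (sym (cong im e)) (∣ᴿ-trans {T′} {B} {B′} T′∣B (div ε refl))
            divides : ∀ k → k ℕ.≤ h ℕ.+ h → w ≈ + 0 [ (+ 2) ^ k ]
            divides k l = ∣ᴿ⇒≈0 (∣ᴿ-trans {(+ 2) ^ k} {T′} {w} (two-power-∣ k (h ℕ.+ h) l) (two-power-∣-im u w (h ℕ.+ h) (suc h) ou ew T′∣im))

        impossible : ⊥
        impossible = from (coprime-product-odd-power {N} {Y} {y₁} (suc h) (odd≢0 oN) cNY NY)
          where
          from : (∃ λ a → N ≡ a ^ r) → ⊥
          from (a , ea) = by (r ℕ.≟ 3)
            where
            by : Dec (r ≡ 3) → ⊥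
            by (yes r3) = cubic r3 a ea
            by (no r≢3) = higher r≢3 a ea

      odd-x : ⊥
      odd-x = from even-root
        where
        from : (∃ λ y₁ → N * Y′ ≡ T * y₁ ^ r) → ⊥
        from (y₁ , e) = by (Coprime-∣* {T} {N} {Y′} (two-power-odd (suc h ℕ.+ suc h) oN) (div (y₁ ^ r) (trans e (ℤₚ.*-comm T (y₁ ^ r)))))
          where
          by : T ∣ᴿ Y′ → ⊥
          by (div Y eY) = impossible y₁ Y e eY

  contradiction : ⊥
  contradiction = from p∣Y₂
    where
    from : P ∣ᴿ Y₂ → ⊥
    from (div Y′ eY) = by (parity x)
      where
      by : x ≈ + 0 [ + 2 ] ⊎ Odd x → ⊥
      by (inj₁ ex) = even Y′ eY ex
      by (inj₂ ox) = split (half-sum-difference ox oQ)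
        where
        split : (∃ λ A → ∃ λ B → (A + B ≡ Q) × (A - B ≡ x ⊎ A - B ≡ - x) × (B ≈ + 0 [ + 2 ])) → ⊥
        split (A , B , s , d , e) = Odd-x.odd-x Y′ eY ox A B s d e

mainTheorem1 :
    ∀ (p q r : ℕ) → Prime p → Prime q → Prime r →
      p ≢ q → q ≢ r → p ≢ r → q ≢ 2 →
      (+ p) ≡ (+ 3) [mod (+ 4) ] →
      (+ p) ≡ (+ 1) [mod (+ r) ] →
      ((+ r) ≡ (+ 3) [mod (+ 8) ] ⊎ (+ r) ≡ - (+ 3) [mod (+ 8) ]) →
      IsGenerator (+ p) (q ^ℕ (r ∸ 1)) →
      IsGenerator (+ q) r →
      IsRthPowerResidue (+ 2) r (+ q) →
      ∀ (x y : ℤ) → Coprime x y →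
        x ^ 4 - (+ q) ^ 4 ≡ (+ p) * y ^ r →
        (+ p) ∣ y
mainTheorem1 p q r pp pq pr p≢q _ _ q≢2 p≡3 _ r≡±3 _ (cqr , generates) _ x y cxy equation = ⊥-elim (by (class-half⁺ c) c)
  where
  from-r : (+ r) ≡ (+ 3) [mod (+ 8) ] ⊎ (+ r) ≡ - (+ 3) [mod (+ 8) ] → (+ r) ≈ + 3 [ + 8 ] ⊎ (+ r) ≈ - (+ 3) [ + 8 ]
  from-r (inj₁ d) = inj₁ (from-∣ {+ r} {+ 3} {+ 8} d)
  from-r (inj₂ d) = inj₂ (from-∣ {+ r} { - (+ 3)} {+ 8} d)
  c : Class r
  c = classify r (from-r r≡±3)
  cQr : Coprimeᴿ (+ q) (+ r)
  cQr = fromCoprime {+ q} {+ r} cqr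
  two-power : ∃ λ k → + 2 ≈ (+ q) ^ k [ + r ]
  two-power = from (generates (+ 2) (toCoprime {+ 2} {+ r} (odd⇒coprime-2 (class-odd c))))
    where
    from : (∃ λ k → (+ 2) ≡ ((+ q) ^ k) [mod (+ r) ]) → ∃ λ k → + 2 ≈ (+ q) ^ k [ + r ]
    from (k , d) = k , from-∣ {+ 2} {(+ q) ^ k} {+ r} d
  by : (∃ λ h → r ≡ odd (suc h)) → Class r → ⊥
  by (h , refl) c = Impossible.contradiction {p} {q} {h} pp pq pr p≢q (odd-prime pq q≢2) (from-∣ {+ p} {+ 3} {+ 4} p≡3) c (Coprime-sym {+ q} {+ r} cQr)
    (Generator.nonresidue c cQr two-power) (Generator.plus-minus-one c cQr two-power) x y (fromCoprime {x} {y} cxy) equation
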